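{- In the Faulty RAM model with a safe memory of size $S$ and at most $\delta$ faults, where $1\le S\le\delta$, there is a (comparison-based) algorithm, S-Sort, with the following property. Let $X$ be a sequence of $n$ keys. The algorithm faithfully sorts the keys in $X$, in time $$O\left(n\log n+\alpha\left(\frac{\delta}{S}+\log S\right)\right),$$ using $\Theta(S)$ safe memory words, where $\alpha\le\delta$ is the actual number of faults injected by the adversary during the execution. The constants hidden in the asymptotic notation are absolute.
   Context: Model (Faulty RAM with safe memory): a unit-cost RAM with two memories, a faulty memory of potentially unbounded size and a safe memory of size $S$ (algorithms may exceed $S$ by a multiplicative constant factor). An adaptive adversary can read both memories and can, at any time (also simultaneously), corrupt (overwrite silently) words in any positions of the faulty memory, for up to a total of $\delta$ corruptions (faults) during the execution; it may corrupt again a word already corrupted. It cannot modify the safe memory. The algorithm knows $\delta$ and $S$. $\alpha\le\delta$ is the number of faults actually injected during the execution of the algorithm. Throughout, $1\le S\le\delta$. Conventions: each key occupies one memory word; all faithful input keys are distinct; sequences and buffers are stored in adjacent memory words. A value is faithful if it has never been corrupted. A sequence is faithfully ordered if all the faithful values in it are correctly ordered among themselves (in increasing order), with corrupted values in arbitrary positions. Resilient sorting: given a set of $n$ keys (stored in the faulty memory), the algorithm "faithfully sorts" them if it outputs a faithfully ordered sequence containing all the input keys; that is, all the faithful input keys are output in correct order, while corrupted keys may be arbitrarily positioned. -}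

module Defs where

open import Data.Bool.Base using (Bool; true; false; if_then_else_)
open import Data.Fin.Base as Fin using (Fin; toℕ; fromℕ<)
open import Data.List.Base using (List; []; _∷_; length; head; drop; foldl)
open import Data.List.Membership.Propositional using (_∉_)
open import Data.Maybe.Base using (Maybe; just; nothing; maybe′)
open import Data.Nat using (ℕ; zero; suc; _+_; _∸_; _*_; _/_; _%_; _≤_; _<ᵇ_; _≡ᵇ_; _<?_; NonZero)
open import Data.Product.Base using (_×_; _,_; ∃-syntax)
open import Data.Sum.Base using (_⊎_; inj₁; inj₂)
open import Function.Base using (_∘_)
open import Relation.Binary.Bundles using (StrictTotalOrder)
open import Relation.Binary.PropositionalEquality using (_≡_)
open import Relation.Nullary.Decidable using (⌊_⌋; yes; no)
open import Level using () renaming (_⊔_ to _⊔ˡ_)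

data Op : Set where
  add sub mul div : Op

-- Arguments are addresses of safe cells, except for the constant of `set` and
-- the jump targets.  Keys can only be moved (`copy`, `loadˢ`, `storeˢ`, `loadᶠ`,
-- `storeᶠ`) and compared (`jumpLess`), so every program is comparison-based.
data Instr : Set where
  set      : (d k : ℕ) → Instr           -- safe[d] := k
  copy     : (d a : ℕ) → Instr           -- safe[d] := safe[a]
  arith    : Op → (d a b : ℕ) → Instr    -- safe[d] := safe[a] op safe[b]
  loadˢ    : (d a : ℕ) → Instr           -- safe[d] := safe[safe[a]]
  storeˢ   : (a b : ℕ) → Instr           -- safe[safe[a]] := safe[b]
  loadᶠ    : (d a : ℕ) → Instr           -- safe[d] := faulty[safe[a]]
  storeᶠ   : (a b : ℕ) → Instr           -- faulty[safe[a]] := safe[b]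
  jump     : (l : ℕ) → Instr             -- goto l
  jumpLess : (a b l : ℕ) → Instr         -- if safe[a] < safe[b] then goto l

-- A program is a finite text that mentions neither the keys nor n, δ, S.
Program : Set
Program = List Instr

fetch : Program → ℕ → Maybe Instr
fetch P pc = head (drop pc P)

⟦_⟧ : Op → ℕ → ℕ → ℕ
⟦ add ⟧ x y       = x + y
⟦ sub ⟧ x y       = x ∸ y
⟦ mul ⟧ x y       = x * y
⟦ div ⟧ x zero    = 0
⟦ div ⟧ x (suc y) = x / suc y

_[_]≔_ : ∀ {a} {A : Set a} → (ℕ → A) → ℕ → A → (ℕ → A)
(f [ i ]≔ x) j = if i ≡ᵇ j then x else f j

-- The execution of P on the input sequence X, with fault parameter δ and safe
-- memory parameter S.  The machine has M safe words, and its numeric words range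
-- over 0, …, W - 1.
module FaultyRAM
  {a ℓ₁ ℓ₂} (K : StrictTotalOrder a ℓ₁ ℓ₂)
  (P : Program)
  (W : ℕ) .{{_ : NonZero W}}
  (M δ S : ℕ)
  {n : ℕ} (X : Fin n → StrictTotalOrder.Carrier K)
  where

  open StrictTotalOrder K using () renaming (Carrier to Key; _<_ to _≺_; _<?_ to _≺?_)

  -- The content of a word as seen by the algorithm.
  Value : Set a
  Value = ℕ ⊎ Key

  -- Key words additionally carry their provenance, which no instruction can
  -- observe: `input i` is a copy of the i-th input key, obtained from the input
  -- through copies made by the algorithm only, whereas `forged x` descends from
  -- a word written by the adversary (even if x is equal to some input key).
  data Word : Set a where
    num    : ℕ → Word
    input  : Fin n → Word
    forged : Key → Word

  value : Word → Value
  value (num k)    = inj₁ k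
  value (input i)  = inj₂ (X i)
  value (forged x) = inj₂ x

  toNum : Word → ℕ
  toNum (num k)    = k
  toNum (input _)  = 0
  toNum (forged _) = 0

  wrap : ℕ → Word
  wrap k = num (k % W)

  -- Corruption may put numbers where keys are expected and vice versa, so the
  -- comparison is total on words; numbers are put below keys.
  less : Value → Value → Bool
  less (inj₁ j) (inj₁ k) = j <ᵇ k
  less (inj₁ _) (inj₂ _) = true
  less (inj₂ _) (inj₁ _) = false
  less (inj₂ x) (inj₂ y) = ⌊ x ≺? y ⌋

  record State : Set a where
    field
      pc          : ℕ
      safe        : ℕ → Word
      faulty      : ℕ → Word
      overwritten : List Word   -- the words destroyed by the adversary so far, one per fault

  open State public

  -- Writes beyond the M words of safe memory are lost.
  writeSafe : ℕ → Word → (ℕ → Word) → (ℕ → Word)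
  writeSafe d w s = if d <ᵇ M then s [ d ]≔ w else s

  next : State → State
  next s = record s { pc = suc (pc s) }

  setSafe : ℕ → Word → State → State
  setSafe d w s = next (record s { safe = writeSafe d w (safe s) })

  setFaulty : ℕ → Word → State → State
  setFaulty d w s = next (record s { faulty = faulty s [ d ]≔ w })

  exec : Instr → State → State
  exec (set d k)        s = setSafe d (wrap k) s
  exec (copy d b)       s = setSafe d (safe s b) s
  exec (arith o d b c)  s = setSafe d (wrap (⟦ o ⟧ (toNum (safe s b)) (toNum (safe s c)))) s
  exec (loadˢ d b)      s = setSafe d (safe s (toNum (safe s b))) s
  exec (storeˢ b c)     s = setSafe (toNum (safe s b)) (safe s c) s
  exec (loadᶠ d b)      s = setSafe d (faulty s (toNum (safe s b))) s
  exec (storeᶠ b c)     s = setFaulty (toNum (safe s b)) (safe s c) s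
  exec (jump l)         s = record s { pc = l }
  exec (jumpLess b c l) s =
    if less (value (safe s b)) (value (safe s c)) then record s { pc = l } else next s

  -- A fault overwrites the word at a position of the faulty memory.
  Fault : Set a
  Fault = ℕ × Value

  forge : Value → Word
  forge (inj₁ k) = wrap k
  forge (inj₂ x) = forged x

  corrupt : State → Fault → State
  corrupt s (p , v) = record s
    { faulty      = faulty s [ p ]≔ forge v
    ; overwritten = faulty s p ∷ overwritten s
    }

  -- The faults injected right before the t-th instruction, chosen with full
  -- knowledge of the current state.  Program and adversary being deterministic,
  -- t and the state determine the whole history.
  Adversary : Set a
  Adversary = (t : ℕ) → State → List Fault

  Halted : State → Set
  Halted s = fetch P (pc s) ≡ nothing

  tick : List Fault → State → State
  tick fs s = maybe′ (λ i → exec i (foldl corrupt s fs)) s (fetch P (pc s))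

  inputAt : ℕ → Word
  inputAt p with p <? n
  ... | yes p<n = input (fromℕ< p<n)
  ... | no  _   = num 0

  -- n, δ and S are given in the first three safe cells, the input sequence in the
  -- first n faulty words.
  initial : State
  initial = record
    { pc          = 0
    ; safe        = writeSafe 0 (wrap n) (writeSafe 1 (wrap δ) (writeSafe 2 (wrap S) (λ _ → num 0)))
    ; faulty      = inputAt
    ; overwritten = []
    }

  -- The state after t instructions; a halted execution suffers no more faults.
  run : Adversary → ℕ → State
  run A zero    = initial
  run A (suc t) = tick (A t (run A t)) (run A t)

  faults : State → ℕ
  faults = length ∘ overwritten

  AtMost_FaultsBy_ : ℕ → Adversary → Set
  AtMost d FaultsBy A = ∀ t → faults (run A t) ≤ d

  -- No word holding the i-th input key has ever been corrupted.
  Faithful : State → Fin n → Set a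
  Faithful s i = input i ∉ overwritten s

  -- The output is a sequence of n adjacent words of the faulty memory, starting at
  -- the position stored in safe cell 0.
  output : State → Fin n → Word
  output s p = faulty s (toNum (safe s 0) + toℕ p)

  FaithfullyOrdered : State → Set (a ⊔ˡ ℓ₂)
  FaithfullyOrdered s =
    ∀ {p q i j} → output s p ≡ input i → output s q ≡ input j →
    Faithful s i → Faithful s j → p Fin.< q → X i ≺ X j

  ContainsFaithfulKeys : State → Set a
  ContainsFaithfulKeys s = ∀ i → Faithful s i → ∃[ p ] output s p ≡ input i

  FaithfullySorted : State → Set (a ⊔ˡ ℓ₂)
  FaithfullySorted s = FaithfullyOrdered s × ContainsFaithfulKeys s

{-# OPTIONS --safe #-}

module Submission where

open import Defs
open import Data.Bool.Base using (Bool; true; false; if_then_else_; _∧_; _∨_; not; T)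
open import Data.Bool.Properties using (T-∧; T-≡)
open import Data.Empty using (⊥; ⊥-elim)
open import Data.Fin.Base using (Fin; toℕ; fromℕ<)
open import Data.Fin.Properties using (toℕ<n; fromℕ<-toℕ; toℕ-fromℕ<)
open import Data.Integer.Base as ℤ using (ℤ; -[1+_])
open import Data.List.Base using (List; []; _∷_; _++_; length; foldl; map)
open import Data.List.Membership.Propositional using (_∈_; _∉_)
open import Data.List.Properties using (length-++; ++-assoc; length-map; ++-identityʳ)
open import Data.List.Relation.Unary.Any using (here; there)
open import Data.Maybe.Base using (just; nothing)
open import Data.Nat hiding (less; compare)
open import Data.Nat.DivMod using (+-distrib-/-∣ˡ; /-monoˡ-≤; [m+kn]%n≡m%n; m%n<n; m*n/n≡m; m/n*n≤m; m/n<m; m/n≤m; m<n⇒m%n≡m; m<n⇒m/n≡0; m≡m%n+[m/n]*n; m≥n⇒m/n>0; n/n≡1)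
open import Data.Nat.Divisibility using (n∣m*n)
open import Data.Nat.Logarithm using (⌈log₂_⌉; ⌈log₂⌉-mono-≤; ⌈log₂2^n⌉≡n)
open import Data.Nat.Properties
open import Algebra.Properties.CommutativeSemigroup +-commutativeSemigroup using (interchange)
open import Data.Product.Base using (_×_; _,_; proj₁; proj₂; ∃-syntax; Σ-syntax)
open import Data.Sum.Base using (_⊎_; inj₁; inj₂)
open import Data.Unit.Base using (⊤; tt)
open import Function.Base using (_∘_)
open import Function.Bundles using (Equivalence)
open import Function.Definitions using (Injective)
open import Level using (Level)
open import Relation.Binary.Bundles using (StrictTotalOrder)
open import Relation.Binary.Definitions using (tri<; tri≈; tri>)
open import Relation.Binary.PropositionalEquality
open import Relation.Nullary using (¬_; yes; no; contradiction)
open import Relation.Nullary.Decidable using (⌊_⌋)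


module LinearArithmetic where
  infixl 6 _⊕_
  infixl 7 _⊗_
  infix  4 _⊑_ _⊏_ _≐_
  infixr 3 _⇒_
  infix  3 ⊢_

  data LExp : Set where
    var : ℕ → LExp
    κ   : ℕ → LExp
    _⊕_ : LExp → LExp → LExp
    _⊗_ : LExp → ℕ → LExp

  data LProp : Set where
    _⊑_ _⊏_ _≐_ : LExp → LExp → LProp

  data Sequent : Set where
    ⊢_  : LProp → Sequent
    _⇒_ : LProp → Sequent → Sequent

  Env : Set
  Env = List ℕ

  at : Env → ℕ → ℕ
  at []       _       = 0
  at (x ∷ ρ) zero    = x
  at (x ∷ ρ) (suc i) = at ρ i

  ⟦_⟧ₑ : LExp → Env → ℕ
  ⟦ var i ⟧ₑ ρ = at ρ i
  ⟦ κ k ⟧ₑ ρ   = k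
  ⟦ a ⊕ b ⟧ₑ ρ = ⟦ a ⟧ₑ ρ + ⟦ b ⟧ₑ ρ
  ⟦ a ⊗ k ⟧ₑ ρ = ⟦ a ⟧ₑ ρ * k

  ⟦_⟧ₚ : LProp → Env → Set
  ⟦ a ⊑ b ⟧ₚ ρ = ⟦ a ⟧ₑ ρ ≤ ⟦ b ⟧ₑ ρ
  ⟦ a ⊏ b ⟧ₚ ρ = ⟦ a ⟧ₑ ρ < ⟦ b ⟧ₑ ρ
  ⟦ a ≐ b ⟧ₚ ρ = ⟦ a ⟧ₑ ρ ≡ ⟦ b ⟧ₑ ρ

  ⟦_⟧ₛ : Sequent → Env → Set
  ⟦ ⊢ g ⟧ₛ ρ   = ⟦ g ⟧ₚ ρ
  ⟦ h ⇒ s ⟧ₛ ρ = ⟦ h ⟧ₚ ρ → ⟦ s ⟧ₛ ρ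

  -- A linear form: constant and coefficients.
  Form : Set
  Form = ℕ × List ℕ

  dot : List ℕ → Env → ℕ
  dot []       _       = 0
  dot (c ∷ cs) []      = 0
  dot (c ∷ cs) (x ∷ ρ) = c * x + dot cs ρ

  ⟦_⟧ᶠ : Form → Env → ℕ
  ⟦ k , cs ⟧ᶠ ρ = k + dot cs ρ

  addL : List ℕ → List ℕ → List ℕ
  addL []       ds       = ds
  addL (c ∷ cs) []       = c ∷ cs
  addL (c ∷ cs) (d ∷ ds) = (c + d) ∷ addL cs ds

  _⊞_ : Form → Form → Form
  (k , cs) ⊞ (l , ds) = (k + l) , addL cs ds

  scale : ℕ → Form → Form
  scale m (k , cs) = (m * k) , map (m *_) cs

  unit : ℕ → List ℕ
  unit zero    = 1 ∷ []
  unit (suc i) = 0 ∷ unit i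

  form : LExp → Form
  form (var i) = 0 , unit i
  form (κ k)   = k , []
  form (a ⊕ b) = form a ⊞ form b
  form (a ⊗ k) = scale k (form a)

  dot-addL : ∀ cs ds ρ → dot (addL cs ds) ρ ≡ dot cs ρ + dot ds ρ
  dot-addL []       ds       ρ       = refl
  dot-addL (c ∷ cs) []       ρ       = sym (+-identityʳ _)
  dot-addL (c ∷ cs) (d ∷ ds) []      = refl
  dot-addL (c ∷ cs) (d ∷ ds) (x ∷ ρ) =
    trans (cong (((c + d) * x) +_) (dot-addL cs ds ρ)) 
      (trans (cong (_+ (dot cs ρ + dot ds ρ)) (*-distribʳ-+ x c d))
             (interchange (c * x) (d * x) (dot cs ρ) (dot ds ρ)))

  dot-scale : ∀ m cs ρ → dot (map (m *_) cs) ρ ≡ m * dot cs ρ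
  dot-scale m []       ρ       = sym (*-zeroʳ m)
  dot-scale m (c ∷ cs) []      = sym (*-zeroʳ m)
  dot-scale m (c ∷ cs) (x ∷ ρ) = trans (cong (m * c * x +_) (dot-scale m cs ρ)) 
      (trans (cong (_+ m * dot cs ρ) (*-assoc m c x)) (sym (*-distribˡ-+ m (c * x) (dot cs ρ))))

  dot-unit : ∀ i ρ → dot (unit i) ρ ≡ at ρ i
  dot-unit zero    []      = refl
  dot-unit zero    (x ∷ ρ) = trans (+-identityʳ (1 * x)) (*-identityˡ x)
  dot-unit (suc i) []      = refl
  dot-unit (suc i) (x ∷ ρ) = dot-unit i ρ

  ⊞-sound : ∀ f g ρ → ⟦ f ⊞ g ⟧ᶠ ρ ≡ ⟦ f ⟧ᶠ ρ + ⟦ g ⟧ᶠ ρ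
  ⊞-sound (k , cs) (l , ds) ρ =
    trans (cong (k + l +_) (dot-addL cs ds ρ)) (interchange k l (dot cs ρ) (dot ds ρ))

  scale-sound : ∀ m f ρ → ⟦ scale m f ⟧ᶠ ρ ≡ m * ⟦ f ⟧ᶠ ρ
  scale-sound m (k , cs) ρ =
    trans (cong (m * k +_) (dot-scale m cs ρ)) (sym (*-distribˡ-+ m k (dot cs ρ)))

  form-sound : ∀ e ρ → ⟦ form e ⟧ᶠ ρ ≡ ⟦ e ⟧ₑ ρ
  form-sound (var i) ρ = dot-unit i ρ
  form-sound (κ k)   ρ = +-identityʳ k
  form-sound (a ⊕ b) ρ =
    trans (⊞-sound (form a) (form b) ρ) (cong₂ _+_ (form-sound a ρ) (form-sound b ρ))
  form-sound (a ⊗ k) ρ =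
    trans (scale-sound k (form a) ρ) (trans (cong (k *_) (form-sound a ρ)) (*-comm k _))

  -- An inequality l ≤ r between linear forms.
  Ineq : Set
  Ineq = Form × Form

  Holds : Env → Ineq → Set
  Holds ρ (l , r) = ⟦ l ⟧ᶠ ρ ≤ ⟦ r ⟧ᶠ ρ

  data AllHold (ρ : Env) : List Ineq → Set where
    []  : AllHold ρ []
    _∷_ : ∀ {i is} → Holds ρ i → AllHold ρ is → AllHold ρ (i ∷ is)

  combine : List ℕ → List Ineq → Ineq
  combine (c ∷ cs) ((l , r) ∷ is) with combine cs is
  ... | L , R = (scale c l ⊞ L) , (scale c r ⊞ R)
  combine _ _ = (0 , []) , (0 , [])

  combine-sound : ∀ cs is ρ → AllHold ρ is → Holds ρ (combine cs is)
  combine-sound []       _        ρ _        = z≤n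
  combine-sound (c ∷ cs) []       ρ _        = z≤n
  combine-sound (c ∷ cs) ((l , r) ∷ is) ρ (h ∷ hs)
    with combine cs is | combine-sound cs is ρ hs
  ... | L , R | H = subst₂ _≤_
    (sym (trans (⊞-sound (scale c l) L ρ) (cong (_+ ⟦ L ⟧ᶠ ρ) (scale-sound c l ρ))))
    (sym (trans (⊞-sound (scale c r) R ρ) (cong (_+ ⟦ R ⟧ᶠ ρ) (scale-sound c r ρ))))
    (+-mono-≤ (*-monoʳ-≤ c h) H)

  leL : List ℕ → List ℕ → Bool
  leL []       _        = true
  leL (c ∷ cs) []       = (c ≡ᵇ 0) ∧ leL cs []
  leL (c ∷ cs) (d ∷ ds) = (c ≤ᵇ d) ∧ leL cs ds

  leL-sound : ∀ cs ds ρ → T (leL cs ds) → dot cs ρ ≤ dot ds ρ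
  leL-sound []       ds       ρ       _ = z≤n
  leL-sound (c ∷ cs) ds       []      _ = z≤n
  leL-sound (c ∷ cs) []       (x ∷ ρ) h with Equivalence.to T-∧ h
  ... | c0 , rest rewrite ≡ᵇ⇒≡ c 0 c0 = ≤-trans (leL-sound cs [] ρ rest) (≤-reflexive (nil ρ))
    where
    nil : ∀ ρ → dot [] ρ ≡ 0
    nil _ = refl
  leL-sound (c ∷ cs) (d ∷ ds) (x ∷ ρ) h with Equivalence.to T-∧ h
  ... | c≤d , rest = +-mono-≤ (*-monoˡ-≤ x (≤ᵇ⇒≤ c d c≤d)) (leL-sound cs ds ρ rest)

  -- The inequality fails for all values of the variables.
  absurdᵇ : Ineq → Bool
  absurdᵇ ((k , cs) , (l , ds)) = (l <ᵇ k) ∧ leL ds cs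

  absurd-sound : ∀ i ρ → T (absurdᵇ i) → Holds ρ i → ∀ {a} {A : Set a} → A
  absurd-sound ((k , cs) , (l , ds)) ρ t h with Equivalence.to T-∧ t
  ... | l<k , ds≤cs =
    contradiction h (<⇒≱ (+-mono-<-≤ (<ᵇ⇒< l k l<k) (leL-sound ds cs ρ ds≤cs)))

  ineqs : LProp → List Ineq
  ineqs (a ⊑ b) = (form a , form b) ∷ []
  ineqs (a ⊏ b) = (form (κ 1 ⊕ a) , form b) ∷ []
  ineqs (a ≐ b) = (form a , form b) ∷ (form b , form a) ∷ []

  toLE : ∀ a b ρ → ⟦ a ⟧ₑ ρ ≤ ⟦ b ⟧ₑ ρ → Holds ρ (form a , form b)
  toLE a b ρ h = subst₂ _≤_ (sym (form-sound a ρ)) (sym (form-sound b ρ)) h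

  ineqs-hold : ∀ p ρ {is} → ⟦ p ⟧ₚ ρ → AllHold ρ is → AllHold ρ (ineqs p ++ is)
  ineqs-hold (a ⊑ b) ρ h hs = toLE a b ρ h ∷ hs
  ineqs-hold (a ⊏ b) ρ h hs = toLE (κ 1 ⊕ a) b ρ h ∷ hs
  ineqs-hold (a ≐ b) ρ h hs = toLE a b ρ (≤-reflexive h) ∷ toLE b a ρ (≤-reflexive (sym h)) ∷ hs

  -- Fourier–Motzkin search for multipliers; its result is checked by absurdᵇ, so
  -- nothing has to be proved about it.  A row is (r - l, multipliers).
  Row : Set
  Row = (ℤ × List ℤ) × List ℕ

  subL : List ℕ → List ℕ → List ℤ
  subL []       []       = []
  subL (c ∷ cs) []       = ℤ.+ c ∷ subL cs []
  subL []       (d ∷ ds) = (ℤ.- (ℤ.+ d)) ∷ subL [] ds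
  subL (c ∷ cs) (d ∷ ds) = (c ℤ.⊖ d) ∷ subL cs ds

  row : ℕ → Ineq → Row
  row i ((k , cs) , (l , ds)) = ((l ℤ.⊖ k) , subL ds cs) , unit i

  rows : ℕ → List Ineq → List Row
  rows i []       = []
  rows i (h ∷ hs) = row i h ∷ rows (suc i) hs

  coef : Row → ℤ
  coef ((_ , [])    , _) = ℤ.+ 0
  coef ((_ , c ∷ _) , _) = c

  tailR : Row → Row
  tailR ((k , [])     , m) = (k , []) , m
  tailR ((k , _ ∷ cs) , m) = (k , cs) , m

  addZ : ℕ → ℕ → List ℤ → List ℤ → List ℤ
  addZ p q []       []       = []
  addZ p q (c ∷ cs) []       = (ℤ.+ p ℤ.* c) ∷ addZ p q cs []
  addZ p q []       (d ∷ ds) = (ℤ.+ q ℤ.* d) ∷ addZ p q [] ds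
  addZ p q (c ∷ cs) (d ∷ ds) = ((ℤ.+ p ℤ.* c) ℤ.+ (ℤ.+ q ℤ.* d)) ∷ addZ p q cs ds

  comb : ℕ → ℕ → Row → Row → Row
  comb p q ((k , cs) , m) ((l , ds) , n) =
    (((ℤ.+ p ℤ.* k) ℤ.+ (ℤ.+ q ℤ.* l)) , addZ p q cs ds) , addL (map (p *_) m) (map (q *_) n)

  positive nonneg negative : List Row → List Row
  positive [] = []
  positive (r ∷ rs) with coef r
  ... | ℤ.+ suc _ = r ∷ positive rs
  ... | _       = positive rs
  negative [] = []
  negative (r ∷ rs) with coef r
  ... | -[1+ _ ] = r ∷ negative rs
  ... | _        = negative rs
  nonneg [] = []
  nonneg (r ∷ rs) with coef r
  ... | ℤ.+ suc _ = nonneg rs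
  ... | _       = tailR r ∷ nonneg rs

  pairs : List Row → List Row → List Row
  pairs []       ns = []
  pairs (p ∷ ps) ns = go ns ++ pairs ps ns
    where
    go : List Row → List Row
    go []       = []
    go (n ∷ ns) = tailR (comb ℤ.∣ coef n ∣ ℤ.∣ coef p ∣ p n) ∷ go ns

  -- Variables are nonnegative, so a row without a positive coefficient may drop it.
  elim : List Row → List Row
  elim rs = pairs (positive rs) (negative rs) ++ nonneg rs

  eliminate : ℕ → List Row → List Row
  eliminate zero    rs = rs
  eliminate (suc n) rs = eliminate n (elim rs)

  refuting : List Row → List ℕ
  refuting [] = []
  refuting (((-[1+ _ ] , _) , m) ∷ _) = m
  refuting (_ ∷ rs) = refuting rs

  multipliers : ℕ → List Ineq → List ℕ
  multipliers n is = refuting (eliminate n (rows 0 is))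

  refutes : ℕ → List Ineq → Bool
  refutes n is = absurdᵇ (combine (multipliers n is) is)

  -- The hypotheses collected so far, and what remains to be proved.
  provable : ℕ → List Ineq → Sequent → Bool
  provable n is (⊢ a ⊑ b)   = refutes n (ineqs (b ⊏ a) ++ is)
  provable n is (⊢ a ⊏ b)   = refutes n (ineqs (b ⊑ a) ++ is)
  provable n is (⊢ a ≐ b)   = refutes n (ineqs (b ⊏ a) ++ is) ∧ refutes n (ineqs (a ⊏ b) ++ is)
  provable n is (h ⇒ s)   = provable n (ineqs h ++ is) s

  refute : ∀ n is ρ → T (refutes n is) → AllHold ρ is → ∀ {a} {A : Set a} → A
  refute n is ρ t hs =
    absurd-sound (combine (multipliers n is) is) ρ t (combine-sound (multipliers n is) is ρ hs)

  provable-sound : ∀ n is s ρ → T (provable n is s) → AllHold ρ is → ⟦ s ⟧ₛ ρ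
  provable-sound n is (⊢ a ⊑ b) ρ t hs with ⟦ a ⟧ₑ ρ ≤? ⟦ b ⟧ₑ ρ
  ... | yes p = p
  ... | no ¬p = refute n (ineqs (b ⊏ a) ++ is) ρ t (ineqs-hold (b ⊏ a) ρ (≰⇒> ¬p) hs)
  provable-sound n is (⊢ a ⊏ b) ρ t hs with ⟦ a ⟧ₑ ρ <? ⟦ b ⟧ₑ ρ
  ... | yes p = p
  ... | no ¬p = refute n (ineqs (b ⊑ a) ++ is) ρ t (ineqs-hold (b ⊑ a) ρ (≮⇒≥ ¬p) hs)
  provable-sound n is (⊢ a ≐ b) ρ t hs with Equivalence.to (T-∧ {refutes n (ineqs (b ⊏ a) ++ is)}) t
  ... | t₁ , t₂ with ⟦ a ⟧ₑ ρ ≤? ⟦ b ⟧ₑ ρ | ⟦ b ⟧ₑ ρ ≤? ⟦ a ⟧ₑ ρ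
  ... | yes p | yes q = ≤-antisym p q
  ... | no ¬p | _     = refute n (ineqs (b ⊏ a) ++ is) ρ t₁ (ineqs-hold (b ⊏ a) ρ (≰⇒> ¬p) hs)
  ... | _     | no ¬q = refute n (ineqs (a ⊏ b) ++ is) ρ t₂ (ineqs-hold (a ⊏ b) ρ (≰⇒> ¬q) hs)
  provable-sound n is (h ⇒ s) ρ t hold = λ x →
    provable-sound n (ineqs h ++ is) s ρ t (ineqs-hold h ρ x hold)

  Curried : ℕ → Set
  Curried zero    = Sequent
  Curried (suc n) = LExp → Curried n

  instantiate : ∀ n → ℕ → Curried n → Sequent
  instantiate zero    i s = s
  instantiate (suc n) i f = instantiate n (suc i) (f (var i))

  Quantified : ℕ → (Env → Set) → Set
  Quantified zero    P = P []
  Quantified (suc n) P = ∀ x → Quantified n (λ ρ → P (x ∷ ρ))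

  quantify : ∀ n {P : Env → Set} → (∀ ρ → P ρ) → Quantified n P
  quantify zero    p = p []
  quantify (suc n) p = λ x → quantify n (λ ρ → p (x ∷ ρ))

  opaque
    linear : ∀ n (f : Curried n) → {T (provable n [] (instantiate n 0 f))} →
             Quantified n ⟦ instantiate n 0 f ⟧ₛ
    linear n f {t} = quantify n (λ ρ → provable-sound n [] (instantiate n 0 f) ρ t [])

open LinearArithmetic using (κ; _⊕_; _⊗_; _⊑_; _⊏_; _≐_; _⇒_; ⊢_; linear)

data Kind : Set where
  safeᵏ faultyᵏ : Kind

-- Safe memory layout: six banks of 16 numeric variables, four banks of 8 word
-- variables, 16 temporaries, and arrays from address 144 on.
data NVar : Set where
  num : (b i : ℕ) {b<6 : T (b <ᵇ 6)} {i<16 : T (i <ᵇ 16)} → NVar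

data WVar : Set where
  wrd : (b i : ℕ) {b<4 : T (b <ᵇ 4)} {i<8 : T (i <ᵇ 8)} → WVar

data Exp : Set where
  ref : NVar → Exp
  lit : ℕ → Exp
  bin : Op → Exp → Exp → Exp

data Cond : Set where
  _<ₙ_ : Exp → Exp → Cond
  _<ʷ_ : WVar → WVar → Cond

infix 5 _<ₙ_ _<ʷ_
infix 4 _≔_
infixr 3 _⨾_

data Cmd : Set where
  skip  : Cmd
  _≔_   : NVar → Exp → Cmd
  load  : Kind → WVar → Exp → Cmd
  store : Kind → Exp → WVar → Cmd
  _⨾_   : Cmd → Cmd → Cmd
  ite   : Cond → Cmd → Cmd → Cmd
  while : Cond → Cmd → Cmd

arrays : ℕ
arrays = 144

nadr : ℕ → ℕ → ℕ
nadr b i = b * 16 + i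

wadr : ℕ → ℕ → ℕ
wadr b i = 96 + (b * 8 + i)

nvar : NVar → ℕ
nvar (num b i) = nadr b i

wvar : WVar → ℕ
wvar (wrd b i) = wadr b i

tmp : ℕ → ℕ
tmp d = 128 + d

expCode : Exp → ℕ → List Instr
expCode (ref x)     d = copy (tmp d) (nvar x) ∷ []
expCode (lit k)     d = set (tmp d) k ∷ []
expCode (bin o e f) d = expCode e d ++ expCode f (suc d) ++ arith o (tmp d) (tmp d) (tmp (suc d)) ∷ []

expSize : Exp → ℕ
expSize (ref x)     = 1
expSize (lit k)     = 1
expSize (bin o e f) = expSize e + (expSize f + 1)

shallow : Exp → ℕ → Bool
shallow (ref x)     d = d <ᵇ 16
shallow (lit k)     d = d <ᵇ 16
shallow (bin o e f) d = shallow e d ∧ shallow f (suc d)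

shallowᶜ : Cond → Bool
shallowᶜ (e <ₙ f) = shallow e 0 ∧ shallow f 1
shallowᶜ (x <ʷ y) = true

condCode : Cond → List Instr
condCode (e <ₙ f) = expCode e 0 ++ expCode f 1
condCode (x <ʷ y) = []

condSize : Cond → ℕ
condSize (e <ₙ f) = expSize e + expSize f
condSize (x <ʷ y) = 0

branch : Cond → ℕ → Instr
branch (e <ₙ f) l = jumpLess (tmp 0) (tmp 1) l
branch (x <ʷ y) l = jumpLess (wvar x) (wvar y) l

loadᵏ : Kind → ℕ → ℕ → Instr
loadᵏ safeᵏ   = loadˢ
loadᵏ faultyᵏ = loadᶠ

storeᵏ : Kind → ℕ → ℕ → Instr
storeᵏ safeᵏ   = storeˢ
storeᵏ faultyᵏ = storeᶠ

size : Cmd → ℕ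
size skip          = 0
size (x ≔ e)       = expSize e + 1
size (load k w e)  = expSize e + 1
size (store k e w) = expSize e + 1
size (c ⨾ d)       = size c + size d
size (ite b c d)   = condSize b + (1 + (size d + (1 + (size c + 1))))
size (while b c)   = condSize b + (1 + (1 + (size c + 1)))

code : Cmd → ℕ → List Instr
code skip          l = []
code (x ≔ e)       l = expCode e 0 ++ copy (nvar x) (tmp 0) ∷ []
code (load k w e)  l = expCode e 0 ++ loadᵏ k (wvar w) (tmp 0) ∷ []
code (store k e w) l = expCode e 0 ++ storeᵏ k (tmp 0) (wvar w) ∷ []
code (c ⨾ d)       l = code c l ++ code d (l + size c)
code (ite b c d)   l =
  condCode b ++ branch b (lᵈ + size d + 1) ∷ code d lᵈ ++
  jump (l + size (ite b c d)) ∷ code c (lᵈ + size d + 1) ++ jump (l + size (ite b c d)) ∷ []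
  where
  lᵈ = l + condSize b + 1
code (while b c)   l =
  condCode b ++ branch b (l + condSize b + 1 + 1) ∷ jump (l + size (while b c)) ∷
  code c (l + condSize b + 1 + 1) ++ jump l ∷ []

expCode-length : ∀ e d → length (expCode e d) ≡ expSize e
expCode-length (ref x)     d = refl
expCode-length (lit k)     d = refl
expCode-length (bin o e f) d =
  trans (length-++ (expCode e d))
    (cong₂ _+_ (expCode-length e d)
      (trans (length-++ (expCode f (suc d))) (cong (_+ 1) (expCode-length f (suc d)))))

condCode-length : ∀ b → length (condCode b) ≡ condSize b
condCode-length (e <ₙ f) =
  trans (length-++ (expCode e 0)) (cong₂ _+_ (expCode-length e 0) (expCode-length f 1))
condCode-length (x <ʷ y) = refl

code-length : ∀ c l → length (code c l) ≡ size c
code-length skip          l = refl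
code-length (x ≔ e)       l = trans (length-++ (expCode e 0)) (cong (_+ 1) (expCode-length e 0))
code-length (load k w e)  l = trans (length-++ (expCode e 0)) (cong (_+ 1) (expCode-length e 0))
code-length (store k e w) l = trans (length-++ (expCode e 0)) (cong (_+ 1) (expCode-length e 0))
code-length (c ⨾ d)       l =
  trans (length-++ (code c l)) (cong₂ _+_ (code-length c l) (code-length d (l + size c)))
code-length (ite b c d)   l =
  trans (length-++ (condCode b)) (cong₂ _+_ (condCode-length b)
    (cong suc (trans (length-++ (code d _)) (cong₂ _+_ (code-length d _)
      (cong suc (trans (length-++ (code c _)) (cong (_+ 1) (code-length c _))))))))
code-length (while b c)   l =
  trans (length-++ (condCode b)) (cong₂ _+_ (condCode-length b)
    (cong (λ k → suc (suc k)) (trans (length-++ (code c _)) (cong (_+ 1) (code-length c _)))))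

bit : Bool → ℕ
bit false = 0
bit true  = 1

bit≤1 : ∀ b → bit b ≤ 1
bit≤1 false = z≤n
bit≤1 true  = ≤-refl

count : (ℕ → Bool) → ℕ → ℕ
count b zero    = 0
count b (suc k) = count b k + bit (b k)

count-or : ∀ {b b₁ b₂} k → (∀ p → p < k → b p ≡ true → b₁ p ≡ true ⊎ b₂ p ≡ true) →
  count b k ≤ count b₁ k + count b₂ k
count-or zero    h = z≤n
count-or {b} {b₁} {b₂} (suc k) h =
  linear 6 (λ c c₁ c₂ x x₁ x₂ → c ⊑ c₁ ⊕ c₂ ⇒ x ⊑ x₁ ⊕ x₂ ⇒ ⊢ c ⊕ x ⊑ (c₁ ⊕ x₁) ⊕ (c₂ ⊕ x₂))
    (count b k) (count b₁ k) (count b₂ k) (bit (b k)) (bit (b₁ k)) (bit (b₂ k))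
    (count-or k (λ p p<k → h p (m<n⇒m<1+n p<k))) (go (b k) refl)
  where
  go : ∀ v → b k ≡ v → bit v ≤ bit (b₁ k) + bit (b₂ k)
  go false _ = z≤n
  go true eq with h k ≤-refl eq
  ... | inj₁ e rewrite e = s≤s z≤n
  ... | inj₂ e rewrite e = m≤n+m 1 _

count-none : ∀ {b} k → (∀ p → p < k → b p ≡ false) → count b k ≡ 0
count-none zero    h = refl
count-none (suc k) h rewrite h k ≤-refl | count-none k (λ p p<k → h p (m<n⇒m<1+n p<k)) = refl

count-all : ∀ {b} k → (∀ p → p < k → b p ≡ true) → count b k ≡ k
count-all zero    h = refl
count-all (suc k) h rewrite h k ≤-refl | count-all k (λ p p<k → h p (m<n⇒m<1+n p<k)) = +-comm k 1

count-mono : ∀ {b b'} k → (∀ p → p < k → b p ≡ true → b' p ≡ true) → count b k ≤ count b' k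
count-mono {b} {b'} k h = subst (count b k ≤_)
  (trans (cong (count b' k +_) (count-none {λ _ → false} k (λ _ _ → refl))) (+-identityʳ _))
  (count-or k (λ p p<k e → inj₁ (h p p<k e)))

count-cong : ∀ {b b'} k → (∀ p → p < k → b p ≡ b' p) → count b k ≡ count b' k
count-cong zero    h = refl
count-cong (suc k) h =
  cong₂ _+_ (count-cong k (λ p p<k → h p (m<n⇒m<1+n p<k))) (cong bit (h k ≤-refl))

count≤ : ∀ b k → count b k ≤ k
count≤ b zero    = z≤n
count≤ b (suc k) = subst (count b (suc k) ≤_) (+-comm k 1) (+-mono-≤ (count≤ b k) (bit≤1 (b k)))

count-not : ∀ b k → count b k + count (λ p → not (b p)) k ≡ k
count-not b zero    = refl
count-not b (suc k) =
  linear 5 (λ c d x y k → c ⊕ d ≐ k ⇒ x ⊕ y ≐ κ 1 ⇒ ⊢ (c ⊕ x) ⊕ (d ⊕ y) ≐ κ 1 ⊕ k)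
    (count b k) _ (bit (b k)) (bit (not (b k))) k (count-not b k) (go (b k))
  where
  go : ∀ v → bit v + bit (not v) ≡ 1
  go false = refl
  go true  = refl

count-split : ∀ b j k → count b (j + k) ≡ count b j + count (λ p → b (j + p)) k
count-split b j zero    = trans (cong (count b) (+-identityʳ j)) (sym (+-identityʳ _))
count-split b j (suc k) = trans (cong (count b) (+-suc j k))
  (trans (cong (_+ bit (b (j + k))) (count-split b j k)) (+-assoc (count b j) _ _))

count-extend : ∀ b {j k} → j ≤ k → count b j ≤ count b k
count-extend b {j} j≤k = subst (λ k → count b j ≤ count b k) (m+[n∸m]≡n j≤k)
  (subst (count b j ≤_) (sym (count-split b j _)) (m≤m+n _ _))

count-first : ∀ b k → count b (suc k) ≡ bit (b 0) + count (λ p → b (suc p)) k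
count-first b k = count-split b 1 k

count-unique : ∀ {b} k → (∀ p q → b p ≡ true → b q ≡ true → p ≡ q) → count b k ≤ 1
count-unique zero    h = z≤n
count-unique {b} (suc k) h = go (b k) refl
  where
  go : ∀ v → b k ≡ v → count b k + bit v ≤ 1
  go false _  = subst (_≤ 1) (sym (+-identityʳ _)) (count-unique k h)
  go true  bk = ≤-reflexive (cong (_+ 1) (count-none k (λ p p<k → none p p<k (b p) refl)))
    where
    none : ∀ p → p < k → ∀ v → b p ≡ v → b p ≡ false
    none p p<k false e = e
    none p p<k true  e = contradiction (h p k e bk) (<⇒≢ p<k)

elem : ℕ → List ℕ → Bool
elem p []      = false
elem p (d ∷ D) = (p ≡ᵇ d) ∨ elem p D

∨-false : ∀ {x y} → x ∨ y ≡ false → x ≡ false × y ≡ false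
∨-false {false} h = refl , h

∨-true : ∀ {x y} → x ∨ y ≡ true → x ≡ true ⊎ y ≡ true
∨-true {true}  h = inj₁ refl
∨-true {false} h = inj₂ h

≡ᵇ-true : ∀ {m n} → (m ≡ᵇ n) ≡ true → m ≡ n
≡ᵇ-true {m} {n} e = ≡ᵇ⇒≡ m n (subst T (sym e) tt)

≡ᵇ-refl : ∀ m → (m ≡ᵇ m) ≡ true
≡ᵇ-refl zero    = refl
≡ᵇ-refl (suc m) = ≡ᵇ-refl m

≡ᵇ-false : ∀ {m n} → (m ≡ᵇ n) ≡ false → m ≢ n
≡ᵇ-false {m} e refl with trans (sym e) (≡ᵇ-refl m)
... | ()

elem-++ : ∀ p D {E} → elem p (D ++ E) ≡ false → elem p D ≡ false × elem p E ≡ false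
elem-++ p []      h = refl , h
elem-++ p (d ∷ D) h with ∨-false {p ≡ᵇ d} h
... | h₁ , h₂ with elem-++ p D h₂
... | h₃ , h₄ rewrite h₁ = h₃ , h₄

elem-map : ∀ (f : ℕ → ℕ) p D → elem (f p) (map f D) ≡ false → elem p D ≡ false
elem-map f p []      h = refl
elem-map f p (d ∷ D) h with ∨-false {f p ≡ᵇ f d} h | p ≡ᵇ d in eq
... | h₁ , h₂ | false = elem-map f p D h₂
... | h₁ , h₂ | true  = contradiction (cong f (≡ᵇ-true eq)) (≡ᵇ-false h₁)

count-elem : ∀ D base k → count (λ p → elem (base + p) D) k ≤ length D
count-elem []      base k = ≤-reflexive (count-none k (λ _ _ → refl))
count-elem (d ∷ D) base k = ≤-trans (count-or k (λ p _ → ∨-true))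
  (+-mono-≤ (count-unique k (λ p q e e' → +-cancelˡ-≡ base p q (trans (≡ᵇ-true e) (sym (≡ᵇ-true e')))))
            (count-elem D base k))

count-dirty : ∀ {b b'} D base k →
  (∀ p → p < k → elem (base + p) D ≡ false → b p ≡ true → b' p ≡ true) →
  count b k ≤ count b' k + length D
count-dirty {b} {b'} D base k h =
  ≤-trans (count-or k (λ p p<k e → go p p<k e (elem (base + p) D) refl))
          (+-monoʳ-≤ (count b' k) (count-elem D base k))
  where
  go : ∀ p → p < k → b p ≡ true → ∀ v → elem (base + p) D ≡ v →
    b' p ≡ true ⊎ elem (base + p) D ≡ true
  go p p<k e false ∉D = inj₁ (h p p<k ∉D e)
  go p p<k e true  ∈D = inj₂ ∈D

count-blocks : ∀ {b g} q E r →
  (∀ j → j < r → g j ≡ true → elem j E ≡ false → q ≤ count (λ p → b (j * q + p)) q * 16) →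
  count g r * q ≤ count b (r * q) * 16 + length E * q
count-blocks {b} {g} q E r h =
  ≤-trans (go r ≤-refl) (+-monoʳ-≤ (count b (r * q) * 16) (*-monoˡ-≤ q (count-elem E 0 r)))
  where
  one : ∀ j → j < r → ∀ v w → g j ≡ v → elem j E ≡ w →
    bit v * q ≤ count (λ p → b (j * q + p)) q * 16 + bit w * q
  one j j<r false w     _ _ = z≤n
  one j j<r true  true  _ _ = m≤n+m _ (count (λ p → b (j * q + p)) q * 16)
  one j j<r true  false g e = ≤-trans (≤-reflexive (+-identityʳ q)) (≤-trans (h j j<r g e) (m≤m+n _ _))
  go : ∀ i → i ≤ r → count g i * q ≤ count b (i * q) * 16 + count (λ j → elem j E) i * q
  go zero    _   = z≤n
  go (suc i) i<r = subst₂ _≤_ (sym (*-distribʳ-+ q (count g i) (bit (g i))))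
    (cong₂ (λ x y → x * 16 + y)
      (trans (sym (count-split b (i * q) q)) (cong (count b) (+-comm (i * q) q)))
      (sym (*-distribʳ-+ q (count (λ j → elem j E) i) (bit (elem i E)))))
    (linear 6 (λ x y z u v w → x ⊑ y ⊗ 16 ⊕ z ⇒ u ⊑ v ⊗ 16 ⊕ w ⇒ ⊢ x ⊕ u ⊑ (y ⊕ v) ⊗ 16 ⊕ (z ⊕ w))
      _ (count b (i * q)) _ _ (count (λ p → b (i * q + p)) q) _
      (go i (<⇒≤ i<r)) (one i i<r (g i) (elem i E) refl refl))

-- Keeping every other element of a sorted run halves every rank up to one.
thin-run : ∀ d h → (∀ p q → p < q → q < h + h → d q ≡ true → d p ≡ true) →
  count (λ i → d (suc (i + i))) h * 2 ≤ count d (h + h)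
  × count d (h + h) ≤ count (λ i → d (suc (i + i))) h * 2 + 1
thin-run d zero    desc = z≤n , z≤n
thin-run d (suc h) desc rewrite +-suc h h
  with thin-run d h (λ p q p<q q< → desc p q p<q (m<n⇒m<1+n (m<n⇒m<1+n q<)))
... | lo , hi = go (d (h + h)) (d (suc (h + h))) refl refl
  where
  c = count (λ i → d (suc (i + i))) h
  e = count d (h + h)
  Goal : Bool → Bool → Set
  Goal v w = (c + bit w) * 2 ≤ e + bit v + bit w × e + bit v + bit w ≤ (c + bit w) * 2 + 1
  go : ∀ v w → d (h + h) ≡ v → d (suc (h + h)) ≡ w → Goal v w
  go false true ev ew = contradiction (trans (sym ev) (desc (h + h) (suc (h + h)) ≤-refl ≤-refl ew)) (λ ())
  go false false _ _ =
    linear 2 (λ c e → c ⊗ 2 ⊑ e ⇒ ⊢ (c ⊕ κ 0) ⊗ 2 ⊑ e ⊕ κ 0 ⊕ κ 0) c e lo ,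
    linear 2 (λ c e → e ⊑ c ⊗ 2 ⊕ κ 1 ⇒ ⊢ e ⊕ κ 0 ⊕ κ 0 ⊑ (c ⊕ κ 0) ⊗ 2 ⊕ κ 1) c e hi
  go true w ev ew =
    linear 3 (λ c e w → c ⊗ 2 ⊑ e ⇒ w ⊑ κ 1 ⇒ ⊢ (c ⊕ w) ⊗ 2 ⊑ e ⊕ κ 1 ⊕ w) c e (bit w) lo (bit≤1 w) ,
    linear 4 (λ c e w h → e ⊑ h ⊕ h ⇒ c ≐ h ⇒ ⊢ e ⊕ κ 1 ⊕ w ⊑ (c ⊕ w) ⊗ 2 ⊕ κ 1) c e (bit w) h
      (count≤ d (h + h)) (count-all h (λ i i<h → desc (suc (i + i)) (h + h) (odd i i<h) (m<n⇒m<1+n ≤-refl) ev))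
    where
    odd : ∀ i → i < h → suc (i + i) < h + h
    odd i i<h = linear 2 (λ i h → i ⊏ h ⇒ ⊢ κ 1 ⊕ (i ⊕ i) ⊏ h ⊕ h) i h i<h

thin-runs : ∀ d h R → (∀ r p q → r < R → p < q → q < h + h → d (r * (h + h) + q) ≡ true → d (r * (h + h) + p) ≡ true) →
  count (λ i → d (suc (i + i))) (R * h) * 2 ≤ count d (R * (h + h))
  × count d (R * (h + h)) ≤ count (λ i → d (suc (i + i))) (R * h) * 2 + R
thin-runs d h zero    desc = z≤n , z≤n
thin-runs d h (suc R) desc
  with thin-runs d h R (λ r p q r<R → desc r p q (m<n⇒m<1+n r<R))
     | thin-run (λ p → d (R * (h + h) + p)) h (λ p q p<q q< → desc R p q ≤-refl p<q q<)
... | lo , hi | lo' , hi' = subst₂ (λ x y → x * 2 ≤ y × y ≤ x * 2 + suc R) (sym eq₁) (sym eq₂)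
  ( linear 4 (λ c e c' e' → c ⊗ 2 ⊑ e ⇒ c' ⊗ 2 ⊑ e' ⇒ ⊢ (c ⊕ c') ⊗ 2 ⊑ e ⊕ e') cR eR cr er lo lo'
  , linear 5 (λ c e c' e' R → e ⊑ c ⊗ 2 ⊕ R ⇒ e' ⊑ c' ⊗ 2 ⊕ κ 1 ⇒ ⊢ e ⊕ e' ⊑ (c ⊕ c') ⊗ 2 ⊕ (κ 1 ⊕ R)) cR eR cr er R hi hi')
  where
  cR = count (λ i → d (suc (i + i))) (R * h)
  eR = count d (R * (h + h))
  cr = count (λ i → d (R * (h + h) + suc (i + i))) h
  er = count (λ p → d (R * (h + h) + p)) (h + h)
  eq₂ : count d (suc R * (h + h)) ≡ eR + er
  eq₂ = trans (cong (count d) (+-comm (h + h) (R * (h + h)))) (count-split d (R * (h + h)) (h + h))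
  index : ∀ i → suc (R * h + i + (R * h + i)) ≡ R * (h + h) + suc (i + i)
  index i = trans (linear 2 (λ x i → ⊢ κ 1 ⊕ (x ⊕ i ⊕ (x ⊕ i)) ≐ (x ⊕ x) ⊕ (κ 1 ⊕ (i ⊕ i))) (R * h) i)
    (cong (_+ suc (i + i)) (sym (*-distribˡ-+ R h h)))
  eq₁ : count (λ i → d (suc (i + i))) (suc R * h) ≡ cR + cr
  eq₁ = trans (cong (count _) (+-comm h (R * h))) (trans (count-split _ (R * h) h)
    (cong (cR +_) (count-cong h (λ i _ → cong d (index i)))))

infixl 6 _∔_ _∸ₑ_
infixl 7 _×ₑ_ _÷ₑ_

_∔_ _∸ₑ_ _×ₑ_ _÷ₑ_ : Exp → Exp → Exp
_∔_  = bin add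
_∸ₑ_ = bin sub
_×ₑ_ = bin mul
_÷ₑ_ = bin div

r : (b i : ℕ) {_ : T (b <ᵇ 6)} {_ : T (i <ᵇ 16)} → Exp
r b i {p} {q} = ref (num b i {p} {q})

-- Numeric bank 4: 0 source, 1 destination, 2 start of the pair of runs, 3 and 4 heads of
-- the two runs, 5 end of the output, 6 and 7 ends of the two runs, 8 run length, 9 total length.
takeˡ takeʳ mergeStep mergePass : Kind → Cmd
takeˡ k = store k (r 4 1 ∔ r 4 5) (wrd 3 0) ⨾ num 4 3 ≔ r 4 3 ∔ lit 1 ⨾ num 4 5 ≔ r 4 5 ∔ lit 1
takeʳ k = store k (r 4 1 ∔ r 4 5) (wrd 3 1) ⨾ num 4 4 ≔ r 4 4 ∔ lit 1 ⨾ num 4 5 ≔ r 4 5 ∔ lit 1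
mergeStep k =
  ite (r 4 3 <ₙ r 4 6)
    (load k (wrd 3 0) (r 4 0 ∔ r 4 3) ⨾
     ite (r 4 4 <ₙ r 4 7)
       (load k (wrd 3 1) (r 4 0 ∔ r 4 4) ⨾ ite (wrd 3 1 <ʷ wrd 3 0) (takeʳ k) (takeˡ k))
       (takeˡ k))
    (load k (wrd 3 1) (r 4 0 ∔ r 4 4) ⨾ takeʳ k)
mergePass k =
  num 4 2 ≔ lit 0 ⨾
  while (r 4 2 <ₙ r 4 9)
    (num 4 3 ≔ r 4 2 ⨾ num 4 6 ≔ r 4 2 ∔ r 4 8 ⨾ num 4 4 ≔ r 4 6 ⨾ num 4 7 ≔ r 4 6 ∔ r 4 8 ⨾
     num 4 5 ≔ r 4 2 ⨾
     while (r 4 5 <ₙ r 4 7) (mergeStep k) ⨾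
     num 4 2 ≔ r 4 7)

-- Numeric bank 3: 0 the block, 1 its size, 2 and 3 work areas, 4 a power of 4, 5 length of the
-- sample, 6 run length, 7 loop index, 8 twice the run length.  The answer is word 0 of bank 2.
mergeCall : Kind → (i j l : ℕ) {_ : T (i <ᵇ 16)} {_ : T (j <ᵇ 16)} {_ : T (l <ᵇ 16)} → Cmd
mergeCall k i j l {p} {q} {s} =
  num 4 0 ≔ r 3 i {_} {p} ⨾ num 4 1 ≔ r 3 j {_} {q} ⨾ num 4 8 ≔ r 3 l {_} {s} ⨾ num 4 9 ≔ r 3 5 ⨾ mergePass k

thinStep thinPass sampleStep sampleMedian : Kind → Cmd
thinStep k =
  load k (wrd 2 0) (r 3 2 ∔ (r 3 7 ∔ r 3 7 ∔ lit 1)) ⨾ store k (r 3 2 ∔ r 3 7) (wrd 2 0) ⨾ num 3 7 ≔ r 3 7 ∔ lit 1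
thinPass k = num 3 5 ≔ r 3 5 ÷ₑ lit 2 ⨾ num 3 7 ≔ lit 0 ⨾ while (r 3 7 <ₙ r 3 5) (thinStep k)
sampleStep k =
  num 3 8 ≔ r 3 6 ∔ r 3 6 ⨾ mergeCall k 2 3 6 ⨾ mergeCall k 3 2 8 ⨾ thinPass k ⨾ num 3 6 ≔ r 3 8
sampleMedian k =
  num 3 5 ≔ r 3 4 ⨾ num 3 6 ≔ lit 1 ⨾ while (r 3 6 <ₙ r 3 5) (sampleStep k) ⨾
  load k (wrd 2 0) (r 3 2 ∔ (r 3 5 ÷ₑ lit 4))

powerOf4 copyStep copyBlock medianᶠ medianˢ : Cmd
powerOf4 = num 3 4 ≔ lit 1 ⨾ while (r 3 4 ×ₑ lit 4 <ₙ r 3 1 ∔ lit 1) (num 3 4 ≔ r 3 4 ×ₑ lit 4)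
copyStep =
  load faultyᵏ (wrd 2 0) (r 3 0 ∔ r 3 7) ⨾ store faultyᵏ (r 3 2 ∔ r 3 7) (wrd 2 0) ⨾ num 3 7 ≔ r 3 7 ∔ lit 1
copyBlock = num 3 7 ≔ lit 0 ⨾ while (r 3 7 <ₙ r 3 4) copyStep
medianᶠ = powerOf4 ⨾ copyBlock ⨾ sampleMedian faultyᵏ
medianˢ = powerOf4 ⨾ sampleMedian safeᵏ

-- Numeric bank 2: 0 the current block, 1 destination, 2 number of finished blocks, 3 number of
-- blocks, 4 block size, 5 and 6 work areas.
collectStep collect : Kind → Cmd
collectStep k =
  num 3 0 ≔ r 2 0 ⨾ num 3 1 ≔ r 2 4 ⨾ num 3 2 ≔ r 2 5 ⨾ num 3 3 ≔ r 2 6 ⨾ medianᶠ ⨾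
  store k (r 2 1 ∔ r 2 2) (wrd 2 0) ⨾ num 2 0 ≔ r 2 0 ∔ r 2 4 ⨾ num 2 2 ≔ r 2 2 ∔ lit 1
collect k = num 2 2 ≔ lit 0 ⨾ while (r 2 2 <ₙ r 2 3) (collectStep k)

-- Numeric bank 1: 0 array, 1 its length, 2 number of blocks, 3 block size, 4 elements at most the
-- pivot, 5 elements at least the pivot, 6 loop index, 7 success.  The pivot is word 0 of bank 2.
rankStep rank : Cmd
rankStep =
  load faultyᵏ (wrd 1 0) (r 1 0 ∔ r 1 6) ⨾
  ite (wrd 2 0 <ʷ wrd 1 0) skip (num 1 4 ≔ r 1 4 ∔ lit 1) ⨾
  ite (wrd 1 0 <ʷ wrd 2 0) skip (num 1 5 ≔ r 1 5 ∔ lit 1) ⨾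
  num 1 6 ≔ r 1 6 ∔ lit 1
rank = num 1 4 ≔ lit 0 ⨾ num 1 5 ≔ lit 0 ⨾ num 1 6 ≔ lit 0 ⨾ while (r 1 6 <ₙ r 1 1) rankStep

-- Numeric bank 0: 0 n, 1 δ, 2 S, 12 a multiple of δ, 13 and 14 work areas.
attempt smallPivot : Cmd
attempt =
  num 2 0 ≔ r 1 0 ⨾ num 2 1 ≔ lit arrays ⨾ num 2 3 ≔ r 1 2 ⨾ num 2 4 ≔ r 1 3 ⨾ num 2 5 ≔ r 0 13 ⨾ num 2 6 ≔ r 0 14 ⨾
  collect safeᵏ ⨾
  num 3 1 ≔ r 1 2 ⨾ num 3 2 ≔ lit arrays ⨾ num 3 3 ≔ lit arrays ∔ r 1 2 ⨾ medianˢ ⨾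
  rank ⨾
  ite (r 1 4 ×ₑ lit 1024 <ₙ r 1 1) skip (ite (r 1 5 ×ₑ lit 1024 <ₙ r 1 1) skip (num 1 7 ≔ lit 1))
smallPivot =
  ite (r 1 1 <ₙ r 0 2) (num 1 2 ≔ r 1 1) (num 1 2 ≔ r 0 2) ⨾ num 1 3 ≔ r 1 1 ÷ₑ r 1 2 ⨾ num 1 7 ≔ lit 0 ⨾
  while (r 1 7 <ₙ lit 1) attempt

-- In bank 0, the segment to be partitioned is [7, 8).
pivot : Cmd
pivot = num 1 1 ≔ r 0 8 ∸ₑ r 0 7 ⨾
  ite (r 0 12 <ₙ r 1 1)
    (num 2 0 ≔ r 0 7 ⨾ num 2 1 ≔ r 0 0 ⨾ num 2 3 ≔ r 0 12 ⨾ num 2 4 ≔ r 1 1 ÷ₑ r 0 12 ⨾ num 2 5 ≔ r 0 13 ⨾ num 2 6 ≔ r 0 14 ⨾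
     collect faultyᵏ ⨾ num 1 0 ≔ r 0 0 ⨾ num 1 1 ≔ r 0 12 ⨾ smallPivot)
    (num 1 0 ≔ r 0 7 ⨾ smallPivot)

-- In bank 0: 9 end of the part below the pivot, 10 the next word, 11 end of the part equal to the
-- pivot.  The word under consideration is word 0 of bank 1.
exchange : (p q : ℕ) {_ : T (p <ᵇ 16)} {_ : T (q <ᵇ 16)} → Cmd
exchange p q {s} {t} =
  load faultyᵏ (wrd 1 1) (r 0 q {_} {t}) ⨾ store faultyᵏ (r 0 p {_} {s}) (wrd 1 1) ⨾ store faultyᵏ (r 0 q {_} {t}) (wrd 1 0)
partitionStep partition : Cmd
partitionStep =
  load faultyᵏ (wrd 1 0) (r 0 10) ⨾
  ite (wrd 2 0 <ʷ wrd 1 0) skip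
    (exchange 10 11 ⨾
     ite (wrd 1 0 <ʷ wrd 2 0) (exchange 11 9 ⨾ num 0 9 ≔ r 0 9 ∔ lit 1) skip ⨾
     num 0 11 ≔ r 0 11 ∔ lit 1) ⨾
  num 0 10 ≔ r 0 10 ∔ lit 1
partition = num 0 9 ≔ r 0 7 ⨾ num 0 10 ≔ r 0 7 ⨾ num 0 11 ≔ r 0 7 ⨾ while (r 0 10 <ₙ r 0 8) partitionStep

-- In bank 0: 3 the length of a segment, 4 half of it, 5 its start, 6 its middle.
narrow split segment level main : Cmd
narrow =
  pivot ⨾ partition ⨾
  ite (r 0 9 <ₙ r 0 6) (ite (r 0 6 <ₙ r 0 11) (num 0 7 ≔ r 0 6) (num 0 7 ≔ r 0 11)) (num 0 8 ≔ r 0 9)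
split = while (r 0 7 <ₙ r 0 6) (ite (r 0 6 <ₙ r 0 8) narrow (num 0 7 ≔ r 0 6))
segment =
  num 0 6 ≔ r 0 5 ∔ r 0 4 ⨾ num 0 7 ≔ r 0 5 ⨾
  ite (r 0 5 ∔ r 0 3 <ₙ r 0 0) (num 0 8 ≔ r 0 5 ∔ r 0 3) (num 0 8 ≔ r 0 0) ⨾
  ite (r 0 6 <ₙ r 0 0) split skip ⨾
  num 0 5 ≔ r 0 5 ∔ r 0 3
level = num 0 4 ≔ r 0 3 ÷ₑ lit 2 ⨾ num 0 5 ≔ lit 0 ⨾ while (r 0 5 <ₙ r 0 0) segment ⨾ num 0 3 ≔ r 0 4
main =
  num 0 12 ≔ r 0 1 ×ₑ lit 8192 ⨾ num 0 13 ≔ r 0 0 ∔ r 0 12 ⨾ num 0 14 ≔ r 0 13 ∔ (r 0 0 ∔ r 0 12) ⨾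
  num 0 3 ≔ lit 1 ⨾
  while (r 0 3 <ₙ r 0 0) (num 0 3 ≔ r 0 3 ∔ r 0 3) ⨾
  while (lit 1 <ₙ r 0 3) level ⨾
  num 0 0 ≔ lit 0

transpose : ℕ → ℕ → ℕ → ℕ
transpose i j p with p ≟ i | p ≟ j
... | yes _ | _     = j
... | no _  | yes _ = i
... | no _  | no _  = p

transpose-left : ∀ i j → transpose i j i ≡ j
transpose-left i j with i ≟ i | i ≟ j
... | yes _ | _ = refl
... | no ne | _ = contradiction refl ne

transpose-right : ∀ i j → transpose i j j ≡ i
transpose-right i j with j ≟ i | j ≟ j
... | yes refl | _ = refl
... | no _ | yes _ = refl
... | no _ | no ne = contradiction refl ne

transpose-other : ∀ i j {p} → p ≢ i → p ≢ j → transpose i j p ≡ p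
transpose-other i j {p} p≢i p≢j with p ≟ i | p ≟ j
... | yes e | _     = contradiction e p≢i
... | no _  | yes e = contradiction e p≢j
... | no _  | no _  = refl

transpose-involutive : ∀ i j p → transpose i j (transpose i j p) ≡ p
transpose-involutive i j p with p ≟ i | p ≟ j
... | yes refl | _        = transpose-right p j
... | no _     | yes refl = transpose-left i p
... | no p≢i   | no p≢j   = transpose-other i j p≢i p≢j

transpose-< : ∀ {i j n p} → i < n → j < n → p < n → transpose i j p < n
transpose-< {i} {j} {n} {p} i<n j<n p<n with p ≟ i | p ≟ j
... | yes _ | _     = j<n
... | no _  | yes _ = i<n
... | no _  | no _  = p<n

-- A permutation of 0, …, n - 1: position p holds the key with index `index p`.
record Placement (n : ℕ) : Set where
  field
    index position : ℕ → ℕ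
    index<    : ∀ {p} → p < n → index p < n
    position< : ∀ {i} → i < n → position i < n
    index-position : ∀ i → index (position i) ≡ i
    position-index : ∀ p → position (index p) ≡ p

open Placement public

identity : ∀ n → Placement n
identity n = record { index = λ p → p ; position = λ i → i ; index< = λ h → h ; position< = λ h → h
                    ; index-position = λ _ → refl ; position-index = λ _ → refl }

swapped : ∀ {n i j} → i < n → j < n → Placement n → Placement n
swapped {i = i} {j} i<n j<n π = record
  { index = λ p → index π (transpose i j p)
  ; position = λ k → transpose i j (position π k)
  ; index< = λ p<n → index< π (transpose-< i<n j<n p<n)
  ; position< = λ k<n → transpose-< i<n j<n (position< π k<n)
  ; index-position = λ k → trans (cong (index π) (transpose-involutive i j (position π k))) (index-position π k)
  ; position-index = λ p → trans (cong (transpose i j) (position-index π (transpose i j p))) (transpose-involutive i j p)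
  }

opaque
  factor : ℕ
  factor = 50000000000

  ≤-factor : ∀ x y → x ≤ y * 50000000000 → x ≤ factor * y
  ≤-factor x y h = ≤-trans h (≤-reflexive (*-comm y 50000000000))

fetch-end : ∀ P → fetch P (length P) ≡ nothing
fetch-end []      = refl
fetch-end (_ ∷ P) = fetch-end P

log≤n*log : ∀ n → ⌈log₂ n ⌉ ≤ n * ⌈log₂ n ⌉
log≤n*log zero    = ≤-trans (⌈log₂⌉-mono-≤ {0} {2 ^ 0} z≤n) (≤-reflexive (⌈log₂2^n⌉≡n 0))
log≤n*log (suc n) = m≤m+n _ (n * ⌈log₂ suc n ⌉)

below-log : ∀ {n} i → 2 ^ i ≤ n → i ≤ ⌈log₂ n ⌉
below-log {n} i h = subst (_≤ ⌈log₂ n ⌉) (⌈log₂2^n⌉≡n i) (⌈log₂⌉-mono-≤ h)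

T⇒≡ : ∀ {b} → T b → b ≡ true
T⇒≡ = Equivalence.to T-≡

≡⇒T : ∀ {b} → b ≡ true → T b
≡⇒T = Equivalence.from T-≡

module _ {a} {A : Set a} (f : ℕ → A) where
  upd-same : ∀ i x → (f [ i ]≔ x) i ≡ x
  upd-same i x with i ≡ᵇ i in eq
  ... | true  = refl
  ... | false = ⊥-elim (subst T eq (≡⇒≡ᵇ i i refl))

  upd-other : ∀ i x {j} → i ≢ j → (f [ i ]≔ x) j ≡ f j
  upd-other i x {j} i≢j with i ≡ᵇ j in eq
  ... | false = refl
  ... | true  = contradiction (≡ᵇ⇒≡ i j (≡⇒T eq)) i≢j

  upd-either : ∀ {ℓ} (R : A → Set ℓ) i x j → (i ≡ j → R x) → (i ≢ j → R (f j)) → R ((f [ i ]≔ x) j)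
  upd-either R i x j h₁ h₂ with i ≟ j
  ... | yes refl = subst R (sym (upd-same i x)) (h₁ refl)
  ... | no i≢j   = subst R (sym (upd-other i x i≢j)) (h₂ i≢j)

pair-inj : ∀ k {b i b' i'} → i < k → i' < k → b * k + i ≡ b' * k + i' → b ≡ b' × i ≡ i'
pair-inj k@(suc _) {b} {i} {b'} {i'} i<k i'<k eq = *-cancelʳ-≡ b b' k (+-cancelʳ-≡ i' (b * k) (b' * k) eq') , i≡i'
  where
  rem : ∀ b {i} → i < k → (b * k + i) % k ≡ i
  rem b {i} i<k = trans (cong (_% k) (+-comm (b * k) i)) (trans ([m+kn]%n≡m%n i b k) (m<n⇒m%n≡m i<k))
  i≡i' : i ≡ i'
  i≡i' = trans (sym (rem b i<k)) (trans (cong (_% k) eq) (rem b' i'<k))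
  eq' : b * k + i' ≡ b' * k + i'
  eq' = trans (cong (b * k +_) (sym i≡i')) eq

nadr< : ∀ {b i} → b < 6 → i < 16 → nadr b i < 96
nadr< {b} {i} b<6 i<16 = linear 2 (λ b i → b ⊏ κ 6 ⇒ i ⊏ κ 16 ⇒ ⊢ b ⊗ 16 ⊕ i ⊏ κ 96) b i b<6 i<16

wadr≥ : ∀ b i → 96 ≤ wadr b i
wadr≥ b i = linear 2 (λ b i → ⊢ κ 96 ⊑ κ 96 ⊕ (b ⊗ 8 ⊕ i)) b i

wadr< : ∀ {b i} → b < 4 → i < 8 → wadr b i < 128
wadr< {b} {i} b<4 i<8 = linear 2 (λ b i → b ⊏ κ 4 ⇒ i ⊏ κ 8 ⇒ ⊢ κ 96 ⊕ (b ⊗ 8 ⊕ i) ⊏ κ 128) b i b<4 i<8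

record Setting (a ℓ₁ ℓ₂ : Level) : Set (Level.suc (a Level.⊔ ℓ₁ Level.⊔ ℓ₂)) where
  field
    K : StrictTotalOrder a ℓ₁ ℓ₂
    P : Program
    W : ℕ
    W≢0 : NonZero W
    M δ S : ℕ
    arrays≤M : arrays ≤ M
    n : ℕ
    X : Fin n → StrictTotalOrder.Carrier K
    A : FaultyRAM.Adversary K P W {{W≢0}} M δ S X

module Machine {a ℓ₁ ℓ₂} (setting : Setting a ℓ₁ ℓ₂) where

  open Setting setting public

  instance
    nonZero-W : NonZero W
    nonZero-W = W≢0

  open FaultyRAM K P W M δ S X public

  -- The memory as the structured programs see it; temporaries are hidden.
  record View : Set a where
    constructor view
    field
      nr  : ℕ → ℕ → ℕ
      wr  : ℕ → ℕ → Word
      ar  : ℕ → Word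
      mem : ℕ → Word
      ow  : List Word

  open View public

  havoc : View → (ℕ → Word) → List Word → View
  havoc σ m o = record σ { mem = m ; ow = o }

  data Corr (m : ℕ → Word) (o : List Word) : (ℕ → Word) → List Word → Set a where
    none : Corr m o m o
    hit  : ∀ {m' o'} → Corr m o m' o' → ∀ p v → Corr m o (m' [ p ]≔ forge v) (m' p ∷ o')

  Corr-trans : ∀ {m o m' o' m″ o″} → Corr m o m' o' → Corr m' o' m″ o″ → Corr m o m″ o″
  Corr-trans c none        = c
  Corr-trans c (hit d p v) = hit (Corr-trans c d) p v

  Havoc : View → (ℕ → Word) → List Word → Set a
  Havoc σ m o = Corr (mem σ) (ow σ) m o × length o ≤ δ

  eval : (ℕ → ℕ → ℕ) → Exp → ℕ
  eval r (ref (num b i)) = r b i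
  eval r (lit k)         = k
  eval r (bin o e f)     = ⟦ o ⟧ (eval r e) (eval r f)

  -- An upper bound on all numbers that occur in the evaluation.
  peak : (ℕ → ℕ → ℕ) → Exp → ℕ
  peak r (ref x)       = 0
  peak r (lit k)       = k
  peak r (bin add e f) = (peak r e + peak r f) + (eval r e + eval r f)
  peak r (bin mul e f) = (peak r e + peak r f) + eval r e * eval r f
  peak r (bin sub e f) = peak r e + peak r f
  peak r (bin div e f) = peak r e + peak r f

  truth : View → Cond → Bool
  truth σ (e <ₙ f)                 = eval (nr σ) e <ᵇ eval (nr σ) f
  truth σ (wrd b i <ʷ wrd b' i') = less (value (wr σ b i)) (value (wr σ b' i'))

  peakᶜ : (ℕ → ℕ → ℕ) → Cond → ℕ
  peakᶜ r (e <ₙ f) = peak r e + peak r f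
  peakᶜ r (x <ʷ y) = 0

  setN : NVar → ℕ → View → View
  setN (num b i) k σ = record σ { nr = nr σ [ b ]≔ (nr σ b [ i ]≔ k) }

  setW : WVar → Word → View → View
  setW (wrd b i) w σ = record σ { wr = wr σ [ b ]≔ (wr σ b [ i ]≔ w) }

  getW : WVar → View → Word
  getW (wrd b i) σ = wr σ b i

  pick : {B : Set a} → Kind → B → B → B
  pick safeᵏ   x y = x
  pick faultyᵏ x y = y

  cells : Kind → View → ℕ → Word
  cells k σ = pick k (ar σ) (mem σ)

  setCell : Kind → ℕ → Word → View → View
  setCell k p w σ = record σ
    { ar  = pick k (ar σ [ p ]≔ w) (ar σ)
    ; mem = pick k (mem σ) (mem σ [ p ]≔ w) }

  Valid : Kind → ℕ → Set
  Valid safeᵏ   p = arrays ≤ p × p < M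
  Valid faultyᵏ p = arrays ≤ arrays

  iter : ℕ → ℕ → State → State
  iter t zero    s = s
  iter t (suc k) s = iter (suc t) k (tick (A t s) s)

  iter-+ : ∀ t j k s → iter t (j + k) s ≡ iter (t + j) k (iter t j s)
  iter-+ t zero    k s = cong (λ t' → iter t' k s) (sym (+-identityʳ t))
  iter-+ t (suc j) k s =
    trans (iter-+ (suc t) j k _) (cong (λ t' → iter t' k (iter t (suc j) s)) (sym (+-suc t j)))

  run-iter : ∀ t k → iter t k (run A t) ≡ run A (t + k)
  run-iter t zero    = cong (run A) (sym (+-identityʳ t))
  run-iter t (suc k) = trans (run-iter (suc t) k) (cong (run A) (sym (+-suc t k)))

  Bounded : ℕ → State → Set
  Bounded t s = ∀ k → faults (iter t k s) ≤ δ

  Bounded-iter : ∀ t j {s} → Bounded t s → Bounded (t + j) (iter t j s)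
  Bounded-iter t j {s} b k = subst (λ s' → faults s' ≤ δ) (iter-+ t j k s) (b (j + k))

  CodeAt : ℕ → List Instr → Set
  CodeAt l is = ∃[ pre ] ∃[ post ] P ≡ pre ++ (is ++ post) × length pre ≡ l

  CodeAt-left : ∀ {l} is {js} → CodeAt l (is ++ js) → CodeAt l is
  CodeAt-left is {js} (pre , post , eq , len) =
    pre , js ++ post , trans eq (cong (pre ++_) (++-assoc is js post)) , len

  CodeAt-right : ∀ {l} is {js k} → length is ≡ k → CodeAt l (is ++ js) → CodeAt (l + k) js
  CodeAt-right is {js} refl (pre , post , eq , refl) =
    pre ++ is , post ,
    trans eq (trans (cong (pre ++_) (++-assoc is js post)) (sym (++-assoc pre is (js ++ post)))) ,
    length-++ pre

  CodeAt-tail : ∀ {l i is} → CodeAt l (i ∷ is) → CodeAt (l + 1) is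
  CodeAt-tail {i = i} = CodeAt-right (i ∷ []) refl

  CodeAt-fetch : ∀ {l i is} → CodeAt l (i ∷ is) → fetch P l ≡ just i
  CodeAt-fetch {i = i} {is} (pre , post , refl , refl) = go pre
    where
    go : ∀ pre → fetch (pre ++ (i ∷ is) ++ post) (length pre) ≡ just i
    go []        = refl
    go (_ ∷ pre) = go pre

  tick-at : ∀ {l i is} fs s → CodeAt l (i ∷ is) → pc s ≡ l → tick fs s ≡ exec i (foldl corrupt s fs)
  tick-at fs s at refl rewrite CodeAt-fetch at = refl

  record Rel (s : State) (σ : View) : Set a where
    field
      nums  : ∀ {b i} → b < 6 → i < 16 → safe s (nadr b i) ≡ num (nr σ b i)
      bound : ∀ {b i} → b < 6 → i < 16 → nr σ b i < W
      words : ∀ {b i} → b < 4 → i < 8 → safe s (wadr b i) ≡ wr σ b i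
      cellˢ : ∀ {p} → arrays ≤ p → p < M → safe s p ≡ ar σ p
      cellᶠ : faulty s ≡ mem σ
      lost  : overwritten s ≡ ow σ

  open Rel

  foldl-corrupt : ∀ fs {s σ} → Rel s σ →
    ∃[ m ] ∃[ o ] Corr (mem σ) (ow σ) m o × Rel (foldl corrupt s fs) (havoc σ m o)
      × safe (foldl corrupt s fs) ≡ safe s × pc (foldl corrupt s fs) ≡ pc s
  foldl-corrupt [] {s} {σ} r = mem σ , ow σ , none , r , refl , refl
  foldl-corrupt ((p , v) ∷ fs) {s} {σ} r
    with foldl-corrupt fs {corrupt s (p , v)} {havoc σ (mem σ [ p ]≔ forge v) (mem σ p ∷ ow σ)}
           record { nums = nums r ; bound = bound r ; words = words r ; cellˢ = cellˢ r
                  ; cellᶠ = cong (_[ p ]≔ forge v) (cellᶠ r)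
                  ; lost = cong₂ (λ m o → m p ∷ o) (cellᶠ r) (lost r) }
  ... | m , o , c , r' , eq , eq' = m , o , Corr-trans (hit none p v) c , r' , eq , eq'

  writeSafe-same : ∀ {d} w s → d < M → writeSafe d w s d ≡ w
  writeSafe-same {d} w s d<M rewrite T⇒≡ (<⇒<ᵇ d<M) = upd-same s d w

  writeSafe-other : ∀ {d} w s {j} → d ≢ j → writeSafe d w s j ≡ s j
  writeSafe-other {d} w s d≢j with d <ᵇ M
  ... | true  = upd-other s d w d≢j
  ... | false = refl

  visible<tmp : ∀ {b i} → b < 6 → i < 16 → ∀ d → tmp d ≢ nadr b i
  visible<tmp b<6 i<16 d eq = <⇒≢ (<-≤-trans (nadr< b<6 i<16) (≤-trans (≤ᵇ⇒≤ 96 128 tt) (m≤m+n 128 d))) (sym eq)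

  word<tmp : ∀ {b i} → b < 4 → i < 8 → ∀ d → tmp d ≢ wadr b i
  word<tmp b<4 i<8 d eq = <⇒≢ (<-≤-trans (wadr< b<4 i<8) (m≤m+n 128 d)) (sym eq)

  tmp<arrays : ∀ {d} → d < 16 → tmp d < arrays
  tmp<arrays d<16 = +-monoʳ-< 128 d<16

  setTmp-Rel : ∀ {s σ d} w → d < 16 → Rel s σ → Rel (setSafe (tmp d) w s) σ
  setTmp-Rel {s} {σ} {d} w d<16 r = record
    { nums = λ b< i< → trans (writeSafe-other w (safe s) (visible<tmp b< i< d)) (nums r b< i<)
    ; bound = bound r
    ; words = λ b< i< → trans (writeSafe-other w (safe s) (word<tmp b< i< d)) (words r b< i<)
    ; cellˢ = λ ≤p p< → trans (writeSafe-other w (safe s) (λ eq → <⇒≱ (tmp<arrays d<16) (subst (arrays ≤_) (sym eq) ≤p))) (cellˢ r ≤p p<)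
    ; cellᶠ = cellᶠ r ; lost = lost r }

  setNVar-Rel : ∀ {s σ b i k} → b < 6 → i < 16 → k < W → Rel s σ →
    Rel (setSafe (nadr b i) (num k) s) (record σ { nr = nr σ [ b ]≔ (nr σ b [ i ]≔ k) })
  setNVar-Rel {s} {σ} {b} {i} {k} b<6 i<16 k<W r = record
    { nums = nums'
    ; bound = bound'
    ; words = λ {b'} {i'} b< i< → trans (writeSafe-other (num k) (safe s)
        (λ eq → <⇒≢ (<-≤-trans (nadr< b<6 i<16) (wadr≥ b' i')) eq)) (words r b< i<)
    ; cellˢ = λ ≤p p< → trans (writeSafe-other (num k) (safe s)
        (λ eq → <⇒≱ (<-≤-trans (nadr< b<6 i<16) (≤ᵇ⇒≤ 96 arrays tt)) (subst (arrays ≤_) (sym eq) ≤p))) (cellˢ r ≤p p<)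
    ; cellᶠ = cellᶠ r ; lost = lost r }
    where
    nums' : ∀ {b' i'} → b' < 6 → i' < 16 → writeSafe (nadr b i) (num k) (safe s) (nadr b' i')
      ≡ num ((nr σ [ b ]≔ (nr σ b [ i ]≔ k)) b' i')
    nums' {b'} {i'} b< i< with b ≟ b' | i ≟ i'
    ... | yes refl | yes refl rewrite upd-same (nr σ) b (nr σ b [ i ]≔ k) | upd-same (nr σ b) i k =
      writeSafe-same (num k) (safe s) (<-≤-trans (nadr< b<6 i<16) (≤-trans (≤ᵇ⇒≤ 96 arrays tt) arrays≤M))
    ... | yes refl | no i≢ rewrite upd-same (nr σ) b (nr σ b [ i ]≔ k) | upd-other (nr σ b) i k i≢ =
      trans (writeSafe-other (num k) (safe s) (λ eq → i≢ (proj₂ (pair-inj 16 {b} {i} {b} i<16 i< eq)))) (nums r b< i<)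
    ... | no b≢ | _ rewrite upd-other (nr σ) b (nr σ b [ i ]≔ k) b≢ =
      trans (writeSafe-other (num k) (safe s) (λ eq → b≢ (proj₁ (pair-inj 16 {b} {i} {b'} i<16 i< eq)))) (nums r b< i<)
    bound' : ∀ {b' i'} → b' < 6 → i' < 16 → (nr σ [ b ]≔ (nr σ b [ i ]≔ k)) b' i' < W
    bound' {b'} {i'} b< i< = upd-either (nr σ) (λ f → f i' < W) b _ b'
      (λ { refl → upd-either (nr σ b) (_< W) i k i' (λ _ → k<W) (λ _ → bound r b< i<) })
      (λ _ → bound r b< i<)

  setWVar-Rel : ∀ {s σ b i w} → b < 4 → i < 8 → Rel s σ →
    Rel (setSafe (wadr b i) w s) (record σ { wr = wr σ [ b ]≔ (wr σ b [ i ]≔ w) })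
  setWVar-Rel {s} {σ} {b} {i} {w} b<4 i<8 r = record
    { nums = λ {b'} {i'} b< i< → trans (writeSafe-other w (safe s)
        (λ eq → <⇒≢ (<-≤-trans (nadr< b< i<) (wadr≥ b i)) (sym eq))) (nums r b< i<)
    ; bound = bound r
    ; words = words'
    ; cellˢ = λ ≤p p< → trans (writeSafe-other w (safe s)
        (λ eq → <⇒≱ (<-≤-trans (wadr< b<4 i<8) (≤ᵇ⇒≤ 128 arrays tt)) (subst (arrays ≤_) (sym eq) ≤p))) (cellˢ r ≤p p<)
    ; cellᶠ = cellᶠ r ; lost = lost r }
    where
    words' : ∀ {b' i'} → b' < 4 → i' < 8 → writeSafe (wadr b i) w (safe s) (wadr b' i')
      ≡ (wr σ [ b ]≔ (wr σ b [ i ]≔ w)) b' i'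
    words' {b'} {i'} b< i< with b ≟ b' | i ≟ i'
    ... | yes refl | yes refl rewrite upd-same (wr σ) b (wr σ b [ i ]≔ w) | upd-same (wr σ b) i w =
      writeSafe-same w (safe s) (<-≤-trans (wadr< b<4 i<8) (≤-trans (≤ᵇ⇒≤ 128 arrays tt) arrays≤M))
    ... | yes refl | no i≢ rewrite upd-same (wr σ) b (wr σ b [ i ]≔ w) | upd-other (wr σ b) i w i≢ =
      trans (writeSafe-other w (safe s) (λ eq → i≢ (proj₂ (pair-inj 8 {b} {i} {b} i<8 i< (+-cancelˡ-≡ 96 _ _ eq))))) (words r b< i<)
    ... | no b≢ | _ rewrite upd-other (wr σ) b (wr σ b [ i ]≔ w) b≢ =
      trans (writeSafe-other w (safe s) (λ eq → b≢ (proj₁ (pair-inj 8 {b} {i} {b'} i<8 i< (+-cancelˡ-≡ 96 _ _ eq))))) (words r b< i<)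

  setCellˢ-Rel : ∀ {s σ p} w → arrays ≤ p → p < M → Rel s σ →
    Rel (setSafe p w s) (record σ { ar = ar σ [ p ]≔ w })
  setCellˢ-Rel {s} {σ} {p} w ≤p p<M r = record
    { nums = λ {b'} {i'} b< i< → trans (writeSafe-other w (safe s)
        (λ eq → <⇒≢ (<-≤-trans (nadr< b< i<) (≤-trans (≤ᵇ⇒≤ 96 arrays tt) ≤p)) (sym eq))) (nums r b< i<)
    ; bound = bound r
    ; words = λ {b'} {i'} b< i< → trans (writeSafe-other w (safe s)
        (λ eq → <⇒≢ (<-≤-trans (wadr< b< i<) (≤-trans (≤ᵇ⇒≤ 128 arrays tt) ≤p)) (sym eq))) (words r b< i<)
    ; cellˢ = cell'
    ; cellᶠ = cellᶠ r ; lost = lost r }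
    where
    cell' : ∀ {q} → arrays ≤ q → q < M → writeSafe p w (safe s) q ≡ (ar σ [ p ]≔ w) q
    cell' {q} ≤q q< with p ≟ q
    ... | yes refl rewrite upd-same (ar σ) p w = writeSafe-same w (safe s) p<M
    ... | no p≢q rewrite upd-other (ar σ) p w p≢q = trans (writeSafe-other w (safe s) p≢q) (cellˢ r ≤q q<)

  pc-Rel : ∀ {s σ l} → Rel s σ → Rel (record s { pc = l }) σ
  pc-Rel r = record { nums = nums r ; bound = bound r ; words = words r ; cellˢ = cellˢ r
                    ; cellᶠ = cellᶠ r ; lost = lost r }

  eval-bound : ∀ {s σ} → Rel s σ → ∀ e → peak (nr σ) e < W → eval (nr σ) e < W
  eval-bound r (ref (num b i {b<6} {i<16})) _ = bound r (<ᵇ⇒< b 6 b<6) (<ᵇ⇒< i 16 i<16)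
  eval-bound r (lit k)         h = h
  eval-bound {σ = σ} r (bin add e f) h = ≤-<-trans (m≤n+m _ (peak (nr σ) e + peak (nr σ) f)) h
  eval-bound {σ = σ} r (bin mul e f) h = ≤-<-trans (m≤n+m _ (peak (nr σ) e + peak (nr σ) f)) h
  eval-bound {σ = σ} r (bin sub e f) h =
    ≤-<-trans (m∸n≤m _ (eval (nr σ) f)) (eval-bound r e (≤-<-trans (m≤m+n _ (peak (nr σ) f)) h))
  eval-bound {σ = σ} r (bin div e f) h = div-bound (eval (nr σ) f)
    where
    e<W = eval-bound r e (≤-<-trans (m≤m+n _ (peak (nr σ) f)) h)
    div-bound : ∀ y → ⟦ div ⟧ (eval (nr σ) e) y < W
    div-bound zero    = ≤-<-trans z≤n e<W
    div-bound (suc y) = ≤-<-trans (m/n≤m _ (suc y)) e<W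

  peak-left : ∀ r o e f → peak r e ≤ peak r (bin o e f)
  peak-left r add e f = ≤-trans (m≤m+n _ (peak r f)) (m≤m+n _ _)
  peak-left r mul e f = ≤-trans (m≤m+n _ (peak r f)) (m≤m+n _ _)
  peak-left r sub e f = m≤m+n _ _
  peak-left r div e f = m≤m+n _ _

  peak-right : ∀ r o e f → peak r f ≤ peak r (bin o e f)
  peak-right r add e f = ≤-trans (m≤n+m _ (peak r e)) (m≤m+n _ _)
  peak-right r mul e f = ≤-trans (m≤n+m _ (peak r e)) (m≤m+n _ _)
  peak-right r sub e f = m≤n+m _ _
  peak-right r div e f = m≤n+m _ _

  step₁ : ∀ {l i is s} t → CodeAt l (i ∷ is) → pc s ≡ l →
    iter t 1 s ≡ exec i (foldl corrupt s (A t s))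
  step₁ {s = s} t at eq = tick-at (A t s) s at eq

  wrap-small : ∀ {k} → k < W → wrap k ≡ num k
  wrap-small k<W = cong num (m<n⇒m%n≡m k<W)

  tmp<M : ∀ {d} → d < 16 → tmp d < M
  tmp<M d<16 = <-≤-trans (tmp<arrays d<16) arrays≤M

  record Evaluated (t l k : ℕ) (s : State) (σ : View) (d v : ℕ) : Set a where
    field
      m'     : ℕ → Word
      o'     : List Word
      corr   : Corr (mem σ) (ow σ) m' o'
      rel    : Rel (iter t k s) (havoc σ m' o')
      pc'    : pc (iter t k s) ≡ l + k
      result : safe (iter t k s) (tmp d) ≡ num v
      below  : ∀ {d'} → d' < d → safe (iter t k s) (tmp d') ≡ safe s (tmp d')

  tmp-inj : ∀ {d d'} → d' < d → tmp d ≢ tmp d'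
  tmp-inj d'<d eq = <⇒≢ (+-monoʳ-< 128 d'<d) (sym eq)

  leaf : ∀ {t l s σ d is v} i w → CodeAt l (i ∷ is) → pc s ≡ l → Rel s σ → d < 16 → w ≡ num v →
    (∀ {s'} → safe s' ≡ safe s → exec i s' ≡ setSafe (tmp d) w s') → Evaluated t l 1 s σ d v
  leaf {t} {l} {s} {σ} {d} i w at eq r d<16 w≡ ex
    with foldl-corrupt (A t s) r
  ... | m , o , c , r' , safe≡ , pc≡ = record
    { m' = m ; o' = o ; corr = c
    ; rel = subst (λ s' → Rel s' (havoc σ m o)) (sym st) (setTmp-Rel w d<16 r')
    ; pc' = trans (cong pc st) (trans (cong suc (trans pc≡ eq)) (sym (+-comm l 1)))
    ; result = trans (cong (λ s' → safe s' (tmp d)) st)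
        (trans (writeSafe-same w (safe (foldl corrupt s (A t s))) (tmp<M d<16)) w≡)
    ; below = λ {d'} d'<d → trans (cong (λ s' → safe s' (tmp d')) st)
        (trans (writeSafe-other w (safe (foldl corrupt s (A t s))) (tmp-inj d'<d)) (cong (λ f → f (tmp d')) safe≡))
    }
    where
    st = trans (step₁ t at eq) (ex safe≡)

  evaluate : ∀ e d {t l s σ} → T (shallow e d) → CodeAt l (expCode e d) → pc s ≡ l → Rel s σ →
    peak (nr σ) e < W → Evaluated t l (expSize e) s σ d (eval (nr σ) e)
  evaluate (ref (num b i {b<6} {i<16})) d {s = s} d<16 at eq r p =
    leaf (copy (tmp d) (nadr b i)) (safe s (nadr b i)) at eq r (<ᵇ⇒< d 16 d<16)
      (nums r (<ᵇ⇒< b 6 b<6) (<ᵇ⇒< i 16 i<16)) (λ {s'} h → cong (λ f → setSafe (tmp d) (f (nadr b i)) s') h)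
  evaluate (lit k) d d<16 at eq r p =
    leaf (set (tmp d) k) (wrap k) at eq r (<ᵇ⇒< d 16 d<16) (wrap-small p) (λ _ → refl)
  evaluate (bin o e f) d {t} {l} {s} {σ} sh at eq r p
    with Equivalence.to T-∧ sh
  ... | she , shf
    with evaluate e d {t} she (CodeAt-left (expCode e d) at) eq r (≤-<-trans (peak-left (nr σ) o e f) p)
  ... | E₁
    with evaluate f (suc d) {t + expSize e} shf
           (CodeAt-left (expCode f (suc d)) (CodeAt-right (expCode e d) (expCode-length e d) at))
           (Evaluated.pc' E₁) (Evaluated.rel E₁) (≤-<-trans (peak-right (nr σ) o e f) p)
  ... | E₂ = record
    { m' = Evaluated.m' E₃ ; o' = Evaluated.o' E₃
    ; corr = Corr-trans (Evaluated.corr E₁) (Corr-trans (Evaluated.corr E₂) (Evaluated.corr E₃))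
    ; rel = subst (λ s' → Rel s' (havoc σ (Evaluated.m' E₃) (Evaluated.o' E₃))) (sym it) (Evaluated.rel E₃)
    ; pc' = trans (cong pc it) (trans (Evaluated.pc' E₃)
        (trans (+-assoc (l + expSize e) (expSize f) 1) (+-assoc l (expSize e) (expSize f + 1))))
    ; result = trans (cong (λ s' → safe s' (tmp d)) it) (Evaluated.result E₃)
    ; below = λ {d'} h → trans (cong (λ s' → safe s' (tmp d')) it)
        (trans (Evaluated.below E₃ h) (trans (Evaluated.below E₂ (m≤n⇒m≤1+n h)) (Evaluated.below E₁ h)))
    }
    where
    r₂ = Evaluated.rel E₂
    t₂ = t + expSize e + expSize f
    s₂ = iter (t + expSize e) (expSize f) (iter t (expSize e) s)
    d<16 : ∀ e d → T (shallow e d) → d < 16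
    d<16 (ref x) d h = <ᵇ⇒< d 16 h
    d<16 (lit k) d h = <ᵇ⇒< d 16 h
    d<16 (bin _ e f) d h = d<16 e d (proj₁ (Equivalence.to T-∧ h))
    value₁ : toNum (safe s₂ (tmp d)) ≡ eval (nr σ) e
    value₁ = cong toNum (trans (Evaluated.below E₂ (n<1+n d)) (Evaluated.result E₁))
    value₂ : toNum (safe s₂ (tmp (suc d))) ≡ eval (nr σ) f
    value₂ = cong toNum (Evaluated.result E₂)
    E₃ : Evaluated t₂ (l + expSize e + expSize f) 1 s₂
           (havoc σ (Evaluated.m' E₂) (Evaluated.o' E₂)) d (eval (nr σ) (bin o e f))
    E₃ = leaf (arith o (tmp d) (tmp d) (tmp (suc d)))
           (wrap (⟦ o ⟧ (toNum (safe s₂ (tmp d))) (toNum (safe s₂ (tmp (suc d))))))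
           (CodeAt-right (expCode f (suc d)) (expCode-length f (suc d))
             (CodeAt-right (expCode e d) (expCode-length e d) at))
           (Evaluated.pc' E₂) r₂ (d<16 e d she)
           (trans (cong wrap (cong₂ ⟦ o ⟧ value₁ value₂)) (wrap-small (eval-bound r (bin o e f) p)))
           (λ {s'} h → cong (λ g → setSafe (tmp d) (wrap (⟦ o ⟧ (toNum (g (tmp d))) (toNum (g (tmp (suc d)))))) s') h)
    it : iter t (expSize (bin o e f)) s ≡ iter t₂ 1 s₂
    it = trans (iter-+ t (expSize e) (expSize f + 1) s)
               (iter-+ (t + expSize e) (expSize f) 1 (iter t (expSize e) s))

  private variable
    ℓ : Level

  record WP (c : Cmd) (Q : ℕ → View → Set ℓ) (t : ℕ) (σ : View) : Set (a Level.⊔ ℓ) where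
    constructor wp
    field
      runs : ∀ {l s} → CodeAt l (code c l) → pc s ≡ l → Rel s σ → Bounded t s →
        ∃[ k ] ∃[ σ' ] pc (iter t k s) ≡ l + size c × Rel (iter t k s) σ' × Q (t + k) σ'

  open WP public

  mono : ∀ {ℓ'} {c} {Q : ℕ → View → Set ℓ} {Q' : ℕ → View → Set ℓ'} {t σ} →
    WP c Q t σ → (∀ t' σ' → Q t' σ' → Q' t' σ') → WP c Q' t σ
  mono w f .runs at eq r b with runs w at eq r b
  ... | k , σ' , eq' , r' , q = k , σ' , eq' , r' , f _ σ' q

  wp-skip : ∀ {Q : ℕ → View → Set ℓ} {t σ} → Q t σ → WP skip Q t σ
  wp-skip {Q = Q} {t} {σ} q .runs {l} at eq r b =
    0 , σ , trans eq (sym (+-identityʳ l)) , r , subst (λ t' → Q t' σ) (sym (+-identityʳ t)) q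

  wp-seq : ∀ {c d} {Q : ℕ → View → Set ℓ} {t σ} → WP c (WP d Q) t σ → WP (c ⨾ d) Q t σ
  wp-seq {c = c} {d} {Q} {t} {σ} w .runs {l} {s} at eq r b with runs w (CodeAt-left (code c l) at) eq r b
  ... | j , σ' , eq' , r' , w'
    with runs w' (CodeAt-right (code c l) (code-length c l) at) eq' r' (Bounded-iter t j b)
  ... | k , σ″ , eq″ , r″ , q =
    j + k , σ″ ,
    trans (cong pc (iter-+ t j k s)) (trans eq″ (+-assoc l (size c) (size d))) ,
    subst (λ s' → Rel s' σ″) (sym (iter-+ t j k s)) r″ ,
    subst (λ t' → Q t' σ″) (+-assoc t j k) q

  lost≤δ : ∀ {t s k σ} → Bounded t s → Rel (iter t k s) σ → length (ow σ) ≤ δ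
  lost≤δ {k = k} b r = subst (λ o → length o ≤ δ) (lost r) (b k)

  -- A command that evaluates e and then executes one more instruction i, which
  -- does f to the view.
  wp-atom : ∀ {c i t σ} e (Q : ℕ → View → Set ℓ) {f : View → View} →
    (∀ l → code c l ≡ expCode e 0 ++ i ∷ []) → size c ≡ expSize e + 1 →
    T (shallow e 0) → peak (nr σ) e < W →
    (∀ {s m o} → Rel s (havoc σ m o) → safe s (tmp 0) ≡ num (eval (nr σ) e) →
       Rel (exec i s) (f (havoc σ m o)) × pc (exec i s) ≡ suc (pc s) × ow (f (havoc σ m o)) ≡ o) →
    (∀ m o → Havoc σ m o → Q (t + (expSize e + 1)) (f (havoc σ m o))) →
    WP c Q t σ
  wp-atom {c = c} {i} {t} {σ} e Q {f} code≡ size≡ sh p ex q .runs {l} {s} at₀ eq r b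
    with subst (CodeAt l) (code≡ l) at₀
  ... | at with evaluate e 0 {t} sh (CodeAt-left (expCode e 0) at) eq r p
  ... | E with foldl-corrupt (A (t + expSize e) (iter t (expSize e) s)) (Evaluated.rel E)
  ... | m , o , c' , r' , safe≡ , pc≡ with ex r' (trans (cong (λ g → g (tmp 0)) safe≡) (Evaluated.result E))
  ... | r″ , pc″ , ow≡ =
    expSize e + 1 , f (havoc σ m o) ,
    trans (cong pc st) (trans pc″ (trans (cong suc (trans pc≡ (Evaluated.pc' E)))
      (trans (sym (+-suc l (expSize e))) (cong (l +_) (trans (sym (+-comm (expSize e) 1)) (sym size≡)))))) ,
    r‴ ,
    q m o (Corr-trans (Evaluated.corr E) c' , subst (λ x → length x ≤ δ) ow≡ (lost≤δ {t} {s} {expSize e + 1} b r‴))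
    where
    st : iter t (expSize e + 1) s ≡ exec i (foldl corrupt (iter t (expSize e) s) (A (t + expSize e) (iter t (expSize e) s)))
    st = trans (iter-+ t (expSize e) 1 s)
           (step₁ (t + expSize e) (CodeAt-right (expCode e 0) (expCode-length e 0) at) (Evaluated.pc' E))
    r‴ : Rel (iter t (expSize e + 1) s) (f (havoc σ m o))
    r‴ = subst (λ s' → Rel s' (f (havoc σ m o))) (sym st) r″

  wp-set : ∀ {x e} {Q : ℕ → View → Set ℓ} {t σ} → {sh : T (shallow e 0)} → peak (nr σ) e < W →
    (∀ m o → Havoc σ m o → Q (t + (expSize e + 1)) (setN x (eval (nr σ) e) (havoc σ m o))) →
    WP (x ≔ e) Q t σ
  wp-set {x = num b i {b<6} {i<16}} {e} {Q} {σ = σ} {sh} p q .runs at eq r₀ bd =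
    runs (wp-atom {c = num b i {b<6} {i<16} ≔ e} e Q {f = setN (num b i {b<6} {i<16}) (eval (nr σ) e)} (λ _ → refl) refl sh p
      (λ {s} r res → subst (λ w → Rel (setSafe (nadr b i) w s) _) (sym res)
        (setNVar-Rel (<ᵇ⇒< b 6 b<6) (<ᵇ⇒< i 16 i<16) (eval-bound r₀ e p) r) , refl , refl)
      q) at eq r₀ bd

  wp-load : ∀ {k w e} {Q : ℕ → View → Set ℓ} {t σ} → {sh : T (shallow e 0)} → peak (nr σ) e < W →
    Valid k (eval (nr σ) e) →
    (∀ m o → Havoc σ m o →
       Q (t + (expSize e + 1)) (setW w (cells k (havoc σ m o) (eval (nr σ) e)) (havoc σ m o))) →
    WP (load k w e) Q t σ
  wp-load {k = safeᵏ} {wrd b i {b<4} {i<8}} {e} {Q} {σ = σ} {sh} p (≤v , v<M) q =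
    wp-atom {c = load safeᵏ (wrd b i {b<4} {i<8}) e} e Q {f = setW (wrd b i {b<4} {i<8}) (ar σ (eval (nr σ) e))} (λ _ → refl) refl sh p
      (λ {s} r res → subst (λ w → Rel (setSafe (wadr b i) w s) _)
        (sym (trans (cong (λ w → safe s (toNum w)) res) (cellˢ r ≤v v<M)))
        (setWVar-Rel (<ᵇ⇒< b 4 b<4) (<ᵇ⇒< i 8 i<8) r) , refl , refl)
      q
  wp-load {k = faultyᵏ} {wrd b i {b<4} {i<8}} {e} {Q} {σ = σ} {sh} p v q =
    wp-atom {c = load faultyᵏ (wrd b i {b<4} {i<8}) e} e Q
      {f = λ σ' → setW (wrd b i {b<4} {i<8}) (mem σ' (eval (nr σ) e)) σ'} (λ _ → refl) refl sh p
      (λ {s} r res → subst (λ w → Rel (setSafe (wadr b i) w s) _)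
        (sym (trans (cong (λ w → faulty s (toNum w)) res) (cong (λ f → f (eval (nr σ) e)) (cellᶠ r))))
        (setWVar-Rel (<ᵇ⇒< b 4 b<4) (<ᵇ⇒< i 8 i<8) r) , refl , refl)
      q

  wp-store : ∀ {k w e} {Q : ℕ → View → Set ℓ} {t σ} → {sh : T (shallow e 0)} → peak (nr σ) e < W →
    Valid k (eval (nr σ) e) →
    (∀ m o → Havoc σ m o →
       Q (t + (expSize e + 1)) (setCell k (eval (nr σ) e) (getW w σ) (havoc σ m o))) →
    WP (store k e w) Q t σ
  wp-store {k = safeᵏ} {wrd b i {b<4} {i<8}} {e} {Q} {σ = σ} {sh} p (≤v , v<M) q =
    wp-atom {c = store safeᵏ e (wrd b i {b<4} {i<8})} e Q {f = setCell safeᵏ (eval (nr σ) e) (wr σ b i)} (λ _ → refl) refl sh p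
      (λ {s} r res → subst₂ (λ x w → Rel (setSafe x w s) _) (cong toNum (sym res))
        (sym (words r (<ᵇ⇒< b 4 b<4) (<ᵇ⇒< i 8 i<8))) (setCellˢ-Rel (wr σ b i) ≤v v<M r) , refl , refl)
      q
  wp-store {k = faultyᵏ} {wrd b i {b<4} {i<8}} {e} {Q} {σ = σ} {sh} p v q =
    wp-atom {c = store faultyᵏ e (wrd b i {b<4} {i<8})} e Q {f = setCell faultyᵏ (eval (nr σ) e) (wr σ b i)} (λ _ → refl) refl sh p
      (λ {s} r res → record { nums = nums r ; bound = bound r ; words = words r ; cellˢ = cellˢ r ; lost = lost r
        ; cellᶠ = trans (cong (λ f → f [ toNum (safe s (tmp 0)) ]≔ safe s (wadr b i)) (cellᶠ r))
            (cong₂ (λ x w → _ [ x ]≔ w) (cong toNum res) (words r (<ᵇ⇒< b 4 b<4) (<ᵇ⇒< i 8 i<8))) } , refl , refl)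
      q

  record Tested (t l : ℕ) (b : Cond) (s : State) (σ : View) (target : ℕ) : Set a where
    field
      m'   : ℕ → Word
      o'   : List Word
      corr : Corr (mem σ) (ow σ) m' o'
      rel  : Rel (iter t (condSize b + 1) s) (havoc σ m' o')
      jumped : truth σ b ≡ true  → pc (iter t (condSize b + 1) s) ≡ target
      fell   : truth σ b ≡ false → pc (iter t (condSize b + 1) s) ≡ l + condSize b + 1

  testJump : ∀ t l x y {is s σ} target c → CodeAt l (jumpLess x y target ∷ is) → pc s ≡ l →
    Rel s σ → less (value (safe s x)) (value (safe s y)) ≡ c →
    ∃[ m ] ∃[ o ] Corr (mem σ) (ow σ) m o × Rel (iter t 1 s) (havoc σ m o)
      × (c ≡ true → pc (iter t 1 s) ≡ target) × (c ≡ false → pc (iter t 1 s) ≡ l + 1)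
  testJump t l x y {s = s} {σ} target c at eq r lt with foldl-corrupt (A t s) r
  ... | m , o , cr , r' , safe≡ , pc≡ = m , o , cr , go c refl
    where
    s₁ = foldl corrupt s (A t s)
    st : iter t 1 s ≡ (if c then record s₁ { pc = target } else next s₁)
    st = trans (step₁ t at eq)
      (cong (λ c' → if c' then record s₁ { pc = target } else next s₁)
        (trans (cong (λ f → less (value (f x)) (value (f y))) safe≡) lt))
    go : ∀ c' → c ≡ c' → Rel (iter t 1 s) (havoc σ m o)
      × (c ≡ true → pc (iter t 1 s) ≡ target) × (c ≡ false → pc (iter t 1 s) ≡ l + 1)
    go true  refl = subst (λ s' → Rel s' (havoc σ m o)) (sym st) (pc-Rel r') , (λ _ → cong pc st) , λ ()
    go false refl = subst (λ s' → Rel s' (havoc σ m o)) (sym st) (pc-Rel r') , (λ ()) ,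
      λ _ → trans (cong pc st) (trans (cong suc (trans pc≡ eq)) (sym (+-comm l 1)))

  test : ∀ b {t l s σ target is} → T (shallowᶜ b) → CodeAt l (condCode b ++ branch b target ∷ is) →
    pc s ≡ l → Rel s σ → peakᶜ (nr σ) b < W → Tested t l b s σ target
  test (e <ₙ f) {t} {l} {s} {σ} {target} {is} sh at eq r p
    with Equivalence.to T-∧ sh
  ... | she , shf
    with subst (CodeAt l) (++-assoc (expCode e 0) (expCode f 1) _) at
  ... | at'
    with evaluate e 0 {t} she (CodeAt-left (expCode e 0) at') eq r (≤-<-trans (m≤m+n _ _) p)
  ... | E₁
    with evaluate f 1 {t + expSize e} shf
           (CodeAt-left (expCode f 1) (CodeAt-right (expCode e 0) (expCode-length e 0) at'))
           (Evaluated.pc' E₁) (Evaluated.rel E₁) (≤-<-trans (m≤n+m _ (peak (nr σ) e)) p)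
  ... | E₂
    with testJump (t + expSize e + expSize f) (l + expSize e + expSize f) (tmp 0) (tmp 1) target
           (truth σ (e <ₙ f))
           (CodeAt-right (expCode f 1) (expCode-length f 1) (CodeAt-right (expCode e 0) (expCode-length e 0) at'))
           (Evaluated.pc' E₂) (Evaluated.rel E₂)
           (cong₂ (λ v w → less (value v) (value w))
             (trans (Evaluated.below E₂ (n<1+n 0)) (Evaluated.result E₁)) (Evaluated.result E₂))
  ... | m , o , c , r' , y , n = record
    { m' = m ; o' = o ; corr = Corr-trans (Evaluated.corr E₁) (Corr-trans (Evaluated.corr E₂) c)
    ; rel = subst (λ s' → Rel s' (havoc σ m o)) (sym it) r'
    ; jumped = λ h → trans (cong pc it) (y h)
    ; fell = λ h → trans (cong pc it) (trans (n h) (cong (_+ 1) (+-assoc l (expSize e) (expSize f))))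
    }
    where
    it : iter t (condSize (e <ₙ f) + 1) s ≡
         iter (t + expSize e + expSize f) 1 (iter (t + expSize e) (expSize f) (iter t (expSize e) s))
    it = trans (cong (λ k → iter t k s) (+-assoc (expSize e) (expSize f) 1))
           (trans (iter-+ t (expSize e) (expSize f + 1) s)
                  (iter-+ (t + expSize e) (expSize f) 1 (iter t (expSize e) s)))
  test (wrd b i {b<4} {i<8} <ʷ wrd b' i' {b'<4} {i'<8}) {t} {l} {s} {σ} {target} sh at eq r p
    with testJump t l (wadr b i) (wadr b' i') target
           (less (value (wr σ b i)) (value (wr σ b' i'))) at eq r
           (cong₂ (λ v w → less (value v) (value w))
             (words r (<ᵇ⇒< b 4 b<4) (<ᵇ⇒< i 8 i<8)) (words r (<ᵇ⇒< b' 4 b'<4) (<ᵇ⇒< i' 8 i'<8)))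
  ... | m , o , c , r' , y , n = record
    { m' = m ; o' = o ; corr = c ; rel = r' ; jumped = y
    ; fell = λ h → trans (n h) (cong (_+ 1) (sym (+-identityʳ l))) }

  jumpStep : ∀ {t l l' is s σ} → CodeAt l (jump l' ∷ is) → pc s ≡ l → Rel s σ →
    ∃[ m ] ∃[ o ] Corr (mem σ) (ow σ) m o × Rel (iter t 1 s) (havoc σ m o) × pc (iter t 1 s) ≡ l'
  jumpStep {t} {s = s} {σ} at eq r with foldl-corrupt (A t s) r
  ... | m , o , c , r' , _ , _ =
    m , o , c , subst (λ s' → Rel s' (havoc σ m o)) (sym (step₁ t at eq)) (pc-Rel r') , cong pc (step₁ t at eq)

  After : (ℕ → View → Set ℓ) → ℕ → View → Set (a Level.⊔ ℓ)
  After Q t σ = ∀ m o → Havoc σ m o → Q (t + 1) (havoc σ m o)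

  -- Running c after j steps, then jumping to end.
  then-jump : ∀ {c end t j l s σ} {Q : ℕ → View → Set ℓ} → CodeAt l (code c l) →
    CodeAt (l + size c) (jump end ∷ []) → pc (iter t j s) ≡ l → Rel (iter t j s) σ → Bounded t s →
    WP c Q (t + j) σ →
    ∃[ k ] ∃[ σ' ] ∃[ m ] ∃[ o ] pc (iter t (j + k + 1) s) ≡ end
      × Rel (iter t (j + k + 1) s) (havoc σ' m o) × Havoc σ' m o × Q (t + (j + k)) σ'
  then-jump {t = t} {j} {s = s} {Q = Q} at at' eq r b w with runs w at eq r (Bounded-iter t j b)
  ... | k , σ' , eq₂ , r₂ , q with jumpStep {t + j + k} at' eq₂ r₂
  ... | m , o , c , r₃ , eq₃ =
    k , σ' , m , o , trans (cong pc it) eq₃ , r₄ , (c , lost≤δ {t} {s} {j + k + 1} b r₄) ,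
    subst (λ t' → Q t' σ') (+-assoc t j k) q
    where
    it = trans (iter-+ t (j + k) 1 s) (cong₂ (λ t' s' → iter t' 1 s') (sym (+-assoc t j k)) (iter-+ t j k s))
    r₄ : Rel (iter t (j + k + 1) s) (havoc σ' m o)
    r₄ = subst (λ s' → Rel s' (havoc σ' m o)) (sym it) r₃

  wp-ite : ∀ {b c d} {Q : ℕ → View → Set ℓ} {t σ} → {sh : T (shallowᶜ b)} → peakᶜ (nr σ) b < W →
    (∀ m o → Havoc σ m o →
       (truth σ b ≡ true  → WP c (After Q) (t + (condSize b + 1)) (havoc σ m o))
     × (truth σ b ≡ false → WP d (After Q) (t + (condSize b + 1)) (havoc σ m o))) →
    WP (ite b c d) Q t σ
  wp-ite {b = b} {c} {d} {Q} {t} {σ} {sh} p q .runs {l} {s} at eq r bd = result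
    where
    E = test b {t} sh at eq r p
    open Tested E
    lᵈ = l + condSize b + 1
    lᶜ = lᵈ + size d + 1
    end = l + size (ite b c d)
    j = condSize b + 1
    restᵈ : CodeAt lᵈ (code d lᵈ ++ jump end ∷ code c lᶜ ++ jump end ∷ [])
    restᵈ = CodeAt-tail (CodeAt-right (condCode b) (condCode-length b) at)
    restᶜ : CodeAt lᶜ (code c lᶜ ++ jump end ∷ [])
    restᶜ = CodeAt-tail (CodeAt-right (code d lᵈ) (code-length d lᵈ) restᵈ)
    qs = q m' o' (corr , lost≤δ {t} {s} {j} bd rel)
    Goal = ∃[ k ] ∃[ σ' ] pc (iter t k s) ≡ end × Rel (iter t k s) σ' × Q (t + k) σ'
    conclude : (∃[ k ] ∃[ σ' ] ∃[ m ] ∃[ o ] pc (iter t (j + k + 1) s) ≡ end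
      × Rel (iter t (j + k + 1) s) (havoc σ' m o) × Havoc σ' m o × After Q (t + (j + k)) σ') → Goal
    conclude (k , σ' , m , o , eq , r , h , q) =
      j + k + 1 , havoc σ' m o , eq , r , subst (λ t' → Q t' (havoc σ' m o)) (+-assoc t (j + k) 1) (q m o h)
    decide : ∀ v → truth σ b ≡ v → Goal
    decide true tr = conclude (then-jump {c = c} {end} {t} {j} {Q = After Q} (CodeAt-left (code c lᶜ) restᶜ)
      (CodeAt-right (code c lᶜ) (code-length c lᶜ) restᶜ) (jumped tr) rel bd (proj₁ qs tr))
    decide false tr = conclude (then-jump {c = d} {end} {t} {j} {Q = After Q} (CodeAt-left (code d lᵈ) restᵈ)
      (CodeAt-left (jump end ∷ []) (CodeAt-right (code d lᵈ) (code-length d lᵈ) restᵈ)) (fell tr) rel bd (proj₂ qs tr))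
    result : Goal
    result = decide (truth σ b) refl

  -- I is a family of invariants indexed by a decreasing measure.
  wp-while : ∀ {b c} {Q : ℕ → View → Set ℓ} (I : ℕ → ℕ → View → Set ℓ) → {sh : T (shallowᶜ b)} →
    (∀ μ t σ → I μ t σ → ∀ m o → Havoc σ m o →
       peakᶜ (nr σ) b < W
     × (truth σ b ≡ true  → WP c (λ t' σ' → ∃[ μ' ] μ' < μ × I μ' (t' + 1) σ') (t + (condSize b + 1)) (havoc σ m o))
     × (truth σ b ≡ false → Q (t + (condSize b + 2)) (havoc σ m o))) →
    ∀ {μ t σ} → I μ t σ → WP (while b c) Q t σ
  wp-while {b = b} {c} {Q} I {sh} body {μ₀} {t₀} {σ₀} inv₀ .runs {l} {s₀} at eq₀ r₀ bd₀ =
    loop μ₀ μ₀ ≤-refl t₀ s₀ σ₀ (mem σ₀) (ow σ₀) inv₀ none eq₀ r₀ bd₀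
    where
    end = l + size (while b c)
    lᶜ = l + condSize b + 1 + 1
    j = condSize b + 1
    atʲ : CodeAt (l + condSize b + 1) (jump end ∷ code c lᶜ ++ jump l ∷ [])
    atʲ = CodeAt-tail (CodeAt-right (condCode b) (condCode-length b) at)
    atᶜ : CodeAt lᶜ (code c lᶜ ++ jump l ∷ [])
    atᶜ = CodeAt-tail atʲ
    loop : ∀ fuel μ → μ ≤ fuel → ∀ t s σ m o → I μ t σ → Corr (mem σ) (ow σ) m o → pc s ≡ l →
      Rel s (havoc σ m o) → Bounded t s →
      ∃[ k ] ∃[ σ' ] pc (iter t k s) ≡ end × Rel (iter t k s) σ' × Q (t + k) σ'
    loop fuel μ μ≤ t s σ m o inv cr eq r bd = decide (truth σ b) refl
      where
      bounded : length o ≤ δ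
      bounded = lost≤δ {t} {s} {0} bd r
      E : Tested t l b s (havoc σ m o) (l + condSize b + 1 + 1)
      E = test b {t} sh at eq r (proj₁ (body μ t σ inv m o (cr , bounded)))
      open Tested E
      B = body μ t σ inv m' o' (Corr-trans cr corr , lost≤δ {t} {s} {j} bd rel)
      Goal = ∃[ k ] ∃[ σ' ] pc (iter t k s) ≡ end × Rel (iter t k s) σ' × Q (t + k) σ'
      same : ∀ b → truth (havoc σ m o) b ≡ truth σ b
      same (_ <ₙ _) = refl
      same (wrd _ _ <ʷ wrd _ _) = refl
      again : ∀ fuel → μ ≤ fuel → (∃[ k ] ∃[ σ' ] ∃[ m ] ∃[ o ] pc (iter t (j + k + 1) s) ≡ l
        × Rel (iter t (j + k + 1) s) (havoc σ' m o) × Havoc σ' m o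
        × ∃[ μ' ] μ' < μ × I μ' (t + (j + k) + 1) σ') → Goal
      again zero μ≤ (_ , _ , _ , _ , _ , _ , _ , _ , μ'<μ , _) = contradiction (<-≤-trans μ'<μ μ≤) (λ ())
      again (suc fuel) μ≤ (k , σ' , m₂ , o₂ , eq₂ , r₂ , (c₂ , _) , μ' , μ'<μ , inv')
        with loop fuel μ' (s≤s⁻¹ (≤-trans μ'<μ μ≤)) (t + (j + k + 1)) (iter t (j + k + 1) s) σ' m₂ o₂
               (subst (λ t' → I μ' t' σ') (+-assoc t (j + k) 1) inv') c₂ eq₂ r₂ (Bounded-iter t (j + k + 1) bd)
      ... | k' , σ″ , eq″ , r″ , q =
        j + k + 1 + k' , σ″ , trans (cong pc (iter-+ t (j + k + 1) k' s)) eq″ ,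
        subst (λ s' → Rel s' σ″) (sym (iter-+ t (j + k + 1) k' s)) r″ ,
        subst (λ t' → Q t' σ″) (+-assoc t (j + k + 1) k') q
      decide : ∀ v → truth σ b ≡ v → Goal
      decide true tr = again fuel μ≤ (then-jump {c = c} {l} {t} {j} {Q = λ t' σ' → ∃[ μ' ] μ' < μ × I μ' (t' + 1) σ'}
        (CodeAt-left (code c lᶜ) atᶜ) (CodeAt-right (code c lᶜ) (code-length c lᶜ) atᶜ)
        (jumped (trans (same b) tr)) rel bd (proj₁ (proj₂ B) tr))
      decide false tr with jumpStep {t + j} atʲ (fell (trans (same b) tr)) rel
      ... | m₂ , o₂ , c₂ , r₂ , eq₂ =
        j + 1 , havoc σ m₂ o₂ , trans (cong pc it) eq₂ , r₃ ,
        subst (λ t' → Q t' (havoc σ m₂ o₂)) (cong (t +_) (sym (+-assoc (condSize b) 1 1)))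
          (proj₂ (proj₂ (body μ t σ inv m₂ o₂ (Corr-trans cr (Corr-trans corr c₂) , lost≤δ {t} {s} {j + 1} bd r₃))) tr)
        where
        it = iter-+ t j 1 s
        r₃ : Rel (iter t (j + 1) s) (havoc σ m₂ o₂)
        r₃ = subst (λ s' → Rel s' (havoc σ m₂ o₂)) (sym it) r₂

  open StrictTotalOrder K using ()
    renaming (Carrier to Key; _<_ to _≺_; _<?_ to _≺?_; compare to compareᴷ; _≈_ to _≈ᴷ_;
              irrefl to ≺-irrefl; trans to ≺-trans; <-respʳ-≈ to ≺-respʳ; <-respˡ-≈ to ≺-respˡ; module Eq to Eqᴷ)

  infix 4 _≼_
  record _≼_ (u w : Value) : Set where
    constructor le
    field
      not-less : less w u ≡ false

  open _≼_ public

  ≺?-true : ∀ {x y} → ⌊ x ≺? y ⌋ ≡ true → x ≺ y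
  ≺?-true {x} {y} h with x ≺? y
  ... | yes p = p

  ≺?-false : ∀ {x y} → ⌊ x ≺? y ⌋ ≡ false → ¬ x ≺ y
  ≺?-false {x} {y} h with x ≺? y
  ... | no ¬p = ¬p

  ≺?-no : ∀ {x y} → ¬ x ≺ y → ⌊ x ≺? y ⌋ ≡ false
  ≺?-no {x} {y} ¬p with x ≺? y
  ... | yes p = contradiction p ¬p
  ... | no _  = refl

  <ᵇ-false : ∀ j k → (j <ᵇ k) ≡ false → k ≤ j
  <ᵇ-false j k h with j <? k
  ... | yes p = ⊥-elim (subst T h (<⇒<ᵇ p))
  ... | no ¬p = ≮⇒≥ ¬p

  <ᵇ-true : ∀ j k → (j <ᵇ k) ≡ true → j < k
  <ᵇ-true j k h = <ᵇ⇒< j k (≡⇒T h)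

  <ᵇ-no : ∀ j k → k ≤ j → (j <ᵇ k) ≡ false
  <ᵇ-no j k h with j <ᵇ k in eq
  ... | false = refl
  ... | true  = contradiction (<ᵇ-true j k eq) (≤⇒≯ h)

  ≼-refl : ∀ u → u ≼ u
  ≼-refl (inj₁ j) = le (<ᵇ-no j j ≤-refl)
  ≼-refl (inj₂ x) = le (≺?-no {x} {x} (≺-irrefl Eqᴷ.refl))

  ≼-trans : ∀ {u v w} → u ≼ v → v ≼ w → u ≼ w
  ≼-trans {inj₁ i} {inj₁ j} {inj₁ k} (le p) (le q) = le (<ᵇ-no k i (≤-trans (<ᵇ-false j i p) (<ᵇ-false k j q)))
  ≼-trans {inj₁ i} {_}      {inj₂ z} p q = le refl
  ≼-trans {inj₂ x} {inj₂ y} {inj₂ z} (le p) (le q) = le (≺?-no {z} {x} (go (≺?-false {y} {x} p) (≺?-false {z} {y} q)))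
    where
    go : ¬ y ≺ x → ¬ z ≺ y → ¬ z ≺ x
    go y⊀x z⊀y z≺x with compareᴷ y x
    ... | tri< y≺x _ _ = y⊀x y≺x
    ... | tri≈ _ y≈x _ = z⊀y (≺-respʳ (Eqᴷ.sym y≈x) z≺x)
    ... | tri> _ _ x≺y = z⊀y (≺-trans z≺x x≺y)

  less⇒≼ : ∀ u w → less u w ≡ true → u ≼ w
  less⇒≼ (inj₁ j) (inj₁ k) h = le (<ᵇ-no k j (<⇒≤ (<ᵇ-true j k h)))
  less⇒≼ (inj₁ j) (inj₂ y) h = le refl
  less⇒≼ (inj₂ x) (inj₂ y) h = le (≺?-no {y} {x} (λ y≺x → ≺-irrefl Eqᴷ.refl (≺-trans (≺?-true {x} {y} h) y≺x)))

  less-≼-trans : ∀ u {v w} → less u v ≡ true → v ≼ w → less u w ≡ true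
  less-≼-trans u {v} {w} p q with less u w in eq
  ... | true  = refl
  ... | false with trans (sym p) (not-less (≼-trans {v} {w} {u} q (le eq)))
  ...   | ()

  ≼-less-trans : ∀ {u v} w → u ≼ v → less v w ≡ true → less u w ≡ true
  ≼-less-trans {u} {v} w p q with less u w in eq
  ... | true  = refl
  ... | false with trans (sym q) (not-less (≼-trans {w} {u} {v} (le eq) p))
  ...   | ()

  Down : (Value → Bool) → Set a
  Down χ = ∀ {u w} → u ≼ w → χ w ≡ true → χ u ≡ true

  atMost below : Value → Value → Bool
  atMost v x = not (less v x)
  below  v x = less x v

  not-true : ∀ {b} → not b ≡ true → b ≡ false
  not-true {false} _ = refl

  not-false : ∀ {b} → b ≡ false → not b ≡ true
  not-false refl = refl

  atMost-down : ∀ v → Down (atMost v)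
  atMost-down v {u} {w} u≼w h = not-false (not-less (≼-trans u≼w (le {w} {v} (not-true h))))

  below-down : ∀ v → Down (below v)
  below-down v u≼w h = ≼-less-trans v u≼w h

  NotInput : Word → Set
  NotInput (num _)    = ⊤
  NotInput (input _)  = ⊥
  NotInput (forged _) = ⊤

  forge-NotInput : ∀ v → NotInput (forge v)
  forge-NotInput (inj₁ k) = tt
  forge-NotInput (inj₂ x) = tt

  -- What can have happened to the positions in U that only the adversary writes to.
  record Fr (U : ℕ → Set) (m : ℕ → Word) (o : List Word) (m' : ℕ → Word) (o' : List Word) : Set a where
    field
      dirty    : List ℕ
      dirty≤   : length dirty + length o ≤ length o'
      clean    : ∀ {p} → U p → elem p dirty ≡ false → m' p ≡ m p
      grows    : ∀ {w} → w ∈ o → w ∈ o'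
      history  : ∀ {p} → U p → m' p ≡ m p ⊎ (m p ∈ o' × NotInput (m' p))

  open Fr public

  Fr-refl : ∀ {U m o} → Fr U m o m o
  Fr-refl = record { dirty = [] ; dirty≤ = ≤-refl ; clean = λ _ _ → refl ; grows = λ x → x ; history = λ _ → inj₁ refl }

  Fr-trans : ∀ {U m o m' o' m″ o″} → Fr U m o m' o' → Fr U m' o' m″ o″ → Fr U m o m″ o″
  Fr-trans {U} {m} {o} {m'} {o'} {m″} {o″} f g = record
    { dirty = dirty f ++ dirty g
    ; dirty≤ = subst (λ x → x + length o ≤ length o″) (sym (length-++ (dirty f)))
        (linear 5 (λ x y u v w → x ⊕ u ⊑ v ⇒ y ⊕ v ⊑ w ⇒ ⊢ x ⊕ y ⊕ u ⊑ w) (length (dirty f)) (length (dirty g))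
          (length o) (length o') (length o″) (dirty≤ f) (dirty≤ g))
    ; clean = λ {p} u h → trans (clean g u (proj₂ (elem-++ p (dirty f) h))) (clean f u (proj₁ (elem-++ p (dirty f) h)))
    ; grows = λ x → grows g (grows f x)
    ; history = hist
    }
    where
    hist : ∀ {p} → U p → m″ p ≡ m p ⊎ (m p ∈ o″ × NotInput (m″ p))
    hist u with history f u | history g u
    ... | inj₁ e        | inj₁ e'       = inj₁ (trans e' e)
    ... | inj₁ e        | inj₂ (i , ni) = inj₂ (subst (_∈ o″) e i , ni)
    ... | inj₂ (i , ni) | inj₁ e'       = inj₂ (grows g i , subst NotInput (sym e') ni)
    ... | inj₂ (i , _)  | inj₂ (_ , ni) = inj₂ (grows g i , ni)

  Fr-weaken : ∀ {U U' : ℕ → Set} {m o m' o'} → (∀ {p} → U' p → U p) → Fr U m o m' o' → Fr U' m o m' o'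
  Fr-weaken h f = record { dirty = dirty f ; dirty≤ = dirty≤ f ; clean = λ u → clean f (h u)
                         ; grows = grows f ; history = λ u → history f (h u) }

  Fr-havoc : ∀ {U m o m' o'} → Corr m o m' o' → Fr U m o m' o'
  Fr-havoc none = Fr-refl
  Fr-havoc {U} (hit {m'} {o'} c p v) = Fr-trans (Fr-havoc c) (record
    { dirty = p ∷ [] ; dirty≤ = ≤-refl
    ; clean = λ {q} _ h → upd-other m' p (forge v) (λ eq → ≡ᵇ-false (proj₁ (∨-false {q ≡ᵇ p} h)) (sym eq))
    ; grows = there
    ; history = λ {q} _ → upd-either m' (λ w → w ≡ m' q ⊎ (m' q ∈ m' p ∷ o' × NotInput w)) p (forge v) q
        (λ { refl → inj₂ (here refl , forge-NotInput v) }) (λ _ → inj₁ refl)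
    })

  Fr-write : ∀ {U m o p w} → (∀ {q} → U q → p ≢ q) → Fr U m o (m [ p ]≔ w) o
  Fr-write {m = m} {p = p} {w} h = record
    { dirty = [] ; dirty≤ = ≤-refl ; clean = λ u _ → upd-other m p w (h u) ; grows = λ x → x
    ; history = λ u → inj₁ (upd-other m p w (h u)) }

  Fr-length : ∀ {U m o m' o'} → Fr U m o m' o' → length o ≤ length o'
  Fr-length f = ≤-trans (m≤n+m _ (length (dirty f))) (dirty≤ f)

  Fr-calm : ∀ {U m o m' o' p} → Fr U m o m' o' → length o' ≡ length o → U p → m' p ≡ m p
  Fr-calm {o = o} f eq u = clean f u (none∈ (dirty f) (+-cancelʳ-≤ (length o) _ 0 (≤-trans (dirty≤ f) (≤-reflexive eq))))
    where
    none∈ : ∀ {p} D → length D ≤ 0 → elem p D ≡ false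
    none∈ [] _ = refl

  Corr-length : ∀ {m o m' o'} → Corr m o m' o' → length o ≤ length o'
  Corr-length none        = ≤-refl
  Corr-length (hit c p v) = m≤n⇒m≤1+n (Corr-length c)

  Corr-calm : ∀ {m o m' o' e} → Corr m o m' o' → e ≤ length o → length o' ≡ e → m' ≡ m × o' ≡ o
  Corr-calm none        e≤ eq = refl , refl
  Corr-calm (hit c p v) e≤ eq = contradiction (≤-trans e≤ (Corr-length c)) (<⇒≱ (≤-reflexive eq))

  -- Cells of kind k have been modified by the program only since there were e faults.
  Calm : Kind → ℕ → List Word → Set
  Calm k e o = k ≡ safeᵏ ⊎ length o ≡ e

  calm-havoc : ∀ k {x m o m' o' e} → Corr m o m' o' → e ≤ length o → Calm k e o' →
    Calm k e o × pick k x m' ≡ pick k x m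
  calm-havoc safeᵏ   c e≤ calm = inj₁ refl , refl
  calm-havoc faultyᵏ c e≤ (inj₂ eq) with Corr-calm c e≤ eq
  ... | refl , refl = inj₂ eq , refl

  SameN SameW : ℕ → View → View → Set a
  SameN zero    σ σ' = Level.Lift a ⊤
  SameN (suc L) σ σ' = SameN L σ σ' × nr σ' L ≡ nr σ L
  SameW zero    σ σ' = Level.Lift a ⊤
  SameW (suc L) σ σ' = SameW L σ σ' × wr σ' L ≡ wr σ L

  SameN-trans : ∀ L {σ σ' σ″} → SameN L σ σ' → SameN L σ' σ″ → SameN L σ σ″
  SameN-trans zero    p q = p
  SameN-trans (suc L) (p , e) (q , e') = SameN-trans L p q , trans e' e

  SameW-trans : ∀ L {σ σ' σ″} → SameW L σ σ' → SameW L σ' σ″ → SameW L σ σ″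
  SameW-trans zero    p q = p
  SameW-trans (suc L) (p , e) (q , e') = SameW-trans L p q , trans e' e

  SameN-refl : ∀ L {σ σ'} → (∀ b → nr σ' b ≡ nr σ b) → SameN L σ σ'
  SameN-refl zero    h = Level.lift tt
  SameN-refl (suc L) h = SameN-refl L h , h L

  SameW-refl : ∀ L {σ σ'} → (∀ b → wr σ' b ≡ wr σ b) → SameW L σ σ'
  SameW-refl zero    h = Level.lift tt
  SameW-refl (suc L) h = SameW-refl L h , h L

  SameN-set : ∀ L b {f σ σ'} → L ≤ b → nr σ' ≡ nr σ [ b ]≔ f → SameN L σ σ'
  SameN-set zero    b L≤ eq = Level.lift tt
  SameN-set (suc L) b {f} {σ} L≤ eq =
    SameN-set L b (<⇒≤ L≤) eq , trans (cong (λ g → g L) eq) (upd-other (nr σ) b f (≢-sym (<⇒≢ L≤)))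

  SameW-set : ∀ L b {f σ σ'} → L ≤ b → wr σ' ≡ wr σ [ b ]≔ f → SameW L σ σ'
  SameW-set zero    b L≤ eq = Level.lift tt
  SameW-set (suc L) b {f} {σ} L≤ eq =
    SameW-set L b (<⇒≤ L≤) eq , trans (cong (λ g → g L) eq) (upd-other (wr σ) b f (≢-sym (<⇒≢ L≤)))

  -- A routine that works on numeric banks ≥ L, word banks ≥ L', and cells of kind k
  -- from address B on, has taken σ to σ'.
  record Keep (L L' : ℕ) (k : Kind) (B : ℕ) (σ σ' : View) : Set a where
    field
      sameN : SameN L σ σ'
      sameW : SameW L' σ σ'
      sameA : k ≡ faultyᵏ → ar σ' ≡ ar σ
      frame : Fr (_< B) (mem σ) (ow σ) (mem σ') (ow σ')

  open Keep public

  Keep-trans : ∀ {L L' k B σ σ' σ″} → Keep L L' k B σ σ' → Keep L L' k B σ' σ″ → Keep L L' k B σ σ″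
  Keep-trans {L} {L'} f g = record
    { sameN = SameN-trans L (sameN f) (sameN g) ; sameW = SameW-trans L' (sameW f) (sameW g)
    ; sameA = λ e → trans (sameA g e) (sameA f e) ; frame = Fr-trans (frame f) (frame g) }

  Keep-havoc : ∀ {L L' k B σ m o} → Havoc σ m o → Keep L L' k B σ (havoc σ m o)
  Keep-havoc {L} {L'} (c , _) = record
    { sameN = SameN-refl L (λ _ → refl) ; sameW = SameW-refl L' (λ _ → refl) ; sameA = λ _ → refl ; frame = Fr-havoc c }

  Keep-refl : ∀ {L L' k B σ} → Keep L L' k B σ σ
  Keep-refl {L} {L'} = record
    { sameN = SameN-refl L (λ _ → refl) ; sameW = SameW-refl L' (λ _ → refl) ; sameA = λ _ → refl ; frame = Fr-refl }

  Keep-setN : ∀ {L L' k B b i v σ} {b<6 : T (b <ᵇ 6)} {i<16 : T (i <ᵇ 16)} → {T (L ≤ᵇ b)} →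
    Keep L L' k B σ (setN (num b i {b<6} {i<16}) v σ)
  Keep-setN {L} {L'} {b = b} {σ = σ} {_} {_} {h} = record
    { sameN = SameN-set L b {σ = σ} (≤ᵇ⇒≤ L b h) refl ; sameW = SameW-refl L' (λ _ → refl) ; sameA = λ _ → refl ; frame = Fr-refl }

  Keep-setW : ∀ {L L' k B b i w σ} {b<4 : T (b <ᵇ 4)} {i<8 : T (i <ᵇ 8)} → {T (L' ≤ᵇ b)} →
    Keep L L' k B σ (setW (wrd b i {b<4} {i<8}) w σ)
  Keep-setW {L} {L'} {b = b} {σ = σ} {_} {_} {h} = record
    { sameN = SameN-refl L (λ _ → refl) ; sameW = SameW-set L' b {σ = σ} (≤ᵇ⇒≤ L' b h) refl ; sameA = λ _ → refl ; frame = Fr-refl }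

  Keep-cell : ∀ {L L' k B p w σ} → (k ≡ faultyᵏ → B ≤ p) → Keep L L' k B σ (setCell k p w σ)
  Keep-cell {L} {L'} {safeᵏ} h = record
    { sameN = SameN-refl L (λ _ → refl) ; sameW = SameW-refl L' (λ _ → refl) ; sameA = λ () ; frame = Fr-refl }
  Keep-cell {L} {L'} {faultyᵏ} h = record
    { sameN = SameN-refl L (λ _ → refl) ; sameW = SameW-refl L' (λ _ → refl) ; sameA = λ _ → refl
    ; frame = Fr-write (λ q<B → λ { refl → <⇒≱ q<B (h refl) }) }

  Keep-weaken : ∀ {L L' k B L₁ L₁' B₁ σ σ'} → (SameN L σ σ' → SameN L₁ σ σ') → (SameW L' σ σ' → SameW L₁' σ σ') →
    B₁ ≤ B → Keep L L' k B σ σ' → Keep L₁ L₁' k B₁ σ σ'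
  Keep-weaken f g B₁≤B kp = record { sameN = f (sameN kp) ; sameW = g (sameW kp) ; sameA = sameA kp
    ; frame = Fr-weaken (λ p<B₁ → <-≤-trans p<B₁ B₁≤B) (frame kp) }

  -- Φ holds of the cells of kind k unless the adversary could have interfered.
  record Fact (k : Kind) (e : ℕ) (Φ : (ℕ → Word) → Set a) (x m : ℕ → Word) (o : List Word) : Set a where
    constructor cf
    field
      since : e ≤ length o
      fact  : Calm k e o → Φ (pick k x m)

  open Fact public

  CF : Kind → ℕ → ((ℕ → Word) → Set a) → View → Set a
  CF k e Φ σ = Fact k e Φ (ar σ) (mem σ) (ow σ)

  cf-havoc : ∀ {k e Φ x m o m' o'} → Corr m o m' o' × length o' ≤ δ → Fact k e Φ x m o → Fact k e Φ x m' o'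
  cf-havoc {k = k} {Φ = Φ} {x} (c , _) f = cf (≤-trans (since f) (Corr-length c)) λ calm →
    let calm' , eq = calm-havoc k {x = x} c (since f) calm in subst Φ (sym eq) (fact f calm')

  cf-store : ∀ {k e x m o} {Φ Ψ : (ℕ → Word) → Set a} p w → (∀ g → Φ g → Ψ (g [ p ]≔ w)) → Fact k e Φ x m o →
    Fact k e Ψ (pick k (x [ p ]≔ w) x) (pick k m (m [ p ]≔ w)) o
  cf-store {k = safeᵏ}   p w h f = cf (since f) λ calm → h _ (fact f calm)
  cf-store {k = faultyᵏ} p w h f = cf (since f) λ calm → h _ (fact f calm)

  cf-map : ∀ {k e x m o} {Φ Ψ : (ℕ → Word) → Set a} → (∀ g → Φ g → Ψ g) → Fact k e Φ x m o → Fact k e Ψ x m o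
  cf-map h f = cf (since f) λ calm → h _ (fact f calm)

  cf-read : ∀ {k e Φ x m o} p → Fact k e Φ x m o → Fact k e (λ g → Φ g × pick k x m p ≡ g p) x m o
  cf-read p f = cf (since f) λ calm → fact f calm , refl

  Post : ∀ {ℓ} → ℕ → (View → Set ℓ) → ℕ → View → Set ℓ
  Post N Ξ t σ = t ≤ N × Ξ σ

  Stable : ∀ {ℓ} → (View → Set ℓ) → Set (a Level.⊔ ℓ)
  Stable Ξ = ∀ {σ m o} → Ξ σ → Havoc σ m o → Ξ (havoc σ m o)

  wp-ite-post : ∀ {ℓ} {b c d N t σ} {Ξ : View → Set ℓ} → {sh : T (shallowᶜ b)} → Stable Ξ → peakᶜ (nr σ) b < W →
    (∀ m o → Havoc σ m o →
       (truth σ b ≡ true  → WP c (Post N Ξ) (t + (condSize b + 1)) (havoc σ m o))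
     × (truth σ b ≡ false → WP d (Post N Ξ) (t + (condSize b + 1)) (havoc σ m o))) →
    WP (ite b c d) (Post (N + 1) Ξ) t σ
  wp-ite-post {Ξ = Ξ} {sh = sh} st p q = wp-ite {sh = sh} p λ m o h →
    (λ e → mono (proj₁ (q m o h) e) (λ t' σ' (t≤ , x) m' o' h' → +-monoˡ-≤ 1 t≤ , st x h')) ,
    (λ e → mono (proj₂ (q m o h) e) (λ t' σ' (t≤ , x) m' o' h' → +-monoˡ-≤ 1 t≤ , st x h'))

  relax : ∀ {ℓ} {c N N' t σ} {Ξ : View → Set ℓ} → N ≤ N' → WP c (Post N Ξ) t σ → WP c (Post N' Ξ) t σ
  relax N≤ w = mono w λ t' σ' (t≤ , x) → ≤-trans t≤ N≤ , x

  opaque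
    wp-for : ∀ {ℓ} {b c n C cost t σ} (I : ℕ → View → Set ℓ) → {sh : T (shallowᶜ b)} → (∀ i → Stable (I i)) →
      (∀ {i σ} → I i σ → peakᶜ (nr σ) b < W) →
      (∀ {i σ} → I i σ → truth σ b ≡ true → i < n) → (∀ {i σ} → I i σ → truth σ b ≡ false → i ≡ n) →
      (∀ {i σ t} → I i σ → i < n → WP c (Post (t + cost) (I (suc i))) t σ) →
      cost + (condSize b + 2) ≤ C → I 0 σ → WP (while b c) (Post (t + n * C + (condSize b + 2)) (I n)) t σ
    wp-for {ℓ} {b} {c} {n} {C} {cost} {t} {σ} I {sh} st pk yes' no' body cost≤ I₀ = wp-while Loop {sh}
      (λ μ t' σ' (i , x , eq , time) m o h → pk x ,
        (λ tr → let i<n = yes' x tr in mono (body (st i x h) i<n) (λ t″ σ″ (t″≤ , x') → advance μ i t' t″ σ″ eq i<n time t″≤ x')) ,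
        (λ fa → finish μ t' time , subst (λ i → I i (havoc σ' m o)) (no' x fa) (st i x h)))
      {n} {t} {σ} (0 , I₀ , refl , ≤-refl)
      where
      Loop : ℕ → ℕ → View → Set ℓ
      Loop μ t' σ' = ∃[ i ] I i σ' × i + μ ≡ n × t' + μ * C ≤ t + n * C
      advance : ∀ μ i t' t″ σ″ → i + μ ≡ n → i < n → t' + μ * C ≤ t + n * C → t″ ≤ t' + (condSize b + 1) + cost →
        I (suc i) σ″ → ∃[ μ' ] μ' < μ × Loop μ' (t″ + 1) σ″
      advance zero i t' t″ σ″ eq i<n = contradiction (trans (sym (+-identityʳ i)) eq) (<⇒≢ i<n)
      advance (suc μ) i t' t″ σ″ eq i<n time t″≤ x = μ , ≤-refl , suc i , x , trans (sym (+-suc i μ)) eq ,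
        linear 7 (λ t' t″ s c C x T → t' ⊕ (C ⊕ x) ⊑ T ⇒ t″ ⊑ t' ⊕ (s ⊕ κ 1) ⊕ c ⇒ c ⊕ (s ⊕ κ 2) ⊑ C ⇒ ⊢ t″ ⊕ κ 1 ⊕ x ⊑ T)
          t' t″ (condSize b) cost C (μ * C) (t + n * C) time t″≤ cost≤
      finish : ∀ μ t' → t' + μ * C ≤ t + n * C → t' + (condSize b + 2) ≤ t + n * C + (condSize b + 2)
      finish μ t' time = +-monoˡ-≤ (condSize b + 2) (≤-trans (m≤m+n t' (μ * C)) time)

  wp-bounded : ∀ {ℓ} {c t σ} {Q : ℕ → View → Set ℓ} → WP c Q t σ → WP c (λ t' σ' → Q t' σ' × length (ow σ') ≤ δ) t σ
  wp-bounded {t = t} w .runs {s = s} at eq r b with runs w at eq r b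
  ... | k , σ' , eq' , r' , q = k , σ' , eq' , r' , q , lost≤δ {t} {s} {k} b r'

  Sorted : ℕ → ℕ → (ℕ → Value) → Set
  Sorted ρ R F = ∀ r p q → r < R → p < q → q < ρ → F (r * ρ + p) ≼ F (r * ρ + q)

  module Pass (k : Kind) (B src dst ρ R : ℕ) (0<ρ : 0 < ρ)
    (src<W : src + R * (ρ + ρ) + 2 < W) (dst<W : dst + R * (ρ + ρ) + 2 < W) (len<W : R * (ρ + ρ) + (ρ + ρ) + 2 < W)
    (validˢ : ∀ p → p < R * (ρ + ρ) → Valid k (src + p)) (validᵈ : ∀ p → p < R * (ρ + ρ) → Valid k (dst + p))
    (apart : ∀ p q → p < R * (ρ + ρ) → q < R * (ρ + ρ) → dst + q ≢ src + p)
    (outside : k ≡ faultyᵏ → B ≤ dst) (e : ℕ) (σ₀ : View) (e≤ : e ≤ length (ow σ₀))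
    (sorted₀ : Calm k e (ow σ₀) → Sorted ρ (R + R) (λ p → value (cells k σ₀ (src + p)))) where

    len : ℕ
    len = R * (ρ + ρ)

    g₀ : ℕ → Word
    g₀ = cells k σ₀

    F : ℕ → Value
    F p = value (g₀ (src + p))

    G : (ℕ → Word) → ℕ → Value
    G g p = value (g (dst + p))

    record Done (o : ℕ) (g : ℕ → Word) : Set a where
      field
        runs₀   : Sorted ρ (R + R) F
        source  : ∀ {p} → p < len → g (src + p) ≡ g₀ (src + p)
        counts  : ∀ (χ : Value → Bool) → count (λ p → χ (G g p)) o ≡ count (λ p → χ (F p)) o
        sorted  : ∀ r p q → p < q → q < ρ + ρ → r * (ρ + ρ) + q < o → G g (r * (ρ + ρ) + p) ≼ G g (r * (ρ + ρ) + q)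

    -- i and j are the heads of the runs [o, m) and [m, u), and z ends the output.
    record Merging (o m u i j z : ℕ) (g : ℕ → Word) : Set a where
      field
        runs₀   : Sorted ρ (R + R) F
        source  : ∀ {p} → p < len → g (src + p) ≡ g₀ (src + p)
        counts  : ∀ (χ : Value → Bool) →
          count (λ p → χ (G g p)) z + count (λ p → χ (F p)) m ≡ count (λ p → χ (F p)) i + count (λ p → χ (F p)) j
        earlier : ∀ r p q → p < q → q < ρ + ρ → r * (ρ + ρ) + q < o → G g (r * (ρ + ρ) + p) ≼ G g (r * (ρ + ρ) + q)
        current : ∀ {p q} → o ≤ p → p < q → q < z → G g p ≼ G g q
        lowˡ    : ∀ {p q} → o ≤ p → p < z → i ≤ q → q < m → G g p ≼ F q
        lowʳ    : ∀ {p q} → o ≤ p → p < z → j ≤ q → q < u → G g p ≼ F q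

    Ascending : ℕ → ℕ → Set
    Ascending b u = ∀ {p q} → b ≤ p → p < q → q < u → F p ≼ F q

    module Put {o m u i j z g} (f : Merging o m u i j z g) (o≤z : o ≤ z) (z<len : z < len) (w : Word) where
      open Merging f
      g' = g [ dst + z ]≔ w

      here' : G g' z ≡ value w
      here' = cong value (upd-same g (dst + z) w)

      there' : ∀ {p} → p < z → G g' p ≡ G g p
      there' {p} p<z = cong value (upd-other g (dst + z) w (λ eq → <⇒≢ p<z (sym (+-cancelˡ-≡ dst z p eq))))

      source' : ∀ {p} → p < len → g' (src + p) ≡ g₀ (src + p)
      source' p<len = trans (upd-other g (dst + z) w (apart _ _ p<len z<len)) (source p<len)

      earlier' : ∀ r p q → p < q → q < ρ + ρ → r * (ρ + ρ) + q < o → G g' (r * (ρ + ρ) + p) ≼ G g' (r * (ρ + ρ) + q)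
      earlier' r p q p<q q< rq<o = subst₂ _≼_ (sym (there' (<-trans (+-monoʳ-< (r * (ρ + ρ)) p<q) (<-≤-trans rq<o o≤z))))
        (sym (there' (<-≤-trans rq<o o≤z))) (earlier r p q p<q q< rq<o)

      current' : (∀ {p} → o ≤ p → p < z → G g p ≼ value w) → ∀ {p q} → o ≤ p → p < q → q < suc z → G g' p ≼ G g' q
      current' h {p} {q} o≤p p<q q<sz with m≤n⇒m<n∨m≡n (s≤s⁻¹ q<sz)
      ... | inj₁ q<z  = subst₂ _≼_ (sym (there' (<-trans p<q q<z))) (sym (there' q<z)) (current o≤p p<q q<z)
      ... | inj₂ refl = subst₂ _≼_ (sym (there' p<q)) (sym here') (h o≤p p<q)

      low' : ∀ {v} → (∀ {p} → o ≤ p → p < z → G g p ≼ v) → value w ≼ v → ∀ {p} → o ≤ p → p < suc z → G g' p ≼ v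
      low' {v} h hw {p} o≤p p<sz with m≤n⇒m<n∨m≡n (s≤s⁻¹ p<sz)
      ... | inj₁ p<z  = subst (_≼ v) (sym (there' p<z)) (h o≤p p<z)
      ... | inj₂ refl = subst (_≼ v) (sym here') hw

      counts' : ∀ (χ : Value → Bool) → count (λ p → χ (G g' p)) (suc z) ≡ count (λ p → χ (G g p)) z + bit (χ (value w))
      counts' χ = cong₂ _+_ (count-cong z (λ p p<z → cong χ (there' p<z))) (cong (λ v → bit (χ v)) here')

    move : ∀ (A B C D x : ℕ) → A + B ≡ C + D → A + x + B ≡ C + x + D
    move A B C D x = linear 5 (λ A B C D x → A ⊕ B ≐ C ⊕ D ⇒ ⊢ A ⊕ x ⊕ B ≐ C ⊕ x ⊕ D) A B C D x

    put-left : ∀ {o m u i j z g w} → Merging o m u i j z g → o ≤ z → z < len → o ≤ i → i < m → value w ≡ F i →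
      Ascending o m → (∀ {q} → j ≤ q → q < u → F i ≼ F q) → Merging o m u (suc i) j (suc z) (g [ dst + z ]≔ w)
    put-left {o} {m} {u} {i} {j} {z} {g} {w} f o≤z z<len o≤i i<m w≡ asc right = record
      { runs₀ = runs₀ ; source = source' ; earlier = earlier'
      ; counts = λ χ → trans (cong (_+ count (λ p → χ (F p)) m)
          (trans (counts' χ) (cong (λ v → count (λ p → χ (G g p)) z + bit (χ v)) w≡)))
          (move (count (λ p → χ (G g p)) z) (count (λ p → χ (F p)) m) (count (λ p → χ (F p)) i) (count (λ p → χ (F p)) j) (bit (χ (F i))) (counts χ))
      ; current = current' (λ o≤p p<z → subst (G g _ ≼_) (sym w≡) (lowˡ o≤p p<z ≤-refl i<m))
      ; lowˡ = λ {p} {q} o≤p p<sz i<q q<m → low' (λ o≤p' p'<z → lowˡ o≤p' p'<z (<⇒≤ i<q) q<m)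
          (subst (_≼ F q) (sym w≡) (asc o≤i i<q q<m)) o≤p p<sz
      ; lowʳ = λ {p} {q} o≤p p<sz j≤q q<u → low' (λ o≤p' p'<z → lowʳ o≤p' p'<z j≤q q<u)
          (subst (_≼ F q) (sym w≡) (right j≤q q<u)) o≤p p<sz
      }
      where
      open Merging f
      open Put f o≤z z<len w

    put-right : ∀ {o m u i j z g w} → Merging o m u i j z g → o ≤ z → z < len → m ≤ j → j < u → value w ≡ F j →
      Ascending m u → (∀ {q} → i ≤ q → q < m → F j ≼ F q) → Merging o m u i (suc j) (suc z) (g [ dst + z ]≔ w)
    put-right {o} {m} {u} {i} {j} {z} {g} {w} f o≤z z<len m≤j j<u w≡ asc left = record
      { runs₀ = runs₀ ; source = source' ; earlier = earlier'
      ; counts = λ χ → trans (cong (_+ count (λ p → χ (F p)) m)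
          (trans (counts' χ) (cong (λ v → count (λ p → χ (G g p)) z + bit (χ v)) w≡)))
          (trans (move (count (λ p → χ (G g p)) z) (count (λ p → χ (F p)) m) (count (λ p → χ (F p)) i) (count (λ p → χ (F p)) j) (bit (χ (F j))) (counts χ))
            (linear 3 (λ x y z → ⊢ x ⊕ y ⊕ z ≐ x ⊕ (z ⊕ y)) (count (λ p → χ (F p)) i) (bit (χ (F j))) (count (λ p → χ (F p)) j)))
      ; current = current' (λ o≤p p<z → subst (G g _ ≼_) (sym w≡) (lowʳ o≤p p<z ≤-refl j<u))
      ; lowˡ = λ {p} {q} o≤p p<sz i≤q q<m → low' (λ o≤p' p'<z → lowˡ o≤p' p'<z i≤q q<m)
          (subst (_≼ F q) (sym w≡) (left i≤q q<m)) o≤p p<sz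
      ; lowʳ = λ {p} {q} o≤p p<sz j<q q<u → low' (λ o≤p' p'<z → lowʳ o≤p' p'<z (<⇒≤ j<q) q<u)
          (subst (_≼ F q) (sym w≡) (asc m≤j j<q q<u)) o≤p p<sz
      }
      where
      open Merging f
      open Put f o≤z z<len w

    ascending : ∀ s → Sorted ρ (R + R) F → s < R + R → Ascending (s * ρ) (s * ρ + ρ)
    ascending s srt s<R {p} {q} b≤p p<q q< = subst₂ (λ x y → F x ≼ F y) (m+[n∸m]≡n b≤p) (m+[n∸m]≡n b≤q)
      (srt s (p ∸ s * ρ) (q ∸ s * ρ) s<R (∸-monoˡ-< p<q b≤p)
        (subst (q ∸ s * ρ <_) (m+n∸m≡n (s * ρ) ρ) (∸-monoˡ-< q< b≤q)))
      where
      b≤q = ≤-trans b≤p (<⇒≤ p<q)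

    ascendingˡ : ∀ s → Sorted ρ (R + R) F → s < R → Ascending (s * (ρ + ρ)) (s * (ρ + ρ) + ρ)
    ascendingˡ s srt s<R = subst (λ b → Ascending b (b + ρ)) (trans (*-distribʳ-+ ρ s s) (sym (*-distribˡ-+ s ρ ρ)))
      (ascending (s + s) srt (+-mono-< s<R s<R))

    ascendingʳ : ∀ s → Sorted ρ (R + R) F → s < R → Ascending (s * (ρ + ρ) + ρ) (s * (ρ + ρ) + ρ + ρ)
    ascendingʳ s srt s<R = subst (λ b → Ascending b (b + ρ))
      (trans (+-comm ρ ((s + s) * ρ)) (cong (_+ ρ) (trans (*-distribʳ-+ ρ s s) (sym (*-distribˡ-+ s ρ ρ)))))
      (ascending (suc (s + s)) srt (linear 2 (λ s R → s ⊏ R ⇒ ⊢ κ 1 ⊕ (s ⊕ s) ⊏ R ⊕ R) s R s<R))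

    begin-merging : ∀ {o m u g} → Done o g → Merging o m u o m o g
    begin-merging d = record
      { runs₀ = runs₀ ; source = source ; counts = λ χ → cong (_+ _) (counts χ) ; earlier = sorted
      ; current = λ o≤p p<q q<o → contradiction (<-trans p<q q<o) (≤⇒≯ o≤p)
      ; lowˡ = λ o≤p p<o _ _ → contradiction p<o (≤⇒≯ o≤p)
      ; lowʳ = λ o≤p p<o _ _ → contradiction p<o (≤⇒≯ o≤p) }
      where open Done d

    end-merging : ∀ {r g} → let o = r * (ρ + ρ) in
      Merging o (o + ρ) (o + ρ + ρ) (o + ρ) (o + ρ + ρ) (o + ρ + ρ) g → Done (o + ρ + ρ) g
    end-merging {r} {g} f = record
      { runs₀ = runs₀ ; source = source
      ; counts = λ χ → +-cancelʳ-≡ (count (λ p → χ (F p)) (o + ρ)) _ _ (trans (counts χ) (+-comm (count (λ p → χ (F p)) (o + ρ)) _))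
      ; sorted = srt }
      where
      open Merging f
      o = r * (ρ + ρ)
      srt : ∀ r' p q → p < q → q < ρ + ρ → r' * (ρ + ρ) + q < o + ρ + ρ → G g (r' * (ρ + ρ) + p) ≼ G g (r' * (ρ + ρ) + q)
      srt r' p q p<q q< lt with r' <? r
      ... | yes r'<r = earlier r' p q p<q q<
              (<-≤-trans (+-monoʳ-< (r' * (ρ + ρ)) q<) (≤-trans (≤-reflexive (+-comm (r' * (ρ + ρ)) (ρ + ρ))) (*-monoˡ-≤ (ρ + ρ) r'<r)))
      ... | no r'≮r = current (≤-trans (*-monoˡ-≤ (ρ + ρ) (≮⇒≥ r'≮r)) (m≤m+n _ p)) (+-monoʳ-< (r' * (ρ + ρ)) p<q) lt

    record Regs (o m u i j z : ℕ) (f : ℕ → ℕ) : Set where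
      field
        r0 : f 0 ≡ src
        r1 : f 1 ≡ dst
        r2 : f 2 ≡ o
        r3 : f 3 ≡ i
        r4 : f 4 ≡ j
        r5 : f 5 ≡ z
        r6 : f 6 ≡ m
        r7 : f 7 ≡ u
        r8 : f 8 ≡ ρ
        r9 : f 9 ≡ len

    Ctx : View → Set a
    Ctx σ = Keep 4 3 k B σ₀ σ

    record Inner (o m u i j : ℕ) (σ : View) : Set a where
      field
        z    : ℕ
        regs : Regs o m u i j z (nr σ 4)
        ctx  : Ctx σ
        z≡   : z + m ≡ i + j
        o≤i  : o ≤ i
        i≤m  : i ≤ m
        m≤j  : m ≤ j
        j≤u  : j ≤ u
        m≡   : m ≡ o + ρ
        u≡   : u ≡ o + ρ + ρ
        u≤   : u ≤ len
        o≡   : ∃[ s ] s < R × o ≡ s * (ρ + ρ)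
        data' : CF k e (Merging o m u i j z) σ

    inner-havoc : ∀ {o m u i j} → Stable (Inner o m u i j)
    inner-havoc I h = record
      { z = z ; regs = regs ; ctx = Keep-trans ctx (Keep-havoc h) ; z≡ = z≡ ; o≤i = o≤i ; i≤m = i≤m ; m≤j = m≤j ; j≤u = j≤u
      ; m≡ = m≡ ; u≡ = u≡ ; u≤ = u≤ ; o≡ = o≡ ; data' = cf-havoc h data' }
      where open Inner I

    Next : (o m u z : ℕ) → View → Set a
    Next o m u z σ = ∃[ i ] ∃[ j ] Σ[ I ∈ Inner o m u i j σ ] Inner.z I ≡ suc z

    next-havoc : ∀ {o m u z} → Stable (Next o m u z)
    next-havoc (i , j , I , eq) h = i , j , inner-havoc I h , eq

    dst+z<W : ∀ {z} → z < len → dst + z < W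
    dst+z<W {z} z<len = <-trans (+-monoʳ-< dst z<len) (≤-<-trans (m≤m+n (dst + len) 2) dst<W)

    src+z<W : ∀ {z} → z < len → src + z < W
    src+z<W {z} z<len = <-trans (+-monoʳ-< src z<len) (≤-<-trans (m≤m+n (src + len) 2) src<W)

    z+1<W : ∀ {z} → z < len → 1 + (z + 1) < W
    z+1<W {z} z<len = linear 4 (λ z l ρ W → z ⊏ l ⇒ l ⊕ (ρ ⊕ ρ) ⊕ κ 2 ⊏ W ⇒ ⊢ κ 1 ⊕ (z ⊕ κ 1) ⊏ W) z len ρ W z<len len<W

    take-time : ∀ t → t + 4 + 4 + 4 ≤ t + 12
    take-time = linear 1 (λ t → ⊢ t ⊕ κ 4 ⊕ κ 4 ⊕ κ 4 ⊑ t ⊕ κ 12)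

    wp-takeˡ : ∀ {o m u i j σ t} (I : Inner o m u i j σ) → Inner.z I < u → i < m →
      CF k e (λ g → Merging o m u i j (Inner.z I) g × value (wr σ 3 0) ≡ F i × (∀ {q} → j ≤ q → q < u → F i ≼ F q)) σ →
      WP (takeˡ k) (Post (t + 12) (Next o m u (Inner.z I))) t σ
    wp-takeˡ {o} {m} {u} {i} {j} {σ} {t} I z<u i<m ld =
      wp-seq (wp-store (subst₂ (λ x y → x + y < W) (sym r1) (sym r5) (dst+z<W z<len))
        (subst₂ (λ x y → Valid k (x + y)) (sym r1) (sym r5) (validᵈ _ z<len)) λ m₁ o₁ h₁ →
      wp-seq (wp-set (subst (λ x → 1 + (x + 1) < W) (sym r3) (z+1<W (<-≤-trans i<m (≤-trans (≤-trans m≤j j≤u) u≤)))) λ m₂ o₂ h₂ →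
      wp-set (subst (λ x → 1 + (x + 1) < W) (sym r5) (z+1<W z<len)) λ m₃ o₃ h₃ →
      take-time t , suc i , j , record
        { z = suc z
        ; regs = record { r0 = r0 ; r1 = r1 ; r2 = r2 ; r3 = trans (+-comm _ 1) (cong suc r3) ; r4 = r4
                        ; r5 = trans (+-comm _ 1) (cong suc r5) ; r6 = r6 ; r7 = r7 ; r8 = r8 ; r9 = r9 }
        ; ctx = Keep-trans ctx (Keep-trans (Keep-havoc h₁) (Keep-trans
            (Keep-cell {p = nr σ 4 1 + nr σ 4 5} {wr σ 3 0} (λ eq → subst₂ (λ x y → B ≤ x + y) (sym r1) (sym r5) (≤-trans (outside eq) (m≤m+n dst z))))
            (Keep-trans (Keep-havoc h₂) (Keep-trans (Keep-setN {b = 4} {3} {nr σ 4 3 + 1}) (Keep-trans (Keep-havoc h₃) (Keep-setN {b = 4} {5} {nr σ 4 5 + 1}))))))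
        ; z≡ = cong suc z≡ ; o≤i = m≤n⇒m≤1+n o≤i ; i≤m = i<m ; m≤j = m≤j ; j≤u = j≤u ; m≡ = m≡ ; u≡ = u≡ ; u≤ = u≤ ; o≡ = o≡
        ; data' = cf-havoc h₃ (cf-havoc h₂ (cf-store (nr σ 4 1 + nr σ 4 5) (wr σ 3 0)
            (λ g (f , w≡ , right) → subst₂ (λ x y → Merging o m u (suc i) j (suc z) (g [ x + y ]≔ wr σ 3 0)) (sym r1) (sym r5)
              (put-left f o≤z z<len o≤i i<m w≡
                (subst₂ Ascending (sym (proj₂ (proj₂ o≡))) (sym (trans m≡ (cong (_+ ρ) (proj₂ (proj₂ o≡)))))
                  (ascendingˡ (proj₁ o≡) (Merging.runs₀ f) (proj₁ (proj₂ o≡)))) right)) (cf-havoc h₁ ld)))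
        } , refl))
      where
      open Inner I
      open Regs regs
      z<len = <-≤-trans z<u u≤
      o≤z : o ≤ z
      o≤z = linear 5 (λ o m i j z → o ⊑ i ⇒ m ⊑ j ⇒ z ⊕ m ≐ i ⊕ j ⇒ ⊢ o ⊑ z) o m i j z o≤i m≤j z≡

    wp-takeʳ : ∀ {o m u i j σ t} (I : Inner o m u i j σ) → Inner.z I < u → j < u →
      CF k e (λ g → Merging o m u i j (Inner.z I) g × value (wr σ 3 1) ≡ F j × (∀ {q} → i ≤ q → q < m → F j ≼ F q)) σ →
      WP (takeʳ k) (Post (t + 12) (Next o m u (Inner.z I))) t σ
    wp-takeʳ {o} {m} {u} {i} {j} {σ} {t} I z<u j<u ld =
      wp-seq (wp-store (subst₂ (λ x y → x + y < W) (sym r1) (sym r5) (dst+z<W z<len))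
        (subst₂ (λ x y → Valid k (x + y)) (sym r1) (sym r5) (validᵈ _ z<len)) λ m₁ o₁ h₁ →
      wp-seq (wp-set (subst (λ x → 1 + (x + 1) < W) (sym r4) (z+1<W (<-≤-trans j<u u≤))) λ m₂ o₂ h₂ →
      wp-set (subst (λ x → 1 + (x + 1) < W) (sym r5) (z+1<W z<len)) λ m₃ o₃ h₃ →
      take-time t , i , suc j , record
        { z = suc z
        ; regs = record { r0 = r0 ; r1 = r1 ; r2 = r2 ; r3 = r3 ; r4 = trans (+-comm _ 1) (cong suc r4)
                        ; r5 = trans (+-comm _ 1) (cong suc r5) ; r6 = r6 ; r7 = r7 ; r8 = r8 ; r9 = r9 }
        ; ctx = Keep-trans ctx (Keep-trans (Keep-havoc h₁) (Keep-trans
            (Keep-cell {p = nr σ 4 1 + nr σ 4 5} {wr σ 3 1} (λ eq → subst₂ (λ x y → B ≤ x + y) (sym r1) (sym r5) (≤-trans (outside eq) (m≤m+n dst z))))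
            (Keep-trans (Keep-havoc h₂) (Keep-trans (Keep-setN {b = 4} {4} {nr σ 4 4 + 1}) (Keep-trans (Keep-havoc h₃) (Keep-setN {b = 4} {5} {nr σ 4 5 + 1}))))))
        ; z≡ = trans (cong suc z≡) (sym (+-suc i j)) ; o≤i = o≤i ; i≤m = i≤m ; m≤j = m≤n⇒m≤1+n m≤j ; j≤u = j<u ; m≡ = m≡ ; u≡ = u≡ ; u≤ = u≤ ; o≡ = o≡
        ; data' = cf-havoc h₃ (cf-havoc h₂ (cf-store (nr σ 4 1 + nr σ 4 5) (wr σ 3 1)
            (λ g (f , w≡ , left) → subst₂ (λ x y → Merging o m u i (suc j) (suc z) (g [ x + y ]≔ wr σ 3 1)) (sym r1) (sym r5)
              (put-right f o≤z z<len m≤j j<u w≡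
                (subst₂ Ascending (sym (trans m≡ (cong (_+ ρ) (proj₂ (proj₂ o≡))))) (sym (trans u≡ (cong (λ x → x + ρ + ρ) (proj₂ (proj₂ o≡)))))
                  (ascendingʳ (proj₁ o≡) (Merging.runs₀ f) (proj₁ (proj₂ o≡)))) left)) (cf-havoc h₁ ld)))
        } , refl))
      where
      open Inner I
      open Regs regs
      z<len = <-≤-trans z<u u≤
      o≤z : o ≤ z
      o≤z = linear 5 (λ o m i j z → o ⊑ i ⇒ m ⊑ j ⇒ z ⊕ m ≐ i ⊕ j ⇒ ⊢ o ⊑ z) o m i j z o≤i m≤j z≡

    inner-setW : ∀ {o m u i j σ b c w} {b<4 : T (b <ᵇ 4)} {c<8 : T (c <ᵇ 8)} → {T (3 ≤ᵇ b)} →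
      Inner o m u i j σ → Inner o m u i j (setW (wrd b c {b<4} {c<8}) w σ)
    inner-setW {b = b} {c} {w} {b<4} {c<8} {h} I = record
      { z = z ; regs = regs ; ctx = Keep-trans ctx (Keep-setW {b = b} {c} {w} {_} {b<4} {c<8} {h}) ; z≡ = z≡ ; o≤i = o≤i ; i≤m = i≤m ; m≤j = m≤j ; j≤u = j≤u
      ; m≡ = m≡ ; u≡ = u≡ ; u≤ = u≤ ; o≡ = o≡ ; data' = data' }
      where open Inner I

    0<W : 0 < W
    0<W = ≤-<-trans z≤n len<W

    wp-choose : ∀ {o m u i j σ t} (I : Inner o m u i j σ) → Inner.z I < u → i < m → j < u →
      CF k e (λ g → Merging o m u i j (Inner.z I) g × value (wr σ 3 0) ≡ F i × value (wr σ 3 1) ≡ F j) σ →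
      WP (ite (wrd 3 1 <ʷ wrd 3 0) (takeʳ k) (takeˡ k)) (Post (t + 1 + 12 + 1) (Next o m u (Inner.z I))) t σ
    wp-choose {o} {m} {u} {i} {j} {σ} I z<u i<m j<u ld = wp-ite-post next-havoc 0<W λ m₁ o₁ h₁ →
      (λ lt → wp-takeʳ (inner-havoc I h₁) z<u j<u (cf-havoc h₁ (cf-map (λ g (f , x , y) → f , y , λ {q} i≤q q<m →
          let j≼i = subst₂ _≼_ y x (less⇒≼ (value (wr σ 3 1)) (value (wr σ 3 0)) lt) in
          below' j≼i (subst₂ Ascending (sym (proj₂ (proj₂ o≡))) (sym (trans m≡ (cong (_+ ρ) (proj₂ (proj₂ o≡)))))
            (ascendingˡ (proj₁ o≡) (Merging.runs₀ f) (proj₁ (proj₂ o≡))) o≤i) i≤q q<m) ld))) ,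
      (λ ge → wp-takeˡ (inner-havoc I h₁) z<u i<m (cf-havoc h₁ (cf-map (λ g (f , x , y) → f , x , λ {q} j≤q q<u →
          below' (subst₂ _≼_ x y (le ge)) (subst₂ Ascending (sym (trans m≡ (cong (_+ ρ) (proj₂ (proj₂ o≡))))) (sym (trans u≡ (cong (λ x → x + ρ + ρ) (proj₂ (proj₂ o≡)))))
            (ascendingʳ (proj₁ o≡) (Merging.runs₀ f) (proj₁ (proj₂ o≡))) m≤j) j≤q q<u) ld)))
      where
      open Inner I
      below' : ∀ {v c d} → v ≼ F c → (∀ {q} → c < q → q < d → F c ≼ F q) → ∀ {q} → c ≤ q → q < d → v ≼ F q
      below' v≼ asc {q} c≤q q<d with m≤n⇒m<n∨m≡n c≤q
      ... | inj₁ c<q  = ≼-trans v≼ (asc c<q q<d)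
      ... | inj₂ refl = v≼

    wp-step : ∀ {o m u i j σ t} (I : Inner o m u i j σ) → Inner.z I < u →
      WP (mergeStep k) (Post (t + 40) (Next o m u (Inner.z I))) t σ
    wp-step {o} {m} {u} {i} {j} {σ} {t} I z<u =
      relax (linear 1 (λ t → ⊢ t ⊕ κ 37 ⊕ κ 1 ⊑ t ⊕ κ 40) t) (wp-ite-post next-havoc 0<W λ m₁ o₁ h₁ →
      (λ lt → let i<m = subst₂ _<_ r3 r6 (<ᵇ-true _ _ lt) in
        wp-seq (wp-load (subst₂ (λ x y → x + y < W) (sym r0) (sym r3) (src+z<W (i<len i<m)))
          (subst₂ (λ x y → Valid k (x + y)) (sym r0) (sym r3) (validˢ _ (i<len i<m))) λ m₂ o₂ h₂ →
        relax (linear 1 (λ t → ⊢ t ⊕ κ 30 ⊕ κ 1 ⊑ t ⊕ κ 37) t) (wp-ite-post next-havoc 0<W λ m₃ o₃ h₃ →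
          (λ lt' → let j<u = subst₂ _<_ r4 r7 (<ᵇ-true _ _ lt') in
            wp-seq (wp-load (subst₂ (λ x y → x + y < W) (sym r0) (sym r4) (src+z<W (<-≤-trans j<u u≤)))
              (subst₂ (λ x y → Valid k (x + y)) (sym r0) (sym r4) (validˢ _ (<-≤-trans j<u u≤))) λ m₄ o₄ h₄ →
            relax (linear 1 (λ t → ⊢ t ⊕ κ 3 ⊕ κ 4 ⊕ κ 3 ⊕ κ 4 ⊕ κ 1 ⊕ κ 12 ⊕ κ 1 ⊑ t ⊕ κ 30) t)
              (wp-choose (inner-setW {b = 3} {1} (inner-havoc (inner-havoc (inner-setW {b = 3} {0} (inner-havoc (inner-havoc I h₁) h₂)) h₃) h₄)) z<u i<m j<u
                (cf-map (λ g ((f , x) , y) → f , x , trans (trans (cong value y) (cong₂ (λ a b → value (g (a + b))) r0 r4)) (cong value (Merging.source f (<-≤-trans j<u u≤))))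
                  (cf-read (nr σ 4 0 + nr σ 4 4) (cf-havoc h₄ (cf-havoc h₃ (loadedˡ h₁ h₂ i<m)))))))) ,
          (λ ge → relax (linear 1 (λ t → ⊢ t ⊕ κ 3 ⊕ κ 4 ⊕ κ 3 ⊕ κ 12 ⊑ t ⊕ κ 30) t)
            (wp-takeˡ (inner-havoc (inner-setW {b = 3} {0} (inner-havoc (inner-havoc I h₁) h₂)) h₃) z<u i<m
              (cf-map (λ g (f , x) → f , x , λ j≤q q<u → contradiction (<-≤-trans (≤-<-trans j≤q q<u) (subst₂ _≤_ r7 r4 (<ᵇ-false _ _ ge))) (<-irrefl refl))
                (cf-havoc h₃ (loadedˡ h₁ h₂ i<m)))))))) ,
      (λ ge → let m≤i = subst₂ _≤_ r6 r3 (<ᵇ-false _ _ ge) ; j<u = j<u' m≤i in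
        wp-seq (wp-load (subst₂ (λ x y → x + y < W) (sym r0) (sym r4) (src+z<W (<-≤-trans j<u u≤)))
          (subst₂ (λ x y → Valid k (x + y)) (sym r0) (sym r4) (validˢ _ (<-≤-trans j<u u≤))) λ m₂ o₂ h₂ →
        relax (linear 1 (λ t → ⊢ t ⊕ κ 3 ⊕ κ 4 ⊕ κ 12 ⊑ t ⊕ κ 37) t)
          (wp-takeʳ (inner-setW {b = 3} {1} (inner-havoc (inner-havoc I h₁) h₂)) z<u j<u
            (cf-map (λ g (f , y) → f , trans (trans (cong value y) (cong₂ (λ a b → value (g (a + b))) r0 r4)) (cong value (Merging.source f (<-≤-trans j<u u≤)))
                , λ i≤q q<m → contradiction (<-≤-trans (≤-<-trans i≤q q<m) m≤i) (<-irrefl refl))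
              (cf-read (nr σ 4 0 + nr σ 4 4) (cf-havoc h₂ (cf-havoc h₁ data'))))))))
      where
      open Inner I
      open Regs regs
      i<len : i < m → i < len
      i<len i<m = <-≤-trans i<m (≤-trans (≤-trans m≤j j≤u) u≤)
      j<u' : m ≤ i → j < u
      j<u' m≤i = linear 5 (λ m i j z u → z ⊏ u ⇒ z ⊕ m ≐ i ⊕ j ⇒ m ⊑ i ⇒ ⊢ j ⊏ u) m i j z u z<u z≡ m≤i
      loadedˡ : ∀ {m₁ o₁ m₂ o₂} → Havoc σ m₁ o₁ → Havoc (havoc σ m₁ o₁) m₂ o₂ → i < m →
        Fact k e (λ g → Merging o m u i j z g × value (pick k (ar σ) m₂ (nr σ 4 0 + nr σ 4 3)) ≡ F i) (ar σ) m₂ o₂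
      loadedˡ h₁ h₂ i<m = cf-map (λ g (f , x) → f , trans (trans (cong value x) (cong₂ (λ a b → value (g (a + b))) r0 r3)) (cong value (Merging.source f (i<len i<m))))
        (cf-read (nr σ 4 0 + nr σ 4 3) (cf-havoc h₂ (cf-havoc h₁ data')))

    Merged : (o m u : ℕ) → View → Set a
    Merged o m u σ = Inner o m u m u σ

    wp-runs : ∀ {o m u σ t} (I : Inner o m u o m σ) →
      WP (while (r 4 5 <ₙ r 4 7) (mergeStep k)) (Post (t + (ρ + ρ) * 50 + 4) (Merged o m u)) t σ
    wp-runs {o} {m} {u} {σ} {t} I₀ = wp-while Inv
      (λ μ t' σ' (i , j , I , μ≡ , time) m₁ o₁ h → let open Inner I in let open Regs regs in 0<W ,
        (λ lt → let z<u = subst₂ _<_ r5 r7 (<ᵇ-true _ _ lt) in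
          mono (wp-step (inner-havoc I h) z<u) (λ t″ σ″ (t″≤ , i' , j' , I' , z≡) →
            pred μ , pred< μ z μ≡ z<u , i' , j' , I' , trans (cong (_+ pred μ) z≡) (suc-pred' μ z μ≡ z<u) ,
            budget μ z t' t″ μ≡ z<u time t″≤)) ,
        (λ ge → let u≤z = subst₂ _≤_ r7 r5 (<ᵇ-false _ _ ge) in
          linear 4 (λ t μ T x → t ⊕ x ⊑ T ⇒ ⊢ t ⊕ κ 4 ⊑ T ⊕ κ 4) t' μ (t + (ρ + ρ) * 50) (μ * 50) time ,
          subst₂ (λ i j → Inner o m u i j (havoc σ' m₁ o₁))
            (linear 5 (λ i j z m u → u ⊑ z ⇒ z ⊕ m ≐ i ⊕ j ⇒ i ⊑ m ⇒ j ⊑ u ⇒ ⊢ i ≐ m) i j z m u u≤z z≡ i≤m j≤u)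
            (linear 5 (λ i j z m u → u ⊑ z ⇒ z ⊕ m ≐ i ⊕ j ⇒ i ⊑ m ⇒ j ⊑ u ⇒ ⊢ j ≐ u) i j z m u u≤z z≡ i≤m j≤u)
            (inner-havoc I h)))
      {ρ + ρ} (o , m , I₀ , init , ≤-refl)
      where
      Inv : ℕ → ℕ → View → Set a
      Inv μ t' σ' = ∃[ i ] ∃[ j ] Σ[ I ∈ Inner o m u i j σ' ] Inner.z I + μ ≡ u × t' + μ * 50 ≤ t + (ρ + ρ) * 50
      init : Inner.z I₀ + (ρ + ρ) ≡ u
      init = linear 5 (λ z o m u ρ → z ⊕ m ≐ o ⊕ m ⇒ u ≐ o ⊕ ρ ⊕ ρ ⇒ ⊢ z ⊕ (ρ ⊕ ρ) ≐ u) (Inner.z I₀) o m u ρ (Inner.z≡ I₀) (Inner.u≡ I₀)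
      pred< : ∀ μ z → z + μ ≡ u → z < u → pred μ < μ
      pred< zero    z eq z<u = contradiction (trans (sym (+-identityʳ z)) eq) (<⇒≢ z<u)
      pred< (suc μ) z eq z<u = ≤-refl
      suc-pred' : ∀ μ z → z + μ ≡ u → z < u → suc z + pred μ ≡ u
      suc-pred' zero    z eq z<u = contradiction (trans (sym (+-identityʳ z)) eq) (<⇒≢ z<u)
      suc-pred' (suc μ) z eq z<u = trans (sym (+-suc z μ)) eq
      budget : ∀ μ z t' t″ → z + μ ≡ u → z < u → t' + μ * 50 ≤ t + (ρ + ρ) * 50 → t″ ≤ t' + 3 + 40 →
        t″ + 1 + pred μ * 50 ≤ t + (ρ + ρ) * 50
      budget zero    z t' t″ eq z<u _ _ = contradiction (trans (sym (+-identityʳ z)) eq) (<⇒≢ z<u)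
      budget (suc μ) z t' t″ eq z<u = linear 4 (λ μ t' t″ T → t' ⊕ (κ 1 ⊕ μ) ⊗ 50 ⊑ T ⇒ t″ ⊑ t' ⊕ κ 3 ⊕ κ 40 ⇒
        ⊢ t″ ⊕ κ 1 ⊕ μ ⊗ 50 ⊑ T) μ t' t″ (t + (ρ + ρ) * 50)

    record Outer (s : ℕ) (σ : View) : Set a where
      field
        r0 : nr σ 4 0 ≡ src
        r1 : nr σ 4 1 ≡ dst
        r2 : nr σ 4 2 ≡ s * (ρ + ρ)
        r8 : nr σ 4 8 ≡ ρ
        r9 : nr σ 4 9 ≡ len
        ctx : Ctx σ
        s≤R : s ≤ R
        data' : CF k e (Done (s * (ρ + ρ))) σ

    outer-havoc : ∀ {s} → Stable (Outer s)
    outer-havoc I h = record { r0 = r0 ; r1 = r1 ; r2 = r2 ; r8 = r8 ; r9 = r9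
      ; ctx = Keep-trans ctx (Keep-havoc h) ; s≤R = s≤R ; data' = cf-havoc h data' }
      where open Outer I

    cost : ℕ
    cost = (ρ + ρ) * 50 + 60

    wp-pair : ∀ {s σ t} → Outer s σ → s < R →
      WP (num 4 3 ≔ r 4 2 ⨾ num 4 6 ≔ r 4 2 ∔ r 4 8 ⨾ num 4 4 ≔ r 4 6 ⨾ num 4 7 ≔ r 4 6 ∔ r 4 8 ⨾ num 4 5 ≔ r 4 2 ⨾
          while (r 4 5 <ₙ r 4 7) (mergeStep k) ⨾ num 4 2 ≔ r 4 7)
        (Post (t + 14 + (ρ + ρ) * 50 + 4 + 2) (Outer (suc s))) t σ
    wp-pair {s} {σ} {t} I s<R =
      wp-seq (wp-set 0<W λ m₁ o₁ h₁ → wp-seq (wp-set (subst₂ (λ x y → x + y < W) (sym r2) (sym r8) m<W) λ m₂ o₂ h₂ →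
      wp-seq (wp-set 0<W λ m₃ o₃ h₃ → wp-seq (wp-set (subst₂ (λ x y → x + y + y < W) (sym r2) (sym r8) u<W) λ m₄ o₄ h₄ →
      wp-seq (wp-set 0<W λ m₅ o₅ h₅ → wp-seq (mono (wp-runs (record
        { z = o ; regs = record { r0 = r0 ; r1 = r1 ; r2 = r2 ; r3 = r2 ; r4 = cong₂ _+_ r2 r8 ; r5 = r2 ; r6 = cong₂ _+_ r2 r8
            ; r7 = cong₂ _+_ (cong₂ _+_ r2 r8) r8 ; r8 = r8 ; r9 = r9 }
        ; ctx = Keep-trans ctx (record { sameN = (((Level.lift tt , refl) , refl) , refl) , refl
            ; sameW = ((Level.lift tt , refl) , refl) , refl ; sameA = λ _ → refl
            ; frame = Fr-trans (Fr-havoc (proj₁ h₁)) (Fr-trans (Fr-havoc (proj₁ h₂)) (Fr-trans (Fr-havoc (proj₁ h₃)) (Fr-trans (Fr-havoc (proj₁ h₄)) (Fr-havoc (proj₁ h₅))))) })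
        ; z≡ = refl ; o≤i = ≤-refl ; i≤m = m≤m+n o ρ ; m≤j = ≤-refl ; j≤u = m≤m+n (o + ρ) ρ ; m≡ = refl ; u≡ = refl
        ; u≤ = u≤ ; o≡ = s , s<R , refl
        ; data' = cf-havoc h₅ (cf-havoc h₄ (cf-havoc h₃ (cf-havoc h₂ (cf-havoc h₁ (cf-map (λ g → begin-merging) data')))))
        })) (λ t' σ' (t'≤ , I') → wp-set 0<W λ m₆ o₆ h₆ → let module J = Inner (inner-havoc I' h₆) in let module Q = Regs J.regs in
          ≤-trans (+-monoˡ-≤ 2 t'≤) (≤-reflexive (linear 2 (λ t x → ⊢ t ⊕ κ 2 ⊕ κ 4 ⊕ κ 2 ⊕ κ 4 ⊕ κ 2 ⊕ x ⊕ κ 4 ⊕ κ 2 ≐ t ⊕ κ 14 ⊕ x ⊕ κ 4 ⊕ κ 2) t ((ρ + ρ) * 50))) ,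
          record { r0 = Q.r0 ; r1 = Q.r1 ; r2 = trans Q.r7 o≡ ; r8 = Q.r8 ; r9 = Q.r9
            ; ctx = Keep-trans J.ctx (Keep-setN {b = 4} {2} {nr σ' 4 7}) ; s≤R = s<R
            ; data' = cf-map (λ g f → subst (λ x → Done x g) o≡ (end-merging {s} (subst (λ z → Merging o (o + ρ) (o + ρ + ρ) (o + ρ) (o + ρ + ρ) z g)
                (linear 4 (λ z m u x → z ⊕ m ≐ m ⊕ u ⇒ ⊢ z ≐ u) J.z (o + ρ) (o + ρ + ρ) 0 J.z≡) f))) J.data' })))))))
      where
      open Outer I
      o = s * (ρ + ρ)
      o≡ : o + ρ + ρ ≡ suc s * (ρ + ρ)
      o≡ = trans (+-assoc o ρ ρ) (+-comm o (ρ + ρ))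
      u≤ : o + ρ + ρ ≤ len
      u≤ = ≤-trans (≤-reflexive o≡) (*-monoˡ-≤ (ρ + ρ) s<R)
      u<W : o + ρ + ρ < W
      u<W = ≤-<-trans u≤ (≤-<-trans (m≤m+n len (ρ + ρ + 2)) (subst (_< W) (+-assoc len (ρ + ρ) 2) len<W))
      m<W : o + ρ < W
      m<W = ≤-<-trans (m≤m+n (o + ρ) ρ) u<W

    PassInv : ℕ → ℕ → ℕ → View → Set a
    PassInv t μ t' σ' = ∃[ s ] Outer s σ' × s + μ ≡ R × t' + μ * cost ≤ t + 2 + R * cost
    opaque
      pass-step : ∀ t μ s t' t″ σ″ → s + μ ≡ R → s < R → t' + μ * cost ≤ t + 2 + R * cost →
        t″ ≤ t' + 3 + 14 + (ρ + ρ) * 50 + 4 + 2 → Outer (suc s) σ″ → ∃[ μ' ] μ' < μ × PassInv t μ' (t″ + 1) σ″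
      pass-step t zero s t' t″ σ″ eq s<R = contradiction (trans (sym (+-identityʳ s)) eq) (<⇒≢ s<R)
      pass-step t (suc μ) s t' t″ σ″ eq s<R time t″≤ I' = μ , ≤-refl , suc s , I' , trans (sym (+-suc s μ)) eq ,
        linear 5 (λ x y t' t″ T → t' ⊕ ((x ⊕ κ 60) ⊕ y) ⊑ T ⇒ t″ ⊑ t' ⊕ κ 3 ⊕ κ 14 ⊕ x ⊕ κ 4 ⊕ κ 2 ⇒ ⊢ t″ ⊕ κ 1 ⊕ y ⊑ T)
          ((ρ + ρ) * 50) (μ * cost) t' t″ (t + 2 + R * cost) time t″≤
      pass-total : ∀ t → t + 2 + R * cost + 4 ≤ t + len * 90 + 10
      pass-total t = sum-up t (R * ((ρ + ρ) * 50)) len R (R * cost) (*-distribˡ-+ R ((ρ + ρ) * 50) 60) (sym (*-assoc R (ρ + ρ) 50)) R+R≤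
        where
        sum-up : ∀ t x l R c → c ≡ x + R * 60 → x ≡ l * 50 → R + R ≤ l → t + 2 + c + 4 ≤ t + l * 90 + 10
        sum-up = linear 5 (λ t x l R c → c ≐ x ⊕ R ⊗ 60 ⇒ x ≐ l ⊗ 50 ⇒ R ⊕ R ⊑ l ⇒ ⊢ t ⊕ κ 2 ⊕ c ⊕ κ 4 ⊑ t ⊕ l ⊗ 90 ⊕ κ 10)
        R≤ : R ≤ R * ρ
        R≤ = subst (_≤ R * ρ) (*-identityʳ R) (*-monoʳ-≤ R 0<ρ)
        R+R≤ : R + R ≤ len
        R+R≤ = ≤-trans (+-mono-≤ R≤ R≤) (≤-reflexive (sym (*-distribˡ-+ R ρ ρ)))

      pass-exit : ∀ t t' x → t' + x ≤ t + 2 + R * cost → t' + 4 ≤ t + len * 90 + 10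
      pass-exit t t' x h = ≤-trans (+-monoˡ-≤ 4 (≤-trans (m≤m+n t' x) h)) (pass-total t)

    opaque
      wp-mergePass : ∀ {t} → nr σ₀ 4 0 ≡ src → nr σ₀ 4 1 ≡ dst → nr σ₀ 4 8 ≡ ρ → nr σ₀ 4 9 ≡ len →
        WP (mergePass k) (Post (t + len * 90 + 10) (λ σ → Ctx σ × CF k e (Done len) σ)) t σ₀
      wp-mergePass {t} e0 e1 e8 e9 =
        wp-seq (wp-set 0<W λ m₁ o₁ h₁ → wp-while (PassInv t)
          (λ μ t' σ' (s , I , μ≡ , time) m₂ o₂ h → let open Outer I in 0<W ,
            (λ lt → let s<R = *-cancelʳ-< (ρ + ρ) s R (subst₂ _<_ r2 r9 (<ᵇ-true _ _ lt)) in
              mono (wp-pair (outer-havoc I h) s<R) (λ t″ σ″ (t″≤ , I') →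
                pass-step t μ s t' t″ σ″ μ≡ s<R time t″≤ I')) ,
            (λ ge → let R≤s = *-cancelʳ-≤ R s (ρ + ρ) {{>-nonZero (<-≤-trans 0<ρ (m≤m+n ρ ρ))}} (subst₂ _≤_ r9 r2 (<ᵇ-false _ _ ge)) in
              pass-exit t t' (μ * cost) time ,
              Keep-trans ctx (Keep-havoc h) ,
              cf-havoc h (subst (λ s → CF k e (Done (s * (ρ + ρ))) σ') (≤-antisym s≤R R≤s) data')))
          {R} (0 , record { r0 = e0 ; r1 = e1 ; r2 = refl ; r8 = e8 ; r9 = e9
                          ; ctx = Keep-trans (Keep-havoc h₁) (Keep-setN {b = 4} {2} {0}) ; s≤R = z≤n
                          ; data' = cf-havoc h₁ (cf e≤ λ calm → record { runs₀ = sorted₀ calm ; source = λ _ → refl ; counts = λ χ → refl ; sorted = λ r p q _ _ () }) }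
              , refl , ≤-refl))

  calm-back : ∀ {L L' k B e σ σ'} → Keep L L' k B σ σ' → e ≤ length (ow σ) → Calm k e (ow σ') → Calm k e (ow σ)
  calm-back kp e≤ (inj₁ eq) = inj₁ eq
  calm-back kp e≤ (inj₂ eq) = inj₂ (≤-antisym (≤-trans (Fr-length (frame kp)) (≤-reflexive eq)) e≤)

  -- The R sorted runs of length ρ at base are a sample of f₀: each element stands for w
  -- elements of f₀, and ranks are off by at most E.
  record Sample (f₀ : ℕ → Value) (N base ρ R w E L : ℕ) (g : ℕ → Word) : Set a where
    field
      runs : Sorted ρ R (λ p → value (g (base + p)))
      lo   : ∀ {χ} → Down χ → count (λ p → χ (value (g (base + p)))) L * w ≤ count (λ p → χ (f₀ p)) N
      hi   : ∀ {χ} → Down χ → count (λ p → χ (f₀ p)) N ≤ count (λ p → χ (value (g (base + p)))) L * w + E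

  sample-merged : ∀ {f₀ N k B src dst ρ R 0<ρ src<W dst<W len<W v₁ v₂ ap out e σ e≤ srt w E g} →
    let open Pass k B src dst ρ R 0<ρ src<W dst<W len<W v₁ v₂ ap out e σ e≤ srt in
    Sample f₀ N src ρ (R + R) w E len (cells k σ) → Done len g → Sample f₀ N dst (ρ + ρ) R w E len g
  sample-merged {f₀} {N} {ρ = ρ} {R} {w = w} {E} smp done = record
    { runs = λ r p q r<R p<q q< → D.sorted r p q p<q q<
        (<-≤-trans (+-monoʳ-< (r * (ρ + ρ)) q<) (≤-trans (≤-reflexive (+-comm (r * (ρ + ρ)) (ρ + ρ))) (*-monoˡ-≤ (ρ + ρ) r<R)))
    ; lo = λ {χ} dn → subst (λ c → c * w ≤ count (λ p → χ (f₀ p)) N) (sym (D.counts χ)) (Sample.lo smp dn)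
    ; hi = λ {χ} dn → subst (λ c → count (λ p → χ (f₀ p)) N ≤ c * w + E) (sym (D.counts χ)) (Sample.hi smp dn) }
    where module D = Pass.Done done

  sample-thinned : ∀ {f₀ N base h R w E g g'} → Sample f₀ N base (h + h) R w E (R * (h + h)) g →
    (∀ p → p < R * h → g' (base + p) ≡ g (base + suc (p + p))) → Sample f₀ N base h R (w + w) (E + w * R) (R * h) g'
  sample-thinned {f₀} {N} {base} {h} {R} {w} {E} {g} {g'} smp half = record
    { runs = λ r p q r<R p<q q<h → subst₂ _≼_ (sym (at' r p r<R (<-trans p<q q<h))) (sym (at' r q r<R q<h))
        (Sample.runs smp r (suc (p + p)) (suc (q + q)) r<R
          (linear 2 (λ p q → p ⊏ q ⇒ ⊢ κ 1 ⊕ (p ⊕ p) ⊏ κ 1 ⊕ (q ⊕ q)) p q p<q)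
          (linear 2 (λ q h → q ⊏ h ⇒ ⊢ κ 1 ⊕ (q ⊕ q) ⊏ h ⊕ h) q h q<h))
    ; lo = λ {χ} dn → ≤-trans (subst₂ _≤_ (cong (_* (w + w)) (sym (same χ))) refl
        (≤-trans (≤-reflexive (double (c χ))) (*-monoˡ-≤ w (proj₁ (thinned χ dn))))) (Sample.lo smp dn)
    ; hi = λ {χ} dn → ≤-trans (Sample.hi smp dn) (≤-trans (+-monoˡ-≤ E (*-monoˡ-≤ w (proj₂ (thinned χ dn))))
        (≤-reflexive (trans (regroup (c χ)) (cong (λ x → x * (w + w) + (E + w * R)) (sym (same χ)))))) }
    where
    double-run : ∀ r p → r * h + p + (r * h + p) ≡ r * (h + h) + (p + p)
    double-run r p = trans (linear 2 (λ x p → ⊢ x ⊕ p ⊕ (x ⊕ p) ≐ x ⊕ x ⊕ (p ⊕ p)) (r * h) p) (cong (_+ (p + p)) (sym (*-distribˡ-+ r h h)))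
    inside : ∀ r p → r < R → p < h → r * h + p < R * h
    inside r p r<R p<h = <-≤-trans (+-monoʳ-< (r * h) p<h) (≤-trans (≤-reflexive (+-comm (r * h) h)) (*-monoˡ-≤ h r<R))
    at' : ∀ r p → r < R → p < h → value (g' (base + (r * h + p))) ≡ value (g (base + (r * (h + h) + suc (p + p))))
    at' r p r<R p<h = cong value (trans (half _ (inside r p r<R p<h))
      (cong (λ x → g (base + x)) (trans (cong suc (double-run r p)) (sym (+-suc (r * (h + h)) (p + p))))))
    c : (Value → Bool) → ℕ
    c χ = count (λ p → χ (value (g (base + suc (p + p))))) (R * h)
    same : ∀ χ → count (λ p → χ (value (g' (base + p)))) (R * h) ≡ c χ
    same χ = count-cong (R * h) (λ p p< → cong (λ x → χ (value x)) (half p p<))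
    thinned : ∀ χ → Down χ → _
    thinned χ dn = thin-runs (λ p → χ (value (g (base + p)))) h R
      (λ r p q r<R p<q q< e → dn (Sample.runs smp r p q r<R p<q q<) e)
    double : ∀ x → x * (w + w) ≡ x * 2 * w
    double x = trans (*-distribˡ-+ x w w) (trans (linear 1 (λ y → ⊢ y ⊕ y ≐ y ⊗ 2) (x * w))
      (trans (*-assoc x w 2) (trans (cong (x *_) (*-comm w 2)) (sym (*-assoc x 2 w)))))
    regroup : ∀ x → (x * 2 + R) * w + E ≡ x * (w + w) + (E + w * R)
    regroup x = trans (cong (_+ E) (trans (*-distribʳ-+ w (x * 2) R) (cong₂ _+_ (sym (double x)) (*-comm R w))))
      (linear 3 (λ a b E → ⊢ a ⊕ b ⊕ E ≐ a ⊕ (E ⊕ b)) (x * (w + w)) (w * R) E)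

  geq : Value → Value → Bool
  geq v x = not (less x v)

  Central : ℕ → (ℕ → Value) → ℕ → Value → Set
  Central c f N v = N ≤ count (λ p → atMost v (f p)) N * c × N ≤ count (λ p → geq v (f p)) N * c

  sample-central : ∀ {f₀ base ρ E g} → 0 < ρ → E + E ≤ ρ * ρ → Sample f₀ (ρ * ρ) base ρ 1 ρ E ρ g →
    Central 4 f₀ (ρ * ρ) (value (g (base + ρ / 4)))
  sample-central {f₀} {base} {ρ} {E} {g} 0<ρ 2E≤ smp = lower , upper
    where
    c = ρ / 4
    G : ℕ → Value
    G p = value (g (base + p))
    v = G c
    c<ρ : c < ρ
    c<ρ = m/n<m ρ 4 {{>-nonZero 0<ρ}} (≤ᵇ⇒≤ 2 4 tt)
    c4≤ : c * 4 ≤ ρ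
    c4≤ = m/n*n≤m ρ 4
    ρ≤ : ρ ≤ (c + 1) * 4
    ρ≤ = linear 3 (λ ρ m c → ρ ≐ m ⊕ c ⊗ 4 ⇒ m ⊏ κ 4 ⇒ ⊢ ρ ⊑ (c ⊕ κ 1) ⊗ 4) ρ (ρ % 4) c (m≡m%n+[m/n]*n ρ 4) (m%n<n ρ 4)
    sorted : ∀ {p q} → p < q → q < ρ → G p ≼ G q
    sorted p<q q<ρ = Sample.runs smp 0 _ _ ≤-refl p<q q<ρ
    many : c + 1 ≤ count (λ p → atMost v (G p)) ρ
    many = subst (_≤ count (λ p → atMost v (G p)) ρ) (trans (count-all (suc c) low) (+-comm 1 c)) (count-extend _ c<ρ)
      where
      low : ∀ p → p < suc c → atMost v (G p) ≡ true
      low p p≤c with m≤n⇒m<n∨m≡n (s≤s⁻¹ p≤c)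
      ... | inj₁ p<c  = not-false (not-less (sorted p<c c<ρ))
      ... | inj₂ refl = not-false (not-less (≼-refl (G p)))
    few : count (λ p → below v (G p)) ρ ≤ c
    few = subst (λ l → count (λ p → below v (G p)) l ≤ c) (m+[n∸m]≡n (<⇒≤ c<ρ))
      (≤-trans (≤-reflexive (trans (count-split _ c (ρ ∸ c)) (trans (cong (count (λ p → below v (G p)) c +_) (count-none (ρ ∸ c) high)) (+-identityʳ _))))
        (count≤ _ c))
      where
      high : ∀ p → p < ρ ∸ c → below v (G (c + p)) ≡ false
      high zero    _  = subst (λ x → below v (G x) ≡ false) (sym (+-identityʳ c)) (not-less (≼-refl v))
      high (suc p) p< = not-less (sorted {c} {c + suc p} (m<m+n c (s≤s z≤n))
        (subst (c + suc p <_) (m+[n∸m]≡n (<⇒≤ c<ρ)) (+-monoʳ-< c p<)))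
    below' = count (λ p → below v (f₀ p)) (ρ * ρ)
    lower : ρ * ρ ≤ count (λ p → atMost v (f₀ p)) (ρ * ρ) * 4
    lower = ≤-trans (*-monoʳ-≤ ρ ρ≤) (≤-trans (≤-reflexive (trans (*-comm ρ ((c + 1) * 4)) (trans (*-assoc (c + 1) 4 ρ)
        (trans (cong ((c + 1) *_) (*-comm 4 ρ)) (sym (*-assoc (c + 1) ρ 4))))))
      (*-monoˡ-≤ 4 (≤-trans (*-monoˡ-≤ ρ many) (Sample.lo smp (atMost-down v)))))
    few' : below' ≤ c * ρ + E
    few' = ≤-trans (Sample.hi smp (below-down v)) (+-monoˡ-≤ E (*-monoˡ-≤ ρ few))
    cρ : c * ρ * 4 ≤ ρ * ρ
    cρ = ≤-trans (≤-reflexive (trans (*-assoc c ρ 4) (trans (cong (c *_) (*-comm ρ 4)) (sym (*-assoc c 4 ρ))))) (*-monoˡ-≤ ρ c4≤)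
    upper : ρ * ρ ≤ count (λ p → geq v (f₀ p)) (ρ * ρ) * 4
    upper = linear 5 (λ b a N cρ E → b ⊑ cρ ⊕ E ⇒ cρ ⊗ 4 ⊑ N ⇒ E ⊕ E ⊑ N ⇒ b ⊕ a ≐ N ⇒ ⊢ N ⊑ a ⊗ 4)
      below' (count (λ p → geq v (f₀ p)) (ρ * ρ)) (ρ * ρ) (c * ρ) E few' cρ 2E≤ (count-not (λ p → below v (f₀ p)) (ρ * ρ))

  opaque
    wp-mergeCall : ∀ {k B src dst ρ R w E f₀ N e σ t} i j l {p q s} → 0 < ρ →
      src + R * (ρ + ρ) + 2 < W → dst + R * (ρ + ρ) + 2 < W → R * (ρ + ρ) + (ρ + ρ) + 2 < W →
      (∀ p → p < R * (ρ + ρ) → Valid k (src + p)) → (∀ p → p < R * (ρ + ρ) → Valid k (dst + p)) →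
      (∀ p q → p < R * (ρ + ρ) → q < R * (ρ + ρ) → dst + q ≢ src + p) → (k ≡ faultyᵏ → B ≤ dst) →
      nr σ 3 i ≡ src → nr σ 3 j ≡ dst → nr σ 3 l ≡ ρ → nr σ 3 5 ≡ R * (ρ + ρ) →
      CF k e (Sample f₀ N src ρ (R + R) w E (R * (ρ + ρ))) σ →
      WP (mergeCall k i j l {p} {q} {s}) (Post (t + R * (ρ + ρ) * 90 + 18)
        (λ σ' → Keep 4 3 k B σ σ' × CF k e (Sample f₀ N dst (ρ + ρ) R w E (R * (ρ + ρ))) σ')) t σ
    wp-mergeCall {k} {B} {src} {dst} {ρ} {R} {σ = σ} {t} i j l 0<ρ b₁ b₂ b₃ v₁ v₂ ap out ei ej el e5 data' =
      wp-seq (wp-set 0<W λ m₁ o₁ h₁ → wp-seq (wp-set 0<W λ m₂ o₂ h₂ → wp-seq (wp-set 0<W λ m₃ o₃ h₃ → wp-seq (wp-set 0<W λ m₄ o₄ h₄ →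
        let data₄ = cf-havoc h₄ (cf-havoc h₃ (cf-havoc h₂ (cf-havoc h₁ data'))) in
        mono (Pass.wp-mergePass k B src dst ρ R 0<ρ b₁ b₂ b₃ v₁ v₂ ap out _ _ (since data₄)
               (λ calm → Sample.runs (fact data₄ calm)) ei ej el e5)
          (λ t' σ' (t'≤ , ctx , done) →
            ≤-trans t'≤ (≤-reflexive (linear 2 (λ t x → ⊢ t ⊕ κ 2 ⊕ κ 2 ⊕ κ 2 ⊕ κ 2 ⊕ x ⊕ κ 10 ≐ t ⊕ x ⊕ κ 18) t (R * (ρ + ρ) * 90))) ,
            Keep-trans (record { sameN = (((Level.lift tt , refl) , refl) , refl) , refl
              ; sameW = ((Level.lift tt , refl) , refl) , refl ; sameA = λ _ → refl
              ; frame = Fr-trans (Fr-havoc (proj₁ h₁)) (Fr-trans (Fr-havoc (proj₁ h₂)) (Fr-trans (Fr-havoc (proj₁ h₃)) (Fr-havoc (proj₁ h₄)))) }) ctx ,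
            cf (since done) λ calm → sample-merged (fact data₄ (calm-back ctx (since data₄) calm)) (fact done calm))))))
      where
      0<W : 0 < W
      0<W = ≤-<-trans z≤n b₁

  half-double : ∀ x → (x + x) / 2 ≡ x
  half-double x = trans (cong (_/ 2) (linear 1 (λ x → ⊢ x ⊕ x ≐ x ⊗ 2) x)) (m*n/n≡m x 2)

  record Bank3 (U V N ρ ρ₂ : ℕ) (f : ℕ → ℕ) : Set where
    field
      areaU : f 2 ≡ U
      areaV : f 3 ≡ V
      power : f 4 ≡ N
      runL  : f 6 ≡ ρ
      twice : f 8 ≡ ρ₂

  module Thin (k : Kind) (B U V N ρ h R : ℕ) (bound : U + R * (h + h) * 4 + 8 < W)
    (valid : ∀ p → p < R * (h + h) → Valid k (U + p)) (outside : k ≡ faultyᵏ → B ≤ U) (f₀ : ℕ → Value) (N₀ w E e : ℕ) where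

    Smp : (ℕ → Word) → Set a
    Smp = Sample f₀ N₀ U (h + h) R w E (R * (h + h))

    record Thinned (g₁ : ℕ → Word) (i : ℕ) (g : ℕ → Word) : Set a where
      field
        before : Smp g₁
        kept   : ∀ p → p < i → g (U + p) ≡ g₁ (U + suc (p + p))
        rest   : ∀ p → i ≤ p → p < R * (h + h) → g (U + p) ≡ g₁ (U + p)

    record Inv (σ₁ : View) (i : ℕ) (σ : View) : Set a where
      field
        regs  : Bank3 U V N ρ h (nr σ 3)
        r5    : nr σ 3 5 ≡ R * h
        r7    : nr σ 3 7 ≡ i
        i≤    : i ≤ R * h
        ctx   : Keep 3 2 k B σ₁ σ
        data' : CF k e (Thinned (cells k σ₁) i) σ

    Rh : R * (h + h) ≡ R * h + R * h
    Rh = *-distribˡ-+ R h h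

    thinned-put : ∀ {g₁ i g w'} → i < R * h → Thinned g₁ i g → w' ≡ g (U + suc (i + i)) → Thinned g₁ (suc i) (g [ U + i ]≔ w')
    thinned-put {g₁} {i} {g} {w'} i< f w≡ = record
      { before = before
      ; kept = λ p p≤i → upd-either g (λ x → x ≡ g₁ (U + suc (p + p))) (U + i) w' (U + p)
          (λ eq → trans w≡ (trans (rest _ (m≤n⇒m≤1+n (m≤m+n i i)) inside) (cong (λ x → g₁ (U + suc (x + x))) (+-cancelˡ-≡ U i p eq))))
          (λ ne → kept p (≤∧≢⇒< (s≤s⁻¹ p≤i) (λ eq → ne (cong (U +_) (sym eq)))))
      ; rest = λ p i<p p< → trans (upd-other g (U + i) w' (λ eq → <⇒≢ i<p (+-cancelˡ-≡ U i p eq))) (rest p (<⇒≤ i<p) p<) }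
      where
      open Thinned f
      inside : suc (i + i) < R * (h + h)
      inside = subst (suc (i + i) <_) (sym Rh) (linear 2 (λ i x → i ⊏ x ⇒ ⊢ κ 1 ⊕ (i ⊕ i) ⊏ x ⊕ x) i (R * h) i<)

    opaque
      wp-thinStep : ∀ {σ₁ i σ t} → Inv σ₁ i σ → i < R * h → WP (thinStep k) (Post (t + 20) (Inv σ₁ (suc i))) t σ
      wp-thinStep {σ₁} {i} {σ} {t} I i< =
        wp-seq (wp-load (subst₂ (λ x y → y + y + 1 + (y + y + 1) + (x + (y + y + 1)) < W) (sym areaU) (sym r7) peak₁)
          (subst₂ (λ x y → Valid k (x + (y + y + 1))) (sym areaU) (sym r7) (subst (λ x → Valid k (U + x)) (+-comm 1 (i + i)) (valid _ inside))) λ m₁ o₁ h₁ →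
        wp-seq (wp-store (subst₂ (λ x y → x + y < W) (sym areaU) (sym r7) peak₂)
          (subst₂ (λ x y → Valid k (x + y)) (sym areaU) (sym r7) (valid i (≤-trans i< (subst (R * h ≤_) (sym Rh) (m≤m+n _ _))))) λ m₂ o₂ h₂ →
        wp-set (subst (λ x → 1 + (x + 1) < W) (sym r7) peak₃) λ m₃ o₃ h₃ →
        linear 1 (λ t → ⊢ t ⊕ κ 8 ⊕ κ 4 ⊕ κ 4 ⊑ t ⊕ κ 20) t , record
          { regs = record { areaU = areaU ; areaV = areaV ; power = power ; runL = runL ; twice = twice } ; r5 = r5
          ; r7 = trans (+-comm _ 1) (cong suc r7) ; i≤ = i<
          ; ctx = Keep-trans ctx (Keep-trans (Keep-havoc h₁) (Keep-trans (Keep-setW {b = 2} {0} {pick k (ar σ) m₁ (nr σ 3 2 + (nr σ 3 7 + nr σ 3 7 + 1))}) (Keep-trans (Keep-havoc h₂)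
              (Keep-trans (Keep-cell {p = nr σ 3 2 + nr σ 3 7} (λ eq → subst₂ (λ x y → B ≤ x + y) (sym areaU) (sym r7) (≤-trans (outside eq) (m≤m+n U i))))
              (Keep-trans (Keep-havoc h₃) (Keep-setN {b = 3} {7} {nr σ 3 7 + 1}))))))
          ; data' = cf-havoc h₃ (cf-store (nr σ 3 2 + nr σ 3 7) (pick k (ar σ) m₁ (nr σ 3 2 + (nr σ 3 7 + nr σ 3 7 + 1)))
              (λ g (f , x) → subst₂ (λ x y → Thinned (cells k σ₁) (suc i) (g [ x + y ]≔ pick k (ar σ) m₁ (nr σ 3 2 + (nr σ 3 7 + nr σ 3 7 + 1)))) (sym areaU) (sym r7)
                (thinned-put i< f (trans x (cong₂ (λ x y → g (x + y)) areaU (trans (cong (λ y → y + y + 1) r7) (+-comm (i + i) 1))))))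
              (cf-havoc h₂ (cf-read (nr σ 3 2 + (nr σ 3 7 + nr σ 3 7 + 1)) (cf-havoc h₁ data')))) }))
        where
        open Inv I
        open Bank3 regs
        inside : suc (i + i) < R * (h + h)
        inside = subst (suc (i + i) <_) (sym Rh) (linear 2 (λ i x → i ⊏ x ⇒ ⊢ κ 1 ⊕ (i ⊕ i) ⊏ x ⊕ x) i (R * h) i<)
        peak₁ : i + i + 1 + (i + i + 1) + (U + (i + i + 1)) < W
        peak₁ = linear 4 (λ i U x W → κ 1 ⊕ (i ⊕ i) ⊏ x ⇒ U ⊕ x ⊗ 4 ⊕ κ 8 ⊏ W ⇒ ⊢ i ⊕ i ⊕ κ 1 ⊕ (i ⊕ i ⊕ κ 1) ⊕ (U ⊕ (i ⊕ i ⊕ κ 1)) ⊏ W) i U (R * (h + h)) W inside bound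
        peak₂ : U + i < W
        peak₂ = linear 4 (λ i U x W → κ 1 ⊕ (i ⊕ i) ⊏ x ⇒ U ⊕ x ⊗ 4 ⊕ κ 8 ⊏ W ⇒ ⊢ U ⊕ i ⊏ W) i U (R * (h + h)) W inside bound
        peak₃ : 1 + (i + 1) < W
        peak₃ = linear 4 (λ i U x W → κ 1 ⊕ (i ⊕ i) ⊏ x ⇒ U ⊕ x ⊗ 4 ⊕ κ 8 ⊏ W ⇒ ⊢ κ 1 ⊕ (i ⊕ κ 1) ⊏ W) i U (R * (h + h)) W inside bound

    0<W : 0 < W
    0<W = ≤-<-trans z≤n bound

    Out : View → View → Set a
    Out σ σ' = Bank3 U V N ρ h (nr σ' 3) × nr σ' 3 5 ≡ R * h × Keep 3 2 k B σ σ' × CF k e (Sample f₀ N₀ U h R (w + w) (E + w * R) (R * h)) σ'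

    opaque
      thin-budget : ∀ μ i t t' t″ → i + suc μ ≡ R * h → t' + suc μ * 30 ≤ t → t″ ≤ t' + 3 + 20 → t″ + 1 + μ * 30 ≤ t
      thin-budget μ i t t' t″ eq = linear 4 (λ μ t t' t″ → t' ⊕ (κ 1 ⊕ μ) ⊗ 30 ⊑ t ⇒ t″ ⊑ t' ⊕ κ 3 ⊕ κ 20 ⇒ ⊢ t″ ⊕ κ 1 ⊕ μ ⊗ 30 ⊑ t) μ t t' t″

      thin-exit : ∀ t t' μ → t' + μ * 30 ≤ t → t' + 4 ≤ t + 4
      thin-exit t t' μ = linear 3 (λ t t' μ → t' ⊕ μ ⊗ 30 ⊑ t ⇒ ⊢ t' ⊕ κ 4 ⊑ t ⊕ κ 4) t t' μ

    opaque
      wp-thinLoop : ∀ {σ₁ t} → Inv σ₁ 0 σ₁ → WP (while (r 3 7 <ₙ r 3 5) (thinStep k)) (Post (t + R * h * 30 + 4) (Out σ₁)) t σ₁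
      wp-thinLoop {σ₁} {t} I₀ = wp-while Loop
        (λ μ t' σ' (i , I , i+μ , time) m₁ o₁ h₁ → let open Inv I in 0<W ,
          (λ lt → let i< = subst₂ _<_ r7 r5 (<ᵇ-true _ _ lt) in
            mono (wp-thinStep (inv-havoc I h₁) i<) (λ t″ σ″ (t″≤ , I') → advance μ i t' t″ σ″ i+μ i< time t″≤ I')) ,
          (λ ge → let ≤i = subst₂ _≤_ r5 r7 (<ᵇ-false _ _ ge) in
            thin-exit (t + R * h * 30) t' μ time , out (≤-antisym i≤ ≤i) (inv-havoc I h₁)))
        {R * h} (0 , I₀ , refl , ≤-refl)
        where
        Loop : ℕ → ℕ → View → Set a
        Loop μ t' σ' = ∃[ i ] Inv σ₁ i σ' × i + μ ≡ R * h × t' + μ * 30 ≤ t + R * h * 30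
        inv-havoc : ∀ {i} → Stable (Inv σ₁ i)
        inv-havoc I hv = record { regs = Inv.regs I ; r5 = Inv.r5 I ; r7 = Inv.r7 I ; i≤ = Inv.i≤ I
          ; ctx = Keep-trans (Inv.ctx I) (Keep-havoc hv) ; data' = cf-havoc hv (Inv.data' I) }
        advance : ∀ μ i t' t″ σ″ → i + μ ≡ R * h → i < R * h → t' + μ * 30 ≤ t + R * h * 30 → t″ ≤ t' + 3 + 20 →
          Inv σ₁ (suc i) σ″ → ∃[ μ' ] μ' < μ × Loop μ' (t″ + 1) σ″
        advance zero i t' t″ σ″ eq i< = contradiction (trans (sym (+-identityʳ i)) eq) (<⇒≢ i<)
        advance (suc μ) i t' t″ σ″ eq i< time t″≤ I' =
          μ , ≤-refl , suc i , I' , trans (sym (+-suc i μ)) eq , thin-budget μ i (t + R * h * 30) t' t″ eq time t″≤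
        out : ∀ {i σ} → i ≡ R * h → Inv σ₁ i σ → Out σ₁ σ
        out {σ = σ} refl I = regs , r5 , ctx , cf (since data') λ calm →
            let f = fact data' calm in sample-thinned (Thinned.before f) (Thinned.kept f)
          where open Inv I

    opaque
      wp-thinPass : ∀ {σ t} → Bank3 U V N ρ h (nr σ 3) → nr σ 3 5 ≡ R * (h + h) → CF k e Smp σ →
        WP (thinPass k) (Post (t + R * h * 30 + 10) (Out σ)) t σ
      wp-thinPass {σ} {t} regs r5 data' =
        wp-seq (wp-set (≤-<-trans (≤-trans (≤ᵇ⇒≤ 2 8 tt) (m≤n+m 8 _)) bound) λ m₁ o₁ h₁ → wp-seq (wp-set 0<W λ m₂ o₂ h₂ →
          mono (wp-thinLoop (record
              { regs = record { areaU = areaU ; areaV = areaV ; power = power ; runL = runL ; twice = twice }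
              ; r5 = trans (cong (_/ 2) (trans r5 Rh)) (half-double (R * h)) ; r7 = refl ; i≤ = z≤n ; ctx = Keep-refl
              ; data' = let d = cf-havoc h₂ (cf-havoc h₁ data') in cf (since d) λ calm → record { before = fact d calm ; kept = λ _ () ; rest = λ _ _ _ → refl } }))
            (λ t' σ' (t'≤ , b , e5 , kp , d) →
              ≤-trans t'≤ (≤-reflexive (linear 2 (λ t x → ⊢ t ⊕ κ 4 ⊕ κ 2 ⊕ x ⊕ κ 4 ≐ t ⊕ x ⊕ κ 10) t (R * h * 30))) , b , e5 ,
              Keep-trans (record { sameN = ((Level.lift tt , refl) , refl) , refl ; sameW = (Level.lift tt , refl) , refl
                ; sameA = λ _ → refl ; frame = Fr-trans (Fr-havoc (proj₁ h₁)) (Fr-havoc (proj₁ h₂)) }) kp , d)))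
        where open Bank3 regs

  module Core (k : Kind) (B U V N : ℕ) (0<N : 0 < N) (U<W : U + N * 4 + 8 < W) (V<W : V + N * 4 + 8 < W)
    (validU : ∀ p → p < N → Valid k (U + p)) (validV : ∀ p → p < N → Valid k (V + p))
    (apart : ∀ p q → p < N → q < N → U + p ≢ V + q) (outU : k ≡ faultyᵏ → B ≤ U) (outV : k ≡ faultyᵏ → B ≤ V)
    (e : ℕ) (f₀ : ℕ → Value) (σ₀ : View) where

    record State' (y : ℕ) (σ : View) : Set a where
      field
        ρ E   : ℕ
        0<ρ   : 0 < ρ
        areaU : nr σ 3 2 ≡ U
        areaV : nr σ 3 3 ≡ V
        power : nr σ 3 4 ≡ N
        r6    : nr σ 3 6 ≡ ρ
        r5    : nr σ 3 5 ≡ 4 ^ y * ρ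
        N≡    : ρ * ρ * 4 ^ y ≡ N
        E≡    : E + E + ρ * 4 ^ y ≡ N
        ctx   : Keep 3 2 k B σ₀ σ
        data' : CF k e (Sample f₀ N U ρ (4 ^ y) ρ E (4 ^ y * ρ)) σ

    state-havoc : ∀ {y} → Stable (State' y)
    state-havoc I h = record { ρ = ρ ; E = E ; 0<ρ = 0<ρ ; areaU = areaU ; areaV = areaV ; power = power ; r6 = r6 ; r5 = r5
      ; N≡ = N≡ ; E≡ = E≡ ; ctx = Keep-trans ctx (Keep-havoc h) ; data' = cf-havoc h data' }
      where open State' I

    0<W : 0 < W
    0<W = ≤-<-trans z≤n U<W

    fromBig : ∀ {x y} → x + N * 4 + 8 < W → y ≤ N → x + y + 2 < W
    fromBig {x} {y} big y≤N = linear 4 (λ x y N W → x ⊕ N ⊗ 4 ⊕ κ 8 ⊏ W ⇒ y ⊑ N ⇒ ⊢ x ⊕ y ⊕ κ 2 ⊏ W) x y N W big y≤N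

    four : ∀ y → 4 ^ suc y ≡ 4 ^ y + 4 ^ y + (4 ^ y + 4 ^ y)
    four y = linear 1 (λ x → ⊢ x ⊕ (x ⊕ (x ⊕ (x ⊕ κ 0))) ≐ x ⊕ x ⊕ (x ⊕ x)) (4 ^ y)

    module Step (y ρ : ℕ) (0<ρ : 0 < ρ) (N≡ : ρ * ρ * 4 ^ suc y ≡ N) where
      R h L : ℕ
      R = 4 ^ y
      h = ρ + ρ
      L = R * (h + h)

      L≡ : 4 ^ suc y * ρ ≡ L
      L≡ = trans (cong (_* ρ) (four y)) (trans (*-distribʳ-+ ρ (R + R) (R + R))
        (trans (cong (λ x → x + x) (trans (*-distribʳ-+ ρ R R) (sym (*-distribˡ-+ R ρ ρ)))) (sym (*-distribˡ-+ R h h))))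

      L₁≡ : (R + R) * h ≡ L
      L₁≡ = trans (*-distribʳ-+ h R R) (sym (*-distribˡ-+ R h h))

      L≤N : L ≤ N
      L≤N = subst₂ _≤_ (trans (*-comm ρ (4 ^ suc y)) L≡) (trans (sym (*-assoc ρ ρ (4 ^ suc y))) N≡)
        (≤-trans (≤-reflexive (sym (*-identityˡ (ρ * 4 ^ suc y)))) (*-monoˡ-≤ (ρ * 4 ^ suc y) 0<ρ))

      1≤Rh : 1 ≤ R * h
      1≤Rh = *-mono-≤ (m^n>0 4 y) (≤-trans 0<ρ (m≤m+n ρ ρ))

      h+h≤L : h + h ≤ L
      h+h≤L = ≤-trans (≤-reflexive (sym (*-identityˡ (h + h)))) (*-monoˡ-≤ (h + h) (m^n>0 4 y))

      runs<W : ∀ {x z} → x ≤ L → z ≤ L → x + z + 2 < W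
      runs<W {x} {z} x≤ z≤ = linear 6 (λ x z L N U W → U ⊕ N ⊗ 4 ⊕ κ 8 ⊏ W ⇒ x ⊑ L ⇒ z ⊑ L ⇒ L ⊑ N ⇒ ⊢ x ⊕ z ⊕ κ 2 ⊏ W) x z L N U W U<W x≤ z≤ L≤N

    opaque
      sample-time : ∀ t x → 1 ≤ x →
        t + 4 + ((x + x) * 90 + 18) + ((x + x) * 90 + 18) + (x * 30 + 10) + 2 + 1 + 3 + x * 450 ≤ t + (x + x) * 450
      sample-time t x = linear 2 (λ t x → κ 1 ⊑ x ⇒
        ⊢ t ⊕ κ 4 ⊕ ((x ⊕ x) ⊗ 90 ⊕ κ 18) ⊕ ((x ⊕ x) ⊗ 90 ⊕ κ 18) ⊕ (x ⊗ 30 ⊕ κ 10) ⊕ κ 2 ⊕ κ 1 ⊕ κ 3 ⊕ x ⊗ 450 ⊑ t ⊕ (x ⊕ x) ⊗ 450) t x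

    opaque
      wp-sampleStep : ∀ {y σ t} → State' (suc y) σ →
        WP (sampleStep k) (λ t' σ' → t' + 1 + 3 + nr σ' 3 5 * 450 ≤ t + nr σ 3 5 * 450 × State' y σ') t σ
      wp-sampleStep {y} {σ} {t} I =
        wp-seq (wp-set (subst (λ x → x + x < W) (sym r6) (≤-<-trans (m≤m+n (ρ + ρ) (0 + 2)) (subst (_< W) (+-assoc (ρ + ρ) 0 2) (runs<W (≤-trans (m≤m+n h h) h+h≤L) z≤n)))) λ m₁ o₁ h₁ →
        wp-seq (mono (wp-mergeCall {ρ = ρ} {R + R} 2 3 6 0<ρ (fromBig U<W (subst (_≤ N) (sym L₁≡) L≤N)) (fromBig V<W (subst (_≤ N) (sym L₁≡) L≤N))
            (runs<W (≤-reflexive L₁≡) (≤-trans (m≤m+n h h) h+h≤L))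
            (λ p p< → validU p (inside₁ p<)) (λ p p< → validV p (inside₁ p<)) (λ p q p< q< eq → apart p q (inside₁ p<) (inside₁ q<) (sym eq)) outV
            areaU areaV r6 (trans r5 (trans L≡ (sym L₁≡)))
            (subst₂ (λ a b → Fact k e (Sample f₀ N U ρ a ρ E b) (ar σ) m₁ o₁) (four y) (trans L≡ (sym L₁≡)) (cf-havoc h₁ data')))
          λ t₁ σ₁ (t₁≤ , kp₁ , d₁) → let n₁ = proj₂ (sameN kp₁) in
        wp-seq (mono (wp-mergeCall {ρ = h} {R} 3 2 8 (≤-trans 0<ρ (m≤m+n ρ ρ)) (fromBig V<W L≤N) (fromBig U<W L≤N)
            (runs<W ≤-refl h+h≤L)
            (λ p p< → validV p (<-≤-trans p< L≤N)) (λ p p< → validU p (<-≤-trans p< L≤N)) (λ p q p< q< eq → apart q p (<-≤-trans q< L≤N) (<-≤-trans p< L≤N) eq) outU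
            (trans (cong (λ f → f 3) n₁) areaV) (trans (cong (λ f → f 2) n₁) areaU) (trans (cong (λ f → f 8) n₁) (cong₂ _+_ r6 r6))
            (trans (cong (λ f → f 5) n₁) (trans r5 L≡)) (subst (λ b → CF k e (Sample f₀ N V h (R + R) ρ E b) σ₁) L₁≡ d₁))
          λ t₂ σ₂ (t₂≤ , kp₂ , d₂) → let n₂ = trans (proj₂ (sameN kp₂)) n₁ in
        wp-seq (mono (Thin.wp-thinPass k B U V N ρ h R
            (linear 4 (λ U x N W → U ⊕ N ⊗ 4 ⊕ κ 8 ⊏ W ⇒ x ⊑ N ⇒ ⊢ U ⊕ x ⊗ 4 ⊕ κ 8 ⊏ W) U L N W U<W L≤N)
            (λ p p< → validU p (<-≤-trans p< L≤N)) outU f₀ N ρ E e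
            (record { areaU = trans (cong (λ f → f 2) n₂) areaU ; areaV = trans (cong (λ f → f 3) n₂) areaV ; power = trans (cong (λ f → f 4) n₂) power
                    ; runL = trans (cong (λ f → f 6) n₂) r6 ; twice = trans (cong (λ f → f 8) n₂) (cong₂ _+_ r6 r6) })
            (trans (cong (λ f → f 5) n₂) (trans r5 L≡)) d₂)
          λ t₃ σ₃ (t₃≤ , b , e5 , kp₃ , d₃) →
        wp-set 0<W λ m₄ o₄ h₄ →
          subst₂ (λ u v → t₃ + 2 + 1 + 3 + u * 450 ≤ t + v * 450) (sym e5) (sym (trans r5 (trans L≡ (*-distribˡ-+ R h h))))
            (≤-trans (linear 7 (λ t t₁ t₂ t₃ x y z → t₁ ⊑ t ⊕ κ 4 ⊕ x ⊕ κ 18 ⇒ t₂ ⊑ t₁ ⊕ x ⊕ κ 18 ⇒ t₃ ⊑ t₂ ⊕ y ⊕ κ 10 ⇒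
                ⊢ t₃ ⊕ κ 2 ⊕ κ 1 ⊕ κ 3 ⊕ z ⊑ t ⊕ κ 4 ⊕ (x ⊕ κ 18) ⊕ (x ⊕ κ 18) ⊕ (y ⊕ κ 10) ⊕ κ 2 ⊕ κ 1 ⊕ κ 3 ⊕ z)
              t t₁ t₂ t₃ ((R * h + R * h) * 90) (R * h * 30) (R * h * 450)
              (subst (λ x → t₁ ≤ t + 4 + x * 90 + 18) (trans L₁≡ (*-distribˡ-+ R h h)) t₁≤)
              (subst (λ x → t₂ ≤ t₁ + x * 90 + 18) (*-distribˡ-+ R h h) t₂≤) t₃≤)
            (sample-time t (R * h) 1≤Rh)) ,
          record { ρ = h ; E = E + ρ * R ; 0<ρ = ≤-trans 0<ρ (m≤m+n ρ ρ)
            ; areaU = Bank3.areaU b ; areaV = Bank3.areaV b ; power = Bank3.power b ; r6 = Bank3.twice b ; r5 = e5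
            ; N≡ = trans (square ρ R) (trans (cong (ρ * ρ *_) (sym (four y))) N≡)
            ; E≡ = trans (trans (cong (E + ρ * R + (E + ρ * R) +_) (*-distribʳ-+ R ρ ρ))
                (linear 2 (λ E x → ⊢ E ⊕ x ⊕ (E ⊕ x) ⊕ (x ⊕ x) ≐ E ⊕ E ⊕ (x ⊕ x ⊕ (x ⊕ x))) E (ρ * R)))
                (trans (cong (E + E +_) (trans (cong₂ _+_ (sym (*-distribˡ-+ ρ R R)) (sym (*-distribˡ-+ ρ R R))) (trans (sym (*-distribˡ-+ ρ (R + R) (R + R))) (cong (ρ *_) (sym (four y)))))) E≡)
            ; ctx = Keep-trans ctx (Keep-trans (Keep-havoc h₁) (Keep-trans (Keep-setN {b = 3} {8} {nr σ 3 6 + nr σ 3 6})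
                (Keep-trans (Keep-weaken proj₁ proj₁ ≤-refl kp₁) (Keep-trans (Keep-weaken proj₁ proj₁ ≤-refl kp₂) (Keep-trans kp₃ (Keep-trans (Keep-havoc h₄) (Keep-setN {b = 3} {6} {nr σ₃ 3 8})))))))
            ; data' = cf-havoc h₄ d₃ }))))
        where
        open State' I
        open Step y ρ 0<ρ N≡
        inside₁ : ∀ {p} → p < (R + R) * h → p < N
        inside₁ {p} p< = <-≤-trans (subst (p <_) L₁≡ p<) L≤N
        square : ∀ ρ R → (ρ + ρ) * (ρ + ρ) * R ≡ ρ * ρ * (R + R + (R + R))
        square ρ R = trans (cong (_* R) (trans (*-distribʳ-+ (ρ + ρ) ρ ρ) (cong₂ _+_ (*-distribˡ-+ ρ ρ ρ) (*-distribˡ-+ ρ ρ ρ))))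
          (trans (*-distribʳ-+ R (ρ * ρ + ρ * ρ) (ρ * ρ + ρ * ρ)) (trans (cong₂ _+_ (*-distribʳ-+ R (ρ * ρ) (ρ * ρ)) (*-distribʳ-+ R (ρ * ρ) (ρ * ρ)))
            (sym (trans (*-distribˡ-+ (ρ * ρ) (R + R) (R + R)) (cong₂ _+_ (*-distribˡ-+ (ρ * ρ) R R) (*-distribˡ-+ (ρ * ρ) R R))))))

    Found : View → Set a
    Found σ = Keep 3 2 k B σ₀ σ × CF k e (λ _ → Level.Lift a (Central 4 f₀ N (value (wr σ 2 0)))) σ

    opaque
      wp-sampleMedian : ∀ {x t} → N ≡ 4 ^ x → nr σ₀ 3 2 ≡ U → nr σ₀ 3 3 ≡ V → nr σ₀ 3 4 ≡ N →
        CF k e (λ g → ∀ p → p < N → value (g (U + p)) ≡ f₀ p) σ₀ → WP (sampleMedian k) (Post (t + N * 450 + 14) Found) t σ₀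
      wp-sampleMedian {x} {t} N≡4^x eU eV eN data₀ =
        wp-seq (wp-set 0<W λ m₁ o₁ h₁ → wp-seq (wp-set 1<W λ m₂ o₂ h₂ → wp-seq
          (mono (wp-while {Q = λ t' σ' → t' ≤ t + N * 450 + 8 × State' 0 σ'} Loop
            (λ μ t' σ' (I , time) m₃ o₃ h₃ → 0<W , (λ lt → iterate μ t' _ (state-havoc I h₃) (<ᵇ-true _ _ lt) time) ,
              (λ ge → exit μ t' σ' (state-havoc I h₃) (<ᵇ-false _ _ ge) time))
            {x} (init h₁ h₂ , ≤-reflexive (cong (λ z → t + 2 + 2 + z * 450) eN)))
          λ t' σ' (t'≤ , I) → finish t' σ' t'≤ I)))
        where
        1<W : 1 < W
        1<W = ≤-<-trans (≤-trans (≤ᵇ⇒≤ 1 8 tt) (m≤n+m 8 _)) U<W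
        Loop : ℕ → ℕ → View → Set a
        Loop μ t' σ' = State' μ σ' × t' + nr σ' 3 5 * 450 ≤ t + 2 + 2 + N * 450
        init : ∀ {m₁ o₁ m₂ o₂} → Havoc σ₀ m₁ o₁ → Havoc (setN (num 3 5) (nr σ₀ 3 4) (havoc σ₀ m₁ o₁)) m₂ o₂ →
          State' x (setN (num 3 6) 1 (havoc (setN (num 3 5) (nr σ₀ 3 4) (havoc σ₀ m₁ o₁)) m₂ o₂))
        init h₁ h₂ = record { ρ = 1 ; E = 0 ; 0<ρ = ≤-refl ; areaU = eU ; areaV = eV ; power = eN ; r6 = refl
          ; r5 = trans eN (trans N≡4^x (sym (*-identityʳ (4 ^ x)))) ; N≡ = trans (*-identityˡ (4 ^ x)) (sym N≡4^x)
          ; E≡ = trans (*-identityˡ (4 ^ x)) (sym N≡4^x)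
          ; ctx = record { sameN = ((Level.lift tt , refl) , refl) , refl ; sameW = (Level.lift tt , refl) , refl
              ; sameA = λ _ → refl ; frame = Fr-trans (Fr-havoc (proj₁ h₁)) (Fr-havoc (proj₁ h₂)) }
          ; data' = cf-map (λ g f → record { runs = λ r p q _ p<q q<1 → contradiction (<-≤-trans p<q (s≤s⁻¹ q<1)) (λ ())
              ; lo = λ {χ} _ → ≤-reflexive (trans (*-identityʳ (cnt g χ)) (same g f χ))
              ; hi = λ {χ} _ → ≤-reflexive (sym (trans (+-identityʳ (cnt g χ * 1)) (trans (*-identityʳ (cnt g χ)) (same g f χ)))) }) (cf-havoc h₂ (cf-havoc h₁ data₀)) }
          where
          cnt : (ℕ → Word) → (Value → Bool) → ℕ
          cnt g χ = count (λ p → χ (value (g (U + p)))) (4 ^ x * 1)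
          same : ∀ (g : ℕ → Word) → (∀ p → p < N → value (g (U + p)) ≡ f₀ p) → ∀ (χ : Value → Bool) →
            count (λ p → χ (value (g (U + p)))) (4 ^ x * 1) ≡ count (λ p → χ (f₀ p)) N
          same g f χ = trans (cong (count (λ p → χ (value (g (U + p))))) (trans (*-identityʳ (4 ^ x)) (sym N≡4^x)))
            (count-cong N (λ p p<N → cong χ (f p p<N)))
        iterate : ∀ μ t' σ' → State' μ σ' → nr σ' 3 6 < nr σ' 3 5 → t' + nr σ' 3 5 * 450 ≤ t + 2 + 2 + N * 450 →
          WP (sampleStep k) (λ t″ σ″ → ∃[ μ' ] μ' < μ × Loop μ' (t″ + 1) σ″) (t' + 3) σ'
        iterate zero t' σ' I lt time = contradiction (subst₂ _<_ r6 (trans r5 (*-identityˡ ρ)) lt) (<-irrefl refl)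
          where open State' I
        iterate (suc μ) t' σ' I lt time = mono (wp-sampleStep I) λ t″ σ″ (time' , I') → μ , ≤-refl , I' ,
          linear 5 (λ t' t″ x y T → t' ⊕ x ⊑ T ⇒ t″ ⊕ κ 1 ⊕ κ 3 ⊕ y ⊑ t' ⊕ κ 3 ⊕ x ⇒ ⊢ t″ ⊕ κ 1 ⊕ y ⊑ T)
            t' t″ (nr σ' 3 5 * 450) (nr σ″ 3 5 * 450) (t + 2 + 2 + N * 450) time time'
        exit : ∀ μ t' σ' {m o} → State' μ (havoc σ' m o) → nr σ' 3 5 ≤ nr σ' 3 6 → t' + nr σ' 3 5 * 450 ≤ t + 2 + 2 + N * 450 →
          t' + 4 ≤ t + N * 450 + 8 × State' 0 (havoc σ' m o)
        exit zero t' σ' I ge time = linear 4 (λ t t' x N → t' ⊕ x ⊑ t ⊕ κ 2 ⊕ κ 2 ⊕ N ⇒ ⊢ t' ⊕ κ 4 ⊑ t ⊕ N ⊕ κ 8) t t' (nr σ' 3 5 * 450) (N * 450) time , I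
        exit (suc μ) t' σ' I ge time = contradiction (≤-trans (subst₂ _≤_ (trans r5 (trans (cong (_* ρ) (four μ)) (*-distribʳ-+ ρ (4 ^ μ + 4 ^ μ) (4 ^ μ + 4 ^ μ)))) r6 ge) ≤-refl)
            (<⇒≱ (linear 2 (λ x ρ → ρ ⊑ x ⇒ κ 1 ⊑ ρ ⇒ ⊢ ρ ⊏ x ⊕ x) ((4 ^ μ + 4 ^ μ) * ρ) ρ
              (≤-trans (≤-reflexive (sym (*-identityˡ ρ))) (*-monoˡ-≤ ρ (≤-trans (m^n>0 4 μ) (m≤m+n _ _)))) 0<ρ))
          where open State' I
        finish : ∀ t' σ' → t' ≤ t + N * 450 + 8 → State' 0 σ' →
          WP (load k (wrd 2 0) (r 3 2 ∔ (r 3 5 ÷ₑ lit 4))) (Post (t + N * 450 + 14) Found) t' σ'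
        finish t' σ' t'≤ I = wp-load (subst₂ (λ x y → 4 + (x + y / 4) < W) (sym areaU) (sym len≡)
              (linear 4 (λ U c N W → U ⊕ N ⊗ 4 ⊕ κ 8 ⊏ W ⇒ c ⊏ N ⇒ ⊢ κ 4 ⊕ (U ⊕ c) ⊏ W) U (ρ / 4) N W U<W c<N))
            (subst₂ (λ x y → Valid k (x + y / 4)) (sym areaU) (sym len≡) (validU _ c<N)) λ m o h →
          linear 3 (λ t t' N → t' ⊑ t ⊕ N ⊕ κ 8 ⇒ ⊢ t' ⊕ κ 6 ⊑ t ⊕ N ⊕ κ 14) t t' (N * 450) t'≤ ,
          Keep-trans ctx (Keep-trans (Keep-havoc h) (Keep-setW {b = 2} {0} {pick k (ar σ') m (nr σ' 3 2 + nr σ' 3 5 / 4)})) ,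
          cf-map (λ g (smp , v≡) → Level.lift (subst₂ (λ N v → Central 4 f₀ N v) ρρ≡N
              (cong value (sym (trans v≡ (cong₂ (λ x y → g (x + y / 4)) areaU len≡))))
              (sample-central {E = E} 0<ρ (subst (E + E ≤_) (sym ρρ≡N) (≤-trans (m≤m+n (E + E) (ρ * 1)) (≤-reflexive E≡)))
                (subst₂ (λ N L → Sample f₀ N U ρ 1 ρ E L g) (sym ρρ≡N) (*-identityˡ ρ) smp))))
            (cf-read (nr σ' 3 2 + nr σ' 3 5 / 4) (cf-havoc h data'))
          where
          open State' I
          len≡ : nr σ' 3 5 ≡ ρ
          len≡ = trans r5 (*-identityˡ ρ)
          ρρ≡N : ρ * ρ ≡ N
          ρρ≡N = trans (sym (*-identityʳ (ρ * ρ))) N≡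
          c<N : ρ / 4 < N
          c<N = <-≤-trans (m/n<m ρ 4 {{>-nonZero 0<ρ}} (≤ᵇ⇒≤ 2 4 tt))
            (subst (ρ ≤_) ρρ≡N (≤-trans (≤-reflexive (sym (*-identityˡ ρ))) (*-monoˡ-≤ ρ 0<ρ)))

  central-block : ∀ f v {N q} → N ≤ q → q < N * 4 → Central 4 f N v → Central 16 f q v
  central-block f v {N} {q} N≤q q<4N (lo , hi) = widen (atMost v) lo , widen (geq v) hi
    where
    widen : ∀ (χ : Value → Bool) → N ≤ count (λ p → χ (f p)) N * 4 → q ≤ count (λ p → χ (f p)) q * 16
    widen χ h = linear 4 (λ N q c d → N ⊑ c ⊗ 4 ⇒ q ⊏ N ⊗ 4 ⇒ c ⊑ d ⇒ ⊢ q ⊑ d ⊗ 16)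
      N q (count (λ p → χ (f p)) N) (count (λ p → χ (f p)) q) h q<4N (count-extend (λ p → χ (f p)) N≤q)

  record Quiet (σ σ' : View) : Set a where
    field
      only  : Havoc σ (mem σ') (ow σ')
      arr   : ar σ' ≡ ar σ
      bankN : SameN 3 σ σ'
      bankW : SameW 2 σ σ'

  quiet-keep : ∀ {k B σ σ'} → Quiet σ σ' → Keep 3 2 k B σ σ'
  quiet-keep q = record { sameN = Quiet.bankN q ; sameW = Quiet.bankW q ; sameA = λ _ → Quiet.arr q ; frame = Fr-havoc (proj₁ (Quiet.only q)) }

  record Power (q : ℕ) (σ σ' : View) : Set a where
    field
      x     : ℕ
      r4    : nr σ' 3 4 ≡ 4 ^ x
      ≤q    : 4 ^ x ≤ q
      r0    : nr σ' 3 0 ≡ nr σ 3 0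
      r1    : nr σ' 3 1 ≡ nr σ 3 1
      r2    : nr σ' 3 2 ≡ nr σ 3 2
      r3    : nr σ' 3 3 ≡ nr σ 3 3
      quiet : Quiet σ σ'

  opaque
    wp-powerOf4 : ∀ {q σ t} → 0 < q → q * 8 + 16 < W → nr σ 3 1 ≡ q →
      WP powerOf4 (Post (t + q * 20 + 20) (λ σ' → Σ[ p ∈ Power q σ σ' ] q < 4 ^ Power.x p * 4)) t σ
    wp-powerOf4 {q} {σ} {t} 0<q big e1 = wp-seq (wp-set (≤-<-trans (≤-trans (≤ᵇ⇒≤ 1 16 tt) (m≤n+m 16 _)) big) λ m₁ o₁ h₁ →
      wp-while Loop (λ μ t' σ' (p , μ≡ , time) m o h → let open Power p in
        subst₂ (λ x y → 0 + 4 + x * 4 + (0 + 1 + (y + 1)) < W) (sym r4) (sym (trans r1 e1))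
          (linear 3 (λ N q W → N ⊑ q ⇒ q ⊗ 8 ⊕ κ 16 ⊏ W ⇒ ⊢ κ 0 ⊕ κ 4 ⊕ N ⊗ 4 ⊕ (κ 0 ⊕ κ 1 ⊕ (q ⊕ κ 1)) ⊏ W) (4 ^ x) q W ≤q big) ,
        (λ lt → let 4N≤q = s≤s⁻¹ (subst (4 ^ x * 4 <_) (+-comm q 1) (subst₂ (λ a b → a * 4 < b + 1) r4 (trans r1 e1) (<ᵇ-true _ _ lt))) in
          wp-set (subst (λ y → 4 + y * 4 < W) (sym r4) (linear 3 (λ N q W → N ⊑ q ⇒ q ⊗ 8 ⊕ κ 16 ⊏ W ⇒ ⊢ κ 4 ⊕ N ⊗ 4 ⊏ W) (4 ^ x) q W ≤q big)) λ m' o' h' →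
          q ∸ 4 ^ x * 4 , smaller (4 ^ x) μ (m^n>0 4 x) 4N≤q μ≡ ,
          record { x = suc x ; r4 = trans (cong (_* 4) r4) (*-comm (4 ^ x) 4) ; ≤q = subst (_≤ q) (*-comm (4 ^ x) 4) 4N≤q
            ; r0 = r0 ; r1 = r1 ; r2 = r2 ; r3 = r3
            ; quiet = record { only = Corr-trans (proj₁ (Quiet.only quiet)) (Corr-trans (proj₁ h) (proj₁ h')) , proj₂ h' ; arr = Quiet.arr quiet
              ; bankN = Quiet.bankN quiet ; bankW = Quiet.bankW quiet } } ,
          trans (cong (q ∸ 4 ^ x * 4 +_) (*-comm 4 (4 ^ x))) (m∸n+n≡m 4N≤q) ,
          subst (λ y → t' + 7 + 4 + 1 ≤ t + y * 20) (*-comm (4 ^ x) 4)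
            (linear 3 (λ t t' N → t' ⊑ t ⊕ N ⊗ 20 ⇒ κ 1 ⊑ N ⇒ ⊢ t' ⊕ κ 7 ⊕ κ 4 ⊕ κ 1 ⊑ t ⊕ (N ⊗ 4) ⊗ 20) t t' (4 ^ x) time (m^n>0 4 x))) ,
        (λ ge → linear 4 (λ t t' N q → t' ⊑ t ⊕ N ⊗ 20 ⇒ N ⊑ q ⇒ ⊢ t' ⊕ κ 8 ⊑ t ⊕ q ⊗ 20 ⊕ κ 20) t t' (4 ^ x) q time ≤q ,
          record { x = x ; r4 = r4 ; ≤q = ≤q ; r0 = r0 ; r1 = r1 ; r2 = r2 ; r3 = r3 ; quiet = extend quiet h } ,
          subst (_≤ 4 ^ x * 4) (+-comm q 1) (subst₂ (λ a b → b + 1 ≤ a * 4) r4 (trans r1 e1) (<ᵇ-false _ _ ge))))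
      {q ∸ 1} (record { x = 0 ; r4 = refl ; ≤q = 0<q ; r0 = refl ; r1 = refl ; r2 = refl ; r3 = refl
        ; quiet = record { only = h₁ ; arr = refl ; bankN = ((Level.lift tt , refl) , refl) , refl ; bankW = (Level.lift tt , refl) , refl } } ,
        m∸n+n≡m 0<q , linear 1 (λ t → ⊢ t ⊕ κ 2 ⊑ t ⊕ κ 20) t))
      where
      Loop : ℕ → ℕ → View → Set a
      Loop μ t' σ' = Σ[ p ∈ Power q σ σ' ] μ + 4 ^ Power.x p ≡ q × t' ≤ t + 4 ^ Power.x p * 20
      smaller : ∀ N μ → 0 < N → N * 4 ≤ q → μ + N ≡ q → q ∸ N * 4 < μ
      smaller N μ 0<N 4N≤ eq = linear 4 (λ N μ q r → κ 1 ⊑ N ⇒ μ ⊕ N ≐ q ⇒ r ⊕ N ⊗ 4 ≐ q ⇒ ⊢ r ⊏ μ) N μ q (q ∸ N * 4) 0<N eq (m∸n+n≡m 4N≤)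
      extend : ∀ {σ₁ m o} → Quiet σ σ₁ → Havoc σ₁ m o → Quiet σ (havoc σ₁ m o)
      extend Q h = record { only = Corr-trans (proj₁ (Quiet.only Q)) (proj₁ h) , proj₂ h ; arr = Quiet.arr Q ; bankN = Quiet.bankN Q ; bankW = Quiet.bankW Q }

  module Block (B src q U V : ℕ) (0<q : 0 < q) (q<W : q * 8 + 16 < W) (U<W : U + q * 4 + 8 < W) (V<W : V + q * 4 + 8 < W)
    (B≤U : B ≤ U) (U+q≤V : U + q ≤ V) (src≤B : src + q ≤ B) (σ₀ : View) where

    m₀ : ℕ → Word
    m₀ = mem σ₀

    e : ℕ
    e = length (ow σ₀)

    record Copied (i : ℕ) (g : ℕ → Word) : Set a where
      field
        done   : ∀ p → p < i → g (U + p) ≡ m₀ (src + p)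
        source : ∀ p → p < q → g (src + p) ≡ m₀ (src + p)

    record Copy (N i : ℕ) (σ : View) : Set a where
      field
        r0 : nr σ 3 0 ≡ src
        r2 : nr σ 3 2 ≡ U
        r3 : nr σ 3 3 ≡ V
        r4 : nr σ 3 4 ≡ N
        r7 : nr σ 3 7 ≡ i
        i≤ : i ≤ N
        ctx : Keep 3 2 faultyᵏ B σ₀ σ
        data' : CF faultyᵏ e (Copied i) σ

    copied-put : ∀ {i g w} → i < q → Copied i g → w ≡ g (src + i) → Copied (suc i) (g [ U + i ]≔ w)
    copied-put {i} {g} {w} i<q f w≡ = record
      { done = λ p p≤i → upd-either g (λ x → x ≡ m₀ (src + p)) (U + i) w (U + p)
          (λ eq → trans w≡ (trans (source i i<q) (cong (λ x → m₀ (src + x)) (+-cancelˡ-≡ U i p eq))))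
          (λ ne → done p (≤∧≢⇒< (s≤s⁻¹ p≤i) (λ eq → ne (cong (U +_) (sym eq)))))
      ; source = λ p p<q → trans (upd-other g (U + i) w (λ eq → <⇒≢ (<-≤-trans (+-monoʳ-< src p<q) (≤-trans (≤-trans src≤B B≤U) (m≤m+n U i))) (sym eq))) (source p p<q) }
      where open Copied f

    copy-havoc : ∀ {N} i → Stable (Copy N i)
    copy-havoc i I h = record { r0 = r0 ; r2 = r2 ; r3 = r3 ; r4 = r4 ; r7 = r7 ; i≤ = i≤ ; ctx = Keep-trans ctx (Keep-havoc h) ; data' = cf-havoc h data' }
      where open Copy I

    opaque
      wp-copyStep : ∀ {N i σ t} → N ≤ q → Copy N i σ → i < N → WP copyStep (Post (t + 12) (Copy N (suc i))) t σ
      wp-copyStep {N} {i} {σ} {t} N≤q I i<N =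
        wp-seq (wp-load (subst₂ (λ x y → x + y < W) (sym r0) (sym r7)
            (linear 6 (λ src i q U B W → i ⊏ q ⇒ src ⊕ q ⊑ B ⇒ B ⊑ U ⇒ U ⊕ q ⊗ 4 ⊕ κ 8 ⊏ W ⇒ ⊢ src ⊕ i ⊏ W) src i q U B W i<q src≤B B≤U U<W)) ≤-refl λ m₁ o₁ h₁ →
        wp-seq (wp-store (subst₂ (λ x y → x + y < W) (sym r2) (sym r7)
            (linear 4 (λ i q U W → i ⊏ q ⇒ U ⊕ q ⊗ 4 ⊕ κ 8 ⊏ W ⇒ ⊢ U ⊕ i ⊏ W) i q U W i<q U<W)) ≤-refl λ m₂ o₂ h₂ →
        wp-set (subst (λ x → 1 + (x + 1) < W) (sym r7) (linear 3 (λ i q W → i ⊏ q ⇒ q ⊗ 8 ⊕ κ 16 ⊏ W ⇒ ⊢ κ 1 ⊕ (i ⊕ κ 1) ⊏ W) i q W i<q q<W)) λ m₃ o₃ h₃ →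
        linear 1 (λ t → ⊢ t ⊕ κ 4 ⊕ κ 4 ⊕ κ 4 ⊑ t ⊕ κ 12) t , record
          { r0 = r0 ; r2 = r2 ; r3 = r3 ; r4 = r4 ; r7 = trans (+-comm _ 1) (cong suc r7) ; i≤ = i<N
          ; ctx = Keep-trans ctx (record { sameN = ((Level.lift tt , refl) , refl) , refl ; sameW = (Level.lift tt , refl) , refl ; sameA = λ _ → refl
              ; frame = Fr-trans (Fr-havoc (proj₁ h₁)) (Fr-trans (Fr-havoc (proj₁ h₂)) (Fr-trans
                  (Fr-write (λ {p} p<B eq → <⇒≱ p<B (subst (B ≤_) eq (subst₂ (λ x y → B ≤ x + y) (sym r2) (sym r7) (≤-trans B≤U (m≤m+n U i))))))
                  (Fr-havoc (proj₁ h₃)))) })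
          ; data' = cf-havoc h₃ (cf-store (nr σ 3 2 + nr σ 3 7) (m₁ (nr σ 3 0 + nr σ 3 7))
              (λ g (f , x) → subst₂ (λ x y → Copied (suc i) (g [ x + y ]≔ m₁ (nr σ 3 0 + nr σ 3 7))) (sym r2) (sym r7)
                (copied-put i<q f (trans x (cong₂ (λ x y → g (x + y)) r0 r7))))
              (cf-havoc h₂ (cf-read (nr σ 3 0 + nr σ 3 7) (cf-havoc h₁ data')))) }))
        where
        open Copy I
        i<q : i < q
        i<q = <-≤-trans i<N N≤q

    0<W : 0 < W
    0<W = ≤-<-trans z≤n q<W

    Out : View → Set a
    Out σ = Keep 3 2 faultyᵏ B σ₀ σ × (length (ow σ) ≡ e → Central 16 (λ p → value (m₀ (src + p))) q (value (wr σ 2 0)))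

    opaque
      wp-medianᶠ : ∀ {t} → nr σ₀ 3 0 ≡ src → nr σ₀ 3 1 ≡ q → nr σ₀ 3 2 ≡ U → nr σ₀ 3 3 ≡ V →
        WP medianᶠ (Post (t + q * 500 + 60) Out) t σ₀
      wp-medianᶠ {t} e0 e1 e2 e3 = wp-seq (mono (wp-powerOf4 0<q q<W e1) λ t₁ σ₁ (t₁≤ , p , q<4N) → let open Power p ; N = 4 ^ x in
        wp-seq (wp-seq (wp-set 0<W λ m₁ o₁ h₁ → mono (wp-for {n = N} {C = 16} (Copy N) copy-havoc (λ _ → 0<W)
            (λ I lt → subst₂ _<_ (Copy.r7 I) (Copy.r4 I) (<ᵇ-true _ _ lt))
            (λ I ge → ≤-antisym (Copy.i≤ I) (subst₂ _≤_ (Copy.r4 I) (Copy.r7 I) (<ᵇ-false _ _ ge)))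
            (wp-copyStep ≤q) ≤-refl
            (record { r0 = trans r0 e0 ; r2 = trans r2 e2 ; r3 = trans r3 e3 ; r4 = r4 ; r7 = refl ; i≤ = z≤n
              ; ctx = Keep-trans (quiet-keep quiet) (Keep-trans (Keep-havoc h₁) (Keep-setN {b = 3} {7} {0}))
              ; data' = cf-havoc h₁ (cf-havoc (Quiet.only quiet) (cf ≤-refl λ _ → record { done = λ _ () ; source = λ _ _ → refl })) }))
          λ t₂ σ₂ (t₂≤ , I) →
          mono (Core.wp-sampleMedian faultyᵏ B U V N (m^n>0 4 x) (small U<W ≤q) (small V<W ≤q) (λ _ _ → ≤-refl) (λ _ _ → ≤-refl)
              (λ a b a<N b<N eq → <⇒≢ (<-≤-trans (+-monoʳ-< U (<-≤-trans a<N ≤q)) (≤-trans U+q≤V (m≤m+n V b))) eq)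
              (λ _ → B≤U) (λ _ → ≤-trans B≤U (≤-trans (m≤m+n U q) U+q≤V)) e (λ p → value (m₀ (src + p))) σ₂ {x = x}
              refl (Copy.r2 I) (Copy.r3 I) (Copy.r4 I) (cf-map (λ g f p p<N → cong value (Copied.done f p p<N)) (Copy.data' I)))
            λ t₃ σ₃ (t₃≤ , kp , d) →
            linear 6 (λ t t₁ t₂ t₃ N q → t₁ ⊑ t ⊕ q ⊗ 20 ⊕ κ 20 ⇒ t₂ ⊑ t₁ ⊕ κ 2 ⊕ N ⊗ 16 ⊕ κ 4 ⇒ t₃ ⊑ t₂ ⊕ N ⊗ 450 ⊕ κ 14 ⇒ N ⊑ q ⇒ ⊢ t₃ ⊑ t ⊕ q ⊗ 500 ⊕ κ 60)
              t t₁ t₂ t₃ N q t₁≤ t₂≤ t₃≤ ≤q ,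
            Keep-trans (Copy.ctx I) kp ,
            λ calm → central-block (λ p → value (m₀ (src + p))) (value (wr σ₃ 2 0)) ≤q q<4N (Level.lower (fact d (inj₂ calm))))))
        where
        small : ∀ {y N} → y + q * 4 + 8 < W → N ≤ q → y + N * 4 + 8 < W
        small {y} {N} big N≤q = linear 4 (λ y N q W → y ⊕ q ⊗ 4 ⊕ κ 8 ⊏ W ⇒ N ⊑ q ⇒ ⊢ y ⊕ N ⊗ 4 ⊕ κ 8 ⊏ W) y N q W big N≤q

  opaque
    wp-medianˢ : ∀ {U V q σ₀ t} B → 0 < q → q * 8 + 16 < W → U + q * 4 + 8 < W → V + q * 4 + 8 < W → U + q ≤ V →
      (∀ p → p < q → Valid safeᵏ (U + p)) → (∀ p → p < q → Valid safeᵏ (V + p)) →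
      nr σ₀ 3 1 ≡ q → nr σ₀ 3 2 ≡ U → nr σ₀ 3 3 ≡ V →
      WP medianˢ (Post (t + q * 500 + 60)
        (λ σ → Fr (_< B) (mem σ₀) (ow σ₀) (mem σ) (ow σ) × SameN 3 σ₀ σ × SameW 2 σ₀ σ
             × Central 16 (λ p → value (ar σ₀ (U + p))) q (value (wr σ 2 0)))) t σ₀
    wp-medianˢ {U} {V} {q} {σ₀} {t} B 0<q q<W U<W V<W U+q≤V vU vV e1 e2 e3 =
      wp-seq (mono (wp-powerOf4 0<q q<W e1) λ t₁ σ₁ (t₁≤ , p , q<4N) → let open Power p ; N = 4 ^ x in
        mono (Core.wp-sampleMedian safeᵏ B U V N (m^n>0 4 x) (small U<W ≤q) (small V<W ≤q)
            (λ p p< → vU p (<-≤-trans p< ≤q)) (λ p p< → vV p (<-≤-trans p< ≤q))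
            (λ a b a<N b<N eq → <⇒≢ (<-≤-trans (+-monoʳ-< U (<-≤-trans a<N ≤q)) (≤-trans U+q≤V (m≤m+n V b))) eq)
            (λ ()) (λ ()) 0 (λ p → value (ar σ₀ (U + p))) σ₁ {x = x} refl (trans r2 e2) (trans r3 e3) r4
            (cf z≤n λ _ p p<N → cong (λ f → value (f (U + p))) (Quiet.arr quiet)))
          λ t₃ σ₃ (t₃≤ , kp , d) →
          linear 5 (λ t t₁ t₃ N q → t₁ ⊑ t ⊕ q ⊗ 20 ⊕ κ 20 ⇒ t₃ ⊑ t₁ ⊕ N ⊗ 450 ⊕ κ 14 ⇒ N ⊑ q ⇒ ⊢ t₃ ⊑ t ⊕ q ⊗ 500 ⊕ κ 60)
            t t₁ t₃ N q t₁≤ t₃≤ ≤q ,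
          Fr-trans (Fr-havoc (proj₁ (Quiet.only quiet))) (frame kp) ,
          SameN-trans 3 {σ₀} {σ₁} {σ₃} (Quiet.bankN quiet) (sameN kp) , SameW-trans 2 {σ₀} {σ₁} {σ₃} (Quiet.bankW quiet) (sameW kp) ,
          central-block (λ p → value (ar σ₀ (U + p))) (value (wr σ₃ 2 0)) ≤q q<4N (Level.lower (fact d (inj₁ refl))))
      where
      small : ∀ {y N} → y + q * 4 + 8 < W → N ≤ q → y + N * 4 + 8 < W
      small {y} {N} big N≤q = linear 4 (λ y N q W → y ⊕ q ⊗ 4 ⊕ κ 8 ⊏ W ⇒ N ⊑ q ⇒ ⊢ y ⊕ N ⊗ 4 ⊕ κ 8 ⊏ W) y N q W big N≤q

  central-cong : ∀ {c q} f g v w → (∀ p → p < q → f p ≡ g p) → v ≡ w → Central c f q v → Central c g q w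
  central-cong {c} {q} f g v .v f≡g refl (lo , hi) =
    subst (λ x → q ≤ x * c) (count-cong q (λ p p<q → cong (atMost v) (f≡g p p<q))) lo ,
    subst (λ x → q ≤ x * c) (count-cong q (λ p p<q → cong (geq v) (f≡g p p<q))) hi

  fr-count : ∀ {U m o m' o'} (χ : Value → Bool) base l → Fr U m o m' o' → (∀ p → p < l → U (base + p)) →
    (count (λ p → χ (value (m (base + p)))) l + length o ≤ count (λ p → χ (value (m' (base + p)))) l + length o')
    × (count (λ p → χ (value (m' (base + p)))) l + length o ≤ count (λ p → χ (value (m (base + p)))) l + length o')
  fr-count {m = m} {o} {m'} {o'} χ base l f inU =
    both (count-dirty (dirty f) base l (λ p p<l ∉D h → trans (cong (χ ∘ value) (clean f (inU p p<l) ∉D)) h)) ,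
    both (count-dirty (dirty f) base l (λ p p<l ∉D h → trans (cong (χ ∘ value) (sym (clean f (inU p p<l) ∉D))) h))
    where
    both : ∀ {c c'} → c ≤ c' + length (dirty f) → c + length o ≤ c' + length o'
    both {c} {c'} h = linear 5 (λ c c' d o o' → c ⊑ c' ⊕ d ⇒ d ⊕ o ⊑ o' ⇒ ⊢ c ⊕ o ⊑ c' ⊕ o') c c' (length (dirty f)) (length o) (length o') h (dirty≤ f)

  setCell-ar : ∀ {k p w σ} → k ≡ faultyᵏ → ar (setCell k p w σ) ≡ ar σ
  setCell-ar refl = refl

  setCell-Fr : ∀ {k B p w σ} → (k ≡ faultyᵏ → B ≤ p) → Fr (_< B) (mem σ) (ow σ) (mem (setCell k p w σ)) (ow σ)
  setCell-Fr {safeᵏ}   h = Fr-refl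
  setCell-Fr {faultyᵏ} h = Fr-write (λ q<B eq → <⇒≱ q<B (subst (_ ≤_) eq (h refl)))

  module Blockwise (k : Kind) (B src dst nb q U V : ℕ) (0<q : 0 < q) (src≤B : src + nb * q ≤ B) (B≤U : B ≤ U)
    (dst≥ : k ≡ faultyᵏ → B ≤ dst) (dst≤ : k ≡ faultyᵏ → dst + nb ≤ U) (validᵈ : ∀ p → p < nb → Valid k (dst + p))
    (U+q≤V : U + q ≤ V) (V<W : V + q * 8 + 16 < W) (dst<W : dst + nb + 4 < W) where

    instance
      q≢0 : NonZero q
      q≢0 = >-nonZero 0<q

    Good : ℕ → View → Set
    Good i σ = Central 16 (λ p → value (mem σ (src + (i * q + p)))) q (value (cells k σ (dst + i)))

    -- Each fault spoils at most three blocks: the one it hits, the one whose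
    -- representative it hits, and the one being processed.
    record Blocks (e j : ℕ) (σ : View) : Set where
      field
        bad  : List ℕ
        few  : length bad + e * 3 ≤ length (ow σ) * 3
        good : ∀ i → i < j → elem i bad ≡ false → Good i σ

    block-of : ∀ i p → p < q → (src + (i * q + p) ∸ src) / q ≡ i
    block-of i p p<q = trans (cong (_/ q) (m+n∸m≡n src (i * q + p)))
      (trans (+-distrib-/-∣ˡ {i * q} p (n∣m*n i)) (trans (cong₂ _+_ (m*n/n≡m i q) (m<n⇒m/n≡0 p<q)) (+-identityʳ i)))

    inside : ∀ {i p} → i < nb → p < q → src + (i * q + p) < B
    inside {i} {p} i<nb p<q = <-≤-trans (+-monoʳ-< src (<-≤-trans (+-monoʳ-< (i * q) p<q)
      (≤-trans (≤-reflexive (+-comm (i * q) q)) (*-monoˡ-≤ q i<nb)))) src≤B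

    blocks-frame : ∀ {e j σ σ'} → j ≤ nb → Fr (_< U) (mem σ) (ow σ) (mem σ') (ow σ') → (k ≡ safeᵏ → ar σ' ≡ ar σ) → Blocks e j σ →
      Σ[ b ∈ Blocks e j σ' ] length (Blocks.bad b) + e * 3 + length (ow σ') ≤ length (ow σ') * 3 + length (ow σ)
    blocks-frame {e} {j} {σ} {σ'} j≤nb f ar≡ b = record
      { bad = map blk D ++ map (_∸ dst) D ++ Blocks.bad b
      ; few = subst (λ x → x + e * 3 ≤ length (ow σ') * 3)
          (sym bad-length)
          (linear 5 (λ d b e o o' → d ⊕ o ⊑ o' ⇒ b ⊕ e ⊗ 3 ⊑ o ⊗ 3 ⇒ ⊢ d ⊕ (d ⊕ b) ⊕ e ⊗ 3 ⊑ o' ⊗ 3)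
            (length D) (length (Blocks.bad b)) e (length (ow σ)) (length (ow σ')) (dirty≤ f) (Blocks.few b))
      ; good = λ i i<j i∉ → let h₁ , h₂ = elem-++ i (map blk D) i∉ ; h₃ , h₄ = elem-++ i (map (_∸ dst) D) h₂ ; i<nb = <-≤-trans i<j j≤nb in
          central-cong _ _ _ _
            (λ p p<q → cong value (sym (clean f (<-≤-trans (inside i<nb p<q) B≤U)
              (elem-map blk (src + (i * q + p)) D (subst (λ x → elem x (map blk D) ≡ false) (sym (block-of' i p p<q)) h₁)))))
            (cong value (sym (cell k refl i i<nb h₃))) (Blocks.good b i i<j h₄) } ,
      subst (λ x → x + e * 3 + length (ow σ') ≤ length (ow σ') * 3 + length (ow σ)) (sym bad-length)
        (linear 5 (λ d b e o o' → d ⊕ o ⊑ o' ⇒ b ⊕ e ⊗ 3 ⊑ o ⊗ 3 ⇒ ⊢ d ⊕ (d ⊕ b) ⊕ e ⊗ 3 ⊕ o' ⊑ o' ⊗ 3 ⊕ o)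
            (length D) (length (Blocks.bad b)) e (length (ow σ)) (length (ow σ')) (dirty≤ f) (Blocks.few b))
      where
      D = dirty f
      blk : ℕ → ℕ
      blk p = (p ∸ src) / q
      block-of' : ∀ i p → p < q → blk (src + (i * q + p)) ≡ i
      block-of' i p p<q = block-of i p p<q
      bad-length : length (map blk D ++ map (_∸ dst) D ++ Blocks.bad b) ≡ length D + (length D + length (Blocks.bad b))
      bad-length = trans (length-++ (map blk D)) (cong₂ _+_ (length-map blk D)
        (trans (length-++ (map (_∸ dst) D)) (cong (_+ length (Blocks.bad b)) (length-map (_∸ dst) D))))
      cell : ∀ k' → k' ≡ k → ∀ i → i < nb → elem i (map (_∸ dst) D) ≡ false → cells k' σ' (dst + i) ≡ cells k' σ (dst + i)
      cell safeᵏ   eq i i<nb _ = cong (λ g → g (dst + i)) (ar≡ (sym eq))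
      cell faultyᵏ eq i i<nb h = clean f (<-≤-trans (+-monoʳ-< dst i<nb) (dst≤ (sym eq)))
        (elem-map (_∸ dst) (dst + i) D (subst (λ x → elem x (map (_∸ dst) D) ≡ false) (sym (m+n∸m≡n dst i)) h))

    record Inv (σ₀ : View) (j : ℕ) (σ : View) : Set a where
      field
        r0 : nr σ 2 0 ≡ src + j * q
        r1 : nr σ 2 1 ≡ dst
        r2 : nr σ 2 2 ≡ j
        r3 : nr σ 2 3 ≡ nb
        r4 : nr σ 2 4 ≡ q
        r5 : nr σ 2 5 ≡ U
        r6 : nr σ 2 6 ≡ V
        j≤ : j ≤ nb
        ctx : Keep 2 2 k B σ₀ σ
        blocks : Blocks (length (ow σ₀)) j σ

    inv-havoc : ∀ {σ₀} j → Stable (Inv σ₀ j)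
    inv-havoc j I h = record { r0 = r0 ; r1 = r1 ; r2 = r2 ; r3 = r3 ; r4 = r4 ; r5 = r5 ; r6 = r6 ; j≤ = j≤
      ; ctx = Keep-trans ctx (Keep-havoc h) ; blocks = proj₁ (blocks-frame j≤ (Fr-havoc (proj₁ h)) (λ _ → refl) blocks) }
      where open Inv I

    0<W : 0 < W
    0<W = ≤-<-trans z≤n V<W

    good-store : ∀ {i j σ} w → i < nb → j < nb → i ≢ j → Good i σ → Good i (setCell k (dst + j) w σ)
    good-store {i} {j} {σ} w i<nb j<nb i≢j = central-cong _ _ _ _ (λ p p<q → cong value (sym (source k refl p p<q))) (cong value (sym (cell k)))
      where
      source : ∀ k' → k' ≡ k → ∀ p → p < q → mem (setCell k' (dst + j) w σ) (src + (i * q + p)) ≡ mem σ (src + (i * q + p))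
      source safeᵏ   _  p p<q = refl
      source faultyᵏ eq p p<q = upd-other (mem σ) (dst + j) w (λ e → <⇒≱ (inside i<nb p<q) (subst (B ≤_) e (≤-trans (dst≥ (sym eq)) (m≤m+n dst j))))
      cell : ∀ k' → cells k' (setCell k' (dst + j) w σ) (dst + i) ≡ cells k' σ (dst + i)
      cell safeᵏ   = upd-other (ar σ) (dst + j) w (λ e → i≢j (sym (+-cancelˡ-≡ dst j i e)))
      cell faultyᵏ = upd-other (mem σ) (dst + j) w (λ e → i≢j (sym (+-cancelˡ-≡ dst j i e)))

    stored : ∀ {j σ} w → j < nb → Central 16 (λ p → value (mem σ (src + (j * q + p)))) q (value w) → Good j (setCell k (dst + j) w σ)
    stored {j} {σ} w j<nb = central-cong _ _ _ _ (λ p p<q → cong value (sym (source k refl p p<q))) (cong value (sym (cell k)))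
      where
      source : ∀ k' → k' ≡ k → ∀ p → p < q → mem (setCell k' (dst + j) w σ) (src + (j * q + p)) ≡ mem σ (src + (j * q + p))
      source safeᵏ   _  p p<q = refl
      source faultyᵏ eq p p<q = upd-other (mem σ) (dst + j) w (λ e → <⇒≱ (inside j<nb p<q) (subst (B ≤_) e (≤-trans (dst≥ (sym eq)) (m≤m+n dst j))))
      cell : ∀ k' → cells k' (setCell k' (dst + j) w σ) (dst + j) ≡ w
      cell safeᵏ   = upd-same (ar σ) (dst + j) w
      cell faultyᵏ = upd-same (mem σ) (dst + j) w

    blocks-next : ∀ {e j σ σ'} w → j < nb → Fr (_< U) (mem σ) (ow σ) (mem σ') (ow σ') → ar σ' ≡ ar σ →
      (length (ow σ') ≡ length (ow σ) → Central 16 (λ p → value (mem σ (src + (j * q + p)))) q (value w)) →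
      Blocks e j σ → Blocks e (suc j) (setCell k (dst + j) w σ')
    blocks-next {e} {j} {σ} {σ'} w j<nb f ar≡ central b with blocks-frame {σ = σ} {σ'} (<⇒≤ j<nb) f (λ _ → ar≡) b | length (ow σ') ≟ length (ow σ)
    ... | b' , spare | yes eq = record { bad = Blocks.bad b' ; few = Blocks.few b' ; good = new }
      where
      new : ∀ i → i < suc j → elem i (Blocks.bad b') ≡ false → Good i (setCell k (dst + j) w σ')
      new i i≤j i∉ with m≤n⇒m<n∨m≡n (s≤s⁻¹ i≤j)
      ... | inj₁ i<j  = good-store {σ = σ'} w (<-trans i<j j<nb) j<nb (<⇒≢ i<j) (Blocks.good b' i i<j i∉)
      ... | inj₂ refl = stored {σ = σ'} w j<nb (central-cong (λ p → value (mem σ (src + (j * q + p)))) (λ p → value (mem σ' (src + (j * q + p)))) (value w) (value w)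
              (λ p p<q → cong value (sym (Fr-calm f eq (<-≤-trans (inside j<nb p<q) B≤U)))) refl (central eq))
    ... | b' , spare | no ne = record { bad = j ∷ Blocks.bad b'
        ; few = linear 4 (λ b e o o' → b ⊕ e ⊗ 3 ⊕ o' ⊑ o' ⊗ 3 ⊕ o ⇒ o ⊏ o' ⇒ ⊢ κ 1 ⊕ b ⊕ e ⊗ 3 ⊑ o' ⊗ 3)
            (length (Blocks.bad b')) e (length (ow σ)) (length (ow σ')) spare (≤∧≢⇒< (Fr-length f) (λ x → ne (sym x)))
        ; good = new }
      where
      new : ∀ i → i < suc j → elem i (j ∷ Blocks.bad b') ≡ false → Good i (setCell k (dst + j) w σ')
      new i i≤j i∉ with ∨-false {i ≡ᵇ j} i∉
      ... | i≢j , i∉' = good-store {σ = σ'} w (<-≤-trans i≤j j<nb) j<nb (≡ᵇ-false i≢j)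
              (Blocks.good b' i (≤∧≢⇒< (s≤s⁻¹ i≤j) (≡ᵇ-false i≢j)) i∉')

    opaque
      wp-collectStep : ∀ {σ₀ j σ t} → Inv σ₀ j σ → j < nb → WP (collectStep k) (Post (t + (q * 500 + 90)) (Inv σ₀ (suc j))) t σ
      wp-collectStep {σ₀} {j} {σ} {t} I j<nb =
        wp-seq (wp-set 0<W λ m₁ o₁ h₁ → wp-seq (wp-set 0<W λ m₂ o₂ h₂ → wp-seq (wp-set 0<W λ m₃ o₃ h₃ → wp-seq (wp-set 0<W λ m₄ o₄ h₄ →
        let h₁₄ = Corr-trans (proj₁ h₁) (Corr-trans (proj₁ h₂) (Corr-trans (proj₁ h₃) (proj₁ h₄))) in
        wp-seq (mono (Block.wp-medianᶠ U (src + j * q) q U V 0<q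
            (linear 3 (λ V q W → V ⊕ q ⊗ 8 ⊕ κ 16 ⊏ W ⇒ ⊢ q ⊗ 8 ⊕ κ 16 ⊏ W) V q W V<W)
            (linear 4 (λ U V q W → V ⊕ q ⊗ 8 ⊕ κ 16 ⊏ W ⇒ U ⊕ q ⊑ V ⇒ ⊢ U ⊕ q ⊗ 4 ⊕ κ 8 ⊏ W) U V q W V<W U+q≤V)
            (linear 3 (λ V q W → V ⊕ q ⊗ 8 ⊕ κ 16 ⊏ W ⇒ ⊢ V ⊕ q ⊗ 4 ⊕ κ 8 ⊏ W) V q W V<W)
            ≤-refl U+q≤V block≤U _ r0 r4 r5 r6) λ t₅ σ₅ (t₅≤ , kp , central) →
        let n₂ = proj₂ (sameN kp) in
        wp-seq (wp-store (subst₂ (λ x y → x + y < W) (sym (trans (cong (λ f → f 1) n₂) r1)) (sym (trans (cong (λ f → f 2) n₂) r2))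
            (linear 4 (λ d j nb W → j ⊏ nb ⇒ d ⊕ nb ⊕ κ 4 ⊏ W ⇒ ⊢ d ⊕ j ⊏ W) dst j nb W j<nb dst<W))
          (subst₂ (λ x y → Valid k (x + y)) (sym (trans (cong (λ f → f 1) n₂) r1)) (sym (trans (cong (λ f → f 2) n₂) r2)) (validᵈ j j<nb)) λ m₆ o₆ h₆ →
        wp-seq (wp-set (subst₂ (λ x y → x + y < W) (sym (trans (cong (λ f → f 0) n₂) r0)) (sym (trans (cong (λ f → f 4) n₂) r4))
            (linear 6 (λ x q B U V W → x ⊕ q ⊑ U ⇒ U ⊕ q ⊑ V ⇒ V ⊕ q ⊗ 8 ⊕ κ 16 ⊏ W ⇒ ⊢ x ⊕ q ⊏ W) (src + j * q) q B U V W block≤U U+q≤V V<W)) λ m₇ o₇ h₇ →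
        wp-set (subst (λ x → 1 + (x + 1) < W) (sym (trans (cong (λ f → f 2) n₂) r2))
            (linear 4 (λ d j nb W → j ⊏ nb ⇒ d ⊕ nb ⊕ κ 4 ⊏ W ⇒ ⊢ κ 1 ⊕ (j ⊕ κ 1) ⊏ W) dst j nb W j<nb dst<W)) λ m₈ o₈ h₈ →
        linear 3 (λ t t₅ q → t₅ ⊑ t ⊕ κ 2 ⊕ κ 2 ⊕ κ 2 ⊕ κ 2 ⊕ q ⊕ κ 60 ⇒ ⊢ t₅ ⊕ κ 4 ⊕ κ 4 ⊕ κ 4 ⊑ t ⊕ (q ⊕ κ 90)) t t₅ (q * 500) t₅≤ ,
        record
          { r0 = trans (cong₂ _+_ (trans (cong (λ f → f 0) n₂) r0) (trans (cong (λ f → f 4) n₂) r4))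
              (trans (+-assoc src (j * q) q) (cong (src +_) (+-comm (j * q) q)))
          ; r1 = trans (cong (λ f → f 1) n₂) r1 ; r2 = trans (+-comm _ 1) (cong suc (trans (cong (λ f → f 2) n₂) r2))
          ; r3 = trans (cong (λ f → f 3) n₂) r3 ; r4 = trans (cong (λ f → f 4) n₂) r4
          ; r5 = trans (cong (λ f → f 5) n₂) r5 ; r6 = trans (cong (λ f → f 6) n₂) r6 ; j≤ = j<nb
          ; ctx = Keep-trans ctx (record { sameN = proj₁ (sameN kp) ; sameW = sameW kp
              ; sameA = λ eq → trans (setCell-ar {k} {nr σ₅ 2 1 + nr σ₅ 2 2} {wr σ₅ 2 0} {havoc σ₅ m₆ o₆} eq) (sameA kp refl)
              ; frame = Fr-trans (Fr-havoc h₁₄) (Fr-trans (Fr-weaken (λ p<B → <-≤-trans p<B B≤U) (frame kp)) (Fr-trans (Fr-havoc (proj₁ h₆)) (Fr-trans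
                  (setCell-Fr {k} {B} {nr σ₅ 2 1 + nr σ₅ 2 2} {wr σ₅ 2 0} {havoc σ₅ m₆ o₆}
                    (λ eq → subst₂ (λ x y → B ≤ x + y) (sym (trans (cong (λ f → f 1) n₂) r1)) (sym (trans (cong (λ f → f 2) n₂) r2)) (≤-trans (dst≥ eq) (m≤m+n dst j))))
                  (Fr-trans (Fr-havoc (proj₁ h₇)) (Fr-havoc (proj₁ h₈)))))) })
          ; blocks = proj₁ (blocks-frame {σ = setCell k (nr σ₅ 2 1 + nr σ₅ 2 2) (wr σ₅ 2 0) (havoc σ₅ m₆ o₆)} j<nb (Fr-trans (Fr-havoc (proj₁ h₇)) (Fr-havoc (proj₁ h₈))) (λ _ → refl)
              (subst₂ (λ x y → Blocks (length (ow σ₀)) (suc j) (setCell k (x + y) (wr σ₅ 2 0) (havoc σ₅ m₆ o₆)))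
                (sym (trans (cong (λ f → f 1) n₂) r1)) (sym (trans (cong (λ f → f 2) n₂) r2))
                (blocks-next {σ = σ} {havoc σ₅ m₆ o₆} (wr σ₅ 2 0) j<nb
                  (Fr-trans (Fr-havoc h₁₄) (Fr-trans (frame kp) (Fr-havoc (proj₁ h₆)))) (sameA kp refl)
                  (λ eq → let calm = squeeze h₁₄ (frame kp) (proj₁ h₆) eq in
                    central-cong _ _ _ _ (λ p p<q → cong value (trans (cong (λ f → f (src + j * q + p)) (proj₁ calm)) (cong (mem σ) (+-assoc src (j * q) p)))) refl
                      (central (proj₂ calm))) blocks))) })))))))
        where
        open Inv I
        block≤U : src + j * q + q ≤ U
        block≤U = ≤-trans (≤-trans (≤-reflexive (trans (+-assoc src (j * q) q) (cong (src +_) (+-comm (j * q) q))))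
          (+-monoʳ-≤ src (*-monoˡ-≤ q j<nb))) (≤-trans src≤B B≤U)
        squeeze : ∀ {m o m' o' m″ o″} → Corr (mem σ) (ow σ) m o → Fr (_< U) m o m' o' → Corr m' o' m″ o″ →
          length o″ ≡ length (ow σ) → m ≡ mem σ × length o' ≡ length o
        squeeze c f d eq with Corr-calm c ≤-refl (≤-antisym (≤-trans (Fr-length f) (≤-trans (Corr-length d) (≤-reflexive eq))) (Corr-length c))
        ... | m≡ , refl = m≡ , ≤-antisym (≤-trans (Corr-length d) (≤-reflexive eq)) (Fr-length f)

    opaque
      wp-collect : ∀ {σ₀ t} → nr σ₀ 2 0 ≡ src → nr σ₀ 2 1 ≡ dst → nr σ₀ 2 3 ≡ nb → nr σ₀ 2 4 ≡ q → nr σ₀ 2 5 ≡ U → nr σ₀ 2 6 ≡ V →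
        WP (collect k) (Post (t + nb * (q * 500 + 100) + 6) (Inv σ₀ nb)) t σ₀
      wp-collect {σ₀} {t} e0 e1 e3 e4 e5 e6 = wp-seq (wp-set 0<W λ m₁ o₁ h₁ →
        mono (wp-for {n = nb} {C = q * 500 + 100} (Inv σ₀) inv-havoc (λ _ → 0<W)
            (λ I lt → subst₂ _<_ (Inv.r2 I) (Inv.r3 I) (<ᵇ-true _ _ lt))
            (λ I ge → ≤-antisym (Inv.j≤ I) (subst₂ _≤_ (Inv.r3 I) (Inv.r2 I) (<ᵇ-false _ _ ge)))
            wp-collectStep (linear 1 (λ x → ⊢ x ⊕ κ 90 ⊕ κ 4 ⊑ x ⊕ κ 100) (q * 500))
            (record { r0 = trans e0 (sym (+-identityʳ src)) ; r1 = e1 ; r2 = refl ; r3 = e3 ; r4 = e4 ; r5 = e5 ; r6 = e6 ; j≤ = z≤n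
              ; ctx = Keep-trans (Keep-havoc h₁) (Keep-setN {b = 2} {2} {0})
              ; blocks = record { bad = [] ; few = *-monoˡ-≤ 3 (Corr-length (proj₁ h₁)) ; good = λ _ () } }))
          λ t' σ' (t'≤ , I) → ≤-trans t'≤ (≤-reflexive (linear 2 (λ t x → ⊢ t ⊕ κ 2 ⊕ x ⊕ κ 4 ≐ t ⊕ x ⊕ κ 6) t (nb * (q * 500 + 100)))) , I)

  rankOf : (Value → Bool) → ℕ → ℕ → View → ℕ
  rankOf χ base l σ = count (λ p → χ (value (mem σ (base + p)))) l

  -- c is the count of χ on the first i words of the array, up to the faults since there were e.
  Approx : (Value → Bool) → (base i c e : ℕ) → View → Set
  Approx χ base i c e σ =
    (rankOf χ base i σ + e ≤ c + length (ow σ)) × (c + e ≤ rankOf χ base i σ + length (ow σ))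

  approx-fr : ∀ χ base i {U : ℕ → Set} {c e σ σ'} → Fr U (mem σ) (ow σ) (mem σ') (ow σ') → (∀ p → p < i → U (base + p)) →
    Approx χ base i c e σ → Approx χ base i c e σ'
  approx-fr χ base i {c = c} {e} {σ} {σ'} f inU (h₁ , h₂) with fr-count χ base i f inU
  ... | g₁ , g₂ =
    linear 6 (λ r r' c e o o' → r' ⊕ o ⊑ r ⊕ o' ⇒ r ⊕ e ⊑ c ⊕ o ⇒ ⊢ r' ⊕ e ⊑ c ⊕ o')
      (rankOf χ base i σ) (rankOf χ base i σ') c e (length (ow σ)) (length (ow σ')) g₂ h₁ ,
    linear 6 (λ r r' c e o o' → r ⊕ o ⊑ r' ⊕ o' ⇒ c ⊕ e ⊑ r ⊕ o ⇒ ⊢ c ⊕ e ⊑ r' ⊕ o')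
      (rankOf χ base i σ) (rankOf χ base i σ') c e (length (ow σ)) (length (ow σ')) g₁ h₂

  approx-suc : ∀ χ base i {c c' e} σ → c' ≡ c + bit (χ (value (mem σ (base + i)))) → Approx χ base i c e σ → Approx χ base (suc i) c' e σ
  approx-suc χ base i {c} {_} {e} σ refl (h₁ , h₂) =
    linear 5 (λ r c e o b → r ⊕ e ⊑ c ⊕ o ⇒ ⊢ r ⊕ b ⊕ e ⊑ c ⊕ b ⊕ o) (rankOf χ base i σ) c e (length (ow σ)) (bit (χ (value (mem σ (base + i))))) h₁ ,
    linear 5 (λ r c e o b → c ⊕ e ⊑ r ⊕ o ⇒ ⊢ c ⊕ b ⊕ e ⊑ r ⊕ b ⊕ o) (rankOf χ base i σ) c e (length (ow σ)) (bit (χ (value (mem σ (base + i))))) h₂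

  module Ranking (base t : ℕ) (bound : base + t + 4 < W) (σ₀ : View) where

    v : Value
    v = value (wr σ₀ 2 0)

    e : ℕ
    e = length (ow σ₀)

    record Frame₁ (σ : View) : Set a where
      field
        bank0 : nr σ 0 ≡ nr σ₀ 0
        r0 : nr σ 1 0 ≡ base
        r1 : nr σ 1 1 ≡ t
        r2 : nr σ 1 2 ≡ nr σ₀ 1 2
        r3 : nr σ 1 3 ≡ nr σ₀ 1 3
        r7 : nr σ 1 7 ≡ nr σ₀ 1 7
        words0 : wr σ 0 ≡ wr σ₀ 0
        words2 : wr σ 2 ≡ wr σ₀ 2
        only : Corr (mem σ₀) (ow σ₀) (mem σ) (ow σ)

    record Inv (i : ℕ) (σ : View) : Set a where
      field
        frame₁ : Frame₁ σ
        r6 : nr σ 1 6 ≡ i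
        i≤ : i ≤ t
        lo : Approx (atMost v) base i (nr σ 1 4) e σ
        hi : Approx (geq v) base i (nr σ 1 5) e σ
        le≤ : nr σ 1 4 ≤ i
        ge≤ : nr σ 1 5 ≤ i

    frame-havoc : Stable Frame₁
    frame-havoc I h = record { bank0 = bank0 ; r0 = r0 ; r1 = r1 ; r2 = r2 ; r3 = r3 ; r7 = r7 ; words0 = words0 ; words2 = words2 ; only = Corr-trans only (proj₁ h) }
      where open Frame₁ I

    inv-havoc : ∀ i → Stable (Inv i)
    inv-havoc i {σ} {m} {o} I h = record { frame₁ = frame-havoc frame₁ h ; r6 = r6 ; i≤ = i≤
      ; lo = approx-fr (atMost v) base i {U = λ _ → ⊤} {σ = σ} {havoc σ m o} (Fr-havoc (proj₁ h)) (λ _ _ → tt) lo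
      ; hi = approx-fr (geq v) base i {U = λ _ → ⊤} {σ = σ} {havoc σ m o} (Fr-havoc (proj₁ h)) (λ _ _ → tt) hi ; le≤ = le≤ ; ge≤ = ge≤ }
      where open Inv I

    0<W : 0 < W
    0<W = ≤-<-trans z≤n bound

    record Read (i : ℕ) (x : Word) (σ₁ σ : View) : Set a where
      field
        frame₁ : Frame₁ σ
        r6 : nr σ 1 6 ≡ i
        x≡ : wr σ 1 0 ≡ x
        since₁ : Corr (mem σ₁) (ow σ₁) (mem σ) (ow σ)
        x₁ : x ≡ mem σ₁ (base + i)

    record Counted (i : ℕ) (x : Word) (σ₁ : View) (c d : ℕ) (σ : View) : Set a where
      field
        read : Read i x σ₁ σ
        r4 : nr σ 1 4 ≡ c
        r5 : nr σ 1 5 ≡ d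

    counted-havoc : ∀ {i x σ₁ c d} → Stable (Counted i x σ₁ c d)
    counted-havoc I h = record { r4 = r4 ; r5 = r5 ; read = record { frame₁ = frame-havoc frame₁ h ; r6 = r6 ; x≡ = x≡ ; since₁ = Corr-trans since₁ (proj₁ h) ; x₁ = x₁ } }
      where
      open Counted I
      open Read read

    opaque
      wp-countLo : ∀ {i x σ₁ c d σ t'} → c ≤ t → Counted i x σ₁ c d σ →
        WP (ite (wrd 2 0 <ʷ wrd 1 0) skip (num 1 4 ≔ r 1 4 ∔ lit 1)) (Post (t' + 6) (Counted i x σ₁ (c + bit (atMost v (value x))) d)) t' σ
      wp-countLo {i} {x} {σ₁} {c} {d} {σ} {t'} c≤ I = relax (linear 1 (λ t → ⊢ t ⊕ κ 5 ⊕ κ 1 ⊑ t ⊕ κ 6) t') (wp-ite-post counted-havoc 0<W λ m o h →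
        (λ lt → wp-skip (linear 1 (λ t → ⊢ t ⊕ κ 1 ⊑ t ⊕ κ 5) t' ,
          subst (λ z → Counted i x σ₁ z d (havoc σ m o)) (trans (sym (+-identityʳ c)) (cong (λ z → c + bit (not z)) (sym (trans (sym less≡) lt)))) (counted-havoc I h))) ,
        (λ ge → wp-set (subst (λ z → 1 + (z + 1) < W) (sym r4) (linear 4 (λ c b t W → c ⊑ t ⇒ b ⊕ t ⊕ κ 4 ⊏ W ⇒ ⊢ κ 1 ⊕ (c ⊕ κ 1) ⊏ W) c base t W c≤ bound)) λ m' o' h' →
          let J = counted-havoc (counted-havoc I h) h' in
          linear 1 (λ t → ⊢ t ⊕ κ 1 ⊕ κ 4 ⊑ t ⊕ κ 5) t' ,
          record { r4 = trans (cong (_+ 1) r4) (cong (λ z → c + bit (not z)) (sym (trans (sym less≡) ge))) ; r5 = r5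
                 ; read = record { frame₁ = record { Frame₁ (Read.frame₁ (Counted.read J)) } ; r6 = r6 ; x≡ = x≡ ; since₁ = Read.since₁ (Counted.read J) ; x₁ = x₁ } }))
        where
        open Counted I
        open Read read
        less≡ : less (value (wr σ 2 0)) (value (wr σ 1 0)) ≡ less v (value x)
        less≡ = cong₂ (λ a b → less (value a) (value b)) (cong (λ f → f 0) (Frame₁.words2 frame₁)) x≡

    opaque
      wp-countHi : ∀ {i x σ₁ c d σ t'} → d ≤ t → Counted i x σ₁ c d σ →
        WP (ite (wrd 1 0 <ʷ wrd 2 0) skip (num 1 5 ≔ r 1 5 ∔ lit 1)) (Post (t' + 6) (Counted i x σ₁ c (d + bit (geq v (value x))))) t' σ
      wp-countHi {i} {x} {σ₁} {c} {d} {σ} {t'} d≤ I = relax (linear 1 (λ t → ⊢ t ⊕ κ 5 ⊕ κ 1 ⊑ t ⊕ κ 6) t') (wp-ite-post counted-havoc 0<W λ m o h →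
        (λ lt → wp-skip (linear 1 (λ t → ⊢ t ⊕ κ 1 ⊑ t ⊕ κ 5) t' ,
          subst (λ z → Counted i x σ₁ c z (havoc σ m o)) (trans (sym (+-identityʳ d)) (cong (λ z → d + bit (not z)) (sym (trans (sym less≡) lt)))) (counted-havoc I h))) ,
        (λ ge → wp-set (subst (λ z → 1 + (z + 1) < W) (sym r5) (linear 4 (λ c b t W → c ⊑ t ⇒ b ⊕ t ⊕ κ 4 ⊏ W ⇒ ⊢ κ 1 ⊕ (c ⊕ κ 1) ⊏ W) d base t W d≤ bound)) λ m' o' h' →
          let J = counted-havoc (counted-havoc I h) h' in
          linear 1 (λ t → ⊢ t ⊕ κ 1 ⊕ κ 4 ⊑ t ⊕ κ 5) t' ,
          record { r5 = trans (cong (_+ 1) r5) (cong (λ z → d + bit (not z)) (sym (trans (sym less≡) ge))) ; r4 = r4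
                 ; read = record { frame₁ = record { Frame₁ (Read.frame₁ (Counted.read J)) } ; r6 = r6 ; x≡ = x≡ ; since₁ = Read.since₁ (Counted.read J) ; x₁ = x₁ } }))
        where
        open Counted I
        open Read read
        less≡ : less (value (wr σ 1 0)) (value (wr σ 2 0)) ≡ less (value x) v
        less≡ = cong₂ (λ a b → less (value a) (value b)) x≡ (cong (λ f → f 0) (Frame₁.words2 frame₁))

    opaque
      wp-rankStep : ∀ {i σ t'} → Inv i σ → i < t → WP rankStep (Post (t' + 24) (Inv (suc i))) t' σ
      wp-rankStep {i} {σ} {t'} I i<t =
        wp-seq (wp-load (subst₂ (λ x y → x + y < W) (sym r0) (sym r6) (linear 4 (λ b i t W → i ⊏ t ⇒ b ⊕ t ⊕ κ 4 ⊏ W ⇒ ⊢ b ⊕ i ⊏ W) base i t W i<t bound)) ≤-refl λ m₁ o₁ h₁ →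
        let σ₁ = havoc σ m₁ o₁ ; x = m₁ (nr σ 1 0 + nr σ 1 6) ; J = inv-havoc i I h₁ in let module J = Inv J in
        wp-seq (mono (wp-countLo {i} {x} {σ₁} (≤-trans le≤ i≤) (record { r4 = refl ; r5 = refl ; read = record
            { frame₁ = record { Frame₁ J.frame₁ } ; r6 = r6 ; x≡ = refl ; since₁ = none
            ; x₁ = cong₂ (λ a b → m₁ (a + b)) r0 r6 } })) λ t₂ σ₂ (t₂≤ , C₂) →
        wp-seq (mono (wp-countHi (≤-trans ge≤ i≤) C₂) λ t₃ σ₃ (t₃≤ , C₃) → let open Counted C₃ in let open Read read renaming (r6 to r6') in
        wp-set (subst (λ z → 1 + (z + 1) < W) (sym r6') (linear 4 (λ c b t W → c ⊏ t ⇒ b ⊕ t ⊕ κ 4 ⊏ W ⇒ ⊢ κ 1 ⊕ (c ⊕ κ 1) ⊏ W) i base t W i<t bound)) λ m₄ o₄ h₄ →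
        linear 3 (λ t t₂ t₃ → t₂ ⊑ t ⊕ κ 4 ⊕ κ 6 ⇒ t₃ ⊑ t₂ ⊕ κ 6 ⇒ ⊢ t₃ ⊕ κ 4 ⊑ t ⊕ κ 24) t' t₂ t₃ t₂≤ t₃≤ ,
        record
          { frame₁ = record { Frame₁ (frame-havoc (Read.frame₁ (Counted.read C₃)) h₄) }
          ; r6 = trans (+-comm _ 1) (cong suc r6') ; i≤ = i<t
          ; lo = approx-fr (atMost v) base (suc i) {U = λ _ → ⊤} {σ = σ₁} {havoc σ₃ m₄ o₄} (Fr-havoc (Corr-trans since₁ (proj₁ h₄))) (λ _ _ → tt)
              (approx-suc (atMost v) base i σ₁ (trans r4 (cong (λ w → nr σ 1 4 + bit (atMost v (value w))) x₁)) J.lo)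
          ; hi = approx-fr (geq v) base (suc i) {U = λ _ → ⊤} {σ = σ₁} {havoc σ₃ m₄ o₄} (Fr-havoc (Corr-trans since₁ (proj₁ h₄))) (λ _ _ → tt)
              (approx-suc (geq v) base i σ₁ (trans r5 (cong (λ w → nr σ 1 5 + bit (geq v (value w))) x₁)) J.hi)
          ; le≤ = subst (_≤ suc i) (sym r4) (grow le≤ (atMost v (value x)))
          ; ge≤ = subst (_≤ suc i) (sym r5) (grow ge≤ (geq v (value x))) })))
        where
        open Inv I
        open Frame₁ frame₁
        grow : ∀ {c} → c ≤ i → ∀ b → c + bit b ≤ suc i
        grow {c} c≤ b = subst (c + bit b ≤_) (+-comm i 1) (+-mono-≤ c≤ (bit≤1 b))

    opaque
      wp-rank : ∀ {t'} → nr σ₀ 1 0 ≡ base → nr σ₀ 1 1 ≡ t → WP rank (Post (t' + t * 30 + 10) (Inv t)) t' σ₀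
      wp-rank {t'} e0 e1 = wp-seq (wp-set 0<W λ m₁ o₁ h₁ → wp-seq (wp-set 0<W λ m₂ o₂ h₂ → wp-seq (wp-set 0<W λ m₃ o₃ h₃ →
        let c = Corr-trans (proj₁ h₁) (Corr-trans (proj₁ h₂) (proj₁ h₃)) in
        mono (wp-for {n = t} {C = 30} Inv inv-havoc (λ _ → 0<W)
          (λ I lt → subst₂ _<_ (Inv.r6 I) (Frame₁.r1 (Inv.frame₁ I)) (<ᵇ-true _ _ lt))
          (λ I ge → ≤-antisym (Inv.i≤ I) (subst₂ _≤_ (Frame₁.r1 (Inv.frame₁ I)) (Inv.r6 I) (<ᵇ-false _ _ ge)))
          wp-rankStep (≤ᵇ⇒≤ 28 30 tt)
          (record { frame₁ = record { bank0 = refl ; r0 = e0 ; r1 = e1 ; r2 = refl ; r3 = refl ; r7 = refl ; words0 = refl ; words2 = refl ; only = c }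
            ; r6 = refl ; i≤ = z≤n ; lo = Corr-length c , Corr-length c ; hi = Corr-length c , Corr-length c ; le≤ = z≤n ; ge≤ = z≤n }))
        λ t″ σ' (t″≤ , I) → ≤-trans t″≤ (≤-reflexive (linear 2 (λ t x → ⊢ t ⊕ κ 2 ⊕ κ 2 ⊕ κ 2 ⊕ x ⊕ κ 4 ≐ t ⊕ x ⊕ κ 10) t' (t * 30))) , I)))

  Rich : ℕ → ℕ → (Value → Bool) → ℕ → ℕ → View → Set
  Rich κ' e χ base t σ = t + e * κ' ≤ rankOf χ base t σ * κ' + length (ow σ) * κ'

  rich-fr : ∀ κ' e χ base t {U : ℕ → Set} {σ σ'} → Fr U (mem σ) (ow σ) (mem σ') (ow σ') → (∀ p → p < t → U (base + p)) →
    Rich κ' e χ base t σ → Rich κ' e χ base t σ'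
  rich-fr κ' e χ base t {σ = σ} {σ'} f inU h = ≤-trans h (subst₂ _≤_ (*-distribʳ-+ κ' (rankOf χ base t σ) (length (ow σ)))
    (*-distribʳ-+ κ' (rankOf χ base t σ') (length (ow σ'))) (*-monoˡ-≤ κ' (proj₁ (fr-count χ base t f inU))))

  module Attempt (base t U V nb q Q : ℕ) (0<nb : 0 < nb) (0<q : 0 < q) (nb≤S : nb ≤ S) (nb≤t : nb ≤ t) (nbq≤t : nb * q ≤ t) (t≤ : t ≤ nb * q + nb * q)
    (q≤Q : q ≤ Q) (base+t≤U : base + t ≤ U) (U+t≤V : U + t ≤ V) (V<W : V + t * 1100 + 2000 < W) (room : arrays + (S + S) ≤ M) (M<W : M + S * 16 + 200 < W)
    (σ₀ : View) (eU : nr σ₀ 0 13 ≡ U) (eV : nr σ₀ 0 14 ≡ V) where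

    record Ctx (σ : View) : Set a where
      field
        bank0 : nr σ 0 ≡ nr σ₀ 0
        r0 : nr σ 1 0 ≡ base
        r1 : nr σ 1 1 ≡ t
        r2 : nr σ 1 2 ≡ nb
        r3 : nr σ 1 3 ≡ q
        words0 : wr σ 0 ≡ wr σ₀ 0
        fr : Fr (_< U) (mem σ₀) (ow σ₀) (mem σ) (ow σ)

    ctx-havoc : Stable Ctx
    ctx-havoc I h = record { bank0 = bank0 ; r0 = r0 ; r1 = r1 ; r2 = r2 ; r3 = r3 ; words0 = words0 ; fr = Fr-trans fr (Fr-havoc (proj₁ h)) }
      where open Ctx I

    e₀ : ℕ
    e₀ = length (ow σ₀)

    Accepted : View → Set
    Accepted σ = Rich 1024 e₀ (atMost (value (wr σ 2 0))) base t σ × Rich 1024 e₀ (geq (value (wr σ 2 0))) base t σ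

    data Outcome (o : ℕ) (σ : View) : Set where
      retry  : nr σ 1 7 ≡ 0 → t + o * Q * 2240 ≤ length (ow σ) * Q * 2240 → Outcome o σ
      accept : nr σ 1 7 ≡ 1 → o ≤ length (ow σ) → Accepted σ → Outcome o σ

    outcome-havoc : ∀ {o} → Stable (Outcome o)
    outcome-havoc (retry z h) hv = retry z (≤-trans h (*-monoˡ-≤ 2240 (*-monoˡ-≤ Q (Corr-length (proj₁ hv)))))
    outcome-havoc {o} {σ} {m} {o'} (accept z o≤ (h₁ , h₂)) hv = accept z (≤-trans o≤ (Corr-length (proj₁ hv)))
      (rich-fr 1024 e₀ (atMost (value (wr σ 2 0))) base t {λ _ → ⊤} {σ} {havoc σ m o'} (Fr-havoc (proj₁ hv)) (λ _ _ → tt) h₁ ,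
       rich-fr 1024 e₀ (geq (value (wr σ 2 0))) base t {λ _ → ⊤} {σ} {havoc σ m o'} (Fr-havoc (proj₁ hv)) (λ _ _ → tt) h₂)

    opaque
      -- r₁ and r₃ are the ranks when the blocks have been processed and at the end.
      estimate : ∀ g E r₁ r₃ c o o₁ o₂ o₃ → nb ≤ g * 16 → g * q ≤ r₁ * 16 + E * q → E + o * 3 ≤ o₁ * 3 →
        r₁ + o₁ ≤ r₃ + o₃ → r₃ + o₂ ≤ c + o₃ → o ≤ o₁ → o ≤ o₂ → o₁ ≤ o₃ → t ≤ c * 512 + (o₃ ∸ o) * q * 1120
      estimate g E r₁ r₃ c o o₁ o₂ o₃ nb≤ gq≤ E≤ r₁≤ r₃≤ o≤o₁ o≤o₂ o₁≤o₃ =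
        linear 8 (λ t nbq gq r c Eq D Dq → t ⊑ nbq ⊕ nbq ⇒ nbq ⊑ gq ⊗ 16 ⇒ gq ⊑ r ⊗ 16 ⊕ Eq ⇒ r ⊑ c ⊕ D ⊗ 2 ⇒ Eq ⊑ Dq ⊗ 3 ⇒ D ⊑ Dq ⇒ ⊢ t ⊑ c ⊗ 512 ⊕ Dq ⊗ 1120)
          t (nb * q) (g * q) r₁ c (E * q) D (D * q) t≤
          (≤-trans (*-monoˡ-≤ q nb≤) (≤-reflexive (trans (*-assoc g 16 q) (trans (cong (g *_) (*-comm 16 q)) (sym (*-assoc g q 16)))))) gq≤
          (linear 8 (λ r₁ r₃ c o o₁ o₂ o₃ D → r₁ ⊕ o₁ ⊑ r₃ ⊕ o₃ ⇒ r₃ ⊕ o₂ ⊑ c ⊕ o₃ ⇒ o ⊑ o₁ ⇒ o ⊑ o₂ ⇒ D ⊕ o ≐ o₃ ⇒ ⊢ r₁ ⊑ c ⊕ D ⊗ 2) r₁ r₃ c o o₁ o₂ o₃ D r₁≤ r₃≤ o≤o₁ o≤o₂ D≡)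
          (≤-trans (*-monoˡ-≤ q (linear 5 (λ E o o₁ o₃ D → E ⊕ o ⊗ 3 ⊑ o₁ ⊗ 3 ⇒ o₁ ⊑ o₃ ⇒ D ⊕ o ≐ o₃ ⇒ ⊢ E ⊑ D ⊗ 3) E o o₁ o₃ D E≤ o₁≤o₃ D≡))
            (≤-reflexive (trans (*-assoc D 3 q) (trans (cong (D *_) (*-comm 3 q)) (sym (*-assoc D q 3))))))
          (≤-trans (≤-reflexive (sym (*-identityʳ D))) (*-monoʳ-≤ D 0<q))
        where
        D : ℕ
        D = o₃ ∸ o
        D≡ : D + o ≡ o₃
        D≡ = m∸n+n≡m (≤-trans o≤o₁ o₁≤o₃)

      too-few : ∀ c o o₃ o₄ → t ≤ c * 512 + (o₃ ∸ o) * q * 1120 → c * 1024 < t → o ≤ o₃ → o₃ ≤ o₄ → t + o * Q * 2240 ≤ o₄ * Q * 2240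
      too-few c o o₃ o₄ h few o≤ o₃≤ = ≤-trans
        (linear 5 (λ t c Dq oQ o₃Q → t ⊑ c ⊗ 512 ⊕ Dq ⊗ 1120 ⇒ c ⊗ 1024 ⊏ t ⇒ Dq ⊕ oQ ⊑ o₃Q ⇒ ⊢ t ⊕ oQ ⊗ 2240 ⊑ o₃Q ⊗ 2240)
          t c ((o₃ ∸ o) * q) (o * Q) (o₃ * Q) h few
          (≤-trans (+-monoˡ-≤ (o * Q) (*-monoʳ-≤ (o₃ ∸ o) q≤Q)) (≤-reflexive (trans (sym (*-distribʳ-+ Q (o₃ ∸ o) o)) (cong (_* Q) (m∸n+n≡m o≤))))))
        (*-monoˡ-≤ 2240 (*-monoˡ-≤ Q o₃≤))

      enough : ∀ c o o₂ o₃ r₃ → t ≤ c * 1024 → c + o₂ ≤ r₃ + o₃ → o ≤ o₂ → t + o * 1024 ≤ r₃ * 1024 + o₃ * 1024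
      enough c o o₂ o₃ r₃ = linear 6 (λ t c o o₂ o₃ r₃ → t ⊑ c ⊗ 1024 ⇒ c ⊕ o₂ ⊑ r₃ ⊕ o₃ ⇒ o ⊑ o₂ ⇒ ⊢ t ⊕ o ⊗ 1024 ⊑ r₃ ⊗ 1024 ⊕ o₃ ⊗ 1024) t c o o₂ o₃ r₃

      attempt-time : ∀ τ τ₁ τ₂ τ₃ → τ₁ ≤ τ + 2 + 2 + 2 + 2 + 2 + 2 + nb * (q * 500 + 100) + 6 → τ₂ ≤ τ₁ + 2 + 2 + 4 + nb * 500 + 60 →
        τ₃ ≤ τ₂ + t * 30 + 10 → τ₃ + 30 ≤ τ + t * 1300
      attempt-time τ τ₁ τ₂ τ₃ h₁ h₂ h₃ = linear 8 (λ τ τ₁ τ₂ τ₃ t nb nbq x → τ₁ ⊑ τ ⊕ κ 2 ⊕ κ 2 ⊕ κ 2 ⊕ κ 2 ⊕ κ 2 ⊕ κ 2 ⊕ x ⊕ κ 6 ⇒ τ₂ ⊑ τ₁ ⊕ κ 2 ⊕ κ 2 ⊕ κ 4 ⊕ nb ⊗ 500 ⊕ κ 60 ⇒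
          τ₃ ⊑ τ₂ ⊕ t ⊗ 30 ⊕ κ 10 ⇒ x ≐ nbq ⊗ 500 ⊕ nb ⊗ 100 ⇒ nbq ⊑ t ⇒ nb ⊑ t ⇒ κ 1 ⊑ nb ⇒ ⊢ τ₃ ⊕ κ 30 ⊑ τ ⊕ t ⊗ 1300)
        τ τ₁ τ₂ τ₃ t nb (nb * q) (nb * (q * 500 + 100)) h₁ h₂ h₃
        (trans (*-distribˡ-+ nb (q * 500) 100) (cong (_+ nb * 100) (sym (*-assoc nb q 500)))) nbq≤t nb≤t 0<nb

    module C = Blockwise safeᵏ U base arrays nb q U V 0<q (≤-trans (+-monoʳ-≤ base nbq≤t) base+t≤U) ≤-refl (λ ()) (λ ())
      (λ p p<nb → m≤m+n arrays p , <-≤-trans (+-monoʳ-< arrays (<-≤-trans p<nb (≤-trans nb≤S (m≤m+n S S)))) room)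
      (≤-trans (+-monoʳ-≤ U (≤-trans (≤-trans (≤-reflexive (sym (*-identityˡ q))) (*-monoˡ-≤ q 0<nb)) nbq≤t)) U+t≤V)
      (linear 4 (λ V q t W → V ⊕ t ⊗ 1100 ⊕ κ 2000 ⊏ W ⇒ q ⊑ t ⇒ ⊢ V ⊕ q ⊗ 8 ⊕ κ 16 ⊏ W) V q t W V<W
        (≤-trans (≤-trans (≤-reflexive (sym (*-identityˡ q))) (*-monoˡ-≤ q 0<nb)) nbq≤t))
      (linear 4 (λ nb S M W → nb ⊑ S ⇒ κ 144 ⊕ (S ⊕ S) ⊑ M ⇒ M ⊕ S ⊗ 16 ⊕ κ 200 ⊏ W ⇒ ⊢ κ 144 ⊕ nb ⊕ κ 4 ⊏ W) nb S M W nb≤S room M<W)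

    -- The pivot is at least as central as the block medians that were not spoiled.
    blocks-rank : ∀ {e σ₁} (χ : Value → Bool) v → (χ ≡ atMost v ⊎ χ ≡ geq v) → (b : C.Blocks e nb σ₁) →
      Central 16 (λ p → value (ar σ₁ (arrays + p))) nb v →
      ∃[ g ] nb ≤ g * 16 × g * q ≤ rankOf χ base t σ₁ * 16 + length (C.Blocks.bad b) * q
    blocks-rank {e} {σ₁} χ v which b (c₁ , c₂) = count (λ j → χ (u j)) nb , majority which ,
      ≤-trans (count-blocks {λ p → χ (value (mem σ₁ (base + p)))} {λ j → χ (u j)} q (C.Blocks.bad b) nb
          (λ j j<nb gj j∉ → block j which gj (C.Blocks.good b j j<nb j∉)))
        (+-monoˡ-≤ (length (C.Blocks.bad b) * q) (*-monoˡ-≤ 16 (count-extend (λ p → χ (value (mem σ₁ (base + p)))) nbq≤t)))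
      where
      u : ℕ → Value
      u j = value (ar σ₁ (arrays + j))
      majority : (χ ≡ atMost v ⊎ χ ≡ geq v) → nb ≤ count (λ j → χ (u j)) nb * 16
      majority (inj₁ refl) = c₁
      majority (inj₂ refl) = c₂
      block : ∀ j → (χ ≡ atMost v ⊎ χ ≡ geq v) → χ (u j) ≡ true → C.Good j σ₁ →
        q ≤ count (λ p → χ (value (mem σ₁ (base + (j * q + p))))) q * 16
      block j (inj₁ refl) gj (l , _) = ≤-trans l (*-monoˡ-≤ 16 (count-mono q (λ p p<q h →
        not-false (not-less (≼-trans {value (mem σ₁ (base + (j * q + p)))} {u j} {v} (le (not-true h)) (le (not-true gj)))))))
      block j (inj₂ refl) gj (_ , l) = ≤-trans l (*-monoˡ-≤ 16 (count-mono q (λ p p<q h →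
        not-false (not-less (≼-trans {v} {u j} {value (mem σ₁ (base + (j * q + p)))} (le (not-true gj)) (le (not-true h)))))))

    0<W : 0 < W
    0<W = ≤-<-trans z≤n V<W

    record Ranked (o : ℕ) (σ₃ : View) : Set a where
      field
        ctx  : Ctx σ₃
        flag : nr σ₃ 1 7 ≡ 0
        le≤  : nr σ₃ 1 4 ≤ t
        ge≤  : nr σ₃ 1 5 ≤ t
        o₂   : ℕ
        o≤o₂ : o ≤ o₂
        e≤o₂ : e₀ ≤ o₂
        o≤o₃ : o ≤ length (ow σ₃)
        lo   : Approx (atMost (value (wr σ₃ 2 0))) base t (nr σ₃ 1 4) o₂ σ₃
        hi   : Approx (geq (value (wr σ₃ 2 0))) base t (nr σ₃ 1 5) o₂ σ₃
        many : t ≤ nr σ₃ 1 4 * 512 + (length (ow σ₃) ∸ o) * q * 1120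
        more : t ≤ nr σ₃ 1 5 * 512 + (length (ow σ₃) ∸ o) * q * 1120

    opaque
      wp-judge : ∀ {o σ₃ τ} → Ranked o σ₃ →
        WP (ite (r 1 4 ×ₑ lit 1024 <ₙ r 1 1) skip (ite (r 1 5 ×ₑ lit 1024 <ₙ r 1 1) skip (num 1 7 ≔ lit 1)))
          (Post (τ + 20 + 1) (λ σ → Ctx σ × Outcome o σ)) τ σ₃
      wp-judge {o} {σ₃} {τ} R = wp-ite-post stable (peak≤ le≤) λ m₁ o₁ h₁ →
        (λ lt → wp-skip (linear 1 (λ t → ⊢ t ⊕ κ 5 ⊑ t ⊕ κ 20) τ , ctx-havoc ctx h₁ ,
          retry flag (too-few (nr σ₃ 1 4) o (length (ow σ₃)) (length o₁) many (subst (nr σ₃ 1 4 * 1024 <_) r1 (<ᵇ-true _ _ lt)) o≤o₃ (Corr-length (proj₁ h₁))))) ,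
        (λ ge → relax (linear 1 (λ t → ⊢ t ⊕ κ 5 ⊕ κ 10 ⊕ κ 1 ⊑ t ⊕ κ 20) τ) (wp-ite-post stable (peak≤ ge≤) λ m₂ o₂' h₂ →
          (λ lt → wp-skip (linear 1 (λ t → ⊢ t ⊕ κ 5 ⊕ κ 5 ⊑ t ⊕ κ 5 ⊕ κ 10) τ , ctx-havoc (ctx-havoc ctx h₁) h₂ ,
            retry flag (too-few (nr σ₃ 1 5) o (length (ow σ₃)) (length o₂') more (subst (nr σ₃ 1 5 * 1024 <_) r1 (<ᵇ-true _ _ lt)) o≤o₃ (Corr-length (Corr-trans (proj₁ h₁) (proj₁ h₂)))))) ,
          (λ ge' → wp-set 1<W λ m₃ o₃ h₃ → linear 1 (λ t → ⊢ t ⊕ κ 5 ⊕ κ 5 ⊕ κ 2 ⊑ t ⊕ κ 5 ⊕ κ 10) τ ,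
            record { Ctx (ctx-havoc (ctx-havoc (ctx-havoc ctx h₁) h₂) h₃) } ,
            accept refl (≤-trans o≤o₃ (Corr-length (Corr-trans (proj₁ h₁) (Corr-trans (proj₁ h₂) (proj₁ h₃)))))
              (rich-fr 1024 e₀ (atMost v) base t {λ _ → ⊤} {σ₃} {havoc σ₃ m₃ o₃} (Fr-havoc (Corr-trans (proj₁ h₁) (Corr-trans (proj₁ h₂) (proj₁ h₃)))) (λ _ _ → tt)
                (enough (nr σ₃ 1 4) e₀ o₂ (length (ow σ₃)) (rankOf (atMost v) base t σ₃) (subst (_≤ nr σ₃ 1 4 * 1024) r1 (<ᵇ-false _ _ ge)) (proj₂ lo) e≤o₂) ,
               rich-fr 1024 e₀ (geq v) base t {λ _ → ⊤} {σ₃} {havoc σ₃ m₃ o₃} (Fr-havoc (Corr-trans (proj₁ h₁) (Corr-trans (proj₁ h₂) (proj₁ h₃)))) (λ _ _ → tt)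
                (enough (nr σ₃ 1 5) e₀ o₂ (length (ow σ₃)) (rankOf (geq v) base t σ₃) (subst (_≤ nr σ₃ 1 5 * 1024) r1 (<ᵇ-false _ _ ge')) (proj₂ hi) e≤o₂)))))
        where
        open Ranked R
        open Ctx ctx
        v : Value
        v = value (wr σ₃ 2 0)
        1<W : 1 < W
        1<W = ≤-<-trans (≤-trans (≤ᵇ⇒≤ 1 2000 tt) (m≤n+m 2000 _)) V<W
        peak≤ : ∀ {c} → c ≤ t → 0 + 1024 + c * 1024 + 0 < W
        peak≤ {c} c≤ = linear 4 (λ c V t W → V ⊕ t ⊗ 1100 ⊕ κ 2000 ⊏ W ⇒ c ⊑ t ⇒ ⊢ κ 0 ⊕ κ 1024 ⊕ c ⊗ 1024 ⊕ κ 0 ⊏ W) c V t W V<W c≤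
        stable : Stable (λ σ → Ctx σ × Outcome o σ)
        stable (c , x) h = ctx-havoc c h , outcome-havoc x h

    opaque
      wp-attempt : ∀ {σ τ} → Ctx σ → nr σ 1 7 ≡ 0 →
        WP attempt (Post (τ + t * 1300) (λ σ' → Ctx σ' × Outcome (length (ow σ)) σ')) τ σ
      wp-attempt {σ} {τ} I flag =
        wp-seq (wp-set 0<W λ m₁ o₁ h₁ → wp-seq (wp-set arr<W λ m₂ o₂ h₂ → wp-seq (wp-set 0<W λ m₃ o₃ h₃ →
        wp-seq (wp-set 0<W λ m₄ o₄ h₄ → wp-seq (wp-set 0<W λ m₅ o₅ h₅ → wp-seq (wp-set 0<W λ m₆ o₆ h₆ →
        let c₆ = Corr-trans (proj₁ h₁) (Corr-trans (proj₁ h₂) (Corr-trans (proj₁ h₃) (Corr-trans (proj₁ h₄) (Corr-trans (proj₁ h₅) (proj₁ h₆))))) in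
        wp-seq (mono (C.wp-collect r0 refl r2 r3 (trans (cong (λ f → f 13) bank0) eU) (trans (cong (λ f → f 14) bank0) eV)) λ τ₁ σ₁ (τ₁≤ , J) →
        let module J = C.Inv J ; n₁ = proj₂ (sameN J.ctx) in
        wp-seq (wp-set 0<W λ m₇ o₇ h₇ → wp-seq (wp-set arr<W λ m₈ o₈ h₈ →
        wp-seq (wp-set (subst (λ x → 144 + (144 + x) < W) (sym (trans (cong (λ f → f 2) n₁) r2)) (linear 4 (λ nb S M W → nb ⊑ S ⇒ κ 144 ⊕ (S ⊕ S) ⊑ M ⇒ M ⊕ S ⊗ 16 ⊕ κ 200 ⊏ W ⇒ ⊢ κ 144 ⊕ (κ 144 ⊕ nb) ⊏ W) nb S M W nb≤S room M<W)) λ m₉ o₉ h₉ →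
        let c₉ = Corr-trans (proj₁ h₇) (Corr-trans (proj₁ h₈) (proj₁ h₉)) in
        wp-seq (mono (wp-medianˢ {arrays} {arrays + nb} {nb} U 0<nb
            (linear 4 (λ nb S M W → nb ⊑ S ⇒ κ 144 ⊕ (S ⊕ S) ⊑ M ⇒ M ⊕ S ⊗ 16 ⊕ κ 200 ⊏ W ⇒ ⊢ nb ⊗ 8 ⊕ κ 16 ⊏ W) nb S M W nb≤S room M<W)
            (linear 4 (λ nb S M W → nb ⊑ S ⇒ κ 144 ⊕ (S ⊕ S) ⊑ M ⇒ M ⊕ S ⊗ 16 ⊕ κ 200 ⊏ W ⇒ ⊢ κ 144 ⊕ nb ⊗ 4 ⊕ κ 8 ⊏ W) nb S M W nb≤S room M<W)
            (linear 4 (λ nb S M W → nb ⊑ S ⇒ κ 144 ⊕ (S ⊕ S) ⊑ M ⇒ M ⊕ S ⊗ 16 ⊕ κ 200 ⊏ W ⇒ ⊢ κ 144 ⊕ nb ⊕ nb ⊗ 4 ⊕ κ 8 ⊏ W) nb S M W nb≤S room M<W)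
            ≤-refl
            (λ p p<nb → m≤m+n arrays p , <-≤-trans (+-monoʳ-< arrays (<-≤-trans p<nb (≤-trans nb≤S (m≤m+n S S)))) room)
            (λ p p<nb → ≤-trans (m≤m+n arrays nb) (m≤m+n (arrays + nb) p) ,
              <-≤-trans (subst (_< arrays + (S + S)) (sym (+-assoc arrays nb p)) (+-monoʳ-< arrays (+-mono-≤-< nb≤S (<-≤-trans p<nb nb≤S)))) room)
            (trans (cong (λ f → f 2) n₁) r2) refl (cong (arrays +_) (trans (cong (λ f → f 2) n₁) r2))) λ τ₂ σ₂ (τ₂≤ , fr₂ , same₂ , samew₂ , central) →
        let n₂ = trans (proj₂ (proj₁ same₂)) n₁ in
        wp-seq (mono (Ranking.wp-rank base t (linear 5 (λ b t U V W → b ⊕ t ⊑ U ⇒ U ⊕ t ⊑ V ⇒ V ⊕ t ⊗ 1100 ⊕ κ 2000 ⊏ W ⇒ ⊢ b ⊕ t ⊕ κ 4 ⊏ W) base t U V W base+t≤U U+t≤V V<W)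
            σ₂ (trans (cong (λ f → f 0) n₂) r0) (trans (cong (λ f → f 1) n₂) r1)) λ τ₃ σ₃ (τ₃≤ , K₃) →
        let module K = Ranking.Inv K₃ in
        let module F = Ranking.Frame₁ K.frame₁
            f₁₃ = Fr-trans (Fr-havoc c₉) (Fr-trans fr₂ (Fr-havoc F.only))
            f₀₃ = Fr-trans (Fr-havoc c₆) (Fr-trans (frame J.ctx) f₁₃)
            o≤₁ = ≤-trans (Corr-length c₆) (Fr-length (frame J.ctx))
            o≤₂ = ≤-trans o≤₁ (≤-trans (Corr-length c₉) (Fr-length fr₂))
            v≡ = cong (λ f → value (f 0)) F.words2
            est = λ (χ : Value → Bool) which c (ap : Approx χ base t c (length (ow σ₂)) σ₃) →
              let g , g₁ , g₂ = blocks-rank {σ₁ = σ₁} χ (value (wr σ₂ 2 0)) which J.blocks central in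
              estimate g (length (C.Blocks.bad J.blocks)) (rankOf χ base t σ₁) (rankOf χ base t σ₃) c (length (ow σ)) (length (ow σ₁)) (length (ow σ₂)) (length (ow σ₃))
                g₁ g₂ (≤-trans (+-monoʳ-≤ (length (C.Blocks.bad J.blocks)) (*-monoˡ-≤ 3 (Corr-length c₆))) (C.Blocks.few J.blocks))
                (proj₁ (fr-count χ base t f₁₃ (λ p p<t → <-≤-trans (+-monoʳ-< base p<t) base+t≤U))) (proj₁ ap) o≤₁ o≤₂ (Fr-length f₁₃)
        in relax (≤-trans (linear 1 (λ t → ⊢ t ⊕ κ 20 ⊕ κ 1 ⊑ t ⊕ κ 30) τ₃) (attempt-time τ τ₁ τ₂ τ₃ τ₁≤ τ₂≤ τ₃≤))
          (wp-judge (record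
            { ctx = record { bank0 = trans F.bank0 (trans (proj₂ (proj₁ (proj₁ same₂))) (trans (proj₂ (proj₁ (sameN J.ctx))) bank0))
                ; r0 = F.r0 ; r1 = F.r1 ; r2 = trans F.r2 (trans (cong (λ f → f 2) n₂) r2) ; r3 = trans F.r3 (trans (cong (λ f → f 3) n₂) r3)
                ; words0 = trans F.words0 (trans (proj₂ (proj₁ samew₂)) (trans (proj₂ (proj₁ (sameW J.ctx))) words0))
                ; fr = Fr-trans fr f₀₃ }
            ; flag = trans F.r7 (trans (cong (λ f → f 7) n₂) flag)
            ; le≤ = K.le≤ ; ge≤ = K.ge≤ ; o₂ = length (ow σ₂) ; o≤o₂ = o≤₂ ; e≤o₂ = ≤-trans (Fr-length fr) o≤₂ ; o≤o₃ = Fr-length f₀₃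
            ; lo = subst (λ v → Approx (atMost v) base t (nr σ₃ 1 4) (length (ow σ₂)) σ₃) (sym v≡) K.lo
            ; hi = subst (λ v → Approx (geq v) base t (nr σ₃ 1 5) (length (ow σ₂)) σ₃) (sym v≡) K.hi
            ; many = est (atMost (value (wr σ₂ 2 0))) (inj₁ refl) (nr σ₃ 1 4) K.lo
            ; more = est (geq (value (wr σ₂ 2 0))) (inj₂ refl) (nr σ₃ 1 5) K.hi }))))))))))))))
        where
        open Ctx I
        arr<W : 144 < W
        arr<W = ≤-<-trans (≤-trans (≤ᵇ⇒≤ 144 2000 tt) (m≤n+m 2000 _)) V<W

  -- Each fault pays for c steps.
  Paid : ∀ {ℓ} → ℕ → ℕ → ℕ → (View → Set ℓ) → ℕ → View → Set ℓ
  Paid c e N Ξ t σ = t + e * c ≤ N + length (ow σ) * c × Ξ σ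

  relax-paid : ∀ {ℓ} {x c e N N' t σ} {Ξ : View → Set ℓ} → N ≤ N' → WP x (Paid c e N Ξ) t σ → WP x (Paid c e N' Ξ) t σ
  relax-paid {c = c} N≤ w = mono w λ t' σ' (t≤ , x) → ≤-trans t≤ (+-monoˡ-≤ (length (ow σ') * c) N≤) , x

  wp-ite-paid : ∀ {ℓ} {b x y c e N t σ} {Ξ : View → Set ℓ} → {sh : T (shallowᶜ b)} → Stable Ξ → peakᶜ (nr σ) b < W →
    (∀ m o → Havoc σ m o →
       (truth σ b ≡ true  → WP x (Paid c e N Ξ) (t + (condSize b + 1)) (havoc σ m o))
     × (truth σ b ≡ false → WP y (Paid c e N Ξ) (t + (condSize b + 1)) (havoc σ m o))) →
    WP (ite b x y) (Paid c e (N + 1) Ξ) t σ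
  wp-ite-paid {c = c} {e} {N} {Ξ = Ξ} {sh = sh} st p q = wp-ite {sh = sh} p λ m o h →
    (λ eq → mono (proj₁ (q m o h) eq) after) , (λ eq → mono (proj₂ (q m o h) eq) after)
    where
    after : ∀ t' σ' → Paid c e N Ξ t' σ' → After (Paid c e (N + 1) Ξ) t' σ'
    after t' σ' (t≤ , x) m o h =
      linear 5 (λ t ec N oc o'c → t ⊕ ec ⊑ N ⊕ oc ⇒ oc ⊑ o'c ⇒ ⊢ t ⊕ κ 1 ⊕ ec ⊑ N ⊕ κ 1 ⊕ o'c)
        t' (e * c) N (length (ow σ') * c) (length o * c) t≤ (*-monoˡ-≤ c (Corr-length (proj₁ h))) , st x h

  div-nonzero : ∀ x y .{{_ : NonZero y}} → ⟦ div ⟧ x y ≡ x / y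
  div-nonzero x (suc y) = refl

  module SmallPivot (base t U V Q : ℕ) (0<t : 0 < t) (0<S : 0 < S) (1≤Q : 1 ≤ Q) (t/S≤Q : S ≤ t → ⟦ div ⟧ t S ≤ Q)
    (base+t≤U : base + t ≤ U) (U+t≤V : U + t ≤ V) (V<W : V + t * 1100 + 2000 < W) (room : arrays + (S + S) ≤ M) (M<W : M + S * 16 + 200 < W)
    (σ₀ : View) (eS : nr σ₀ 0 2 ≡ S) (eU : nr σ₀ 0 13 ≡ U) (eV : nr σ₀ 0 14 ≡ V) (e0 : nr σ₀ 1 0 ≡ base) (e1 : nr σ₀ 1 1 ≡ t) where

    e₀ : ℕ
    e₀ = length (ow σ₀)

    record Kept (σ : View) : Set a where
      field
        bank0  : nr σ 0 ≡ nr σ₀ 0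
        words0 : wr σ 0 ≡ wr σ₀ 0
        fr     : Fr (_< U) (mem σ₀) (ow σ₀) (mem σ) (ow σ)

    Accept : View → Set
    Accept σ = Rich 1024 e₀ (atMost (value (wr σ 2 0))) base t σ × Rich 1024 e₀ (geq (value (wr σ 2 0))) base t σ

    record Chosen (σ : View) : Set a where
      field
        kept : Kept σ
        r0 : nr σ 1 0 ≡ base
        r1 : nr σ 1 1 ≡ t
        r2 : nr σ 1 2 ≡ t × t ≤ S ⊎ nr σ 1 2 ≡ S × S ≤ t

    chosen-havoc : Stable Chosen
    chosen-havoc I h = record { kept = record { bank0 = bank0 ; words0 = words0 ; fr = Fr-trans fr (Fr-havoc (proj₁ h)) } ; r0 = r0 ; r1 = r1 ; r2 = r2 }
      where
      open Chosen I
      open Kept kept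

    0<W : 0 < W
    0<W = ≤-<-trans z≤n V<W

    module Blocks' (nb : ℕ) (0<nb : 0 < nb) (nb≤S : nb ≤ S) (nb≤t : nb ≤ t) (q≤Q : ⟦ div ⟧ t nb ≤ Q) where
      instance
        nb≢0 : NonZero nb
        nb≢0 = >-nonZero 0<nb

      q : ℕ
      q = ⟦ div ⟧ t nb

      q≡ : q ≡ t / nb
      q≡ = div-nonzero t nb

      0<q : 0 < q
      0<q = subst (0 <_) (sym q≡) (m≥n⇒m/n>0 nb≤t)

      nbq≡ : nb * q ≡ t / nb * nb
      nbq≡ = trans (cong (nb *_) q≡) (*-comm nb (t / nb))

      nbq≤t : nb * q ≤ t
      nbq≤t = ≤-trans (≤-reflexive nbq≡) (m/n*n≤m t nb)

      t≤ : t ≤ nb * q + nb * q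
      t≤ = linear 4 (λ t nb r nbq → t ≐ r ⊕ nbq ⇒ r ⊏ nb ⇒ nb ⊑ nbq ⇒ ⊢ t ⊑ nbq ⊕ nbq) t nb (t % nb) (nb * q)
        (trans (m≡m%n+[m/n]*n t nb) (cong (t % nb +_) (sym nbq≡))) (m%n<n t nb)
        (≤-trans (≤-reflexive (sym (*-identityʳ nb))) (*-monoʳ-≤ nb 0<q))

      open Attempt base t U V nb q Q 0<nb 0<q nb≤S nb≤t nbq≤t t≤ q≤Q base+t≤U U+t≤V V<W room M<W σ₀ eU eV hiding (e₀; 0<W)

      c : ℕ
      c = Q * 3000000

      Phase : ℕ → ℕ → View → ℕ → Set
      Phase τ μ σ τ' = (nr σ 1 7 ≡ 0 × μ ≡ suc (δ ∸ length (ow σ)) × τ' + e₀ * c ≤ τ + length (ow σ) * c)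
        ⊎ (nr σ 1 7 ≡ 1 × μ ≡ 0 × Accepted σ × τ' + e₀ * c ≤ τ + t * 1310 + length (ow σ) * c)

      opaque
        pays : ∀ τ τ' τ″ o o' → t + o * Q * 2240 ≤ o' * Q * 2240 → τ' + e₀ * c ≤ τ + o * c → τ″ ≤ τ' + 3 + t * 1300 →
          τ″ + 1 + e₀ * c ≤ τ + o' * c
        pays τ τ' τ″ o o' = λ h₁ h₂ h₃ → subst (λ x → τ″ + 1 + e₀ * c ≤ τ + x) (*-assoc o' Q 3000000) (linear 8 (λ τ τ' τ″ t oQ o'Q ec oc → t ⊕ oQ ⊗ 2240 ⊑ o'Q ⊗ 2240 ⇒ τ' ⊕ ec ⊑ τ ⊕ oc ⇒ τ″ ⊑ τ' ⊕ κ 3 ⊕ t ⊗ 1300 ⇒ κ 1 ⊑ t ⇒ oc ≐ oQ ⊗ 3000000 ⇒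
              ⊢ τ″ ⊕ κ 1 ⊕ ec ⊑ τ ⊕ o'Q ⊗ 3000000)
            τ τ' τ″ t (o * Q) (o' * Q) (e₀ * c) (o * c) h₁ h₂ h₃ 0<t (sym (*-assoc o Q 3000000)))

        ends : ∀ τ τ' τ″ oc o'c → oc ≤ o'c → τ' + e₀ * c ≤ τ + oc → τ″ ≤ τ' + 3 + t * 1300 → τ″ + 1 + e₀ * c ≤ τ + t * 1310 + o'c
        ends τ τ' τ″ oc o'c h₁ h₂ h₃ = linear 7 (λ τ τ' τ″ t ec oc o'c → oc ⊑ o'c ⇒ τ' ⊕ ec ⊑ τ ⊕ oc ⇒ τ″ ⊑ τ' ⊕ κ 3 ⊕ t ⊗ 1300 ⇒ κ 1 ⊑ t ⇒
            ⊢ τ″ ⊕ κ 1 ⊕ ec ⊑ τ ⊕ t ⊗ 1310 ⊕ o'c) τ τ' τ″ t (e₀ * c) oc o'c h₁ h₂ h₃ 0<t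

        fewer : ∀ o o' → t + o * Q * 2240 ≤ o' * Q * 2240 → o < o'
        fewer o o' h = *-cancelʳ-< Q o o' (*-cancelʳ-< 2240 (o * Q) (o' * Q) (≤-trans (+-monoˡ-≤ (o * Q * 2240) 0<t) h))

      opaque
        wp-attempts : ∀ {σ τ} → Ctx σ → nr σ 1 7 ≡ 0 →
          WP (while (r 1 7 <ₙ lit 1) attempt) (Paid c e₀ (τ + t * 1310 + 4) (λ σ' → Ctx σ' × Accepted σ')) τ σ
        wp-attempts {σ} {τ} I flag = wp-while Loop
          (λ μ τ' σ' (J , ph) m o h → 1<W , (λ lt → again μ τ' σ' m o h J ph (<ᵇ-true _ _ lt)) , (λ ge → stop μ τ' σ' m o h J ph (<ᵇ-false _ _ ge)))
          (I , inj₁ (flag , refl , +-monoʳ-≤ τ (*-monoˡ-≤ c (Fr-length (Ctx.fr I)))))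
          where
          Loop : ℕ → ℕ → View → Set a
          Loop μ τ' σ' = Ctx σ' × Phase τ μ σ' τ'
          1<W : 1 < W
          1<W = ≤-<-trans (≤-trans (≤ᵇ⇒≤ 1 2000 tt) (m≤n+m 2000 _)) V<W
          again : ∀ μ τ' σ' m o → Havoc σ' m o → Ctx σ' → Phase τ μ σ' τ' → nr σ' 1 7 < 1 →
            WP attempt (λ τ″ σ″ → ∃[ μ' ] μ' < μ × Loop μ' (τ″ + 1) σ″) (τ' + 3) (havoc σ' m o)
          again μ τ' σ' m o h J (inj₂ (f1 , _)) lt = contradiction (subst (_< 1) f1 lt) (<-irrefl refl)
          again μ τ' σ' m o h J (inj₁ (f0 , refl , time)) lt = mono (wp-bounded (wp-attempt (ctx-havoc J h) f0)) (λ τ″ σ″ (x , b) → after τ″ σ″ x b)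
            where
            after : ∀ τ″ σ″ → Post (τ' + 3 + t * 1300) (λ σ″ → Ctx σ″ × Outcome (length o) σ″) τ″ σ″ → length (ow σ″) ≤ δ → ∃[ μ' ] μ' < suc (δ ∸ length (ow σ')) × Loop μ' (τ″ + 1) σ″
            after τ″ σ″ (τ≤ , J' , retry f h') bd = suc (δ ∸ length (ow σ″)) ,
              s≤s (∸-monoʳ-< (≤-<-trans (Corr-length (proj₁ h)) (fewer (length o) (length (ow σ″)) h')) bd) , J' ,
              inj₁ (f , refl , pays τ τ' τ″ (length o) (length (ow σ″)) h' (≤-trans time (+-monoʳ-≤ τ (*-monoˡ-≤ c (Corr-length (proj₁ h))))) τ≤)
            after τ″ σ″ (τ≤ , J' , accept f o≤ h') bd = 0 , s≤s z≤n , J' ,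
              inj₂ (f , refl , h' , ends τ τ' τ″ (length (ow σ') * c) (length (ow σ″) * c) (*-monoˡ-≤ c (≤-trans (Corr-length (proj₁ h)) o≤)) time τ≤)
          stop : ∀ μ τ' σ' m o → Havoc σ' m o → Ctx σ' → Phase τ μ σ' τ' → 1 ≤ nr σ' 1 7 →
            Paid c e₀ (τ + t * 1310 + 4) (λ σ' → Ctx σ' × Accepted σ') (τ' + 4) (havoc σ' m o)
          stop μ τ' σ' m o h J (inj₁ (f0 , _)) ge = contradiction (subst (1 ≤_) f0 ge) (λ ())
          stop μ τ' σ' m o h J (inj₂ (f1 , _ , (a₁ , a₂) , time)) ge =
            linear 6 (λ τ τ' x ec oc o'c → τ' ⊕ ec ⊑ τ ⊕ x ⊕ oc ⇒ oc ⊑ o'c ⇒ ⊢ τ' ⊕ κ 4 ⊕ ec ⊑ τ ⊕ x ⊕ κ 4 ⊕ o'c)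
              τ τ' (t * 1310) (e₀ * c) (length (ow σ') * c) (length o * c) time (*-monoˡ-≤ c (Corr-length (proj₁ h))) ,
            ctx-havoc J h ,
            (rich-fr 1024 e₀ (atMost (value (wr σ' 2 0))) base t {λ _ → ⊤} {σ'} {havoc σ' m o} (Fr-havoc (proj₁ h)) (λ _ _ → tt) a₁ ,
             rich-fr 1024 e₀ (geq (value (wr σ' 2 0))) base t {λ _ → ⊤} {σ'} {havoc σ' m o} (Fr-havoc (proj₁ h)) (λ _ _ → tt) a₂)

      out : ∀ {σ} → Ctx σ → Kept σ
      out I = record { bank0 = bank0 ; words0 = words0 ; fr = fr }
        where open Ctx I

    Result : View → Set a
    Result σ = Kept σ × Accept σ

    cost : ℕ
    cost = Q * 3000000

    opaque
      wp-smallPivot : ∀ {τ} → WP smallPivot (Paid cost e₀ (τ + t * 1310 + 30) Result) τ σ₀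
      wp-smallPivot {τ} = wp-seq (mono (wp-ite-post {N = τ + 5} {Ξ = Chosen} chosen-havoc 0<W λ m₁ o₁ h₁ →
          (λ lt → wp-set 0<W λ m₂ o₂ h₂ → linear 1 (λ t → ⊢ t ⊕ κ 3 ⊕ κ 2 ⊑ t ⊕ κ 5) τ ,
            record { kept = record { bank0 = refl ; words0 = refl ; fr = Fr-havoc (Corr-trans (proj₁ h₁) (proj₁ h₂)) } ; r0 = e0 ; r1 = e1
                   ; r2 = inj₁ (e1 , <⇒≤ (subst₂ _<_ e1 eS (<ᵇ-true _ _ lt))) }) ,
          (λ ge → wp-set 0<W λ m₂ o₂ h₂ → linear 1 (λ t → ⊢ t ⊕ κ 3 ⊕ κ 2 ⊑ t ⊕ κ 5) τ ,
            record { kept = record { bank0 = refl ; words0 = refl ; fr = Fr-havoc (Corr-trans (proj₁ h₁) (proj₁ h₂)) } ; r0 = e0 ; r1 = e1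
                   ; r2 = inj₂ (eS , subst₂ _≤_ eS e1 (<ᵇ-false _ _ ge)) }))
        λ τ₁ σ₁ (τ₁≤ , C) → go τ₁ σ₁ τ₁≤ C (Chosen.r2 C))
        where
        rest : Cmd
        rest = num 1 3 ≔ r 1 1 ÷ₑ r 1 2 ⨾ num 1 7 ≔ lit 0 ⨾ while (r 1 7 <ₙ lit 1) attempt
        run' : ∀ nb (0<nb : 0 < nb) (nb≤S : nb ≤ S) (nb≤t : nb ≤ t) (q≤Q : ⟦ div ⟧ t nb ≤ Q) τ₁ σ₁ → τ₁ ≤ τ + 5 + 1 → Chosen σ₁ → nr σ₁ 1 2 ≡ nb →
          WP rest (Paid cost e₀ (τ + t * 1310 + 30) Result) τ₁ σ₁
        run' nb 0<nb nb≤S nb≤t q≤Q τ₁ σ₁ τ₁≤ C e2 =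
          wp-seq (wp-set 0<W λ m₁ o₁ h₁ → wp-seq (wp-set 0<W λ m₂ o₂ h₂ →
          mono (Blocks'.wp-attempts nb 0<nb nb≤S nb≤t q≤Q (record { bank0 = bank0 ; r0 = r0 ; r1 = r1 ; r2 = e2 ; r3 = cong₂ ⟦ div ⟧ r1 e2 ; words0 = words0
              ; fr = Fr-trans fr (Fr-havoc (Corr-trans (proj₁ h₁) (proj₁ h₂))) }) refl)
            λ τ₂ σ₂ (time , I , acc) →
              ≤-trans time (+-monoˡ-≤ (length (ow σ₂) * cost) (linear 3 (λ τ τ₁ x → τ₁ ⊑ τ ⊕ κ 5 ⊕ κ 1 ⇒ ⊢ τ₁ ⊕ κ 4 ⊕ κ 2 ⊕ x ⊕ κ 4 ⊑ τ ⊕ x ⊕ κ 30) τ τ₁ (t * 1310) τ₁≤)) ,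
              Blocks'.out nb 0<nb nb≤S nb≤t q≤Q I , acc))
          where
          open Chosen C
          open Kept kept
        go : ∀ τ₁ σ₁ → τ₁ ≤ τ + 5 + 1 → Chosen σ₁ → (nr σ₁ 1 2 ≡ t × t ≤ S ⊎ nr σ₁ 1 2 ≡ S × S ≤ t) → WP rest (Paid cost e₀ (τ + t * 1310 + 30) Result) τ₁ σ₁
        go τ₁ σ₁ τ₁≤ C (inj₁ (e2 , t≤S)) = run' t 0<t t≤S ≤-refl (≤-trans (≤-reflexive one) 1≤Q) τ₁ σ₁ τ₁≤ C e2
          where
          instance
            t≢0 : NonZero t
            t≢0 = >-nonZero 0<t
          one : ⟦ div ⟧ t t ≡ 1
          one = trans (div-nonzero t t) (n/n≡1 t)
        go τ₁ σ₁ τ₁≤ C (inj₂ (e2 , S≤t)) = run' S 0<S ≤-refl S≤t (t/S≤Q S≤t) τ₁ σ₁ τ₁≤ C e2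

  module Pivoting (from to T₀ U V Q : ℕ) (a<b : from < to) (b≤n : to ≤ n) (0<δ : 0 < δ) (T₀≡ : T₀ ≡ δ * 8192) (n+T₀≤U : n + T₀ ≤ U) (U+≤V : U + (n + T₀) ≤ V)
    (V<W : V + (n + T₀) * 1100 + 2000 < W) (room : arrays + (S + S) ≤ M) (M<W : M + S * 16 + 200 < W) (0<S : 0 < S) (1≤Q : 1 ≤ Q)
    (t/S≤Q : ∀ t → t ≤ T₀ → S ≤ t → ⟦ div ⟧ t S ≤ Q)
    (σ₀ : View) (en : nr σ₀ 0 0 ≡ n) (eS : nr σ₀ 0 2 ≡ S) (ea : nr σ₀ 0 7 ≡ from) (eb : nr σ₀ 0 8 ≡ to)
    (eT : nr σ₀ 0 12 ≡ T₀) (eU : nr σ₀ 0 13 ≡ U) (eV : nr σ₀ 0 14 ≡ V) where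

    m : ℕ
    m = to ∸ from

    0<m : 0 < m
    0<m = m<n⇒0<n∸m a<b

    a+m≡b : from + m ≡ to
    a+m≡b = m+[n∸m]≡n (<⇒≤ a<b)

    m≤n : m ≤ n
    m≤n = ≤-trans (m∸n≤m to from) b≤n

    e₀ : ℕ
    e₀ = length (ow σ₀)

    c : ℕ
    c = Q * 3000000

    record Result (σ : View) : Set a where
      field
        bank0  : nr σ 0 ≡ nr σ₀ 0
        words0 : wr σ 0 ≡ wr σ₀ 0
        fr     : Fr (_< n) (mem σ₀) (ow σ₀) (mem σ) (ow σ)
        lower  : Rich 65536 e₀ (atMost (value (wr σ 2 0))) from m σ
        upper  : Rich 65536 e₀ (geq (value (wr σ 2 0))) from m σ

    result-havoc : Stable Result
    result-havoc {σ} {m'} {o} I h = record { bank0 = bank0 ; words0 = words0 ; fr = Fr-trans fr (Fr-havoc (proj₁ h))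
      ; lower = rich-fr 65536 e₀ (atMost (value (wr σ 2 0))) from m {λ _ → ⊤} {σ} {havoc σ m' o} (Fr-havoc (proj₁ h)) (λ _ _ → tt) lower
      ; upper = rich-fr 65536 e₀ (geq (value (wr σ 2 0))) from m {λ _ → ⊤} {σ} {havoc σ m' o} (Fr-havoc (proj₁ h)) (λ _ _ → tt) upper }
      where open Result I

    0<W : 0 < W
    0<W = ≤-<-trans z≤n V<W

    0<T₀ : 0 < T₀
    0<T₀ = subst (0 <_) (sym T₀≡) (≤-trans 0<δ (≤-trans (≤-reflexive (sym (*-identityʳ δ))) (*-monoʳ-≤ δ (≤ᵇ⇒≤ 1 8192 tt))))

    opaque
      coarsen : ∀ r o e₁ → e₀ ≤ e₁ → m + e₁ * 1024 ≤ r * 1024 + o * 1024 → m + e₀ * 65536 ≤ r * 65536 + o * 65536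
      coarsen r o e₁ = linear 5 (λ m r o e₀ e₁ → e₀ ⊑ e₁ ⇒ m ⊕ e₁ ⊗ 1024 ⊑ r ⊗ 1024 ⊕ o ⊗ 1024 ⇒ ⊢ m ⊕ e₀ ⊗ 65536 ⊑ r ⊗ 65536 ⊕ o ⊗ 65536) m r o e₀ e₁

      -- Of T₀ = 8192 δ blocks, at most 3 δ are spoiled.
      majority : ∀ R q E r e₁ e₂ o → T₀ + e₂ * 1024 ≤ R * 1024 + o * 1024 → R * q ≤ r * 16 + E * q → E + e₁ * 3 ≤ o * 3 → o ≤ δ → e₀ ≤ o →
        m ≤ T₀ * q + T₀ * q → m + e₀ * 65536 ≤ r * 65536 + o * 65536
      majority R q E r e₁ e₂ o h₁ h₂ h₃ o≤δ e₀≤o h₄ =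
        linear 8 (λ m T₀q δq Rq r Eq e₀ o → m ⊑ T₀q ⊕ T₀q ⇒ T₀q ≐ δq ⊗ 8192 ⇒ δq ⊗ 7 ⊑ Rq ⇒ Rq ⊑ r ⊗ 16 ⊕ Eq ⇒ Eq ⊑ δq ⊗ 3 ⇒ e₀ ⊑ o ⇒ ⊢ m ⊕ e₀ ⊗ 65536 ⊑ r ⊗ 65536 ⊕ o ⊗ 65536)
          m (T₀ * q) (δ * q) (R * q) r (E * q) e₀ o h₄ (trans (cong (_* q) T₀≡) (swap δ 8192))
          (≤-trans (≤-reflexive (sym (swap δ 7))) (*-monoˡ-≤ q (linear 5 (λ T δ R o e → T ⊕ e ⊗ 1024 ⊑ R ⊗ 1024 ⊕ o ⊗ 1024 ⇒ T ≐ δ ⊗ 8192 ⇒ o ⊑ δ ⇒ ⊢ δ ⊗ 7 ⊑ R) T₀ δ R o e₂ h₁ T₀≡ o≤δ)))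
          h₂
          (≤-trans (*-monoˡ-≤ q (linear 4 (λ E e o δ → E ⊕ e ⊗ 3 ⊑ o ⊗ 3 ⇒ o ⊑ δ ⇒ ⊢ E ⊑ δ ⊗ 3) E e₁ o δ h₃ o≤δ)) (≤-reflexive (swap δ 3))) e₀≤o
        where
        swap : ∀ x k → x * k * q ≡ x * q * k
        swap x k = trans (*-assoc x k q) (trans (cong (x *_) (*-comm k q)) (sym (*-assoc x q k)))

    module Big (T₀<m : T₀ < m) where
      instance
        T₀≢0 : NonZero T₀
        T₀≢0 = >-nonZero 0<T₀

      q : ℕ
      q = ⟦ div ⟧ m T₀

      q≡ : q ≡ m / T₀
      q≡ = div-nonzero m T₀

      0<q : 0 < q
      0<q = subst (0 <_) (sym q≡) (m≥n⇒m/n>0 (<⇒≤ T₀<m))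

      Tq≡ : T₀ * q ≡ m / T₀ * T₀
      Tq≡ = trans (cong (T₀ *_) q≡) (*-comm T₀ (m / T₀))

      Tq≤m : T₀ * q ≤ m
      Tq≤m = ≤-trans (≤-reflexive Tq≡) (m/n*n≤m m T₀)

      m≤ : m ≤ T₀ * q + T₀ * q
      m≤ = linear 4 (λ m T r Tq → m ≐ r ⊕ Tq ⇒ r ⊏ T ⇒ T ⊑ Tq ⇒ ⊢ m ⊑ Tq ⊕ Tq) m T₀ (m % T₀) (T₀ * q)
        (trans (m≡m%n+[m/n]*n m T₀) (cong (m % T₀ +_) (sym Tq≡))) (m%n<n m T₀)
        (≤-trans (≤-reflexive (sym (*-identityʳ T₀))) (*-monoʳ-≤ T₀ 0<q))

      q≤m : q ≤ m
      q≤m = subst (_≤ m) (sym q≡) (m/n≤m m T₀)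

      module C = Blockwise faultyᵏ n from n T₀ q U V 0<q (≤-trans (+-monoʳ-≤ from Tq≤m) (≤-trans (≤-reflexive a+m≡b) b≤n)) (≤-trans (m≤m+n n T₀) n+T₀≤U)
        (λ _ → ≤-refl) (λ _ → n+T₀≤U) (λ _ _ → ≤-refl)
        (≤-trans (+-monoʳ-≤ U (≤-trans (≤-trans q≤m m≤n) (m≤m+n n T₀))) U+≤V)
        (linear 5 (λ V q n T W → V ⊕ (n ⊕ T) ⊗ 1100 ⊕ κ 2000 ⊏ W ⇒ q ⊑ n ⇒ ⊢ V ⊕ q ⊗ 8 ⊕ κ 16 ⊏ W) V q n T₀ W V<W (≤-trans q≤m m≤n))
        (linear 4 (λ V n T W → V ⊕ (n ⊕ T) ⊗ 1100 ⊕ κ 2000 ⊏ W ⇒ ⊢ n ⊕ T ⊕ κ 4 ⊏ W) V n T₀ W V<W)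

      rank-blocks : ∀ {e₁ σ} (χ : Value → Bool) v → (χ ≡ atMost v ⊎ χ ≡ geq v) → (B : C.Blocks e₁ T₀ σ) →
        rankOf χ n T₀ σ * q ≤ rankOf χ from m σ * 16 + length (C.Blocks.bad B) * q
      rank-blocks {σ = σ} χ v which B =
        ≤-trans (count-blocks {λ p → χ (value (mem σ (from + p)))} {λ j → χ (u j)} q (C.Blocks.bad B) T₀
            (λ j j<T gj j∉ → block j which gj (C.Blocks.good B j j<T j∉)))
          (+-monoˡ-≤ (length (C.Blocks.bad B) * q) (*-monoˡ-≤ 16 (count-extend (λ p → χ (value (mem σ (from + p)))) Tq≤m)))
        where
        u : ℕ → Value
        u j = value (mem σ (n + j))
        block : ∀ j → (χ ≡ atMost v ⊎ χ ≡ geq v) → χ (u j) ≡ true → C.Good j σ → q ≤ count (λ p → χ (value (mem σ (from + (j * q + p))))) q * 16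
        block j (inj₁ refl) gj (l , _) = ≤-trans l (*-monoˡ-≤ 16 (count-mono q (λ p p<q h →
          not-false (not-less (≼-trans {value (mem σ (from + (j * q + p)))} {u j} {v} (le (not-true h)) (le (not-true gj)))))))
        block j (inj₂ refl) gj (_ , l) = ≤-trans l (*-monoˡ-≤ 16 (count-mono q (λ p p<q h →
          not-false (not-less (≼-trans {v} {u j} {value (mem σ (from + (j * q + p)))} (le (not-true gj)) (le (not-true h)))))))

      opaque
        big-time : ∀ τ τ₁ τ₂ x y → τ₁ ≤ τ + 4 + 3 + 2 + 2 + 2 + 4 + 2 + 2 + T₀ * (q * 500 + 100) + 6 → τ₂ + x ≤ τ₁ + 2 + 2 + T₀ * 1310 + 30 + y →
          τ₂ + x ≤ τ + m * 2000 + 99 + y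
        big-time τ τ₁ τ₂ x y h₁ h₂ = linear 8 (λ τ τ₁ τx y m T Tq z → τ₁ ⊑ τ ⊕ κ 4 ⊕ κ 3 ⊕ κ 2 ⊕ κ 2 ⊕ κ 2 ⊕ κ 4 ⊕ κ 2 ⊕ κ 2 ⊕ z ⊕ κ 6 ⇒ τx ⊑ τ₁ ⊕ κ 2 ⊕ κ 2 ⊕ T ⊗ 1310 ⊕ κ 30 ⊕ y ⇒
            z ≐ Tq ⊗ 500 ⊕ T ⊗ 100 ⇒ Tq ⊑ m ⇒ T ⊑ m ⇒ ⊢ τx ⊑ τ ⊕ m ⊗ 2000 ⊕ κ 99 ⊕ y)
          τ τ₁ (τ₂ + x) y m T₀ (T₀ * q) (T₀ * (q * 500 + 100)) h₁ h₂ (trans (*-distribˡ-+ T₀ (q * 500) 100) (cong (_+ T₀ * 100) (sym (*-assoc T₀ q 500)))) Tq≤m (<⇒≤ T₀<m)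

      opaque
        wp-big : ∀ {σ τ} → nr σ 0 ≡ nr σ₀ 0 → wr σ 0 ≡ wr σ₀ 0 → nr σ 1 1 ≡ m → Corr (mem σ₀) (ow σ₀) (mem σ) (ow σ) →
          WP (num 2 0 ≔ r 0 7 ⨾ num 2 1 ≔ r 0 0 ⨾ num 2 3 ≔ r 0 12 ⨾ num 2 4 ≔ r 1 1 ÷ₑ r 0 12 ⨾ num 2 5 ≔ r 0 13 ⨾ num 2 6 ≔ r 0 14 ⨾
              collect faultyᵏ ⨾ num 1 0 ≔ r 0 0 ⨾ num 1 1 ≔ r 0 12 ⨾ smallPivot)
            (Paid c e₀ (τ + m * 2000 + 99) Result) (τ + 4 + 3) σ
        wp-big {σ} {τ} b0 w0 em c₀ =
          wp-seq (wp-set 0<W λ m₁ o₁ h₁ → wp-seq (wp-set 0<W λ m₂ o₂ h₂ → wp-seq (wp-set 0<W λ m₃ o₃ h₃ →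
          wp-seq (wp-set 0<W λ m₄ o₄ h₄ → wp-seq (wp-set 0<W λ m₅ o₅ h₅ → wp-seq (wp-set 0<W λ m₆ o₆ h₆ →
          let c₆ = Corr-trans (proj₁ h₁) (Corr-trans (proj₁ h₂) (Corr-trans (proj₁ h₃) (Corr-trans (proj₁ h₄) (Corr-trans (proj₁ h₅) (proj₁ h₆))))) in
          wp-seq (mono (C.wp-collect (z 7 ea) (z 0 en) (z 12 eT) (cong₂ ⟦ div ⟧ em (z 12 eT)) (z 13 eU) (z 14 eV)) λ τ₁ σ₁ (τ₁≤ , J) →
          let module J = C.Inv J ; n₀ = trans (proj₂ (proj₁ (sameN J.ctx))) b0 ; z₁ = λ i {x} (eq : nr σ₀ 0 i ≡ x) → trans (cong (λ f → f i) n₀) eq in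
          wp-seq (wp-set 0<W λ m₇ o₇ h₇ → wp-seq (wp-set 0<W λ m₈ o₈ h₈ →
          let c₈ = Corr-trans (proj₁ h₇) (proj₁ h₈) in
          mono (wp-bounded (SmallPivot.wp-smallPivot n T₀ U V Q 0<T₀ 0<S 1≤Q (t/S≤Q T₀ ≤-refl) n+T₀≤U (≤-trans (+-monoʳ-≤ U (m≤n+m T₀ n)) U+≤V)
              (linear 4 (λ V n T W → V ⊕ (n ⊕ T) ⊗ 1100 ⊕ κ 2000 ⊏ W ⇒ ⊢ V ⊕ T ⊗ 1100 ⊕ κ 2000 ⊏ W) V n T₀ W V<W) room M<W
              _ (z₁ 2 eS) (z₁ 13 eU) (z₁ 14 eV) (z₁ 0 en) (z₁ 12 eT)))
            λ τ₂ σ₂ x → let time , kept , acc₁ , acc₂ = proj₁ x ; o≤δ = proj₂ x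
                            f₁₂ = Fr-trans (Fr-havoc c₈) (SmallPivot.Kept.fr kept)
                            B₂ = proj₁ (C.blocks-frame {σ = σ₁} {σ₂} ≤-refl f₁₂ (λ ()) J.blocks)
                            f₀₂ = Fr-trans (Fr-havoc (Corr-trans c₀ c₆)) (Fr-trans (frame J.ctx) (Fr-weaken (λ p<n → <-≤-trans p<n (≤-trans (m≤m+n n T₀) n+T₀≤U)) f₁₂))
                            e₁ = length o₆ ; v = value (wr σ₂ 2 0) in
              settle τ τ₁ τ₂ (e₀ * c) _ (length (ow σ₂) * c) τ₁≤ time (*-monoˡ-≤ c (≤-trans (Corr-length (Corr-trans c₀ c₆)) (≤-trans (Fr-length (frame J.ctx)) (Corr-length c₈)))) ,
              record
                { bank0 = trans (SmallPivot.Kept.bank0 kept) n₀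
                ; words0 = trans (SmallPivot.Kept.words0 kept) (trans (proj₂ (proj₁ (sameW J.ctx))) w0)
                ; fr = f₀₂
                ; lower = majority (rankOf (atMost v) n T₀ σ₂) q (length (C.Blocks.bad B₂)) (rankOf (atMost v) from m σ₂) e₁ (length o₈) (length (ow σ₂))
                    acc₁ (rank-blocks (atMost v) v (inj₁ refl) B₂) (C.Blocks.few B₂) o≤δ (Fr-length f₀₂) m≤
                ; upper = majority (rankOf (geq v) n T₀ σ₂) q (length (C.Blocks.bad B₂)) (rankOf (geq v) from m σ₂) e₁ (length o₈) (length (ow σ₂))
                    acc₂ (rank-blocks (geq v) v (inj₂ refl) B₂) (C.Blocks.few B₂) o≤δ (Fr-length f₀₂) m≤ })))))))))
          where
          z : ∀ i {x} → nr σ₀ 0 i ≡ x → nr σ 0 i ≡ x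
          z i eq = trans (cong (λ f → f i) b0) eq
          settle : ∀ τ τ₁ τ₂ x x' y → τ₁ ≤ τ + 4 + 3 + 2 + 2 + 2 + 4 + 2 + 2 + T₀ * (q * 500 + 100) + 6 → τ₂ + x' ≤ τ₁ + 2 + 2 + T₀ * 1310 + 30 + y → x ≤ x' →
            τ₂ + x ≤ τ + m * 2000 + 99 + y
          settle τ τ₁ τ₂ x x' y h₁ h₂ x≤ = ≤-trans (+-monoʳ-≤ τ₂ x≤) (big-time τ τ₁ τ₂ x' y h₁ h₂)

    opaque
      wp-little : ∀ {σ τ} → m ≤ T₀ → nr σ 0 ≡ nr σ₀ 0 → wr σ 0 ≡ wr σ₀ 0 → nr σ 1 1 ≡ m → Corr (mem σ₀) (ow σ₀) (mem σ) (ow σ) →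
        WP (num 1 0 ≔ r 0 7 ⨾ smallPivot) (Paid c e₀ (τ + m * 2000 + 99) Result) (τ + 4 + 3) σ
      wp-little {σ} {τ} m≤T₀ b0 w0 em c₀ = wp-seq (wp-set 0<W λ m₁ o₁ h₁ →
        mono (SmallPivot.wp-smallPivot from m U V Q 0<m 0<S 1≤Q (t/S≤Q m m≤T₀) (≤-trans (≤-reflexive a+m≡b) (≤-trans b≤n (≤-trans (m≤m+n n T₀) n+T₀≤U)))
            (≤-trans (+-monoʳ-≤ U (≤-trans m≤n (m≤m+n n T₀))) U+≤V)
            (linear 5 (λ V m n T W → V ⊕ (n ⊕ T) ⊗ 1100 ⊕ κ 2000 ⊏ W ⇒ m ⊑ n ⇒ ⊢ V ⊕ m ⊗ 1100 ⊕ κ 2000 ⊏ W) V m n T₀ W V<W m≤n) room M<W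
            _ (z 2 eS) (z 13 eU) (z 14 eV) (z 7 ea) em)
          λ τ₂ σ₂ x → let time , kept , acc₁ , acc₂ = x ; v = value (wr σ₂ 2 0) ; e≤ = Corr-length (Corr-trans c₀ (proj₁ h₁)) in
            settle τ τ₂ (e₀ * c) (length o₁ * c) (length (ow σ₂) * c) time (*-monoˡ-≤ c e≤) ,
            record
              { bank0 = trans (SmallPivot.Kept.bank0 kept) b0 ; words0 = trans (SmallPivot.Kept.words0 kept) w0
              ; fr = Fr-trans (Fr-havoc (Corr-trans c₀ (proj₁ h₁))) (Fr-weaken (λ p<n → <-≤-trans p<n (≤-trans (m≤m+n n T₀) n+T₀≤U)) (SmallPivot.Kept.fr kept))
              ; lower = coarsen (rankOf (atMost v) from m σ₂) (length (ow σ₂)) (length o₁) e≤ acc₁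
              ; upper = coarsen (rankOf (geq v) from m σ₂) (length (ow σ₂)) (length o₁) e≤ acc₂ })
        where
        z : ∀ i {x} → nr σ₀ 0 i ≡ x → nr σ 0 i ≡ x
        z i eq = trans (cong (λ f → f i) b0) eq
        settle : ∀ τ τ₂ x x' y → τ₂ + x' ≤ τ + 4 + 3 + 2 + m * 1310 + 30 + y → x ≤ x' → τ₂ + x ≤ τ + m * 2000 + 99 + y
        settle τ τ₂ x x' y = linear 6 (λ τ τ₂ x x' y m → τ₂ ⊕ x' ⊑ τ ⊕ κ 4 ⊕ κ 3 ⊕ κ 2 ⊕ m ⊗ 1310 ⊕ κ 30 ⊕ y ⇒ x ⊑ x' ⇒ ⊢ τ₂ ⊕ x ⊑ τ ⊕ m ⊗ 2000 ⊕ κ 99 ⊕ y) τ τ₂ x x' y m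

    opaque
      wp-pivot : ∀ {τ} → WP pivot (Paid c e₀ (τ + m * 2000 + 100) Result) τ σ₀
      wp-pivot {τ} = wp-seq (wp-set 0<W λ m₁ o₁ h₁ →
        relax-paid {c = c} {e₀} (≤-reflexive (+-assoc (τ + m * 2000) 99 1)) (wp-ite-paid {c = c} {e₀} result-havoc 0<W λ m₂ o₂ h₂ →
          (λ lt → Big.wp-big (subst₂ _<_ eT em (<ᵇ-true _ _ lt)) refl refl em (Corr-trans (proj₁ h₁) (proj₁ h₂))) ,
          (λ ge → wp-little (subst₂ _≤_ em eT (<ᵇ-false _ _ ge)) refl refl em (Corr-trans (proj₁ h₁) (proj₁ h₂)))))
        where
        em : nr σ₀ 0 8 ∸ nr σ₀ 0 7 ≡ m
        em = cong₂ _∸_ eb ea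

  -- Word w is the key with index k, or has replaced it after a fault.
  Holds-key : ℕ → List Word → Word → Set a
  Holds-key k o w = w ≡ inputAt k ⊎ (inputAt k ∈ o × NotInput w)

  Placed : Placement n → (ℕ → Word) → List Word → Set a
  Placed π m o = ∀ p → p < n → Holds-key (index π p) o (m p)

  holds-more : ∀ {k o o' w} → (∀ {x} → x ∈ o → x ∈ o') → Holds-key k o w → Holds-key k o' w
  holds-more g (inj₁ e)        = inj₁ e
  holds-more g (inj₂ (i , ni)) = inj₂ (g i , ni)

  holds-fr : ∀ {U m o m' o' k p} → Fr U m o m' o' → U p → Holds-key k o (m p) → Holds-key k o' (m' p)
  holds-fr {m = m} {p = p} f u h with history f u
  ... | inj₁ e = subst (Holds-key _ _) (sym e) (holds-more (grows f) h)
  holds-fr {o' = o'} f u (inj₁ e)       | inj₂ (i , ni) = inj₂ (subst (_∈ o') e i , ni)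
  holds-fr f u (inj₂ (i , _)) | inj₂ (_ , ni) = inj₂ (grows f i , ni)

  placed-fr : ∀ {π m o m' o'} → Fr (_< n) m o m' o' → Placed π m o → Placed π m' o'
  placed-fr f h p p<n = holds-fr f p<n (h p p<n)

  -- The key with index k, if faithful, satisfies χ.
  Key-is : (Value → Bool) → List Word → ℕ → Set a
  Key-is χ o k = inputAt k ∉ o → χ (value (inputAt k)) ≡ true

  key-more : ∀ {χ o o' k} → (∀ {x} → x ∈ o → x ∈ o') → Key-is χ o k → Key-is χ o' k
  key-more g h ∉ = h (λ i → ∉ (g i))

  classify : ∀ {χ k o w} → Holds-key k o w → χ (value w) ≡ true → Key-is χ o k
  classify {χ} (inj₁ e) h _ = trans (cong (χ ∘ value) (sym e)) h
  classify (inj₂ (i , _)) h ∉ = contradiction i ∉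

  above : Value → Value → Bool
  above v x = less v x

  record Zones (v : Value) (κ' : ℕ → ℕ) (lo l e i : ℕ) (o : List Word) : Set a where
    field
      small : ∀ {p} → lo ≤ p → p < l → Key-is (below v) o (κ' p)
      same  : ∀ {p} → l ≤ p → p < e → Key-is (atMost v) o (κ' p) × Key-is (geq v) o (κ' p)
      large : ∀ {p} → e ≤ p → p < i → Key-is (above v) o (κ' p)

  zones-more : ∀ {v κ' lo l e i o o'} → (∀ {x} → x ∈ o → x ∈ o') → Zones v κ' lo l e i o → Zones v κ' lo l e i o'
  zones-more {v} g z = record
    { small = λ h₁ h₂ → key-more {below v} g (Zones.small z h₁ h₂)
    ; same = λ h₁ h₂ → key-more {atMost v} g (proj₁ (Zones.same z h₁ h₂)) , key-more {geq v} g (proj₂ (Zones.same z h₁ h₂))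
    ; large = λ h₁ h₂ → key-more {above v} g (Zones.large z h₁ h₂) }

  zones-large : ∀ {v κ' lo l e i o} → Zones v κ' lo l e i o → Key-is (above v) o (κ' i) → Zones v κ' lo l e (suc i) o
  zones-large {v} {κ'} {o = o} z h = record { small = Zones.small z ; same = Zones.same z ; large = λ {p} e≤p p≤i → new p e≤p (m≤n⇒m<n∨m≡n (s≤s⁻¹ p≤i)) }
    where
    new : ∀ p → _ → p < _ ⊎ p ≡ _ → Key-is (above v) o (κ' p)
    new p e≤p (inj₁ p<i)  = Zones.large z e≤p p<i
    new p e≤p (inj₂ refl) = h

  zones-equal : ∀ {v κ' lo l e i o} → l ≤ e → e ≤ i → Zones v κ' lo l e i o → Key-is (atMost v) o (κ' i) × Key-is (geq v) o (κ' i) →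
    Zones v (κ' ∘ transpose i e) lo l (suc e) (suc i) o
  zones-equal {v} {κ'} {lo} {l} {e} {i} {o} l≤e e≤i z h = record
    { small = λ {p} lo≤p p<l → subst (λ x → Key-is (below v) o (κ' x)) (sym (transpose-other i e (<⇒≢ (<-≤-trans p<l (≤-trans l≤e e≤i))) (<⇒≢ (<-≤-trans p<l l≤e)))) (Zones.small z lo≤p p<l)
    ; same = λ {p} l≤p p≤e → mid p l≤p (m≤n⇒m<n∨m≡n (s≤s⁻¹ p≤e))
    ; large = λ {p} e<p p≤i → high p e<p (m≤n⇒m<n∨m≡n (s≤s⁻¹ p≤i)) }
    where
    mid : ∀ p → l ≤ p → p < e ⊎ p ≡ e → Key-is (atMost v) o (κ' (transpose i e p)) × Key-is (geq v) o (κ' (transpose i e p))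
    mid p l≤p (inj₁ p<e)  = subst (λ x → Key-is (atMost v) o (κ' x) × Key-is (geq v) o (κ' x)) (sym (transpose-other i e (<⇒≢ (<-≤-trans p<e e≤i)) (<⇒≢ p<e))) (Zones.same z l≤p p<e)
    mid p l≤p (inj₂ refl) = subst (λ x → Key-is (atMost v) o (κ' x) × Key-is (geq v) o (κ' x)) (sym (transpose-right i p)) h
    high : ∀ p → e < p → p < i ⊎ p ≡ i → Key-is (above v) o (κ' (transpose i e p))
    high p e<p (inj₁ p<i)  = subst (λ x → Key-is (above v) o (κ' x)) (sym (transpose-other i e (<⇒≢ p<i) (≢-sym (<⇒≢ e<p)))) (Zones.large z (<⇒≤ e<p) p<i)
    high p e<p (inj₂ refl) = subst (λ x → Key-is (above v) o (κ' x)) (sym (transpose-left p e)) (Zones.large z ≤-refl e<p)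

  zones-small : ∀ {v κ' lo l e i o} → l ≤ e → e ≤ i → Zones v κ' lo l e i o → Key-is (below v) o (κ' i) →
    Zones v (κ' ∘ transpose i e ∘ transpose e l) lo (suc l) (suc e) (suc i) o
  zones-small {v} {κ'} {lo} {l} {e} {i} {o} l≤e e≤i z h = record
    { small = λ {p} lo≤p p≤l → low p lo≤p (m≤n⇒m<n∨m≡n (s≤s⁻¹ p≤l))
    ; same = λ {p} l<p p≤e → mid p l<p (m≤n⇒m<n∨m≡n (s≤s⁻¹ p≤e))
    ; large = λ {p} e<p p≤i → high p e<p (m≤n⇒m<n∨m≡n (s≤s⁻¹ p≤i)) }
    where
    τ : ℕ → ℕ
    τ p = transpose i e (transpose e l p)
    τ-other : ∀ {p} → p ≢ e → p ≢ l → p ≢ i → τ p ≡ p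
    τ-other a b c = trans (cong (transpose i e) (transpose-other e l a b)) (transpose-other i e c a)
    low : ∀ p → lo ≤ p → p < l ⊎ p ≡ l → Key-is (below v) o (κ' (τ p))
    low p lo≤p (inj₁ p<l)  = subst (λ x → Key-is (below v) o (κ' x)) (sym (τ-other (<⇒≢ (<-≤-trans p<l l≤e)) (<⇒≢ p<l) (<⇒≢ (<-≤-trans p<l (≤-trans l≤e e≤i))))) (Zones.small z lo≤p p<l)
    low p lo≤p (inj₂ refl) = subst (λ x → Key-is (below v) o (κ' x)) (sym (trans (cong (transpose i e) (transpose-right e p)) (transpose-right i e))) h
    mid : ∀ p → l < p → p < e ⊎ p ≡ e → Key-is (atMost v) o (κ' (τ p)) × Key-is (geq v) o (κ' (τ p))
    mid p l<p (inj₁ p<e)  = subst (λ x → Key-is (atMost v) o (κ' x) × Key-is (geq v) o (κ' x)) (sym (τ-other (<⇒≢ p<e) (≢-sym (<⇒≢ l<p)) (<⇒≢ (<-≤-trans p<e e≤i)))) (Zones.same z (<⇒≤ l<p) p<e)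
    mid p l<p (inj₂ refl) = subst (λ x → Key-is (atMost v) o (κ' x) × Key-is (geq v) o (κ' x))
      (sym (trans (cong (transpose i p) (transpose-left p l)) (transpose-other i p (<⇒≢ (<-≤-trans l<p e≤i)) (<⇒≢ l<p)))) (Zones.same z ≤-refl l<p)
    high : ∀ p → e < p → p < i ⊎ p ≡ i → Key-is (above v) o (κ' (τ p))
    high p e<p (inj₁ p<i)  = subst (λ x → Key-is (above v) o (κ' x)) (sym (τ-other (≢-sym (<⇒≢ e<p)) (≢-sym (<⇒≢ (≤-<-trans l≤e e<p))) (<⇒≢ p<i))) (Zones.large z (<⇒≤ e<p) p<i)
    high p e<p (inj₂ refl) = subst (λ x → Key-is (above v) o (κ' x))
      (sym (trans (cong (transpose p e) (transpose-other e l (≢-sym (<⇒≢ e<p)) (≢-sym (<⇒≢ (≤-<-trans l≤e e<p))))) (transpose-left p e))) (Zones.large z ≤-refl e<p)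

  record Exchanged (P' Q' : ℕ) (π : Placement n) (σ σ' : View) : Set a where
    field
      regs  : nr σ' ≡ nr σ
      word0 : wr σ' 0 ≡ wr σ 0
      word2 : wr σ' 2 ≡ wr σ 2
      x≡    : wr σ' 1 0 ≡ wr σ 1 0
      placed : Placed π (mem σ') (ow σ')
      fr    : Fr (λ z → z ≢ P' × z ≢ Q') (mem σ) (ow σ) (mem σ') (ow σ')

  opaque
    wp-exchange : ∀ {P' Q' π σ τ} p q {s t} → n < W → (P<n : P' < n) (Q<n : Q' < n) → nr σ 0 p ≡ P' → nr σ 0 q ≡ Q' →
      Placed π (mem σ) (ow σ) → Holds-key (index π P') (ow σ) (wr σ 1 0) →
      WP (exchange p q {s} {t}) (Post (τ + 6) (Exchanged P' Q' (swapped P<n Q<n π) σ)) τ σ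
    wp-exchange {P'} {Q'} {π} {σ} {τ} p q n<W P<n Q<n refl refl pl hx =
      wp-seq (wp-load (≤-<-trans z≤n n<W) ≤-refl λ m₁ o₁ h₁ → wp-seq (wp-store (≤-<-trans z≤n n<W) ≤-refl λ m₂ o₂ h₂ →
      wp-store (≤-<-trans z≤n n<W) ≤-refl λ m₃ o₃ h₃ →
        linear 1 (λ t → ⊢ t ⊕ κ 2 ⊕ κ 2 ⊕ κ 2 ⊑ t ⊕ κ 6) τ , record
        { regs = refl ; word0 = refl ; word2 = refl ; x≡ = refl
        ; placed = λ z z<n → place m₁ m₂ m₃ (proj₁ h₁) (proj₁ h₂) (proj₁ h₃) z z<n
        ; fr = Fr-trans (Fr-havoc (proj₁ h₁)) (Fr-trans (Fr-havoc (proj₁ h₂)) (Fr-trans (Fr-write (λ u e → proj₁ u (sym e)))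
            (Fr-trans (Fr-havoc (proj₁ h₃)) (Fr-write (λ u e → proj₂ u (sym e)))))) }))
      where
      place : ∀ {o₁ o₂ o₃} m₁ m₂ m₃ → Corr (mem σ) (ow σ) m₁ o₁ → Corr m₁ o₁ m₂ o₂ → Corr (m₂ [ P' ]≔ m₁ Q') o₂ m₃ o₃ →
        ∀ z → z < n → Holds-key (index π (transpose P' Q' z)) o₃ ((m₃ [ Q' ]≔ wr σ 1 0) z)
      place {o₁} {o₂} {o₃} m₁ m₂ m₃ c₁ c₂ c₃ z z<n = upd-either m₃ (Holds-key (index π (transpose P' Q' z)) o₃) Q' (wr σ 1 0) z
        (λ { refl → subst (λ x → Holds-key (index π x) o₃ (wr σ 1 0)) (sym (transpose-right P' z))
               (holds-more (grows (Fr-trans {λ _ → ⊤} (Fr-havoc c₁) (Fr-havoc c₂))) hx |> holds-more (grows (Fr-havoc {λ _ → ⊤} c₃))) })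
        (λ Q≢z → holds-fr {λ _ → ⊤} (Fr-havoc c₃) tt (upd-either m₂ (Holds-key (index π (transpose P' Q' z)) o₂) P' (m₁ Q') z
          (λ { refl → subst (λ x → Holds-key (index π x) o₂ (m₁ Q')) (sym (transpose-left z Q'))
                 (holds-more (grows (Fr-havoc {λ _ → ⊤} c₂)) (holds-fr {λ _ → ⊤} (Fr-havoc c₁) tt (pl Q' Q<n))) })
          (λ P≢z → subst (λ x → Holds-key (index π x) o₂ (m₂ z)) (sym (transpose-other P' Q' (≢-sym P≢z) (≢-sym Q≢z)))
                 (holds-fr {λ _ → ⊤} (Fr-havoc (Corr-trans c₁ c₂)) tt (pl z z<n)))))
        where
        _|>_ : ∀ {ℓ ℓ'} {A : Set ℓ} {B : Set ℓ'} → A → (A → B) → B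
        x |> f = f x

  Cut : ℕ → Placement n → List Word → Set a
  Cut c π o = ∀ p q → p < c → c ≤ q → q < n → inputAt (index π p) ∉ o → inputAt (index π q) ∉ o →
    less (value (inputAt (index π p))) (value (inputAt (index π q))) ≡ true

  cut-more : ∀ {c π o o'} → (∀ {x} → x ∈ o → x ∈ o') → Cut c π o → Cut c π o'
  cut-more g h p q p<c c≤q q<n p∉ q∉ = h p q p<c c≤q q<n (λ i → p∉ (g i)) (λ i → q∉ (g i))

  cut-swapped : ∀ {c i j π o} (i<n : i < n) (j<n : j < n) → (i < c × j < c) ⊎ (c ≤ i × c ≤ j) → Cut c π o → Cut c (swapped i<n j<n π) o
  cut-swapped {c} {i} {j} i<n j<n side h p q p<c c≤q q<n = h (transpose i j p) (transpose i j q) (low side) (high side) (transpose-< i<n j<n q<n)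
    where
    low : (i < c × j < c) ⊎ (c ≤ i × c ≤ j) → transpose i j p < c
    low (inj₁ (i<c , j<c)) = transpose-< i<c j<c p<c
    low (inj₂ (c≤i , c≤j)) = subst (_< c) (sym (transpose-other i j (<⇒≢ (<-≤-trans p<c c≤i)) (<⇒≢ (<-≤-trans p<c c≤j)))) p<c
    high : (i < c × j < c) ⊎ (c ≤ i × c ≤ j) → c ≤ transpose i j q
    high (inj₁ (i<c , j<c)) = subst (c ≤_) (sym (transpose-other i j (≢-sym (<⇒≢ (<-≤-trans i<c c≤q))) (≢-sym (<⇒≢ (<-≤-trans j<c c≤q))))) c≤q
    high (inj₂ (c≤i , c≤j)) with q ≟ i | q ≟ j
    ... | yes _ | _     = c≤j
    ... | no _  | yes _ = c≤i
    ... | no _  | no _  = c≤q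

  Ext : ℕ → Set
  Ext j = j < 9 ⊎ 11 < j

  ext≢ : ∀ {j} c → Ext j → {T (9 ≤ᵇ c)} → {T (c ≤ᵇ 11)} → c ≢ j
  ext≢ c (inj₁ j<9)  {h} refl = <⇒≱ j<9 (≤ᵇ⇒≤ 9 c h)
  ext≢ c (inj₂ 11<j) {_} {h} refl = <⇒≱ 11<j (≤ᵇ⇒≤ c 11 h)

  module Partitioning (lo hi : ℕ) (lo≤hi : lo ≤ hi) (hi≤n : hi ≤ n) (n<W : n + 4 < W) (σ₀ : View) (ea : nr σ₀ 0 7 ≡ lo) (eb : nr σ₀ 0 8 ≡ hi)
    (π₀ : Placement n) (placed₀ : Placed π₀ (mem σ₀) (ow σ₀)) where

    v : Value
    v = value (wr σ₀ 2 0)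

    e₀ : ℕ
    e₀ = length (ow σ₀)

    m : ℕ
    m = hi ∸ lo

    -- Positions lo ≤ … < l < … ≤ e < … ≤ i hold small, equal and large keys; words from c on have
    -- not been looked at; dl and dg are the contributions of a word that is being moved.
    record PS (i₀ i c k dl dg : ℕ) (σ : View) : Set a where
      field
        l e nl ng : ℕ
        outer  : ∀ j → Ext j → nr σ 0 j ≡ nr σ₀ 0 j
        r9     : nr σ 0 9 ≡ l
        r10    : nr σ 0 10 ≡ i₀
        r11    : nr σ 0 11 ≡ e
        word2  : wr σ 2 ≡ wr σ₀ 2
        l≡     : lo + nl ≡ l
        e≡     : e + ng ≡ i
        l≤e    : l ≤ e
        c+k    : c + k ≡ hi
        π      : Placement n
        placed : Placed π (mem σ) (ow σ)
        zones  : Zones v (index π) lo l e i (ow σ)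
        cuts   : ∀ {c} → c ≤ lo ⊎ hi ≤ c → Cut c π₀ (ow σ₀) → Cut c π (ow σ)
        grown  : ∀ {x} → x ∈ ow σ₀ → x ∈ ow σ
        o≤     : e₀ ≤ length (ow σ)
        lowC   : nl + dl + rankOf (below v) c k σ + e₀ ≤ rankOf (below v) lo m σ₀ + length (ow σ)
        highC  : ng + dg + rankOf (above v) c k σ + e₀ ≤ rankOf (above v) lo m σ₀ + length (ow σ)

    counts-fr : ∀ χ c k {x R σ σ'} {U : ℕ → Set} → Fr U (mem σ) (ow σ) (mem σ') (ow σ') → (∀ p → p < k → U (c + p)) →
      x + rankOf χ c k σ + e₀ ≤ R + length (ow σ) → x + rankOf χ c k σ' + e₀ ≤ R + length (ow σ')
    counts-fr χ c k {x} {R} {σ} {σ'} f inU h = linear 7 (λ x r r' e R o o' → x ⊕ r ⊕ e ⊑ R ⊕ o ⇒ r' ⊕ o ⊑ r ⊕ o' ⇒ ⊢ x ⊕ r' ⊕ e ⊑ R ⊕ o')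
      x (rankOf χ c k σ) (rankOf χ c k σ') e₀ R (length (ow σ)) (length (ow σ')) h (proj₂ (fr-count χ c k f inU))

    ps-havoc : ∀ {i₀ i c k dl dg} → Stable (PS i₀ i c k dl dg)
    ps-havoc {c = c} {k} {dl} {dg} {σ} {m'} {o'} I h = record { PS I
      ; placed = placed-fr {π = PS.π I} f (PS.placed I) ; zones = zones-more (grows g) (PS.zones I)
      ; cuts = λ s x → cut-more {π = PS.π I} (grows g) (PS.cuts I s x) ; grown = λ x → grows g (PS.grown I x)
      ; o≤ = ≤-trans (PS.o≤ I) (Corr-length (proj₁ h))
      ; lowC = counts-fr (below v) c k {σ = σ} {havoc σ m' o'} g (λ _ _ → tt) (PS.lowC I)
      ; highC = counts-fr (above v) c k {σ = σ} {havoc σ m' o'} g (λ _ _ → tt) (PS.highC I) }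
      where
      f : Fr (_< n) (mem σ) (ow σ) m' o'
      f = Fr-havoc (proj₁ h)
      g : Fr (λ _ → ⊤) (mem σ) (ow σ) m' o'
      g = Fr-havoc (proj₁ h)

    0<W : 0 < W
    0<W = ≤-<-trans z≤n n<W

    rank-first : ∀ χ i k σ → rankOf χ i (suc k) σ ≡ bit (χ (value (mem σ i))) + rankOf χ (suc i) k σ
    rank-first χ i k σ = trans (count-first (λ p → χ (value (mem σ (i + p)))) k)
      (cong₂ _+_ (cong (λ z → bit (χ (value (mem σ z)))) (+-identityʳ i)) (count-cong k (λ p _ → cong (λ z → χ (value (mem σ z))) (+-suc i p))))

    -- Word x of position i is in the register.
    look : ∀ {i k σ} → PS i i i (suc k) 0 0 σ → let x = value (mem σ i) in PS i i (suc i) k (bit (below v x)) (bit (above v x)) σ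
    look {i} {k} {σ} I = record { PS I ; c+k = trans (sym (+-suc i k)) (PS.c+k I)
      ; lowC = subst (_≤ rankOf (below v) lo m σ₀ + length (ow σ)) (shift (PS.nl I) (below v)) (PS.lowC I)
      ; highC = subst (_≤ rankOf (above v) lo m σ₀ + length (ow σ)) (shift (PS.ng I) (above v)) (PS.highC I) }
      where
      shift : ∀ x χ → x + 0 + rankOf χ i (suc k) σ + e₀ ≡ x + bit (χ (value (mem σ i))) + rankOf χ (suc i) k σ + e₀
      shift x χ = trans (cong (λ z → x + 0 + z + e₀) (rank-first χ i k σ))
        (linear 4 (λ x b r e → ⊢ x ⊕ κ 0 ⊕ (b ⊕ r) ⊕ e ≐ x ⊕ b ⊕ r ⊕ e) x (bit (χ (value (mem σ i)))) (rankOf χ (suc i) k σ) e₀)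

    forget : ∀ x b r {R} → x + b + r + e₀ ≤ R → x + 0 + r + e₀ ≤ R
    forget x b r {R} = linear 5 (λ x b r e R → x ⊕ b ⊕ r ⊕ e ⊑ R ⇒ ⊢ x ⊕ κ 0 ⊕ r ⊕ e ⊑ R) x b r e₀ R

    absorb : ∀ x b r {R} → b ≡ true → x + bit b + r + e₀ ≤ R → suc x + 0 + r + e₀ ≤ R
    absorb x _ r {R} refl = linear 4 (λ x r e R → x ⊕ κ 1 ⊕ r ⊕ e ⊑ R ⇒ ⊢ κ 1 ⊕ x ⊕ κ 0 ⊕ r ⊕ e ⊑ R) x r e₀ R

    record Loaded (i k : ℕ) (w : Word) (σ : View) : Set a where
      field
        ps : PS i i (suc i) k (bit (below v (value w))) (bit (above v (value w))) σ
        w≡ : wr σ 1 0 ≡ w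
        holds : Holds-key (index (PS.π ps) i) (ow σ) w

    loaded-havoc : ∀ {i k w} → Stable (Loaded i k w)
    loaded-havoc I h = record { ps = ps-havoc ps h ; w≡ = w≡ ; holds = holds-more (grows (Fr-havoc {λ _ → ⊤} (proj₁ h))) holds }
      where open Loaded I

    large : ∀ {i k w σ} → above v (value w) ≡ true → Loaded i k w σ → PS i (suc i) (suc i) k 0 0 σ
    large {i} {k} {w} {σ} gt L = record { PS ps ; ng = suc (PS.ng ps) ; e≡ = trans (+-suc (PS.e ps) (PS.ng ps)) (cong suc (PS.e≡ ps))
      ; zones = zones-large (PS.zones ps) (classify {above v} holds gt)
      ; lowC = forget (PS.nl ps) (bit (below v (value w))) (rankOf (below v) (suc i) k σ) (PS.lowC ps) ; highC = absorb (PS.ng ps) (above v (value w)) (rankOf (above v) (suc i) k σ) gt (PS.highC ps) }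
      where open Loaded L

    i<hi : ∀ {i₀ i c k dl dg σ} → PS i₀ i (suc c) k dl dg σ → c < hi
    i<hi {c = c} {k} I = subst (suc c ≤_) (PS.c+k I) (m≤m+n (suc c) k)

    opaque
      wp-place : ∀ {i k w σ τ} → Loaded i k w σ → above v (value w) ≡ false →
        WP (exchange 10 11 ⨾ ite (wrd 1 0 <ʷ wrd 2 0) (exchange 11 9 ⨾ num 0 9 ≔ r 0 9 ∔ lit 1) skip ⨾ num 0 11 ≔ r 0 11 ∔ lit 1)
          (Post (τ + 30) (PS i (suc i) (suc i) k 0 0)) τ σ
      wp-place {i} {k} {w} {σ} {τ} L w≼v =
        wp-seq (mono (wp-exchange {π = π} 10 11 (≤-<-trans (m≤m+n n 4) n<W) i<n e<n r10 r11 placed (subst (Holds-key (index π i) (ow σ)) (sym w≡) holds)) λ τ₁ σ₁ (τ₁≤ , E₁) →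
        let module E₁ = Exchanged E₁ in
        wp-seq (mono (wp-ite-post {N = τ₁ + 12} {Ξ = Ξ} stable 0<W λ m₂ o₂ h₂ →
          (λ lt → wp-seq (mono (wp-exchange {π = π₁} 11 9 (≤-<-trans (m≤m+n n 4) n<W) e<n l<n (reg E₁ 11 r11) (reg E₁ 9 r9)
                (placed-fr {π = π₁} (Fr-havoc (proj₁ h₂)) E₁.placed)
                (subst₂ (λ x y → Holds-key (index π x) o₂ y) (sym (transpose-right i e)) (sym (trans E₁.x≡ w≡)) (holds-more (λ x → grows (Fr-havoc {λ _ → ⊤} (proj₁ h₂)) (grows E₁.fr x)) holds)))
              λ τ₃ σ₃ (τ₃≤ , E₃) → let module E₃ = Exchanged E₃
                                       is< = trans (sym (less≡ E₁)) lt
                                       f = Fr-trans (after E₁.fr) (Fr-trans (Fr-havoc (proj₁ h₂)) (after' E₃.fr)) in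
              wp-set (subst (λ x → 1 + (x + 1) < W) (sym (trans (cong (λ f → f 0 9) E₃.regs) (reg E₁ 9 r9))) (in-range l<n)) λ m₄ o₄ h₄ →
              linear 2 (λ t t₃ → t₃ ⊑ t ⊕ κ 1 ⊕ κ 6 ⇒ ⊢ t₃ ⊕ κ 4 ⊑ t ⊕ κ 12) τ₁ τ₃ τ₃≤ ,
              adjust {m' = m₄} {o₄} h₄ (suc l) (suc nl) (swapped e<n l<n π₁)
                (λ j x → trans (upd-other (nr σ₃ 0) 9 (nr σ₃ 0 9 + 1) (ext≢ 9 x)) (trans (cong (λ f → f 0 j) E₃.regs) (trans (cong (λ f → f 0 j) E₁.regs) (outer j x))))
                (trans (+-comm _ 1) (cong suc (trans (cong (λ f → f 0 9) E₃.regs) (reg E₁ 9 r9))))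
                (trans (cong (λ f → f 0 10) E₃.regs) (reg E₁ 10 r10)) (trans (cong (λ f → f 0 11) E₃.regs) (reg E₁ 11 r11))
                (trans E₃.word2 (trans E₁.word2 word2)) (trans (+-suc lo nl) (cong suc l≡)) (s≤s l≤e) E₃.placed
                (zones-more (grows f) (zones-small l≤e e≤i zones (classify {below v} holds is<)))
                (λ s c → cut-swapped {π = π₁} e<n l<n (side s lo≤e e<hi lo≤l l<hi) (cut-swapped {π = π} i<n e<n (side s lo≤i i<hi' lo≤e e<hi) (cut-more {π = π} (grows f) (cuts s c))))
                f (absorb nl (below v (value w)) (rankOf (below v) (suc i) k σ) is< lowC) (forget ng (bit (above v (value w))) (rankOf (above v) (suc i) k σ) highC))) ,
          (λ ge → wp-skip (linear 1 (λ t → ⊢ t ⊕ κ 1 ⊑ t ⊕ κ 12) τ₁ ,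
              adjust' {m' = m₂} {o₂} h₂ l nl π₁ (λ j x → trans (cong (λ f → f 0 j) E₁.regs) (outer j x))
                (reg E₁ 9 r9) (reg E₁ 10 r10) (reg E₁ 11 r11) (trans E₁.word2 word2) l≡ (m≤n⇒m≤1+n l≤e) E₁.placed
                (zones-more (grows E₁.fr) (zones-equal l≤e e≤i zones (classify {atMost v} holds (not-false w≼v) , classify {geq v} holds (not-false (trans (sym (less≡ E₁)) ge)))))
                (λ s c → cut-swapped {π = π} i<n e<n (side s lo≤i i<hi' lo≤e e<hi) (cut-more {π = π} (grows E₁.fr) (cuts s c)))
                (after E₁.fr) (forget nl (bit (below v (value w))) (rankOf (below v) (suc i) k σ) lowC) (forget ng (bit (above v (value w))) (rankOf (above v) (suc i) k σ) highC))))
        λ τ₅ σ₅ (τ₅≤ , S₅) → let open Sorted' S₅ in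
        wp-set (subst (λ x → 1 + (x + 1) < W) (sym q11) (in-range e<n)) λ m₆ o₆ h₆ →
          linear 3 (λ t t₁ t₅ → t₁ ⊑ t ⊕ κ 6 ⇒ t₅ ⊑ t₁ ⊕ κ 12 ⊕ κ 1 ⇒ ⊢ t₅ ⊕ κ 4 ⊑ t ⊕ κ 30) τ τ₁ τ₅ τ₁≤ τ₅≤ ,
          ps-set (ps-havoc' S₅ h₆)))
        where
        open Loaded L
        open PS ps
        e≤i : e ≤ i
        e≤i = subst (e ≤_) e≡ (m≤m+n e ng)
        lo≤l : lo ≤ l
        lo≤l = subst (lo ≤_) l≡ (m≤m+n lo nl)
        i<hi' : i < hi
        i<hi' = i<hi ps
        e<hi : e < hi
        e<hi = ≤-<-trans e≤i i<hi'
        l<hi : l < hi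
        l<hi = ≤-<-trans l≤e e<hi
        lo≤e : lo ≤ e
        lo≤e = ≤-trans lo≤l l≤e
        lo≤i : lo ≤ i
        lo≤i = ≤-trans lo≤e e≤i
        i<n : i < n
        i<n = <-≤-trans i<hi' hi≤n
        e<n : e < n
        e<n = ≤-<-trans e≤i i<n
        l<n : l < n
        l<n = ≤-<-trans l≤e e<n
        π₁ : Placement n
        π₁ = swapped i<n e<n π
        in-range : ∀ {x} → x < n → 1 + (x + 1) < W
        in-range {x} x<n = linear 3 (λ x n W → x ⊏ n ⇒ n ⊕ κ 4 ⊏ W ⇒ ⊢ κ 1 ⊕ (x ⊕ κ 1) ⊏ W) x n W x<n n<W
        side : ∀ {c x y} → c ≤ lo ⊎ hi ≤ c → lo ≤ x → x < hi → lo ≤ y → y < hi → (x < c × y < c) ⊎ (c ≤ x × c ≤ y)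
        side (inj₁ c≤) lx xh ly yh = inj₂ (≤-trans c≤ lx , ≤-trans c≤ ly)
        side (inj₂ ≤c) lx xh ly yh = inj₁ (<-≤-trans xh ≤c , <-≤-trans yh ≤c)
        reg : ∀ {π' σ' x} → Exchanged i e π' σ σ' → ∀ j → nr σ 0 j ≡ x → nr σ' 0 j ≡ x
        reg E j eq = trans (cong (λ f → f 0 j) (Exchanged.regs E)) eq
        less≡ : ∀ {π' σ'} → Exchanged i e π' σ σ' → less (value (wr σ' 1 0)) (value (wr σ' 2 0)) ≡ less (value w) v
        less≡ E = cong₂ (λ x y → less (value x) (value y)) (trans (Exchanged.x≡ E) w≡) (trans (cong (λ f → f 0) (Exchanged.word2 E)) (cong (λ f → f 0) word2))
        after : ∀ {m o m' o'} → Fr (λ z → z ≢ i × z ≢ e) m o m' o' → Fr (suc i ≤_) m o m' o'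
        after = Fr-weaken (λ i<z → ≢-sym (<⇒≢ i<z) , ≢-sym (<⇒≢ (≤-<-trans e≤i i<z)))
        after' : ∀ {m o m' o'} → Fr (λ z → z ≢ e × z ≢ l) m o m' o' → Fr (suc i ≤_) m o m' o'
        after' = Fr-weaken (λ i<z → ≢-sym (<⇒≢ (≤-<-trans e≤i i<z)) , ≢-sym (<⇒≢ (≤-<-trans (≤-trans l≤e e≤i) i<z)))
        -- As PS, but the end of the equal part has not been advanced yet.
        record Sorted' (σ' : View) : Set a where
          field
            q11 : nr σ' 0 11 ≡ e
            ps' : PS i (suc i) (suc i) k 0 0 (setN (num 0 11) (suc e) σ')
            pse : PS.e ps' ≡ suc e
        Ξ : View → Set a
        Ξ = Sorted'
        ps-havoc' : ∀ {σ' m o} → Sorted' σ' → Havoc σ' m o → Sorted' (havoc σ' m o)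
        ps-havoc' S h = record { q11 = Sorted'.q11 S ; ps' = ps-havoc (Sorted'.ps' S) h ; pse = Sorted'.pse S }
        stable : Stable Ξ
        stable = ps-havoc'
        ps-set : ∀ {σ'} → Sorted' σ' → PS i (suc i) (suc i) k 0 0 (setN (num 0 11) (nr σ' 0 11 + 1) σ')
        ps-set {σ'} S = subst (λ x → PS i (suc i) (suc i) k 0 0 (setN (num 0 11) x σ')) (trans (cong suc (sym (Sorted'.q11 S))) (+-comm 1 _)) (Sorted'.ps' S)
        adjust' : ∀ {σ' m' o'} → Havoc σ' m' o' → ∀ l' nl' (π' : Placement n) → (∀ j → Ext j → nr σ' 0 j ≡ nr σ₀ 0 j) → nr σ' 0 9 ≡ l' → nr σ' 0 10 ≡ i → nr σ' 0 11 ≡ e →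
          wr σ' 2 ≡ wr σ₀ 2 → lo + nl' ≡ l' → l' ≤ suc e → Placed π' (mem σ') (ow σ') → Zones v (index π') lo l' (suc e) (suc i) (ow σ') →
          (∀ {c} → c ≤ lo ⊎ hi ≤ c → Cut c π₀ (ow σ₀) → Cut c π' (ow σ')) → Fr (suc i ≤_) (mem σ) (ow σ) (mem σ') (ow σ') →
          nl' + 0 + rankOf (below v) (suc i) k σ + e₀ ≤ rankOf (below v) lo m σ₀ + length (ow σ) →
          ng + 0 + rankOf (above v) (suc i) k σ + e₀ ≤ rankOf (above v) lo m σ₀ + length (ow σ) → Sorted' (havoc σ' m' o')
        adjust' {σ'} h l' nl' π' out q9 q10 q11 q2 l≡' l'≤ pl zn ct f lc hc = record { q11 = q11 ; pse = refl ; ps' = ps-havoc {σ = setN (num 0 11) (suc e) σ'} (record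
          { l = l' ; e = suc e ; nl = nl' ; ng = ng ; outer = λ j x → trans (upd-other (nr σ' 0) 11 (suc e) (ext≢ 11 x)) (out j x)
          ; r9 = q9 ; r10 = q10 ; r11 = refl ; word2 = q2 ; l≡ = l≡' ; e≡ = cong suc e≡ ; l≤e = l'≤ ; c+k = c+k ; π = π' ; placed = pl ; zones = zn ; cuts = ct
          ; grown = λ x → grows f (grown x) ; o≤ = ≤-trans o≤ (Fr-length f)
          ; lowC = counts-fr (below v) (suc i) k {σ = σ} {σ'} f (λ p _ → m≤m+n (suc i) p) lc
          ; highC = counts-fr (above v) (suc i) k {σ = σ} {σ'} f (λ p _ → m≤m+n (suc i) p) hc }) h }
        adjust : ∀ {σ' m' o'} → Havoc σ' m' o' → ∀ l' nl' (π' : Placement n) → (∀ j → Ext j → (nr σ' 0 [ 9 ]≔ (nr σ' 0 9 + 1)) j ≡ nr σ₀ 0 j) → nr σ' 0 9 + 1 ≡ l' → nr σ' 0 10 ≡ i → nr σ' 0 11 ≡ e →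
          wr σ' 2 ≡ wr σ₀ 2 → lo + nl' ≡ l' → l' ≤ suc e → Placed π' (mem σ') (ow σ') → Zones v (index π') lo l' (suc e) (suc i) (ow σ') →
          (∀ {c} → c ≤ lo ⊎ hi ≤ c → Cut c π₀ (ow σ₀) → Cut c π' (ow σ')) → Fr (suc i ≤_) (mem σ) (ow σ) (mem σ') (ow σ') →
          nl' + 0 + rankOf (below v) (suc i) k σ + e₀ ≤ rankOf (below v) lo m σ₀ + length (ow σ) →
          ng + 0 + rankOf (above v) (suc i) k σ + e₀ ≤ rankOf (above v) lo m σ₀ + length (ow σ) → Sorted' (setN (num 0 9) (nr σ' 0 9 + 1) (havoc σ' m' o'))
        adjust {σ'} h l' nl' π' out q9 q10 q11 q2 l≡' l'≤ pl zn ct f lc hc = adjust' {setN (num 0 9) (nr σ' 0 9 + 1) σ'} h l' nl' π' out q9 q10 q11 q2 l≡' l'≤ pl zn ct f lc hc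

    opaque
      wp-partitionStep : ∀ {i k σ τ} → PS i i i (suc k) 0 0 σ → WP partitionStep (Post (τ + 40) (PS (suc i) (suc i) (suc i) k 0 0)) τ σ
      wp-partitionStep {i} {k} {σ} {τ} I =
        wp-seq (wp-load 0<W ≤-refl λ m₁ o₁ h₁ → let J = ps-havoc I h₁ in
        wp-seq (mono (wp-ite-post {N = τ + 34} {Ξ = PS i (suc i) (suc i) k 0 0} ps-havoc 0<W λ m₂ o₂ h₂ →
          (λ lt → wp-skip (linear 1 (λ t → ⊢ t ⊕ κ 2 ⊕ κ 1 ⊑ t ⊕ κ 34) τ , large (trans (sym (less≡ {havoc σ m₁ o₁} (PS.word2 J))) lt) (loaded-havoc (loaded J) h₂))) ,
          (λ ge → relax (linear 1 (λ t → ⊢ t ⊕ κ 2 ⊕ κ 1 ⊕ κ 30 ⊑ t ⊕ κ 34) τ) (wp-place (loaded-havoc (loaded J) h₂) (trans (sym (less≡ {havoc σ m₁ o₁} (PS.word2 J))) ge))))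
        λ τ₃ σ₃ (τ₃≤ , I₃) →
        wp-set (subst (λ x → 1 + (x + 1) < W) (sym (PS.r10 I₃)) (linear 3 (λ x n W → x ⊏ n ⇒ n ⊕ κ 4 ⊏ W ⇒ ⊢ κ 1 ⊕ (x ⊕ κ 1) ⊏ W) i n W (<-≤-trans (i<hi I₃) hi≤n) n<W)) λ m₄ o₄ h₄ →
        linear 2 (λ t t₃ → t₃ ⊑ t ⊕ κ 34 ⊕ κ 1 ⇒ ⊢ t₃ ⊕ κ 4 ⊑ t ⊕ κ 40) τ τ₃ τ₃≤ ,
        bump (ps-havoc I₃ h₄)))
        where
        bump : ∀ {σ'} → PS i (suc i) (suc i) k 0 0 σ' → PS (suc i) (suc i) (suc i) k 0 0 (setN (num 0 10) (nr σ' 0 10 + 1) σ')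
        bump {σ'} I' = record { PS I' ; outer = λ j x → trans (upd-other (nr σ' 0) 10 (nr σ' 0 10 + 1) (ext≢ 10 x)) (PS.outer I' j x)
          ; r10 = trans (+-comm _ 1) (cong suc (PS.r10 I')) }
        loaded : ∀ {σ'} (J : PS i i i (suc k) 0 0 σ') → Loaded i k (mem σ' i) (setW (wrd 1 0) (mem σ' (nr σ' 0 10)) σ')
        loaded {σ'} J = record { ps = record { PS (look J) } ; w≡ = cong (mem σ') (PS.r10 J)
          ; holds = PS.placed J i (<-≤-trans (subst (i <_) (PS.c+k J) (m<m+n i (s≤s z≤n))) hi≤n) }
        less≡ : ∀ {σ'} → wr σ' 2 ≡ wr σ₀ 2 → less (value (wr σ' 2 0)) (value (mem σ' (nr σ 0 10))) ≡ less v (value (mem σ' i))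
        less≡ {σ'} e2 = cong₂ (λ x y → less (value x) (value y)) (cong (λ f → f 0) e2) (cong (mem σ') (PS.r10 I))

    opaque
      wp-partition : ∀ {τ} → WP partition (Post (τ + m * 50 + 10) (PS hi hi hi 0 0 0)) τ σ₀
      wp-partition {τ} = wp-seq (wp-set 0<W λ m₁ o₁ h₁ → wp-seq (wp-set 0<W λ m₂ o₂ h₂ → wp-seq (wp-set 0<W λ m₃ o₃ h₃ →
        mono (wp-for {n = m} {C = 50} I∙ (λ i (h , I) hv → h , ps-havoc I hv) (λ _ → 0<W)
          (λ {i} (i≤m , I) lt → +-cancelˡ-< lo i m (subst₂ _<_ (PS.r10 I) (trans (trans (PS.outer I 8 (inj₁ (≤ᵇ⇒≤ 9 9 tt))) eb) (sym (m+[n∸m]≡n lo≤hi))) (<ᵇ-true _ _ lt)))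
          (λ {i} (i≤m , I) ge → ≤-antisym i≤m (+-cancelˡ-≤ lo m i (subst₂ _≤_ (trans (trans (PS.outer I 8 (inj₁ (≤ᵇ⇒≤ 9 9 tt))) eb) (sym (m+[n∸m]≡n lo≤hi))) (PS.r10 I) (<ᵇ-false _ _ ge))))
          (λ {i} {σ} {t} (i≤m , I) i<m → relax ≤-refl (mono (wp-partitionStep (next-k i (m ∸ suc i) (suc-∸ i<m) I)) λ t' σ' (t≤ , I') →
            t≤ , i<m , subst (λ x → PS x x x (m ∸ suc i) 0 0 σ') (sym (+-suc lo i)) I'))
          (≤ᵇ⇒≤ 44 50 tt)
          (z≤n , ps-havoc {σ = setN (num 0 11) (nr σ₀ 0 7) (setN (num 0 10) (nr σ₀ 0 7) (setN (num 0 9) (nr σ₀ 0 7) σ₀))} start (Corr-trans (proj₁ h₁) (Corr-trans (proj₁ h₂) (proj₁ h₃)) , proj₂ h₃)))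
        λ τ' σ' (τ'≤ , (_ , I)) → ≤-trans τ'≤ (≤-reflexive (linear 2 (λ t x → ⊢ t ⊕ κ 2 ⊕ κ 2 ⊕ κ 2 ⊕ x ⊕ κ 4 ≐ t ⊕ x ⊕ κ 10) τ (m * 50))) ,
          subst₂ (λ x y → PS x x x y 0 0 σ') (m+[n∸m]≡n lo≤hi) (n∸n≡0 m) I)))
        where
        I∙ : ℕ → View → Set a
        I∙ i σ = i ≤ m × PS (lo + i) (lo + i) (lo + i) (m ∸ i) 0 0 σ
        suc-∸ : ∀ {i} → i < m → m ∸ i ≡ suc (m ∸ suc i)
        suc-∸ {i} i<m = +-∸-assoc 1 {m} {suc i} i<m
        next-k : ∀ i k' → m ∸ i ≡ suc k' → ∀ {σ} → PS (lo + i) (lo + i) (lo + i) (m ∸ i) 0 0 σ → PS (lo + i) (lo + i) (lo + i) (suc k') 0 0 σ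
        next-k i k' eq {σ} = subst (λ x → PS (lo + i) (lo + i) (lo + i) x 0 0 σ) eq
        start : PS (lo + 0) (lo + 0) (lo + 0) m 0 0 (setN (num 0 11) (nr σ₀ 0 7) (setN (num 0 10) (nr σ₀ 0 7) (setN (num 0 9) (nr σ₀ 0 7) σ₀)))
        start = record
          { l = lo + 0 ; e = lo + 0 ; nl = 0 ; ng = 0
          ; outer = λ j x → trans (upd-other ((nr σ₀ 0 [ 9 ]≔ nr σ₀ 0 7) [ 10 ]≔ nr σ₀ 0 7) 11 (nr σ₀ 0 7) (ext≢ 11 x)) (trans (upd-other (nr σ₀ 0 [ 9 ]≔ nr σ₀ 0 7) 10 (nr σ₀ 0 7) (ext≢ 10 x)) (upd-other (nr σ₀ 0) 9 (nr σ₀ 0 7) (ext≢ 9 x)))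
          ; r9 = trans ea (sym (+-identityʳ lo)) ; r10 = trans ea (sym (+-identityʳ lo)) ; r11 = trans ea (sym (+-identityʳ lo)) ; word2 = refl
          ; l≡ = refl ; e≡ = +-identityʳ (lo + 0) ; l≤e = ≤-refl ; c+k = trans (cong (_+ m) (+-identityʳ lo)) (m+[n∸m]≡n lo≤hi) ; π = π₀ ; placed = placed₀
          ; zones = record { small = λ h₁ h₂ → contradiction (<-≤-trans h₂ (≤-trans (≤-reflexive (+-identityʳ lo)) h₁)) (<-irrefl refl)
              ; same = λ h₁ h₂ → contradiction (<-≤-trans h₂ h₁) (<-irrefl refl) ; large = λ h₁ h₂ → contradiction (<-≤-trans h₂ h₁) (<-irrefl refl) }
          ; cuts = λ _ x → x ; grown = λ x → x ; o≤ = ≤-refl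
          ; lowC = ≤-reflexive (cong (λ x → rankOf (below v) x m σ₀ + e₀) (+-identityʳ lo))
          ; highC = ≤-reflexive (cong (λ x → rankOf (above v) x m σ₀ + e₀) (+-identityʳ lo)) }

  -- Between the keys that are equal to the pivot there is nothing to separate, since the keys are distinct.
  module Separation (X-inj : Injective _≡_ _≈ᴷ_ X) where

    inputAt-key : ∀ {k} (k<n : k < n) → inputAt k ≡ input (fromℕ< k<n)
    inputAt-key {k} k<n with k <? n
    ... | yes p  = cong (λ h → input (fromℕ< h)) (≤-irrelevant p k<n)
    ... | no ¬p  = contradiction k<n ¬p

    same-key : ∀ {j k} → j < n → k < n → value (inputAt j) ≼ value (inputAt k) → value (inputAt k) ≼ value (inputAt j) → j ≡ k
    same-key {j} {k} j<n k<n j≼k k≼j = trans (sym (toℕ-fromℕ< j<n)) (trans (cong toℕ (X-inj x≈y)) (toℕ-fromℕ< k<n))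
      where
      x y : Key
      x = X (fromℕ< j<n)
      y = X (fromℕ< k<n)
      y⊀x : ¬ y ≺ x
      y⊀x = ≺?-false {y} {x} (not-less (subst₂ (λ u w → value u ≼ value w) (inputAt-key j<n) (inputAt-key k<n) j≼k))
      x⊀y : ¬ x ≺ y
      x⊀y = ≺?-false {x} {y} (not-less (subst₂ (λ u w → value u ≼ value w) (inputAt-key k<n) (inputAt-key j<n) k≼j))
      x≈y : x ≈ᴷ y
      x≈y with compareᴷ x y
      ... | tri< x≺y _ _ = contradiction x≺y x⊀y
      ... | tri≈ _ e _   = e
      ... | tri> _ _ y≺x = contradiction y≺x y⊀x

    cut-zone : ∀ {v lo l e hi c o} (π : Placement n) → Zones v (index π) lo l e hi o → Cut lo π o → Cut hi π o →
      lo ≤ l → e ≤ hi → l ≤ c → c ≤ e → Cut c π o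
    cut-zone {v} {lo} {l} {e} {hi} {c} {o} π z cutˡ cutʰ lo≤l e≤hi l≤c c≤e p q p<c c≤q q<n p∉ q∉ with p <? lo | q <? hi
    ... | yes p<lo | _       = cutˡ p q p<lo (≤-trans (≤-trans lo≤l l≤c) c≤q) q<n p∉ q∉
    ... | no _     | no q≮hi = cutʰ p q (<-≤-trans p<c (≤-trans c≤e e≤hi)) (≮⇒≥ q≮hi) q<n p∉ q∉
    ... | no p≮lo  | yes q<hi with p <? l | q <? e
    ...   | yes p<l | yes q<e = less-≼-trans (value (inputAt (index π p))) {v} (Zones.small z (≮⇒≥ p≮lo) p<l p∉)
                                  (le (not-true (proj₂ (Zones.same z (≤-trans l≤c c≤q) q<e) q∉)))
    ...   | yes p<l | no q≮e  = less-≼-trans (value (inputAt (index π p))) {v} (Zones.small z (≮⇒≥ p≮lo) p<l p∉)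
                                  (less⇒≼ v (value (inputAt (index π q))) (Zones.large z (≮⇒≥ q≮e) q<hi q∉))
    ...   | no p≮l  | no q≮e  = ≼-less-trans {v = v} (value (inputAt (index π q)))
                                  (le (not-true (proj₁ (Zones.same z (≮⇒≥ p≮l) (<-≤-trans p<c c≤e)) p∉))) (Zones.large z (≮⇒≥ q≮e) q<hi q∉)
    ...   | no p≮l  | yes q<e = contradiction (trans (sym (position-index π p)) (trans (cong (position π) coincide) (position-index π q))) (<⇒≢ (<-≤-trans p<c c≤q))
      where
      kp kq : Value
      kp = value (inputAt (index π p))
      kq = value (inputAt (index π q))
      zp : Key-is (atMost v) o (index π p) × Key-is (geq v) o (index π p)
      zp = Zones.same z (≮⇒≥ p≮l) (<-≤-trans p<c c≤e)
      zq : Key-is (atMost v) o (index π q) × Key-is (geq v) o (index π q)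
      zq = Zones.same z (≤-trans l≤c c≤q) q<e
      coincide : index π p ≡ index π q
      coincide = same-key (index< π (<-trans (<-≤-trans p<c c≤q) q<n)) (index< π q<n)
        (≼-trans {kp} {v} {kq} (le (not-true (proj₁ zp p∉))) (le (not-true (proj₂ zq q∉))))
        (≼-trans {kq} {v} {kp} (le (not-true (proj₁ zq q∉))) (le (not-true (proj₂ zp p∉))))

  cut-end : ∀ {c π o} → n ≤ c → Cut c π o
  cut-end n≤c p q p<c c≤q q<n = contradiction (<-≤-trans q<n (≤-trans n≤c c≤q)) (<-irrefl refl)

  opaque
    peak-product : ∀ f e k {B} → peak f e ≡ 0 → eval f e * k + k < B → peak f (e ×ₑ lit k) < B
    peak-product f e k {B} p h = subst (_< B) (trans (+-comm (eval f e * k) k) (cong (λ x → x + k + eval f e * k) (sym p))) h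

  module Sorting (T₀ U V Q : ℕ) (0<δ : 0 < δ) (T₀≡ : T₀ ≡ δ * 8192) (U≡ : U ≡ n + T₀) (V≡ : V ≡ U + (n + T₀))
    (V<W : V + (n + T₀) * 1100 + 2000 < W) (room : arrays + (S + S) ≤ M) (M<W : M + S * 16 + 200 < W) (0<S : 0 < S) (1≤Q : 1 ≤ Q)
    (t/S≤Q : ∀ t → t ≤ T₀ → S ≤ t → ⟦ div ⟧ t S ≤ Q) (X-inj : Injective _≡_ _≈ᴷ_ X) where

    open Separation X-inj

    c Φ : ℕ
    c = Q * 3000000
    Φ = 144179200

    n+4<W : n + 4 < W
    n+4<W = linear 4 (λ V n T W → V ⊕ (n ⊕ T) ⊗ 1100 ⊕ κ 2000 ⊏ W ⇒ ⊢ n ⊕ κ 4 ⊏ W) V n T₀ W V<W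

    0<W : 0 < W
    0<W = ≤-<-trans z≤n n+4<W

    record Globals (f : ℕ → ℕ) : Set where
      field
        g0  : f 0 ≡ n
        g2  : f 2 ≡ S
        g12 : f 12 ≡ T₀
        g13 : f 13 ≡ U
        g14 : f 14 ≡ V

    Inner : ℕ → Set
    Inner j = j < 7 ⊎ 11 < j

    inner≢ : ∀ {j} c → Inner j → {T (7 ≤ᵇ c)} → {T (c ≤ᵇ 11)} → c ≢ j
    inner≢ c (inj₁ j<7)  {h} refl = <⇒≱ j<7 (≤ᵇ⇒≤ 7 c h)
    inner≢ c (inj₂ 11<j) {_} {h} refl = <⇒≱ 11<j (≤ᵇ⇒≤ c 11 h)

    inner-ext : ∀ {j} → Inner j → Ext j
    inner-ext (inj₁ j<7) = inj₁ (≤-trans j<7 (≤ᵇ⇒≤ 7 9 tt))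
    inner-ext (inj₂ h)   = inj₂ h

    module Splitting (lo mid hi : ℕ) (lo≤mid : lo ≤ mid) (mid≤hi : mid ≤ hi) (hi≤n : hi ≤ n)
      (σ₀ : View) (globals : Globals (nr σ₀ 0)) (e6 : nr σ₀ 0 6 ≡ mid) (e7 : nr σ₀ 0 7 ≡ lo) (e8 : nr σ₀ 0 8 ≡ hi)
      (π₀ : Placement n) (placed₀ : Placed π₀ (mem σ₀) (ow σ₀)) (cutˡ : Cut lo π₀ (ow σ₀)) (cutʰ : Cut hi π₀ (ow σ₀)) where

      -- The keys in dispute are those between from and to.
      record SI (x : ℕ) (σ : View) : Set a where
        field
          from to : ℕ
          regs : ∀ j → Inner j → nr σ 0 j ≡ nr σ₀ 0 j
          r7 : nr σ 0 7 ≡ from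
          r8 : nr σ 0 8 ≡ to
          lo≤from  : lo ≤ from
          from≤mid : from ≤ mid
          mid≤to   : mid ≤ to
          to≤hi    : to ≤ hi
          extent   : from < mid → from + x ≡ to
          π : Placement n
          placed   : Placed π (mem σ) (ow σ)
          cutᶠ : Cut from π (ow σ)
          cutᵗ : Cut to π (ow σ)
          cuts : ∀ {c} → c ≤ lo ⊎ hi ≤ c → Cut c π₀ (ow σ₀) → Cut c π (ow σ)
          o≤ : length (ow σ₀) ≤ length (ow σ)

      si-havoc : ∀ {x} → Stable (SI x)
      si-havoc {x} {σ} {m'} {o'} I h = record { SI I
        ; placed = placed-fr {π = SI.π I} f (SI.placed I) ; cutᶠ = cut-more {π = SI.π I} (grows f) (SI.cutᶠ I)
        ; cutᵗ = cut-more {π = SI.π I} (grows f) (SI.cutᵗ I) ; cuts = λ s x → cut-more {π = SI.π I} (grows f) (SI.cuts I s x)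
        ; o≤ = ≤-trans (SI.o≤ I) (Corr-length (proj₁ h)) }
        where
        f : Fr (_< n) (mem σ) (ow σ) m' o'
        f = Fr-havoc (proj₁ h)

      record Shrunk (x o : ℕ) (σ : View) : Set a where
        field
          x'  : ℕ
          si  : SI x' σ
          pay : x' * 65536 + x + o * 65536 ≤ x * 65536 + length (ow σ) * 65536
          o≤' : o ≤ length (ow σ)

      shrunk-havoc : ∀ {x o} → Stable (Shrunk x o)
      shrunk-havoc I h = record { Shrunk I ; si = si-havoc (Shrunk.si I) h
        ; pay = ≤-trans (Shrunk.pay I) (+-monoʳ-≤ _ (*-monoˡ-≤ 65536 (Corr-length (proj₁ h)))) ; o≤' = ≤-trans (Shrunk.o≤' I) (Corr-length (proj₁ h)) }

      settled : ∀ {x o σ} → o ≤ length (ow σ) → SI 0 σ → Shrunk x o σ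
      settled {x} {o} {σ} o≤ I = record { x' = 0 ; si = I ; o≤' = o≤
        ; pay = linear 3 (λ x o o' → o ⊑ o' ⇒ ⊢ κ 0 ⊗ 65536 ⊕ x ⊕ o ⊗ 65536 ⊑ x ⊗ 65536 ⊕ o' ⊗ 65536) x o (length (ow σ)) o≤ }

      opaque
        shrink : ∀ {nl e₁ B o₂ G m e₀ x o} → nl + 0 + 0 + e₁ ≤ B + o₂ → B + G ≡ m → m ≡ x → m + e₀ * 65536 ≤ G * 65536 + e₁ * 65536 → o ≤ e₀ →
          nl * 65536 + x + o * 65536 ≤ x * 65536 + o₂ * 65536
        shrink {nl} {e₁} {B} {o₂} {G} {m} {e₀} {_} {o} h₁ h₂ refl = linear 8 (λ nl e₁ B o₂ G m e₀ o → nl ⊕ κ 0 ⊕ κ 0 ⊕ e₁ ⊑ B ⊕ o₂ ⇒ B ⊕ G ≐ m ⇒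
          m ⊕ e₀ ⊗ 65536 ⊑ G ⊗ 65536 ⊕ e₁ ⊗ 65536 ⇒ o ⊑ e₀ ⇒ ⊢ nl ⊗ 65536 ⊕ m ⊕ o ⊗ 65536 ⊑ m ⊗ 65536 ⊕ o₂ ⊗ 65536) nl e₁ B o₂ G m e₀ o h₁ h₂

        settle-narrow : ∀ τ τ₁ τ₂ τ₃ x oc e₀ec o₁c o₂c → τ₁ + e₀ec ≤ τ + x * 2000 + 100 + o₁c → τ₂ ≤ τ₁ + x * 50 + 10 → τ₃ ≤ τ₂ + 20 + 1 → oc ≤ e₀ec → o₁c ≤ o₂c →
          τ₃ + oc ≤ τ + x * 2050 + 140 + o₂c
        settle-narrow τ τ₁ τ₂ τ₃ x oc e₀c o₁c o₂c h₁ h₂ h₃ h₄ h₅ = linear 9 (λ τ τ₁ τ₂ τ₃ x oc e₀c o₁c o₂c → τ₁ ⊕ e₀c ⊑ τ ⊕ x ⊗ 2000 ⊕ κ 100 ⊕ o₁c ⇒ τ₂ ⊑ τ₁ ⊕ x ⊗ 50 ⊕ κ 10 ⇒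
          τ₃ ⊑ τ₂ ⊕ κ 20 ⊕ κ 1 ⇒ oc ⊑ e₀c ⇒ o₁c ⊑ o₂c ⇒ ⊢ τ₃ ⊕ oc ⊑ τ ⊕ x ⊗ 2050 ⊕ κ 140 ⊕ o₂c) τ τ₁ τ₂ τ₃ x oc e₀c o₁c o₂c h₁ h₂ h₃ h₄ h₅

      opaque
        wp-narrow : ∀ {x o σ τ} → o ≤ length (ow σ) → (I : SI x σ) → SI.from I < mid → mid < SI.to I →
          WP narrow (Paid c o (τ + x * 2050 + 140) (Shrunk x o)) τ σ
        wp-narrow {x} {o} {σ} {τ} o≤σ I from<mid mid<to =
          wp-seq (mono (Pivoting.wp-pivot from to T₀ U V Q from<to to≤n 0<δ T₀≡ (≤-reflexive (sym U≡)) (≤-reflexive (sym V≡)) V<W room M<W 0<S 1≤Q t/S≤Q σ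
              (glob 0 (inj₁ (≤ᵇ⇒≤ 1 7 tt)) G.g0) (glob 2 (inj₁ (≤ᵇ⇒≤ 3 7 tt)) G.g2) r7 r8 (glob 12 (inj₂ (≤ᵇ⇒≤ 12 12 tt)) G.g12) (glob 13 (inj₂ (≤ᵇ⇒≤ 12 13 tt)) G.g13) (glob 14 (inj₂ (≤ᵇ⇒≤ 12 14 tt)) G.g14))
            λ τ₁ σ₁ (τ₁≤ , R) → after τ₁ σ₁ τ₁≤ R)
          where
          open SI I
          module G = Globals globals
          from<to : from < to
          from<to = <-trans from<mid mid<to
          to≤n : to ≤ n
          to≤n = ≤-trans to≤hi hi≤n
          glob : ∀ j {y} → Inner j → nr σ₀ 0 j ≡ y → nr σ 0 j ≡ y
          glob j i eq = trans (regs j i) eq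
          m : ℕ
          m = to ∸ from
          m≡x : m ≡ x
          m≡x = trans (cong (_∸ from) (sym (extent from<mid))) (m+n∸m≡n from x)
          module Piv = Pivoting from to T₀ U V Q from<to to≤n 0<δ T₀≡ (≤-reflexive (sym U≡)) (≤-reflexive (sym V≡)) V<W room M<W 0<S 1≤Q t/S≤Q σ
              (glob 0 (inj₁ (≤ᵇ⇒≤ 1 7 tt)) G.g0) (glob 2 (inj₁ (≤ᵇ⇒≤ 3 7 tt)) G.g2) r7 r8 (glob 12 (inj₂ (≤ᵇ⇒≤ 12 12 tt)) G.g12) (glob 13 (inj₂ (≤ᵇ⇒≤ 12 13 tt)) G.g13) (glob 14 (inj₂ (≤ᵇ⇒≤ 12 14 tt)) G.g14)
          after : ∀ τ₁ σ₁ → τ₁ + length (ow σ) * c ≤ τ + m * 2000 + 100 + length (ow σ₁) * c → Piv.Result σ₁ →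
            WP (partition ⨾ ite (r 0 9 <ₙ r 0 6) (ite (r 0 6 <ₙ r 0 11) (num 0 7 ≔ r 0 6) (num 0 7 ≔ r 0 11)) (num 0 8 ≔ r 0 9))
              (Paid c o (τ + x * 2050 + 140) (Shrunk x o)) τ₁ σ₁
          after τ₁ σ₁ τ₁≤ R = wp-seq (mono Par.wp-partition λ τ₂ σ₂ (τ₂≤ , J) → let module J = Par.PS J in
            mono (wp-ite-post {N = τ₂ + 20} {Ξ = Ξ} stable 0<W λ m₃ o₃ h₃ → let J' = Par.ps-havoc J h₃ in
              (λ l<mid → relax (linear 1 (λ t → ⊢ t ⊕ κ 3 ⊕ κ 10 ⊕ κ 1 ⊑ t ⊕ κ 20) τ₂) (wp-ite-post {N = τ₂ + 3 + 10} {Ξ = Ξ} stable 0<W λ m₄ o₄ h₄ → let J″ = Par.ps-havoc J' h₄ in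
                (λ mid<e → wp-set 0<W λ m₅ o₅ h₅ → linear 1 (λ t → ⊢ t ⊕ κ 3 ⊕ κ 3 ⊕ κ 2 ⊑ t ⊕ κ 3 ⊕ κ 10) τ₂ ,
                  middle {havoc σ₂ m₅ o₅} (Par.ps-havoc J″ h₅) (subst₂ _<_ J.r9 (reg6 J) (<ᵇ-true _ _ l<mid)) (subst₂ _<_ (reg6 J) J.r11 (<ᵇ-true _ _ mid<e)) (reg6 J)) ,
                (λ e≤mid → wp-set 0<W λ m₅ o₅ h₅ → linear 1 (λ t → ⊢ t ⊕ κ 3 ⊕ κ 3 ⊕ κ 2 ⊑ t ⊕ κ 3 ⊕ κ 10) τ₂ ,
                  upper {havoc σ₂ m₅ o₅} (Par.ps-havoc J″ h₅) (subst₂ _≤_ J.r11 (reg6 J) (<ᵇ-false _ _ e≤mid)) J.r11))) ,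
              (λ mid≤l → wp-set 0<W λ m₅ o₅ h₅ → linear 1 (λ t → ⊢ t ⊕ κ 3 ⊕ κ 2 ⊑ t ⊕ κ 20) τ₂ ,
                  lower {havoc σ₂ m₅ o₅} (Par.ps-havoc J' h₅) (subst₂ _≤_ (reg6 J) J.r9 (<ᵇ-false _ _ mid≤l)) J.r9))
            λ τ₃ σ₃ (τ₃≤ , Sh) → settle-narrow τ τ₁ τ₂ τ₃ x (o * c) (length (ow σ) * c) (length (ow σ₁) * c) (length (ow σ₃) * c)
              (subst (λ z → τ₁ + length (ow σ) * c ≤ τ + z * 2000 + 100 + length (ow σ₁) * c) m≡x τ₁≤) (subst (λ z → τ₂ ≤ τ₁ + z * 50 + 10) m≡x τ₂≤)
              τ₃≤ (*-monoˡ-≤ c o≤σ) (*-monoˡ-≤ c (proj₂ Sh)) , proj₁ Sh)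
            where
            module R = Piv.Result R
            placed₁ : Placed π (mem σ₁) (ow σ₁)
            placed₁ = placed-fr {π = π} R.fr placed
            cut₁ : ∀ {c} → Cut c π (ow σ) → Cut c π (ow σ₁)
            cut₁ = cut-more {π = π} (grows R.fr)
            module Par = Partitioning from to (<⇒≤ from<to) to≤n n+4<W σ₁ (trans (cong (λ f → f 7) R.bank0) r7) (trans (cong (λ f → f 8) R.bank0) r8) π placed₁
            v : Value
            v = value (wr σ₁ 2 0)
            Ξ : View → Set a
            Ξ σ' = Shrunk x o σ' × length (ow σ₁) ≤ length (ow σ')
            stable : Stable Ξ
            stable (I , o≤) h = shrunk-havoc I h , ≤-trans o≤ (Corr-length (proj₁ h))
            reg : ∀ {σ'} → Par.PS to to to 0 0 0 σ' → ∀ j {y} → Ext j → nr σ 0 j ≡ y → nr σ' 0 j ≡ y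
            reg J j e eq = trans (Par.PS.outer J j e) (trans (cong (λ f → f j) R.bank0) eq)
            reg6 : ∀ {σ'} → Par.PS to to to 0 0 0 σ' → nr σ' 0 6 ≡ mid
            reg6 J = reg J 6 (inj₁ (≤ᵇ⇒≤ 7 9 tt)) (glob 6 (inj₁ (≤ᵇ⇒≤ 7 7 tt)) e6)
            module Finish {σ' : View} (J : Par.PS to to to 0 0 0 σ') where
              module J = Par.PS J
              from≤l : from ≤ J.l
              from≤l = subst (from ≤_) J.l≡ (m≤m+n from J.nl)
              e≤to : J.e ≤ to
              e≤to = subst (J.e ≤_) J.e≡ (m≤m+n J.e J.ng)
              e₀≤ : length (ow σ) ≤ length (ow σ')
              e₀≤ = ≤-trans (Fr-length R.fr) J.o≤
              cut : ∀ {c} → J.l ≤ c → c ≤ J.e → Cut c J.π (ow σ')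
              cut = cut-zone {v} J.π J.zones (J.cuts (inj₁ ≤-refl) (cut₁ cutᶠ)) (J.cuts (inj₂ ≤-refl) (cut₁ cutᵗ)) from≤l e≤to
              outside : ∀ {c} → c ≤ lo ⊎ hi ≤ c → Cut c π₀ (ow σ₀) → Cut c J.π (ow σ')
              outside (inj₁ c≤lo) x = J.cuts (inj₁ (≤-trans c≤lo lo≤from)) (cut₁ (cuts (inj₁ c≤lo) x))
              outside (inj₂ hi≤c) x = J.cuts (inj₂ (≤-trans to≤hi hi≤c)) (cut₁ (cuts (inj₂ hi≤c) x))
              raise : ∀ y {from' x'} → y ≡ from' → lo ≤ from' → from' ≤ mid → (from' < mid → from' + x' ≡ to) → Cut from' J.π (ow σ') → SI x' (setN (num 0 7) y σ')
              raise y {from'} refl lo≤ ≤mid ext cut' = record { from = from' ; to = to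
                ; regs = λ j i → trans (upd-other (nr σ' 0) 7 y (inner≢ 7 i)) (reg J j (inner-ext i) (regs j i))
                ; r7 = refl ; r8 = reg J 8 (inj₁ (≤ᵇ⇒≤ 9 9 tt)) r8 ; lo≤from = lo≤ ; from≤mid = ≤mid ; mid≤to = mid≤to ; to≤hi = to≤hi
                ; extent = ext ; π = J.π ; placed = J.placed ; cutᶠ = cut' ; cutᵗ = J.cuts (inj₂ ≤-refl) (cut₁ cutᵗ) ; cuts = outside ; o≤ = ≤-trans o≤ e₀≤ }
              shrunk-low : J.nl * 65536 + x + o * 65536 ≤ x * 65536 + length (ow σ') * 65536
              shrunk-low = shrink {J.nl} {length (ow σ₁)} {rankOf (below v) from m σ₁} {length (ow σ')} {rankOf (geq v) from m σ₁} {m} {length (ow σ)} {x} {o}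
                J.lowC (count-not (λ p → below v (value (mem σ₁ (from + p)))) m) m≡x R.upper o≤σ
              shrunk-high : J.ng * 65536 + x + o * 65536 ≤ x * 65536 + length (ow σ') * 65536
              shrunk-high = shrink {J.ng} {length (ow σ₁)} {rankOf (above v) from m σ₁} {length (ow σ')} {rankOf (atMost v) from m σ₁} {m} {length (ow σ)} {x} {o}
                J.highC (count-not (λ p → above v (value (mem σ₁ (from + p)))) m) m≡x R.lower o≤σ
            middle : ∀ {σ'} (J : Par.PS to to to 0 0 0 σ') → Par.PS.l J < mid → mid < Par.PS.e J → nr σ' 0 6 ≡ mid → Ξ (setN (num 0 7) (nr σ' 0 6) σ')
            middle {σ'} J l<mid mid<e eq = settled (≤-trans o≤σ e₀≤)
                (raise (nr σ' 0 6) eq lo≤mid ≤-refl (λ h → contradiction h (<-irrefl refl)) (cut (<⇒≤ l<mid) (<⇒≤ mid<e))) , J.o≤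
              where open Finish J
            upper : ∀ {σ'} (J : Par.PS to to to 0 0 0 σ') → Par.PS.e J ≤ mid → nr σ' 0 11 ≡ Par.PS.e J → Ξ (setN (num 0 7) (nr σ' 0 11) σ')
            upper {σ'} J e≤mid eq = record { x' = J.ng
                ; si = raise (nr σ' 0 11) eq (≤-trans lo≤from (≤-trans from≤l J.l≤e)) e≤mid (λ _ → J.e≡) (cut J.l≤e ≤-refl)
                ; pay = shrunk-high ; o≤' = ≤-trans o≤σ e₀≤ } , J.o≤
              where open Finish J
            lower : ∀ {σ'} (J : Par.PS to to to 0 0 0 σ') → mid ≤ Par.PS.l J → nr σ' 0 9 ≡ Par.PS.l J → Ξ (setN (num 0 8) (nr σ' 0 9) σ')
            lower {σ'} J mid≤l eq = record { x' = J.nl ; si = record { from = from ; to = J.l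
                ; regs = λ j i → trans (upd-other (nr σ' 0) 8 (nr σ' 0 9) (inner≢ 8 i)) (reg J j (inner-ext i) (regs j i))
                ; r7 = reg J 7 (inj₁ (≤ᵇ⇒≤ 8 9 tt)) r7 ; r8 = eq ; lo≤from = lo≤from ; from≤mid = from≤mid ; mid≤to = mid≤l
                ; to≤hi = ≤-trans (≤-trans J.l≤e e≤to) to≤hi ; extent = λ _ → J.l≡ ; π = J.π ; placed = J.placed
                ; cutᶠ = J.cuts (inj₁ ≤-refl) (cut₁ cutᶠ) ; cutᵗ = cut ≤-refl J.l≤e ; cuts = outside ; o≤ = ≤-trans o≤ e₀≤ }
                ; pay = shrunk-low ; o≤' = ≤-trans o≤σ e₀≤ } , J.o≤
              where open Finish J

      record Halved (σ : View) : Set a where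
        field
          regs : ∀ j → Inner j → nr σ 0 j ≡ nr σ₀ 0 j
          π : Placement n
          placed : Placed π (mem σ) (ow σ)
          cut    : Cut mid π (ow σ)
          cuts   : ∀ {c} → c ≤ lo ⊎ hi ≤ c → Cut c π₀ (ow σ₀) → Cut c π (ow σ)
          o≤     : length (ow σ₀) ≤ length (ow σ)

      halved-havoc : Stable Halved
      halved-havoc {σ} {m'} {o'} I h = record { Halved I
        ; placed = placed-fr {π = Halved.π I} f (Halved.placed I) ; cut = cut-more {π = Halved.π I} (grows f) (Halved.cut I)
        ; cuts = λ s x → cut-more {π = Halved.π I} (grows f) (Halved.cuts I s x) ; o≤ = ≤-trans (Halved.o≤ I) (Corr-length (proj₁ h)) }
        where
        f : Fr (_< n) (mem σ) (ow σ) m' o'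
        f = Fr-havoc (proj₁ h)

      -- A round on x keys takes O(x) steps and, unless faults occur, leaves at most x - x / 65536 keys.
      record Loop (N μ t : ℕ) (σ : View) : Set a where
        field
          x : ℕ
          si : SI x σ
          measure : x + δ ≡ μ + length (ow σ)
          time : t + x * Φ + length (ow σ₀) * (c + Φ) ≤ N + length (ow σ) * (c + Φ)

      opaque
        decrease : ∀ x x' o o' μ μ' → 0 < x → x' * 65536 + x + o * 65536 ≤ x * 65536 + o' * 65536 → x + δ ≡ μ + o → x' + δ ≡ μ' + o' → μ' < μ
        decrease x x' o o' μ μ' = linear 7 (λ x x' o o' μ μ' δ → κ 0 ⊏ x ⇒ x' ⊗ 65536 ⊕ x ⊕ o ⊗ 65536 ⊑ x ⊗ 65536 ⊕ o' ⊗ 65536 ⇒ x ⊕ δ ≐ μ ⊕ o ⇒ x' ⊕ δ ≐ μ' ⊕ o' ⇒ ⊢ μ' ⊏ μ)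
          x x' o o' μ μ' δ

        charge : ∀ x x' o o' t t' E N → 0 < x → x' * 65536 + x + o * 65536 ≤ x * 65536 + o' * 65536 → t + x * Φ + E ≤ N + o * (c + Φ) → t' + o * c ≤ t + x * 2050 + 149 + o' * c →
          t' + 1 + x' * Φ + E ≤ N + o' * (c + Φ)
        charge x x' o o' t t' E N 0<x h₁ h₂ h₃ = subst (t' + 1 + x' * Φ + E ≤_) (cong (N +_) (sym (*-distribˡ-+ o' c Φ)))
          (linear 10 (λ x x' o o' t t' E N oc o'c → κ 0 ⊏ x ⇒ x' ⊗ 65536 ⊕ x ⊕ o ⊗ 65536 ⊑ x ⊗ 65536 ⊕ o' ⊗ 65536 ⇒ t ⊕ x ⊗ 144179200 ⊕ E ⊑ N ⊕ (oc ⊕ o ⊗ 144179200) ⇒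
            t' ⊕ oc ⊑ t ⊕ x ⊗ 2050 ⊕ κ 149 ⊕ o'c ⇒ ⊢ t' ⊕ κ 1 ⊕ x' ⊗ 144179200 ⊕ E ⊑ N ⊕ (o'c ⊕ o' ⊗ 144179200))
            x x' o o' t t' E N (o * c) (o' * c) 0<x h₁ (subst (t + x * Φ + E ≤_) (cong (N +_) (*-distribˡ-+ o c Φ)) h₂) h₃)

        finish-time : ∀ t x E N o o' → o ≤ o' → t + x * Φ + E ≤ N + o * (c + Φ) → t + 4 + E ≤ N + 4 + o' * (c + Φ)
        finish-time t x E N o o' o≤ h = linear 6 (λ t xΦ E N O O' → t ⊕ xΦ ⊕ E ⊑ N ⊕ O ⇒ O ⊑ O' ⇒ ⊢ t ⊕ κ 4 ⊕ E ⊑ N ⊕ κ 4 ⊕ O') t (x * Φ) E N (o * (c + Φ)) (o' * (c + Φ)) h (*-monoˡ-≤ (c + Φ) o≤)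

      opaque
        wp-split : ∀ {τ} → length (ow σ₀) ≤ δ → WP split (Paid (c + Φ) (length (ow σ₀)) (τ + (hi ∸ lo) * Φ + 4) Halved) τ σ₀
        wp-split {τ} o≤δ = wp-while (Loop (τ + (hi ∸ lo) * Φ)) (λ μ t σ L m₁ o₁ h₁ → 0<W ,
            (λ lt → round L h₁ lt) ,
            (λ ge → finish L h₁ ge))
          {hi ∸ lo + (δ ∸ length (ow σ₀))} record { x = hi ∸ lo
            ; si = record { from = lo ; to = hi ; regs = λ _ _ → refl ; r7 = e7 ; r8 = e8 ; lo≤from = ≤-refl ; from≤mid = lo≤mid ; mid≤to = mid≤hi ; to≤hi = ≤-refl
                ; extent = λ _ → m+[n∸m]≡n (≤-trans lo≤mid mid≤hi) ; π = π₀ ; placed = placed₀ ; cutᶠ = cutˡ ; cutᵗ = cutʰ ; cuts = λ _ x → x ; o≤ = ≤-refl }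
            ; measure = trans (cong (hi ∸ lo +_) (sym (m∸n+n≡m o≤δ))) (sym (+-assoc (hi ∸ lo) (δ ∸ length (ow σ₀)) (length (ow σ₀)))) ; time = ≤-refl }
          where
          N : ℕ
          N = τ + (hi ∸ lo) * Φ
          r6 : ∀ {x σ} → SI x σ → nr σ 0 6 ≡ mid
          r6 I = trans (SI.regs I 6 (inj₁ (≤ᵇ⇒≤ 7 7 tt))) e6
          finish : ∀ {μ t σ m₁ o₁} → Loop N μ t σ → (h : Havoc σ m₁ o₁) → (nr σ 0 7 <ᵇ nr σ 0 6) ≡ false → Paid (c + Φ) (length (ow σ₀)) (N + 4) Halved (t + 4) (havoc σ m₁ o₁)
          finish {μ} {t} {σ} {m₁} {o₁} L h ge = finish-time t x (length (ow σ₀) * (c + Φ)) N (length (ow σ)) (length o₁) (Corr-length (proj₁ h)) time ,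
            halved-havoc {σ} record { regs = regs ; π = π ; placed = placed ; cut = subst (λ z → Cut z π (ow σ)) (≤-antisym from≤mid (subst₂ _≤_ (r6 si) r7 (<ᵇ-false _ _ ge))) cutᶠ ; cuts = cuts ; o≤ = o≤ } h
            where
            open Loop L
            open SI si
          round : ∀ {μ t σ m₁ o₁} → Loop N μ t σ → (h : Havoc σ m₁ o₁) → (nr σ 0 7 <ᵇ nr σ 0 6) ≡ true →
            WP (ite (r 0 6 <ₙ r 0 8) narrow (num 0 7 ≔ r 0 6)) (λ t' σ' → ∃[ μ' ] μ' < μ × Loop N μ' (t' + 1) σ') (t + 3) (havoc σ m₁ o₁)
          round {μ} {t} {σ} {m₁} {o₁} L h₁ lt = mono (wp-bounded (wp-ite-paid {c = c} {length (ow σ)} {t + 3 + 3 + x * 2050 + 140} {Ξ = Shrunk x (length (ow σ))} shrunk-havoc 0<W λ m₂ o₂ h₂ →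
              let I₂ = si-havoc (si-havoc si h₁) h₂ ; o≤₂ = Corr-length (Corr-trans (proj₁ h₁) (proj₁ h₂)) in
              (λ mid<to → wp-narrow o≤₂ I₂ from<mid (subst₂ _<_ (r6 si) r8 (<ᵇ-true _ _ mid<to))) ,
              (λ to≤mid → wp-set 0<W λ m₃ o₃ h₃ →
                 linear 5 (λ t x oc o'c z → oc ⊑ o'c ⇒ ⊢ t ⊕ κ 3 ⊕ κ 3 ⊕ κ 2 ⊕ oc ⊑ t ⊕ κ 3 ⊕ κ 3 ⊕ x ⊗ 2050 ⊕ κ 140 ⊕ o'c) t x (length (ow σ) * c) (length o₃ * c) 0
                   (*-monoˡ-≤ c (≤-trans o≤₂ (Corr-length (proj₁ h₃)))) ,
                 settled (≤-trans o≤₂ (Corr-length (proj₁ h₃))) (level-out (si-havoc I₂ h₃) (≤-antisym (subst₂ _≤_ r8 (r6 si) (<ᵇ-false _ _ to≤mid)) mid≤to)))))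
            λ t' σ' ((t'≤ , Sh) , o'≤δ) → let open Shrunk Sh renaming (si to si') in
              x' + (δ ∸ length (ow σ')) , decrease x x' (length (ow σ)) (length (ow σ')) μ _ 0<x pay measure (refill x' o'≤δ) , record
                { x = x' ; si = si' ; measure = refill x' o'≤δ
                ; time = charge x x' (length (ow σ)) (length (ow σ')) t t' (length (ow σ₀) * (c + Φ)) N 0<x pay time
                    (≤-trans t'≤ (≤-reflexive (linear 3 (λ t x o → ⊢ t ⊕ κ 3 ⊕ κ 3 ⊕ x ⊗ 2050 ⊕ κ 140 ⊕ κ 1 ⊕ o ≐ t ⊕ x ⊗ 2050 ⊕ κ 147 ⊕ o) t x (length (ow σ') * c)) |> λ e → ≤-trans e (+-monoˡ-≤ _ (+-monoʳ-≤ (t + x * 2050) (≤ᵇ⇒≤ 147 149 tt))))) }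
            where
            open Loop L
            open SI si
            _|>_ : ∀ {ℓ ℓ'} {A : Set ℓ} {B : Set ℓ'} → A → (A → B) → B
            y |> f = f y
            from<mid : from < mid
            from<mid = subst₂ _<_ r7 (r6 si) (<ᵇ-true _ _ lt)
            0<x : 0 < x
            0<x = +-cancelˡ-< from 0 x (subst₂ _<_ (sym (+-identityʳ from)) (sym (extent from<mid)) (<-≤-trans from<mid mid≤to))
            refill : ∀ y {o} → o ≤ δ → y + δ ≡ y + (δ ∸ o) + o
            refill y {o} o≤δ = trans (cong (y +_) (sym (m∸n+n≡m o≤δ))) (sym (+-assoc y (δ ∸ o) o))
            level-out : ∀ {σ'} (I : SI x σ') → SI.to I ≡ mid → SI 0 (setN (num 0 7) (nr σ' 0 6) σ')
            level-out {σ'} I to≡mid = record { from = mid ; to = SI.to I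
              ; regs = λ j i → trans (upd-other (nr σ' 0) 7 (nr σ' 0 6) (inner≢ 7 i)) (SI.regs I j i)
              ; r7 = r6 I ; r8 = SI.r8 I ; lo≤from = lo≤mid ; from≤mid = ≤-refl ; mid≤to = SI.mid≤to I ; to≤hi = SI.to≤hi I
              ; extent = λ h → contradiction h (<-irrefl refl) ; π = SI.π I ; placed = SI.placed I
              ; cutᶠ = subst (λ z → Cut z (SI.π I) (ow σ')) to≡mid (SI.cutᵗ I) ; cutᵗ = SI.cutᵗ I ; cuts = SI.cuts I ; o≤ = SI.o≤ I }

    Ψ : ℕ
    Ψ = 144179260

    -- Of the p steps that are still allowed, the faults have paid for some.
    Due : ℕ → ℕ → ℕ → View → Set
    Due N p t σ = t + p ≤ N + length (ow σ) * (c + Φ)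

    record Sliced (s : ℕ) (σ : View) : Set a where
      field
        globals : Globals (nr σ 0)
        r3 : nr σ 0 3 ≡ s
        π : Placement n
        placed : Placed π (mem σ) (ow σ)
        cuts : ∀ k → Cut (k * s) π (ow σ)

    sliced-havoc : ∀ {s} → Stable (Sliced s)
    sliced-havoc {s} {σ} {m'} {o'} I h = record { globals = globals ; r3 = r3 ; π = π ; placed = placed-fr {π = π} f placed
      ; cuts = λ k → cut-more {π = π} (grows f) (cuts k) }
      where
      open Sliced I
      f : Fr (_< n) (mem σ) (ow σ) m' o'
      f = Fr-havoc (proj₁ h)

    module Halving (s h : ℕ) (s≡ : s ≡ h + h) (0<h : 0 < h) (s≤ : s ≤ n + n) where

      -- Segments of length s have been halved up to position lo.
      record LS (l lo : ℕ) (σ : View) : Set a where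
        field
          globals : Globals (nr σ 0)
          r3 : nr σ 0 3 ≡ s
          r4 : nr σ 0 4 ≡ h
          r5 : nr σ 0 5 ≡ l
          π : Placement n
          placed : Placed π (mem σ) (ow σ)
          coarse : ∀ k → Cut (k * s) π (ow σ)
          fine : ∀ k → k * h ≤ lo → Cut (k * h) π (ow σ)

      ls-havoc : ∀ {l lo} → Stable (LS l lo)
      ls-havoc {_} {_} {σ} {m'} {o'} I h = record { globals = globals ; r3 = r3 ; r4 = r4 ; r5 = r5 ; π = π ; placed = placed-fr {π = π} f placed
        ; coarse = λ k → cut-more {π = π} (grows f) (coarse k) ; fine = λ k s≤n → cut-more {π = π} (grows f) (fine k s≤n) }
        where
        open LS I
        f : Fr (_< n) (mem σ) (ow σ) m' o'
        f = Fr-havoc (proj₁ h)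

      record Ready (j : ℕ) (σ : View) : Set a where
        field
          ls : LS (j * s) (j * s) σ
          r6 : nr σ 0 6 ≡ j * s + h
          r7 : nr σ 0 7 ≡ j * s
          r8 : nr σ 0 8 ≡ (j * s + s) ⊓ n

      ready-havoc : ∀ {j} → Stable (Ready j)
      ready-havoc I h = record { Ready I ; ls = ls-havoc (Ready.ls I) h }

      opaque
        js≡ : ∀ j → (j + j) * h ≡ j * s
        js≡ j = trans (*-distribʳ-+ h j j) (trans (sym (*-distribˡ-+ j h h)) (cong (j *_) (sym s≡)))

        refine : ∀ j {π o} → (∀ k → Cut (k * s) π o) → (∀ k → k * h ≤ j * s → Cut (k * h) π o) → Cut (j * s + h) π o →
          ∀ k → k * h ≤ suc j * s → Cut (k * h) π o
        refine j {π} {o} coarse fine mid k k≤ with k ≤? j + j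
        ... | yes k≤2j = fine k (≤-trans (*-monoˡ-≤ h k≤2j) (≤-reflexive (js≡ j)))
        ... | no k≰2j with k ≟ suc (j + j)
        ...   | yes refl = subst (λ z → Cut z π o) (trans (+-comm (j * s) h) (cong (h +_) (sym (js≡ j)))) mid
        ...   | no k≢    = subst (λ z → Cut z π o) (≤-antisym low k≤) (coarse (suc j))
          where
          low : suc j * s ≤ k * h
          low = ≤-trans (≤-reflexive (trans (cong₂ _+_ s≡ (sym (js≡ j))) (+-assoc h h ((j + j) * h)))) (*-monoˡ-≤ h (≤∧≢⇒< (≰⇒> k≰2j) (≢-sym k≢)))

        side : ∀ j k → k * s ≤ j * s ⊎ (j * s + s) ⊓ n ≤ k * s
        side j k with k ≤? j
        ... | yes k≤j = inj₁ (*-monoˡ-≤ s k≤j)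
        ... | no k≰j  = inj₂ (≤-trans (m⊓n≤m (j * s + s) n) (≤-trans (≤-reflexive (+-comm (j * s) s)) (*-monoˡ-≤ s (≰⇒> k≰j))))

        cut-hi : ∀ j {π o} → (∀ k → Cut (k * s) π o) → Cut ((j * s + s) ⊓ n) π o
        cut-hi j {π} {o} coarse with ≤-total (j * s + s) n
        ... | inj₁ s≤n = subst (λ z → Cut z π o) (trans (+-comm s (j * s)) (sym (m≤n⇒m⊓n≡m s≤n))) (coarse (suc j))
        ... | inj₂ n≤s = subst (λ z → Cut z π o) (sym (m≥n⇒m⊓n≡n n≤s)) (cut-end {π = π} {o} ≤-refl)

        gap : ∀ j → j * s < n → n ∸ suc j * s + ((j * s + s) ⊓ n ∸ j * s) ≤ n ∸ j * s
        gap j js<n with ≤-total (j * s + s) n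
        ... | inj₁ s≤n = ≤-reflexive (+-cancelˡ-≡ (j * s) _ _ (trans (cong₂ (λ x y → j * s + (n ∸ x + (y ∸ j * s))) (+-comm s (j * s)) (m≤n⇒m⊓n≡m s≤n))
          (trans (cong (λ z → j * s + (n ∸ (j * s + s) + z)) (m+n∸m≡n (j * s) s))
          (trans (trans (cong (j * s +_) (+-comm _ s)) (sym (+-assoc (j * s) s _))) (trans (m+[n∸m]≡n s≤n) (sym (m+[n∸m]≡n (<⇒≤ js<n))))))))
        ... | inj₂ n≤s = ≤-reflexive (cong₂ (λ x y → x + (y ∸ j * s)) (m≤n⇒m∸n≡0 (≤-trans n≤s (≤-reflexive (+-comm (j * s) s)))) (m≥n⇒m⊓n≡n n≤s))

        room-for : ∀ x → x < n → x + s < W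
        room-for x x<n = linear 6 (λ x s n V T W → x ⊏ n ⇒ s ⊑ n ⊕ n ⇒ V ⊕ (n ⊕ T) ⊗ 1100 ⊕ κ 2000 ⊏ W ⇒ ⊢ x ⊕ s ⊏ W) x s n V T₀ W x<n s≤ V<W

        h≤s : h ≤ s
        h≤s = ≤-trans (m≤m+n h h) (≤-reflexive (sym s≡))

        lo<hi : ∀ j → j * s < n → j * s < (j * s + s) ⊓ n
        lo<hi j js<n = ⊓-pres-m< (m<m+n (j * s) (<-≤-trans 0<h h≤s)) js<n

      opaque
        wp-segment : ∀ {j σ τ} → LS (j * s) (j * s) σ → j * s < n →
          WP segment (Paid (c + Φ) (length (ow σ)) (τ + ((j * s + s) ⊓ n ∸ j * s) * Φ + 40) (LS (suc j * s) (suc j * s))) τ σ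
        wp-segment {j} {σ} {τ} I js<n =
          wp-seq (wp-set (subst₂ (λ x y → x + y < W) (sym r5) (sym r4) (≤-<-trans (+-monoʳ-≤ (j * s) h≤s) (room-for (j * s) js<n))) λ m₁ o₁ h₁ →
          wp-seq (wp-set 0<W λ m₂ o₂ h₂ →
          wp-seq (mono (wp-ite-post {N = τ + 4 + 2 + 9} {Ξ = λ σ' → Ready j σ' × length (ow σ) ≤ length (ow σ')} (λ x h → ready-havoc (proj₁ x) h , ≤-trans (proj₂ x) (Corr-length (proj₁ h)))
              (subst (_< W) (sym (+-identityʳ _)) sum<W) λ m₃ o₃ h₃ →
            (λ lt → wp-set sum<W λ m₄ o₄ h₄ → ≤-reflexive (linear 1 (λ t → ⊢ t ⊕ κ 4 ⊕ κ 2 ⊕ κ 5 ⊕ κ 4 ≐ t ⊕ κ 4 ⊕ κ 2 ⊕ κ 9) τ) ,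
               ready h₁ h₂ h₃ h₄ (nr σ 0 5 + nr σ 0 3) (trans (cong₂ _+_ r5 r3) (sym (m≤n⇒m⊓n≡m (<⇒≤ (subst₂ _<_ (cong₂ _+_ r5 r3) g0 (<ᵇ-true _ _ lt))))))) ,
            (λ ge → wp-set 0<W λ m₄ o₄ h₄ → linear 1 (λ t → ⊢ t ⊕ κ 4 ⊕ κ 2 ⊕ κ 5 ⊕ κ 2 ⊑ t ⊕ κ 4 ⊕ κ 2 ⊕ κ 9) τ ,
               ready h₁ h₂ h₃ h₄ (nr σ 0 0) (trans g0 (sym (m≥n⇒m⊓n≡n (subst₂ _≤_ g0 (cong₂ _+_ r5 r3) (<ᵇ-false _ _ ge)))))))
          λ τ₃ σ₃ (τ₃≤ , (Rd , o≤₃)) →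
          wp-seq (mono (wp-ite-paid {c = c + Φ} {length (ow σ)} {τ₃ + 3 + (hi ∸ j * s) * Φ + 4} {Ξ = LS (j * s) (suc j * s)} ls-havoc 0<W λ m₄ o₄ h₄ →
              let Rd' = ready-havoc Rd h₄ in
              (λ mid<n → halve (≤-trans o≤₃ (Corr-length (proj₁ h₄))) (proj₂ h₄) Rd' (subst₂ _<_ (Ready.r6 Rd') (Globals.g0 (LS.globals (Ready.ls Rd'))) (<ᵇ-true _ _ mid<n))) ,
              (λ n≤mid → wp-skip (linear 4 (λ t x o o' → o ⊑ o' ⇒ ⊢ t ⊕ κ 3 ⊕ o ⊑ t ⊕ κ 3 ⊕ x ⊕ κ 4 ⊕ o') τ₃ ((hi ∸ j * s) * Φ) (length (ow σ) * (c + Φ)) (length o₄ * (c + Φ))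
                   (*-monoˡ-≤ (c + Φ) (≤-trans o≤₃ (Corr-length (proj₁ h₄)))) ,
                 still (Ready.ls Rd') (subst₂ _≤_ (Globals.g0 (LS.globals (Ready.ls Rd'))) (Ready.r6 Rd') (<ᵇ-false _ _ n≤mid)))))
          λ τ₅ σ₅ (τ₅≤ , J) →
          wp-set (subst₂ (λ x y → x + y < W) (sym (LS.r5 J)) (sym (LS.r3 J)) (room-for (j * s) js<n)) λ m₆ o₆ h₆ →
            linear 7 (λ t t₃ t₅ x o o₅ o₆ → t₃ ⊑ t ⊕ κ 4 ⊕ κ 2 ⊕ κ 9 ⊕ κ 1 ⇒ t₅ ⊕ o ⊑ t₃ ⊕ κ 3 ⊕ x ⊕ κ 4 ⊕ κ 1 ⊕ o₅ ⇒ o₅ ⊑ o₆ ⇒ ⊢ t₅ ⊕ κ 4 ⊕ o ⊑ t ⊕ x ⊕ κ 40 ⊕ o₆)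
              τ τ₃ τ₅ ((hi ∸ j * s) * Φ) (length (ow σ) * (c + Φ)) (length (ow σ₅) * (c + Φ)) (length o₆ * (c + Φ)) τ₃≤ τ₅≤ (*-monoˡ-≤ (c + Φ) (Corr-length (proj₁ h₆))) ,
            step (ls-havoc J h₆)))))
          where
          open LS I
          open Globals globals
          hi : ℕ
          hi = (j * s + s) ⊓ n
          sum<W : nr σ 0 5 + nr σ 0 3 < W
          sum<W = subst₂ (λ x y → x + y < W) (sym r5) (sym r3) (room-for (j * s) js<n)
          ready : ∀ {m₁ o₁ m₂ o₂ m₃ o₃ m₄ o₄} → Corr (mem σ) (ow σ) m₁ o₁ × length o₁ ≤ δ → Corr m₁ o₁ m₂ o₂ × length o₂ ≤ δ → Corr m₂ o₂ m₃ o₃ × length o₃ ≤ δ → Corr m₃ o₃ m₄ o₄ × length o₄ ≤ δ →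
            ∀ v → v ≡ hi → let σ' = setN (num 0 8) v (setN (num 0 7) (nr σ 0 5) (setN (num 0 6) (nr σ 0 5 + nr σ 0 4) (havoc σ m₄ o₄))) in Ready j σ' × length (ow σ) ≤ length o₄
          ready {m₄ = m₄} {o₄} h₁ h₂ h₃ h₄ v eq = record
              { ls = record { globals = record { Globals globals } ; r3 = r3 ; r4 = r4 ; r5 = r5 ; π = LS.π L ; placed = LS.placed L ; coarse = LS.coarse L ; fine = LS.fine L }
              ; r6 = cong₂ _+_ r5 r4 ; r7 = r5 ; r8 = eq } , Corr-length cr
            where
            cr : Corr (mem σ) (ow σ) m₄ o₄
            cr = Corr-trans (proj₁ h₁) (Corr-trans (proj₁ h₂) (Corr-trans (proj₁ h₃) (proj₁ h₄)))
            L : LS (j * s) (j * s) (havoc σ m₄ o₄)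
            L = ls-havoc I (cr , proj₂ h₄)
          still : ∀ {σ'} → LS (j * s) (j * s) σ' → n ≤ j * s + h → LS (j * s) (suc j * s) σ'
          still {σ'} L n≤ = record { LS L ; fine = refine j {LS.π L} {ow σ'} (LS.coarse L) (LS.fine L) (cut-end {π = LS.π L} {ow σ'} n≤) }
          step : ∀ {σ'} → LS (j * s) (suc j * s) σ' → LS (suc j * s) (suc j * s) (setN (num 0 5) (nr σ' 0 5 + nr σ' 0 3) σ')
          step L = record { globals = record { Globals (LS.globals L) } ; r3 = LS.r3 L ; r4 = LS.r4 L ; r5 = trans (cong₂ _+_ (LS.r5 L) (LS.r3 L)) (+-comm (j * s) s)
            ; π = LS.π L ; placed = LS.placed L ; coarse = LS.coarse L ; fine = LS.fine L }
          halve : ∀ {σ' t} → length (ow σ) ≤ length (ow σ') → length (ow σ') ≤ δ → Ready j σ' → j * s + h < n →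
            WP split (Paid (c + Φ) (length (ow σ)) (t + 3 + (hi ∸ j * s) * Φ + 4) (LS (j * s) (suc j * s))) (t + 3) σ'
          halve {σ'} {t} o≤ o≤δ Rd mid<n = mono (Sp.wp-split o≤δ) λ t' σ″ (t'≤ , H) → let open Sp.Halved H using (regs) in
            ≤-trans (+-monoʳ-≤ t' (*-monoˡ-≤ (c + Φ) o≤)) t'≤ , record
              { globals = record { g0 = trans (regs 0 (inj₁ (≤ᵇ⇒≤ 1 7 tt))) L.g.g0 ; g2 = trans (regs 2 (inj₁ (≤ᵇ⇒≤ 3 7 tt))) L.g.g2 ; g12 = trans (regs 12 (inj₂ (≤ᵇ⇒≤ 12 12 tt))) L.g.g12
                  ; g13 = trans (regs 13 (inj₂ (≤ᵇ⇒≤ 12 13 tt))) L.g.g13 ; g14 = trans (regs 14 (inj₂ (≤ᵇ⇒≤ 12 14 tt))) L.g.g14 }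
              ; r3 = trans (regs 3 (inj₁ (≤ᵇ⇒≤ 4 7 tt))) L.r3 ; r4 = trans (regs 4 (inj₁ (≤ᵇ⇒≤ 5 7 tt))) L.r4 ; r5 = trans (regs 5 (inj₁ (≤ᵇ⇒≤ 6 7 tt))) L.r5
              ; π = Sp.Halved.π H ; placed = Sp.Halved.placed H ; coarse = coarse' H
              ; fine = refine j {Sp.Halved.π H} {ow σ″} (coarse' H) (λ k k≤ → Sp.Halved.cuts H (inj₁ k≤) (L.fine k k≤)) (Sp.Halved.cut H) }
            where
            module L where
              open LS (Ready.ls Rd) public
              module g = Globals (LS.globals (Ready.ls Rd))
            module Sp = Splitting (j * s) (j * s + h) hi (m≤m+n (j * s) h) (⊓-glb (+-monoʳ-≤ (j * s) h≤s) (<⇒≤ mid<n)) (m⊓n≤n (j * s + s) n) σ' L.globals (Ready.r6 Rd) (Ready.r7 Rd) (Ready.r8 Rd)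
              L.π L.placed (L.coarse j) (cut-hi j {L.π} {ow σ'} L.coarse)
            coarse' : ∀ {σ″} (H : Sp.Halved σ″) k → Cut (k * s) (Sp.Halved.π H) (ow σ″)
            coarse' H k = Sp.Halved.cuts H (side j k) (L.coarse k)

      record Segments (N p μ t : ℕ) (σ : View) : Set a where
        field
          j : ℕ
          ls : LS (j * s) (j * s) σ
          left : μ ≡ n ∸ j * s
          due : Due N (μ * Ψ + p) t σ

      opaque
        segment-time : ∀ N p t t' y μ μ' o o' → 0 < y → μ' + y ≤ μ → t + (μ * Ψ + p) ≤ N + o → t' + o ≤ t + 3 + y * Φ + 40 + o' → t' + 1 + (μ' * Ψ + p) ≤ N + o'
        segment-time N p t t' y μ μ' o o' = linear 9 (λ N p t t' y μ μ' o o' → κ 0 ⊏ y ⇒ μ' ⊕ y ⊑ μ ⇒ t ⊕ (μ ⊗ 144179260 ⊕ p) ⊑ N ⊕ o ⇒ t' ⊕ o ⊑ t ⊕ κ 3 ⊕ y ⊗ 144179200 ⊕ κ 40 ⊕ o' ⇒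
          ⊢ t' ⊕ κ 1 ⊕ (μ' ⊗ 144179260 ⊕ p) ⊑ N ⊕ o') N p t t' y μ μ' o o'

        level-start : ∀ N p t n o o' → t + (n * Ψ + 20 + p) ≤ N + o → o ≤ o' → t + 4 + 2 + (n * Ψ + (p + 6)) ≤ N + o'
        level-start N p t n o o' = linear 6 (λ N p t n o o' → t ⊕ (n ⊗ 144179260 ⊕ κ 20 ⊕ p) ⊑ N ⊕ o ⇒ o ⊑ o' ⇒ ⊢ t ⊕ κ 4 ⊕ κ 2 ⊕ (n ⊗ 144179260 ⊕ (p ⊕ κ 6)) ⊑ N ⊕ o') N p t n o o'

        level-end : ∀ N p t x o o' → t + (x + (p + 6)) ≤ N + o → o ≤ o' → t + 4 + 2 + p ≤ N + o'
        level-end N p t x o o' = linear 6 (λ N p t x o o' → t ⊕ (x ⊕ (p ⊕ κ 6)) ⊑ N ⊕ o ⇒ o ⊑ o' ⇒ ⊢ t ⊕ κ 4 ⊕ κ 2 ⊕ p ⊑ N ⊕ o') N p t x o o'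

      opaque
        wp-level : ∀ {N p t σ} → Sliced s σ → Due N (n * Ψ + 20 + p) t σ → WP level (λ t' σ' → Sliced h σ' × Due N p t' σ') t σ
        wp-level {N} {p} {t} {σ} I due₀ =
          wp-seq (wp-set (≤-<-trans (m≤n+m 2 n) (≤-<-trans (+-monoʳ-≤ n (≤ᵇ⇒≤ 2 4 tt)) n+4<W)) λ m₁ o₁ h₁ → wp-seq (wp-set 0<W λ m₂ o₂ h₂ →
          wp-seq (wp-while (Segments N (p + 6)) (λ μ t' σ' L m₃ o₃ h₃ → 0<W , (λ lt → again L h₃ lt) , (λ ge → done L h₃ ge))
            record { j = 0 ; left = refl ; due = level-start N p t n (length (ow σ) * (c + Φ)) (length o₂ * (c + Φ)) due₀ (*-monoˡ-≤ (c + Φ) (Corr-length (Corr-trans (proj₁ h₁) (proj₁ h₂))))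
                   ; ls = start (sliced-havoc I (Corr-trans (proj₁ h₁) (proj₁ h₂) , proj₂ h₂)) })))
          where
          open Sliced I
          half : ⟦ div ⟧ (nr σ 0 3) 2 ≡ h
          half = trans (cong (_/ 2) (trans r3 (trans s≡ (trans (cong (h +_) (sym (+-identityʳ h))) (*-comm 2 h))))) (m*n/n≡m h 2)
          start : ∀ {m' o'} → Sliced s (havoc σ m' o') → LS 0 0 (setN (num 0 5) 0 (setN (num 0 4) (⟦ div ⟧ (nr σ 0 3) 2) (havoc σ m' o')))
          start {m'} {o'} J = record { globals = record { Globals globals } ; r3 = r3 ; r4 = half ; r5 = refl ; π = Sliced.π J ; placed = Sliced.placed J ; coarse = Sliced.cuts J
            ; fine = λ k k≤ → λ p q p< → contradiction (<-≤-trans p< k≤) (λ ()) }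
          again : ∀ {μ t' σ' m₃ o₃} → Segments N (p + 6) μ t' σ' → Havoc σ' m₃ o₃ → (nr σ' 0 5 <ᵇ nr σ' 0 0) ≡ true →
            WP segment (λ t″ σ″ → ∃[ μ' ] μ' < μ × Segments N (p + 6) μ' (t″ + 1) σ″) (t' + 3) (havoc σ' m₃ o₃)
          again {μ} {t'} {σ'} {m₃} {o₃} L h₃ lt = mono (wp-segment {j} (ls-havoc ls h₃) js<n) λ t″ σ″ (t″≤ , J) →
              n ∸ suc j * s , decreasing , record { j = suc j ; ls = J ; left = refl
                ; due = segment-time N (p + 6) t' t″ y μ (n ∸ suc j * s) (length o₃ * (c + Φ)) (length (ow σ″) * (c + Φ)) 0<y gap'
                    (≤-trans due (+-monoʳ-≤ N (*-monoˡ-≤ (c + Φ) (Corr-length (proj₁ h₃))))) t″≤ }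
            where
            open Segments L
            js<n : j * s < n
            js<n = subst₂ _<_ (LS.r5 ls) (Globals.g0 (LS.globals ls)) (<ᵇ-true _ _ lt)
            y : ℕ
            y = (j * s + s) ⊓ n ∸ j * s
            0<y : 0 < y
            0<y = m<n⇒0<n∸m (lo<hi j js<n)
            gap' : n ∸ suc j * s + y ≤ μ
            gap' = subst (n ∸ suc j * s + y ≤_) (sym left) (gap j js<n)
            decreasing : n ∸ suc j * s < μ
            decreasing = <-≤-trans (m<m+n _ 0<y) gap'
          done : ∀ {μ t' σ' m₃ o₃} → Segments N (p + 6) μ t' σ' → Havoc σ' m₃ o₃ → (nr σ' 0 5 <ᵇ nr σ' 0 0) ≡ false →
            WP (num 0 3 ≔ r 0 4) (λ t' σ' → Sliced h σ' × Due N p t' σ') (t' + 4) (havoc σ' m₃ o₃)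
          done {μ} {t'} {σ'} L h₃ ge = wp-set 0<W λ m₄ o₄ h₄ → let J = ls-havoc (ls-havoc ls h₃) h₄ in
              record { globals = record { Globals (LS.globals ls) } ; r3 = LS.r4 ls ; π = LS.π J ; placed = LS.placed J ; cuts = all J } ,
              level-end N p t' (μ * Ψ) (length (ow σ') * (c + Φ)) (length o₄ * (c + Φ)) due (*-monoˡ-≤ (c + Φ) (Corr-length (Corr-trans (proj₁ h₃) (proj₁ h₄))))
            where
            open Segments L
            n≤ : n ≤ j * s
            n≤ = subst₂ _≤_ (Globals.g0 (LS.globals ls)) (LS.r5 ls) (<ᵇ-false _ _ ge)
            all : ∀ {σ'} (J : LS (j * s) (j * s) σ') k → Cut (k * h) (LS.π J) (ow σ')
            all {σ'} J k with k * h ≤? j * s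
            ... | yes k≤ = LS.fine J k k≤
            ... | no k≰  = cut-end {π = LS.π J} {ow σ'} (≤-trans n≤ (<⇒≤ (≰⇒> k≰)))

    D G : ℕ
    D = ⌈log₂ n ⌉ + ⌈log₂ n ⌉
    G = n * Ψ + 30

    record Doubling (N μ t : ℕ) (σ : View) : Set a where
      field
        i : ℕ
        globals : Globals (nr σ 0)
        r3  : nr σ 0 3 ≡ 2 ^ i
        i+μ : i + μ ≡ D
        i≤  : 0 < i → 2 ^ i ≤ n + n
        placed : Placed (identity n) (mem σ) (ow σ)
        due : Due N (μ * 8 + (D * G + 10)) t σ

    record Leveled (N μ t : ℕ) (σ : View) : Set a where
      field
        sliced : Sliced (2 ^ μ) σ
        small : 0 < μ → 2 ^ μ ≤ n + n
        due : Due N (μ * G + 6) t σ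

    record Ordered (σ : View) : Set a where
      field
        r0 : nr σ 0 0 ≡ 0
        π : Placement n
        placed : Placed π (mem σ) (ow σ)
        cuts : ∀ k → Cut k π (ow σ)

    double : ∀ i → 2 ^ suc i ≡ 2 ^ i + 2 ^ i
    double i = cong (2 ^ i +_) (+-identityʳ (2 ^ i))

    opaque
      Vs<W : ∀ x → x ≤ n + n → x + x < W
      Vs<W x x≤ = linear 5 (λ x n V T W → x ⊑ n ⊕ n ⇒ V ⊕ (n ⊕ T) ⊗ 1100 ⊕ κ 2000 ⊏ W ⇒ ⊢ x ⊕ x ⊏ W) x n V T₀ W x≤ V<W

      1<W : 1 < W
      1<W = linear 4 (λ n V T W → V ⊕ (n ⊕ T) ⊗ 1100 ⊕ κ 2000 ⊏ W ⇒ ⊢ κ 1 ⊏ W) n V T₀ W V<W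

      T₀<W : δ * 8192 + 8192 < W
      T₀<W = linear 5 (λ n V T W δ → κ 0 ⊏ δ ⇒ T ≐ δ ⊗ 8192 ⇒ V ⊕ (n ⊕ T) ⊗ 1100 ⊕ κ 2000 ⊏ W ⇒ ⊢ δ ⊗ 8192 ⊕ κ 8192 ⊏ W) n V T₀ W δ 0<δ T₀≡ V<W

      U<W : n + T₀ < W
      U<W = linear 4 (λ n V T W → V ⊕ (n ⊕ T) ⊗ 1100 ⊕ κ 2000 ⊏ W ⇒ ⊢ n ⊕ T ⊏ W) n V T₀ W V<W

      V'<W : n + T₀ + (U + (n + T₀)) < W
      V'<W = linear 5 (λ n U V T W → V ≐ U ⊕ (n ⊕ T) ⇒ V ⊕ (n ⊕ T) ⊗ 1100 ⊕ κ 2000 ⊏ W ⇒ ⊢ n ⊕ T ⊕ (U ⊕ (n ⊕ T)) ⊏ W) n U V T₀ W V≡ V<W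

      start-time : ∀ τ x y o → τ + 4 + 4 + 6 + 2 + (x + (y + 10)) ≤ τ + y + x + 30 + o
      start-time τ x y o = linear 4 (λ τ x y o → ⊢ τ ⊕ κ 4 ⊕ κ 4 ⊕ κ 6 ⊕ κ 2 ⊕ (x ⊕ (y ⊕ κ 10)) ⊑ τ ⊕ y ⊕ x ⊕ κ 30 ⊕ o) τ x y o

      double-time : ∀ t x y N o o' → t + (8 + x + y) ≤ N + o → o ≤ o' → t + 3 + 4 + 1 + (x + y) ≤ N + o'
      double-time t x y N o o' = linear 6 (λ t x y N o o' → t ⊕ (κ 8 ⊕ x ⊕ y) ⊑ N ⊕ o ⇒ o ⊑ o' ⇒ ⊢ t ⊕ κ 3 ⊕ κ 4 ⊕ κ 1 ⊕ (x ⊕ y) ⊑ N ⊕ o') t x y N o o'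

      switch-time : ∀ t x y z N o o' → t + (x + (y + 10)) ≤ N + o → o ≤ o' → z ≤ y → t + 4 + (z + 6) ≤ N + o'
      switch-time t x y z N o o' = linear 7 (λ t x y z N o o' → t ⊕ (x ⊕ (y ⊕ κ 10)) ⊑ N ⊕ o ⇒ o ⊑ o' ⇒ z ⊑ y ⇒ ⊢ t ⊕ κ 4 ⊕ (z ⊕ κ 6) ⊑ N ⊕ o') t x y z N o o'

      level-time : ∀ t x y N o o' → t + (x + 30 + y + 6) ≤ N + o → o ≤ o' → t + 3 + (x + 20 + (1 + (y + 6))) ≤ N + o'
      level-time t x y N o o' = linear 6 (λ t x y N o o' → t ⊕ (x ⊕ κ 30 ⊕ y ⊕ κ 6) ⊑ N ⊕ o ⇒ o ⊑ o' ⇒ ⊢ t ⊕ κ 3 ⊕ (x ⊕ κ 20 ⊕ (κ 1 ⊕ (y ⊕ κ 6))) ⊑ N ⊕ o') t x y N o o'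

      end-time : ∀ t x N o o' → t + (x + 6) ≤ N + o → o ≤ o' → t + 4 + 2 ≤ N + o'
      end-time t x N o o' = linear 5 (λ t x N o o' → t ⊕ (x ⊕ κ 6) ⊑ N ⊕ o ⇒ o ⊑ o' ⇒ ⊢ t ⊕ κ 4 ⊕ κ 2 ⊑ N ⊕ o') t x N o o'

    opaque
      wp-double : ∀ {N μ t σ' m o} → Doubling N μ t σ' → Havoc σ' m o → (nr σ' 0 3 <ᵇ nr σ' 0 0) ≡ true →
        WP (num 0 3 ≔ r 0 3 ∔ r 0 3) (λ t' σ' → ∃[ μ' ] μ' < μ × Doubling N μ' (t' + 1) σ') (t + 3) (havoc σ' m o)
      wp-double {N} {μ} {t} {σ'} {m} {o} L h lt = wp-set (subst (λ x → x + x < W) (sym r3) (Vs<W (2 ^ i) (≤-trans (<⇒≤ 2^i<n) (m≤m+n n n)))) (next-power μ i+μ due)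
        where
        open Doubling L
        2^i<n : 2 ^ i < n
        2^i<n = subst₂ _<_ r3 (Globals.g0 globals) (<ᵇ-true _ _ lt)
        0<log : 0 < ⌈log₂ n ⌉
        0<log = below-log 1 (≤-trans (s≤s (m^n>0 2 i)) 2^i<n)
        next-power : ∀ μ → i + μ ≡ D → Due N (μ * 8 + (D * G + 10)) t σ' → ∀ m₁ o₁ → Havoc (havoc σ' m o) m₁ o₁ →
          ∃[ μ' ] μ' < μ × Doubling N μ' (t + 3 + 4 + 1) (setN (num 0 3) (nr σ' 0 3 + nr σ' 0 3) (havoc σ' m₁ o₁))
        next-power zero eq d m₁ o₁ h₁ = contradiction (trans (sym (+-identityʳ i)) eq) (<⇒≢ (≤-<-trans (below-log i (<⇒≤ 2^i<n)) (m<m+n ⌈log₂ n ⌉ 0<log)))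
        next-power (suc μ') eq d m₁ o₁ h₁ = μ' , ≤-refl , record
          { i = suc i ; globals = record { Globals globals } ; r3 = trans (cong₂ _+_ r3 r3) (sym (double i)) ; i+μ = trans (sym (+-suc i μ')) eq
          ; i≤ = λ _ → ≤-trans (≤-reflexive (double i)) (+-mono-≤ (<⇒≤ 2^i<n) (<⇒≤ 2^i<n))
          ; placed = placed-fr {π = identity n} (Fr-havoc (Corr-trans (proj₁ h) (proj₁ h₁))) placed
          ; due = double-time t (μ' * 8) (D * G + 10) N (length (ow σ') * (c + Φ)) (length o₁ * (c + Φ)) d (*-monoˡ-≤ (c + Φ) (Corr-length (Corr-trans (proj₁ h) (proj₁ h₁)))) }

    opaque
      wp-finish : ∀ {N μ t σ' m o} → Leveled N μ t σ' → Havoc σ' m o → (1 <ᵇ nr σ' 0 3) ≡ false →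
        WP (num 0 0 ≔ lit 0) (λ t' σ' → t' ≤ N + length (ow σ') * (c + Φ) × Ordered σ') (t + 4) (havoc σ' m o)
      wp-finish {N} {μ} {t} {σ'} L h ge = wp-set 0<W λ m₁ o₁ h₁ → let J = sliced-havoc (sliced-havoc sliced h) h₁ in
          end-time t (μ * G) N (length (ow σ') * (c + Φ)) (length o₁ * (c + Φ)) due (*-monoˡ-≤ (c + Φ) (Corr-length (Corr-trans (proj₁ h) (proj₁ h₁)))) ,
          record { r0 = refl ; π = Sliced.π J ; placed = Sliced.placed J
            ; cuts = λ k → subst (λ z → Cut z (Sliced.π J) o₁) (trans (cong (k *_) length-one) (*-identityʳ k)) (Sliced.cuts J k) }
        where
        open Leveled L
        length-one : 2 ^ μ ≡ 1
        length-one = ≤-antisym (subst (_≤ 1) (Sliced.r3 sliced) (<ᵇ-false 1 _ ge)) (m^n>0 2 μ)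

    opaque
      wp-descend : ∀ {N μ t σ' m o} → Leveled N μ t σ' → Havoc σ' m o → (1 <ᵇ nr σ' 0 3) ≡ true →
        WP level (λ t' σ' → ∃[ μ' ] μ' < μ × Leveled N μ' (t' + 1) σ') (t + 3) (havoc σ' m o)
      wp-descend {N} {zero} {t} {σ'} L h lt = contradiction (subst (1 <_) (Sliced.r3 (Leveled.sliced L)) (<ᵇ-true 1 _ lt)) (<-irrefl refl)
      wp-descend {N} {suc μ'} {t} {σ'} {m} {o} L h lt = mono (Halving.wp-level (2 ^ suc μ') (2 ^ μ') (double μ') (m^n>0 2 μ') (small (s≤s z≤n)) {N} {1 + (μ' * G + 6)} (sliced-havoc sliced h)
          (level-time t (n * Ψ) (μ' * G) N (length (ow σ') * (c + Φ)) (length o * (c + Φ)) due (*-monoˡ-≤ (c + Φ) (Corr-length (proj₁ h)))))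
        λ t' σ″ (J , d) → μ' , ≤-refl , record { sliced = J ; small = λ _ → ≤-trans (^-monoʳ-≤ 2 (n≤1+n μ')) (small (s≤s z≤n))
          ; due = subst (_≤ N + length (ow σ″) * (c + Φ)) (sym (+-assoc t' 1 (μ' * G + 6))) d }
        where open Leveled L

    opaque
      wp-levels : ∀ {N μ t σ' m o} → Doubling N μ t σ' → Havoc σ' m o → (nr σ' 0 3 <ᵇ nr σ' 0 0) ≡ false →
        WP (while (lit 1 <ₙ r 0 3) level ⨾ num 0 0 ≔ lit 0) (λ t' σ' → t' ≤ N + length (ow σ') * (c + Φ) × Ordered σ') (t + 4) (havoc σ' m o)
      wp-levels {N} {μ} {t} {σ'} {m} {o} L h ge = wp-seq (wp-while (Leveled N) (λ μ t σ' L m₆ o₆ h₆ → 1<W , (λ lt → wp-descend L h₆ lt) , (λ ge → wp-finish L h₆ ge)) {i} record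
          { sliced = record { globals = globals ; r3 = r3 ; π = identity n ; placed = placed-fr {π = identity n} (Fr-havoc (proj₁ h)) placed ; cuts = whole }
          ; small = i≤
          ; due = switch-time t (μ * 8) (D * G) (i * G) N (length (ow σ') * (c + Φ)) (length o * (c + Φ)) due (*-monoˡ-≤ (c + Φ) (Corr-length (proj₁ h)))
              (*-monoˡ-≤ G (subst (i ≤_) i+μ (m≤m+n i μ))) })
        where
        open Doubling L
        n≤ : n ≤ 2 ^ i
        n≤ = subst₂ _≤_ (Globals.g0 globals) r3 (<ᵇ-false _ _ ge)
        whole : ∀ k → Cut (k * 2 ^ i) (identity n) o
        whole zero    p q ()
        whole (suc k) = cut-end {π = identity n} {o} (≤-trans n≤ (m≤m+n (2 ^ i) (k * 2 ^ i)))

    opaque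
      wp-main : ∀ {σ τ} → nr σ 0 0 ≡ n → nr σ 0 1 ≡ δ → nr σ 0 2 ≡ S → Placed (identity n) (mem σ) (ow σ) →
        WP main (λ t' σ' → t' ≤ τ + D * G + D * 8 + 30 + length (ow σ') * (c + Φ) × Ordered σ') τ σ
      wp-main {σ} {τ} r0 r1 r2 placed₀ =
        wp-seq (wp-set (peak-product (nr σ) (r 0 1) 8192 refl (subst (λ x → x * 8192 + 8192 < W) (sym r1) T₀<W)) λ m₁ o₁ h₁ →
        wp-seq (wp-set (subst₂ (λ x y → x + y < W) (sym r0) (sym r12) U<W) λ m₂ o₂ h₂ →
        wp-seq (wp-set (subst₂ (λ x y → x + (y + x) < W) (sym n+T₀) (sym r13) V'<W) λ m₃ o₃ h₃ →
        wp-seq (wp-set 1<W λ m₄ o₄ h₄ →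
        wp-seq (wp-while (Doubling N) (λ μ t σ' L m₅ o₅ h₅ → 0<W , (λ lt → wp-double L h₅ lt) , (λ ge → wp-levels L h₅ ge)) {D} record
          { i = 0 ; globals = record { g0 = r0 ; g2 = r2 ; g12 = r12 ; g13 = r13 ; g14 = trans (cong₂ _+_ r13 n+T₀) (sym V≡) }
          ; r3 = refl ; i+μ = refl ; i≤ = λ ()
          ; placed = placed-fr {π = identity n} (Fr-havoc (Corr-trans (proj₁ h₁) (Corr-trans (proj₁ h₂) (Corr-trans (proj₁ h₃) (proj₁ h₄))))) placed₀
          ; due = start-time τ (D * 8) (D * G) (length o₄ * (c + Φ)) })))))
        where
        N : ℕ
        N = τ + D * G + D * 8 + 30
        r12 : nr σ 0 1 * 8192 ≡ T₀
        r12 = trans (cong (_* 8192) r1) (sym T₀≡)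
        n+T₀ : nr σ 0 0 + nr σ 0 1 * 8192 ≡ n + T₀
        n+T₀ = cong₂ _+_ r0 r12
        r13 : nr σ 0 0 + nr σ 0 1 * 8192 ≡ U
        r13 = trans n+T₀ (sym U≡)

  module Execution .{{_ : NonZero S}} (P≡ : P ≡ code main 0) (S≤δ : S ≤ δ) (M≡ : M ≡ S * 146) (B : ℕ) (B≡ : B ≡ 2 + n + δ) (W≥ : B ^ 20 ≤ W)
    (X-inj : Injective _≡_ (StrictTotalOrder._≈_ K) X) (few : AtMost δ FaultsBy A) where

    T₀ U V Q : ℕ
    T₀ = δ * 8192
    U  = n + T₀
    V  = U + (n + T₀)
    Q  = δ / S * 16384

    0<S : 0 < S
    0<S = >-nonZero⁻¹ S

    opaque
      wide : B * 1162261467 ≤ W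
      wide = ≤-trans (*-monoʳ-≤ B (^-monoˡ-≤ 19 {3} {B} (linear 4 (λ B n δ S → κ 0 ⊏ S ⇒ S ⊑ δ ⇒ B ≐ κ 2 ⊕ n ⊕ δ ⇒ ⊢ κ 3 ⊑ B) B n δ S 0<S S≤δ B≡))) W≥

    opaque
      V<W : V + (n + T₀) * 1100 + 2000 < W
      V<W = linear 4 (λ B n δ W → B ≐ κ 2 ⊕ n ⊕ δ ⇒ B ⊗ 1162261467 ⊑ W ⇒ ⊢ n ⊕ δ ⊗ 8192 ⊕ (n ⊕ δ ⊗ 8192) ⊕ (n ⊕ δ ⊗ 8192) ⊗ 1100 ⊕ κ 2000 ⊏ W) B n δ W B≡ wide

      M<W : M + S * 16 + 200 < W
      M<W = linear 6 (λ B n δ W S M → B ≐ κ 2 ⊕ n ⊕ δ ⇒ B ⊗ 1162261467 ⊑ W ⇒ S ⊑ δ ⇒ M ≐ S ⊗ 146 ⇒ ⊢ M ⊕ S ⊗ 16 ⊕ κ 200 ⊏ W) B n δ W S M B≡ wide S≤δ M≡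

      small<W : n < W × δ < W × S < W
      small<W = linear 4 (λ B n δ W → B ≐ κ 2 ⊕ n ⊕ δ ⇒ B ⊗ 1162261467 ⊑ W ⇒ ⊢ n ⊏ W) B n δ W B≡ wide ,
        linear 4 (λ B n δ W → B ≐ κ 2 ⊕ n ⊕ δ ⇒ B ⊗ 1162261467 ⊑ W ⇒ ⊢ δ ⊏ W) B n δ W B≡ wide ,
        linear 5 (λ B n δ W S → B ≐ κ 2 ⊕ n ⊕ δ ⇒ B ⊗ 1162261467 ⊑ W ⇒ S ⊑ δ ⇒ ⊢ S ⊏ W) B n δ W S B≡ wide S≤δ

      room : arrays + (S + S) ≤ M
      room = linear 2 (λ S M → κ 0 ⊏ S ⇒ M ≐ S ⊗ 146 ⇒ ⊢ κ 144 ⊕ (S ⊕ S) ⊑ M) S M 0<S M≡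

      1≤δ/S : 1 ≤ δ / S
      1≤δ/S = m≥n⇒m/n>0 S≤δ

      1≤Q : 1 ≤ Q
      1≤Q = ≤-trans 1≤δ/S (≤-trans (≤-reflexive (sym (*-identityʳ (δ / S)))) (*-monoʳ-≤ (δ / S) (≤ᵇ⇒≤ 1 16384 tt)))

      T₀≤ : T₀ ≤ Q * S
      T₀≤ = linear 5 (λ δ r S qS QS → δ ≐ r ⊕ qS ⇒ r ⊏ S ⇒ S ⊑ qS ⇒ QS ≐ qS ⊗ 16384 ⇒ ⊢ δ ⊗ 8192 ⊑ QS) δ (δ % S) S (δ / S * S) (Q * S)
        (m≡m%n+[m/n]*n δ S) (m%n<n δ S) (≤-trans (≤-reflexive (sym (*-identityˡ S))) (*-monoˡ-≤ S 1≤δ/S))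
        (trans (*-assoc (δ / S) 16384 S) (trans (cong (δ / S *_) (*-comm 16384 S)) (sym (*-assoc (δ / S) S 16384))))

      t/S≤Q : ∀ t → t ≤ T₀ → S ≤ t → ⟦ div ⟧ t S ≤ Q
      t/S≤Q t t≤ _ = ≤-trans (≤-reflexive (div-nonzero t S)) (≤-trans (/-monoˡ-≤ S (≤-trans t≤ T₀≤)) (≤-reflexive (m*n/n≡m Q S)))

    open Sorting T₀ U V Q (≤-trans 0<S S≤δ) refl refl refl V<W room M<W 0<S 1≤Q t/S≤Q X-inj

    open Separation X-inj

    Numeric : Word → Set a
    Numeric w = ∃[ j ] w ≡ num j × j < W

    numeric-write : ∀ d k s → (∀ p → Numeric (s p)) → ∀ p → Numeric (writeSafe d (wrap k) s p)
    numeric-write d k s h p with d <ᵇ M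
    ... | true  = upd-either s Numeric d (wrap k) p (λ _ → k % W , refl , m%n<n k W) (λ _ → h p)
    ... | false = h p

    safe₀ : ℕ → Word
    safe₀ = safe initial

    numeric₀ : ∀ p → Numeric (safe₀ p)
    numeric₀ = numeric-write 0 n _ (numeric-write 1 δ _ (numeric-write 2 S _ (λ _ → 0 , refl , ≤-<-trans z≤n (proj₁ small<W))))

    σ₀ : View
    σ₀ = view (λ b i → toNum (safe₀ (nadr b i))) (λ b i → safe₀ (wadr b i)) safe₀ inputAt []

    rel₀ : Rel initial σ₀
    rel₀ = record
      { nums = λ {b} {i} _ _ → let _ , eq , _ = numeric₀ (nadr b i) in trans eq (cong (num ∘ toNum) (sym eq))
      ; bound = λ {b} {i} _ _ → let _ , eq , j<W = numeric₀ (nadr b i) in subst (_< W) (cong toNum (sym eq)) j<W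
      ; words = λ _ _ → refl ; cellˢ = λ _ _ → refl ; cellᶠ = refl ; lost = refl }

    0<M : ∀ {d} → {T (d <ᵇ 144)} → d < M
    0<M {d} {h} = <-≤-trans (<ᵇ⇒< d 144 h) (≤-trans (m≤m+n 144 (S + S)) room)

    cell₀ : toNum (safe₀ 0) ≡ n
    cell₀ = trans (cong toNum (writeSafe-same (wrap n) _ 0<M)) (cong toNum (wrap-small (proj₁ small<W)))

    cell₁ : toNum (safe₀ 1) ≡ δ
    cell₁ = trans (cong toNum (trans (writeSafe-other {0} (wrap n) _ (λ ())) (writeSafe-same (wrap δ) _ 0<M))) (cong toNum (wrap-small (proj₁ (proj₂ small<W))))

    cell₂ : toNum (safe₀ 2) ≡ S
    cell₂ = trans (cong toNum (trans (writeSafe-other {0} (wrap n) _ (λ ())) (trans (writeSafe-other {1} (wrap δ) _ (λ ())) (writeSafe-same (wrap S) _ 0<M))))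
      (cong toNum (wrap-small (proj₂ (proj₂ small<W))))

    bounded : Bounded 0 initial
    bounded k = subst (λ s → faults s ≤ δ) (sym (run-iter 0 k)) (few k)

    position-key : ∀ {s σ} (R : Rel s σ) (O : Ordered σ) → ∀ p {i} → output s p ≡ input i → inputAt (index (Ordered.π O) (toℕ p)) ≡ input i
    position-key {s} {σ} R O p {i} eq = held (Ordered.placed O (toℕ p) (toℕ<n p))
      where
      word : mem σ (toℕ p) ≡ input i
      word = trans (sym (trans (cong₂ (λ f x → f (toNum x + toℕ p)) (Rel.cellᶠ R) (Rel.nums R {0} {0} (≤ᵇ⇒≤ 1 6 tt) (≤ᵇ⇒≤ 1 16 tt))) (cong (λ x → mem σ (x + toℕ p)) (Ordered.r0 O)))) eq
      held : Holds-key (index (Ordered.π O) (toℕ p)) (ow σ) (mem σ (toℕ p)) → inputAt (index (Ordered.π O) (toℕ p)) ≡ input i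
      held (inj₁ e)       = trans (sym e) word
      held (inj₂ (_ , h)) = ⊥-elim (subst NotInput word h)

    sorted : ∀ {s σ} → Rel s σ → Ordered σ → FaithfullySorted s
    sorted {s} {σ} R O = ordered , contained
      where
      open Ordered O
      ordered : FaithfullyOrdered s
      ordered {p} {q} {i} {j} ei ej fi fj p<q = ≺?-true (trans (sym (cong₂ (λ u w → less (value u) (value w)) ki kj))
          (cuts (toℕ q) (toℕ p) (toℕ q) p<q ≤-refl (toℕ<n q) (subst₂ _∉_ (sym ki) (Rel.lost R) fi) (subst₂ _∉_ (sym kj) (Rel.lost R) fj)))
        where
        ki : inputAt (index π (toℕ p)) ≡ input i
        ki = position-key R O p ei
        kj : inputAt (index π (toℕ q)) ≡ input j
        kj = position-key R O q ej
      contained : ContainsFaithfulKeys s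
      contained i fi = fromℕ< p<n , trans found (held (placed _ p<n))
        where
        p<n : position π (toℕ i) < n
        p<n = position< π (toℕ<n i)
        key : inputAt (index π (position π (toℕ i))) ≡ input i
        key = trans (cong inputAt (index-position π (toℕ i))) (trans (inputAt-key (toℕ<n i)) (cong input (fromℕ<-toℕ i (toℕ<n i))))
        found : output s (fromℕ< p<n) ≡ mem σ (position π (toℕ i))
        found = trans (cong₂ (λ f x → f (toNum x + toℕ (fromℕ< p<n))) (Rel.cellᶠ R) (Rel.nums R {0} {0} (≤ᵇ⇒≤ 1 6 tt) (≤ᵇ⇒≤ 1 16 tt)))
          (cong₂ (λ x y → mem σ (x + y)) r0 (toℕ-fromℕ< p<n))
        held : Holds-key (index π (position π (toℕ i))) (ow σ) (mem σ (position π (toℕ i))) → mem σ (position π (toℕ i)) ≡ input i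
        held (inj₁ e)       = trans e key
        held (inj₂ (h , _)) = contradiction (subst₂ _∈_ key (sym (Rel.lost R)) h) fi

    opaque
      total-time : ∀ k α z → z ≡ 1 + n * ⌈log₂ n ⌉ + α * (δ / S + ⌈log₂ S ⌉) → k ≤ 0 + D * G + D * 8 + 30 + α * (c + Φ) → k ≤ factor * z
      total-time k α z z≡ h = ≤-factor k z (linear 10 (λ k DG D αc L nL α αq αl z → z ≐ κ 1 ⊕ nL ⊕ (αq ⊕ αl) ⇒ k ⊑ κ 0 ⊕ DG ⊕ D ⊗ 8 ⊕ κ 30 ⊕ αc ⇒ D ≐ L ⊕ L ⇒
          DG ≐ (nL ⊗ 144179260 ⊕ L ⊗ 30) ⊗ 2 ⇒ L ⊑ nL ⇒ α ⊑ αq ⇒ αc ≐ αq ⊗ 49152000000 ⊕ α ⊗ 144179200 ⇒ ⊢ k ⊑ z ⊗ 50000000000)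
          k (D * G) D (α * (c + Φ)) ⌈log₂ n ⌉ (n * ⌈log₂ n ⌉) α (α * (δ / S)) (α * ⌈log₂ S ⌉) z
          (trans z≡ (cong (1 + n * ⌈log₂ n ⌉ +_) (*-distribˡ-+ α (δ / S) ⌈log₂ S ⌉))) h refl DG (log≤n*log n) α≤ αc)
        where
        α≤ : α ≤ α * (δ / S)
        α≤ = ≤-trans (≤-reflexive (sym (*-identityʳ α))) (*-monoʳ-≤ α 1≤δ/S)
        αc : α * (c + Φ) ≡ α * (δ / S) * 49152000000 + α * 144179200
        αc = trans (*-distribˡ-+ α c Φ) (cong (_+ α * Φ) (trans (cong (α *_) (*-assoc (δ / S) 16384 3000000)) (sym (*-assoc α (δ / S) 49152000000))))
        LG : ⌈log₂ n ⌉ * G ≡ n * ⌈log₂ n ⌉ * 144179260 + ⌈log₂ n ⌉ * 30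
        LG = trans (*-distribˡ-+ ⌈log₂ n ⌉ (n * Ψ) 30) (cong (_+ ⌈log₂ n ⌉ * 30) (trans (sym (*-assoc ⌈log₂ n ⌉ n Ψ)) (cong (_* Ψ) (*-comm ⌈log₂ n ⌉ n))))
        DG : D * G ≡ (n * ⌈log₂ n ⌉ * 144179260 + ⌈log₂ n ⌉ * 30) * 2
        DG = trans (*-distribʳ-+ G ⌈log₂ n ⌉ ⌈log₂ n ⌉) (trans (cong₂ _+_ LG LG) (linear 1 (λ x → ⊢ x ⊕ x ≐ x ⊗ 2) (n * ⌈log₂ n ⌉ * 144179260 + ⌈log₂ n ⌉ * 30)))

    Solved : ℕ → State → Set _
    Solved t s = Halted s × FaithfullySorted s × t ≤ factor * (1 + n * ⌈log₂ n ⌉ + faults s * (δ / S + ⌈log₂ S ⌉))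

    opaque
      solved : ∀ {t s σ} → pc s ≡ length P → Rel s σ → Ordered σ → t ≤ 0 + D * G + D * 8 + 30 + length (ow σ) * (c + Φ) → Solved t s
      solved {t} {s} {σ} pc≡ R O time = trans (cong (fetch P) pc≡) (fetch-end P) , sorted R O ,
        subst (λ o → t ≤ factor * (1 + n * ⌈log₂ n ⌉ + length o * (δ / S + ⌈log₂ S ⌉))) (sym (Rel.lost R)) (total-time t (length (ow σ)) _ refl time)

    opaque
      run-main : ∃[ t ] ∃[ σ ] pc (iter 0 t initial) ≡ 0 + size main × Rel (iter 0 t initial) σ
        × (t ≤ 0 + D * G + D * 8 + 30 + length (ow σ) * (c + Φ) × Ordered σ)
      run-main = runs (wp-main {σ₀} {0} cell₀ cell₁ cell₂ (λ _ _ → inj₁ refl)) ([] , [] , trans P≡ (sym (++-identityʳ (code main 0))) , refl) refl rel₀ bounded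

    opaque
      halts : ∃[ t ] Solved t (run A t)
      halts = let t , σ , pc≡ , R , time , O = run-main in
        t , subst (Solved t) (run-iter 0 t) (solved (trans pc≡ (trans (sym (code-length main 0)) (cong length (sym P≡)))) R O time)

opaque
  program : Program
  program = code main 0

  program≡ : program ≡ code main 0
  program≡ = refl

theorem1 : ∀ {a ℓ₁ ℓ₂} →
    ∃[ P ] ∃[ w ] ∃[ c ] ∃[ C ]
    ((K : StrictTotalOrder a ℓ₁ ℓ₂) (n δ S : ℕ) .{{_ : NonZero S}} → S ≤ δ →
    (X : Fin n → StrictTotalOrder.Carrier K) → Injective _≡_ (StrictTotalOrder._≈_ K) X →
    (W : ℕ) .{{_ : NonZero W}} → (2 + n + δ) ^ w ≤ W →
    let open FaultyRAM K P W (c * S) δ S X in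
    (A : Adversary) → AtMost δ FaultsBy A →
    ∃[ T ] (Halted (run A T)
    × FaithfullySorted (run A T)
    × T ≤ C * (1 + n * ⌈log₂ n ⌉ + faults (run A T) * (δ / S + ⌈log₂ S ⌉))))
theorem1 = program , 20 , 146 , factor , λ K n δ S S≤δ X X-inj W W≥ A few →
  Machine.Execution.halts
    (record { K = K ; P = program ; W = W ; W≢0 = >-nonZero (>-nonZero⁻¹ W) ; M = 146 * S ; δ = δ ; S = S
            ; arrays≤M = ≤-trans (≤ᵇ⇒≤ 144 146 tt) (m≤m*n 146 S) ; n = n ; X = X ; A = A })
    program≡ S≤δ (*-comm 146 S) (2 + n + δ) refl W≥ X-inj few
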